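{- For non-negative integers $x,y,z,a$, the tiling generating function of ${}^*\mathcal{E}_{x,y,z}(a)$ equals $E_4(x,y,z,a)$, where \[E_4(x,0,z,a)=\frac{1}{2^{a+z-1}}\prod_{i=1}^{a-1}\frac{i!(x+i-2)!(2x+2i-2)_i(x+2i-1)_i(x+3i-1)}{(x+2i-1)!(2i)!}\prod_{i=1}^{z-1}\frac{i!(x+3a+i-2)!(2x+6a+2i-2)_i(x+3a+2i-1)_i(x+3a+3i-1)}{(x+3a+2i-1)!(2i)!},\] and for $y>0$, $E_4(x,y,z,a)=E_3(x,y,z,a)/K(x,y,z,a)$ with \[K(x,2k,z,a)= 2^{k+\lfloor \frac{z+1}{2}\rfloor+\lfloor \frac{a+1}{2}\rfloor-1}\frac{\prod_{i=1}^{k+\lfloor \frac{z}{2}\rfloor+a}(2x+6i-5) \prod_{i=1}^{\lfloor \frac{z+1}{2}\rfloor}(x+3k+3a+3i-4)}{\prod_{i=1}^{\lfloor \frac{a+1}{2}\rfloor}(2x+6k+6\lfloor \frac{a}{2}\rfloor+6i-5) \prod_{i=1}^{k+z+\lfloor \frac{a}{2}\rfloor}(2x+3k+3\lfloor \frac{a+1}{2}\rfloor+3i-4)},\] \[K(x,2k+1,z,a)= 2^{k+\lfloor \frac{z}{2}\rfloor+\lfloor \frac{a}{2}\rfloor}\frac{\prod_{i=1}^{k+\lfloor \frac{z+1}{2}\rfloor+a}(2x+6i-5) \prod_{i=1}^{\lfloor \frac{z}{2}\rfloor}(x+3k+3a+3i-1)}{\prod_{i=1}^{\lfloor \frac{a}{2}\rfloor}(2x+6k+6\lfloor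 \frac{a+1}{2}\rfloor+6i-5) \prod_{i=1}^{k+z+\lfloor \frac{a+1}{2}\rfloor}(x+3k+3\lfloor \frac{a}{2}\rfloor+3i-1)}.\]
   Context: Regions live on the triangular lattice drawn with one family of lattice lines horizontal; a lozenge is the union of two unit triangles sharing an edge, a tiling is a covering by lozenges without gaps or overlaps. The weight of a tiling is the product of the weights of its lozenges, and the tiling generating function $\operatorname{M}(R)$ is the sum of the weights of all tilings of $R$. The region $\mathcal{E}_{x,y,z}(a)$ (defined when $y+z\ge1$): start from a pentagonal region (horizontal northern and southern sides, straight southeastern side, western and northeastern sides following zig-zag lattice paths) whose western, northern, northeastern, southeastern and southern sides have lengths $y+z+a-1,\ x,\ y+z+2a-1,\ y+z-1,\ x+y+z+3a-2$; remove the $(y+a)$-th through $(y+2a-1)$-th up-pointing unit triangles on the northeastern side (counting from top to bottom), and remove the lozenges thereby forced. The weighted region ${}^*\mathcal{E}_{x,y,z}(a)$ is obtained by assigning weight $1/2$ to each northeastern boundary lozenge (all other lozenges weight $1$). $E_3$ is defined as follows, with $f(x)=2\lfloor\frac{x+1}{2}\rfloor+\lfloor\frac{x}{2}\rfloor$: for $k\ge1$ \[E_{3}(x,2k,z,a)=2^{\lfloor\frac{a+1}{2}\rfloor\lfloor\frac{z+1}{2}\rfloor+\lfloor\frac{a}{2}\rfloor\lfloor\frac{z}{2}\rfloor-a-z-2k+1}\prod_{i=1}^{2k-1+a+z}\frac{i!(x+i-2)!(2x+2i-2)_i(x+2i-1)_i(2x+3i-2)}{(x+2i-1)!(2i)!}\prod_{i=1}^{\lceil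 \frac{a-1}{3}\rceil}[2x+6k+2f(a+i-1)-1]_{f(a-3i+2)-1}\prod_{i=1}^{\lceil \frac{a-2}{3}\rceil}(x+3k+f(a+i-2)+1)_{f(a-3i+1)-1}\] \[\times\prod_{i=1}^{\lfloor \frac{a+1}{2}\rfloor}[2x+6k+2z+4a+4i-5]_{\lfloor\frac{z}{2}\rfloor +a-5i+4}(x+3k+z+2a+2i-3)_{\lfloor\frac{z+1}{2}\rfloor+a-5i+4}\prod_{i=1}^{\lfloor\frac{a}{2}\rfloor}[2x+6k+2z+4a+4i-3]_{\lfloor\frac{z+1}{2}\rfloor+a-5i+1} (x+3k+z+2a+2i-2)_{\lfloor\frac{z}{2}\rfloor+a-5i+2}\] \[\times\prod_{i=1}^{a}\frac{[2k+2i-1]_{z+a-2i+1}(k+i)_{z+a-2i+1}}{(i)_{z+a-2i+1}[2x+4k+2a+2i-3]_{z+a-2i+1}(x+4k+z+2a+i-2)_{z+a-2i+1}},\] and for $k\ge0$ \[E_{3}(x,2k+1,z,a)=2^{\lfloor\frac{a}{2}\rfloor\lfloor\frac{z+1}{2}\rfloor+\lfloor\frac{a+1}{2}\rfloor\lfloor\frac{z}{2}\rfloor-a-z-2k}\prod_{i=1}^{2k+a+z}\frac{i!(x+i-2)!(2x+2i-2)_i(x+2i-1)_i(2x+3i-2)}{(x+2i-1)!(2i)!}\prod_{i=1}^{\lfloor \frac{a-2}{3}\rfloor}[2x+6k+2f(a+i)-1]_{f(a-3i+1)-1}\prod_{i=1}^{\lfloor \frac{a-1}{3}\rfloor}(x+3k+f(a+i-1)+1)_{f(a-3i+2)-1}\]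 \[\times\prod_{i=1}^{\lfloor \frac{a+1}{2}\rfloor}[2x+6k+2z+4a+4i-3]_{\lfloor\frac{z+1}{2}\rfloor +a-5i+4}(x+3k+z+2a+2i-1)_{\lfloor\frac{z}{2}\rfloor+a-5i+4}\prod_{i=1}^{\lfloor\frac{a}{2}\rfloor}[2x+6k+2z+4a+4i-1]_{\lfloor\frac{z}{2}\rfloor+a-5i+2} (x+3k+z+2a+2i)_{\lfloor\frac{z+1}{2}\rfloor+a-5i+1}\] \[\times\prod_{i=1}^{a}\frac{[2k+2i+1]_{z+a-2i+1}(k+i)_{z+a-2i+1}}{(i)_{z+a-2i+1}[2x+4k+2a+2i-1]_{z+a-2i+1}(x+4k+z+2a+i)_{z+a-2i+1}}.\] Pochhammer symbols: $(x)_n=x(x+1)\cdots(x+n-1)$ for $n>0$, $(x)_0=1$, $(x)_{ -n}=\frac{1}{(x-1)\cdots(x-n)}$; $[x]_n=x(x+2)\cdots(x+2(n-1))$ for $n>0$, $[x]_0=1$, $[x]_n=\frac{1}{(x-2)(x-4)\cdots(x+2n)}$ for $n<0$.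
   Formalization: Corrected: the last product in K(x,2k,z,a) has x+3k+… instead of 2x+3k+… (else E_4(1,2,1,0)=175/18, not 25/4); in E_3(x,2k+1,z,a) the f-products run to ceilings, not floors (else off by x+4 at y=1,z=0,a=2); the factor with (-1)! at x=0,i=1 is read in cancelled form. -}

module Defs where

open import Data.Bool.Base using (Bool; true; false; _∧_; _∨_; not; if_then_else_)
open import Data.Nat.Base as ℕ
  using (ℕ; zero; suc; _+_; _*_; _∸_; _/_; _%_; _≤ᵇ_; _<ᵇ_; _≡ᵇ_; _!)
open import Data.Integer.Base as ℤ using (ℤ; +_; -[1+_])
open import Data.Rational.Base as ℚ using (ℚ; 0ℚ; 1ℚ; ½; 1/_; ≢-nonZero)
open import Data.Rational.Properties using (_≟_)
open import Data.List.Base using (List; []; _∷_; _++_; map; foldr; concatMap; upTo; length)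
open import Data.Product.Base using (_×_; _,_; proj₁; proj₂)
open import Relation.Nullary.Decidable.Core using (yes; no)

filter : {A : Set} → (A → Bool) → List A → List A
filter p []       = []
filter p (x ∷ xs) = if p x then x ∷ filter p xs else filter p xs

⟦_⟧ : ℤ → ℚ
⟦ z ⟧ = z ℚ./ 1

⟦_⟧ℕ : ℕ → ℚ
⟦ n ⟧ℕ = (+ n) ℚ./ 1

_⊖_ : ℕ → ℕ → ℤ
m ⊖ n = (+ m) ℤ.- (+ n)

-- total reciprocal (1/0 := 0); only ever applied to nonzero values in E_4
inv : ℚ → ℚ
inv p with p ≟ 0ℚ
... | yes _  = 0ℚ
... | no p≢0 = (1/ p) {{≢-nonZero p≢0}}

∏[1‥_] : ℕ → (ℕ → ℚ) → ℚ
∏[1‥ zero  ] g = 1ℚ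
∏[1‥ suc n ] g = ∏[1‥ n ] g ℚ.* g (suc n)

pow2 : ℤ → ℚ
pow2 (+ n)      = ∏[1‥ n ] (λ _ → ⟦ + 2 ⟧)
pow2 -[1+ n ]   = inv (∏[1‥ suc n ] (λ _ → ⟦ + 2 ⟧))

poch : ℤ → ℤ → ℚ
poch x (+ n)      = ∏[1‥ n ] (λ i → ⟦ x ℤ.+ (i ⊖ 1) ⟧)
poch x -[1+ n ]   = inv (∏[1‥ suc n ] (λ i → ⟦ x ℤ.- (+ i) ⟧))

poch2 : ℤ → ℤ → ℚ
poch2 x (+ n)     = ∏[1‥ n ] (λ i → ⟦ x ℤ.+ ((2 * i) ⊖ 2) ⟧)
poch2 x -[1+ n ]  = inv (∏[1‥ suc n ] (λ i → ⟦ x ℤ.- (+ (2 * i)) ⟧))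

-- f(x) = 2⌊(x+1)/2⌋ + ⌊x/2⌋   (only used at non-negative arguments)
f : ℕ → ℕ
f n = 2 * ((n + 1) / 2) + n / 2

-- FR X i = (X+i-2)! (2X+2i-2)_i / (X+2i-1)!   (for i ≥ 1), written in the
-- cancelled form 2 (2X+2i-1)_{i-1} / (X+i)_i, which agrees with the quotient
-- whenever X+i ≥ 2 and gives its (polynomial) value when X = 0, i = 1.
FR : ℕ → ℕ → ℚ
FR X i = ⟦ + 2 ⟧ ℚ.* poch (+ (2 * X + 2 * i ∸ 1)) (i ⊖ 1) ℚ.* inv (poch (+ (X + i)) (+ i))

P₃ : ℕ → ℕ → ℚ
P₃ x i = ⟦ i ! ⟧ℕ ℚ.* FR x i ℚ.* poch (+ (x + 2 * i ∸ 1)) (+ i)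
         ℚ.* ⟦ + (2 * x + 3 * i ∸ 2) ⟧ ℚ.* inv ⟦ (2 * i) ! ⟧ℕ

P₄ : ℕ → ℕ → ℚ
P₄ X i = ⟦ i ! ⟧ℕ ℚ.* FR X i ℚ.* poch (+ (X + 2 * i ∸ 1)) (+ i)
         ℚ.* ⟦ + (X + 3 * i ∸ 1) ⟧ ℚ.* inv ⟦ (2 * i) ! ⟧ℕ

-- E_3(x, 2k, z, a)  (k ≥ 1)
-- NB: ⌈(a-1)/3⌉ = ⌊(a+1)/3⌋ and ⌈(a-2)/3⌉ = ⌊a/3⌋ for all a ∈ ℕ.

E3even : ℕ → ℕ → ℕ → ℕ → ℚ
E3even x k z a =
  pow2 ((((a + 1) / 2) * ((z + 1) / 2) + (a / 2) * (z / 2) + 1) ⊖ (a + z + 2 * k))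
  ℚ.* ∏[1‥ 2 * k ∸ 1 + a + z ] (P₃ x)
  ℚ.* ∏[1‥ (a + 1) / 3 ] (λ i →
        poch2 ((2 * x + 6 * k + 2 * f (a + i ∸ 1)) ⊖ 1) (f (a + 2 ∸ 3 * i) ⊖ 1))
  ℚ.* ∏[1‥ a / 3 ] (λ i →
        poch (+ (x + 3 * k + f (a + i ∸ 2) + 1)) (f (a + 1 ∸ 3 * i) ⊖ 1))
  ℚ.* ∏[1‥ (a + 1) / 2 ] (λ i →
        poch2 ((2 * x + 6 * k + 2 * z + 4 * a + 4 * i) ⊖ 5) ((z / 2 + a + 4) ⊖ (5 * i))
        ℚ.* poch ((x + 3 * k + z + 2 * a + 2 * i) ⊖ 3) (((z + 1) / 2 + a + 4) ⊖ (5 * i)))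
  ℚ.* ∏[1‥ a / 2 ] (λ i →
        poch2 ((2 * x + 6 * k + 2 * z + 4 * a + 4 * i) ⊖ 3) (((z + 1) / 2 + a + 1) ⊖ (5 * i))
        ℚ.* poch ((x + 3 * k + z + 2 * a + 2 * i) ⊖ 2) ((z / 2 + a + 2) ⊖ (5 * i)))
  ℚ.* ∏[1‥ a ] (λ i →
        let m = (z + a + 1) ⊖ (2 * i) in
        poch2 ((2 * k + 2 * i) ⊖ 1) m ℚ.* poch (+ (k + i)) m
        ℚ.* inv (poch (+ i) m
                 ℚ.* poch2 ((2 * x + 4 * k + 2 * a + 2 * i) ⊖ 3) m
                 ℚ.* poch ((x + 4 * k + z + 2 * a + i) ⊖ 2) m))

-- E_3(x, 2k+1, z, a)  (k ≥ 0); upper limits ⌈(a-2)/3⌉, ⌈(a-1)/3⌉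

E3odd : ℕ → ℕ → ℕ → ℕ → ℚ
E3odd x k z a =
  pow2 (((a / 2) * ((z + 1) / 2) + ((a + 1) / 2) * (z / 2)) ⊖ (a + z + 2 * k))
  ℚ.* ∏[1‥ 2 * k + a + z ] (P₃ x)
  ℚ.* ∏[1‥ a / 3 ] (λ i →
        poch2 ((2 * x + 6 * k + 2 * f (a + i)) ⊖ 1) (f (a + 1 ∸ 3 * i) ⊖ 1))
  ℚ.* ∏[1‥ (a + 1) / 3 ] (λ i →
        poch (+ (x + 3 * k + f (a + i ∸ 1) + 1)) (f (a + 2 ∸ 3 * i) ⊖ 1))
  ℚ.* ∏[1‥ (a + 1) / 2 ] (λ i →
        poch2 ((2 * x + 6 * k + 2 * z + 4 * a + 4 * i) ⊖ 3) (((z + 1) / 2 + a + 4) ⊖ (5 * i))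
        ℚ.* poch ((x + 3 * k + z + 2 * a + 2 * i) ⊖ 1) ((z / 2 + a + 4) ⊖ (5 * i)))
  ℚ.* ∏[1‥ a / 2 ] (λ i →
        poch2 ((2 * x + 6 * k + 2 * z + 4 * a + 4 * i) ⊖ 1) ((z / 2 + a + 2) ⊖ (5 * i))
        ℚ.* poch (+ (x + 3 * k + z + 2 * a + 2 * i)) (((z + 1) / 2 + a + 1) ⊖ (5 * i)))
  ℚ.* ∏[1‥ a ] (λ i →
        let m = (z + a + 1) ⊖ (2 * i) in
        poch2 (+ (2 * k + 2 * i + 1)) m ℚ.* poch (+ (k + i)) m
        ℚ.* inv (poch (+ i) m
                 ℚ.* poch2 ((2 * x + 4 * k + 2 * a + 2 * i) ⊖ 1) m
                 ℚ.* poch (+ (x + 4 * k + z + 2 * a + i)) m))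

-- K(x, 2k, z, a)  (k ≥ 1); last denominator factor x+3k+…

Keven : ℕ → ℕ → ℕ → ℕ → ℚ
Keven x k z a =
  pow2 ((k + (z + 1) / 2 + (a + 1) / 2) ⊖ 1)
  ℚ.* ∏[1‥ k + z / 2 + a ] (λ i → ⟦ (2 * x + 6 * i) ⊖ 5 ⟧)
  ℚ.* ∏[1‥ (z + 1) / 2 ] (λ i → ⟦ (x + 3 * k + 3 * a + 3 * i) ⊖ 4 ⟧)
  ℚ.* inv (∏[1‥ (a + 1) / 2 ] (λ i → ⟦ (2 * x + 6 * k + 6 * (a / 2) + 6 * i) ⊖ 5 ⟧)
           ℚ.* ∏[1‥ k + z + a / 2 ] (λ i → ⟦ (x + 3 * k + 3 * ((a + 1) / 2) + 3 * i) ⊖ 4 ⟧))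

Kodd : ℕ → ℕ → ℕ → ℕ → ℚ
Kodd x k z a =
  pow2 (+ (k + z / 2 + a / 2))
  ℚ.* ∏[1‥ k + (z + 1) / 2 + a ] (λ i → ⟦ (2 * x + 6 * i) ⊖ 5 ⟧)
  ℚ.* ∏[1‥ z / 2 ] (λ i → ⟦ (x + 3 * k + 3 * a + 3 * i) ⊖ 1 ⟧)
  ℚ.* inv (∏[1‥ a / 2 ] (λ i → ⟦ (2 * x + 6 * k + 6 * ((a + 1) / 2) + 6 * i) ⊖ 5 ⟧)
           ℚ.* ∏[1‥ k + z + (a + 1) / 2 ] (λ i → ⟦ (x + 3 * k + 3 * (a / 2) + 3 * i) ⊖ 1 ⟧))

E4 : ℕ → ℕ → ℕ → ℕ → ℚ
E4 x zero z a =
  inv (pow2 ((a + z) ⊖ 1))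
  ℚ.* ∏[1‥ a ∸ 1 ] (P₄ x)
  ℚ.* ∏[1‥ z ∸ 1 ] (P₄ (x + 3 * a))
E4 x (suc y) z a with suc y % 2
... | zero  = E3even x (suc y / 2) z a ℚ.* inv (Keven x (suc y / 2) z a)
... | suc _ = E3odd  x (suc y / 2) z a ℚ.* inv (Kodd  x (suc y / 2) z a)

-- The triangular lattice.
-- A unit triangle is a cell (j , c): j = row (between horizontal lattice
-- lines j and j+1, counted from the bottom), c = column (position of the
-- centroid in half-units, increasing eastward).  Two cells in the same row
-- with consecutive columns share a slanted edge; the cell (j , c) points up
-- iff j + c is odd, and a down-pointing cell (j , c) shares its top
-- horizontal edge with the up-pointing cell (j+1 , c).

Cell : Set
Cell = ℕ × ℕ

isUp : Cell → Bool
isUp (j , c) = (j + c) % 2 ≡ᵇ 1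

-- Lozenges: hor j c = {(j,c),(j,c+1)};  ver j c = {(j,c),(j+1,c)} with (j,c) down.
data Lozenge : Set where
  hor : ℕ → ℕ → Lozenge
  ver : ℕ → ℕ → Lozenge

cellsOf : Lozenge → List Cell
cellsOf (hor j c) = (j , c) ∷ (j , suc c) ∷ []
cellsOf (ver j c) = (j , c) ∷ (suc j , c) ∷ []

_≡ᶜ_ : Cell → Cell → Bool
(j , c) ≡ᶜ (j' , c') = (j ≡ᵇ j') ∧ (c ≡ᵇ c')

covers : Lozenge → Cell → Bool
covers l q = foldr (λ q' b → (q' ≡ᶜ q) ∨ b) false (cellsOf l)

-- The region E_{x,y,z}(a)  (y + z ≥ 1).
-- Pentagon: the western side is a vertical zig-zag with y+z+a-1 teeth
-- (2(y+z+a-1) rows, column 0 is westmost in every row), the northern side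
-- has length x, the northeastern side is a zig-zag with n_NE = y+z+2a-1
-- unit steps in direction -60° (one per row, separated by unit horizontal
-- steps), the southeastern side is straight (direction of the 60° lattice
-- lines) of length y+z-1, and the southern side has length x+y+z+3a-2.

nRows : ℕ → ℕ → ℕ → ℕ
nRows y z a = 2 * (y + z + a) ∸ 2

nNE : ℕ → ℕ → ℕ → ℕ
nNE y z a = y + z + 2 * a ∸ 1

nSE : ℕ → ℕ → ℕ
nSE y z = y + z ∸ 1

-- position (1 = top) of row j among the rows of the northeastern side
topIndex : ℕ → ℕ → ℕ → ℕ → ℕ
topIndex y z a j = nRows y z a ∸ j

-- easternmost column of row j in the pentagon: in the northeastern rows
-- (j ≥ y+z-1) it is the up-pointing triangle on the NE side, at column
-- 2x + 3(t-1) for the t-th row from the top; the rows below follow the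
-- straight southeastern side (one column less per row downwards).
rowEnd : ℕ → ℕ → ℕ → ℕ → ℕ → ℕ
rowEnd x y z a j =
  if nSE y z ≤ᵇ j
  then 2 * x + 3 * (topIndex y z a j ∸ 1)
  else 2 * x + 3 * (nNE y z a ∸ 1) ∸ (nSE y z ∸ suc j)

inNERow : ℕ → ℕ → ℕ → ℕ → Bool
inNERow y z a j = (nSE y z ≤ᵇ j) ∧ (j <ᵇ nRows y z a)

isNEtriangle : ℕ → ℕ → ℕ → ℕ → Cell → Bool
isNEtriangle x y z a (j , c) = inNERow y z a j ∧ (c ≡ᵇ rowEnd x y z a j)

removed : ℕ → ℕ → ℕ → ℕ → Cell → Bool
removed x y z a (j , c) =
  isNEtriangle x y z a (j , c)
  ∧ (y + a ≤ᵇ topIndex y z a j) ∧ (topIndex y z a j + 1 ≤ᵇ y + 2 * a)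

inE : ℕ → ℕ → ℕ → ℕ → Cell → Bool
inE x y z a (j , c) =
  (j <ᵇ nRows y z a) ∧ (c ≤ᵇ rowEnd x y z a j) ∧ not (removed x y z a (j , c))

cellsE : ℕ → ℕ → ℕ → ℕ → List Cell
cellsE x y z a =
  filter (λ q → inE x y z a q)
    (concatMap (λ j → map (λ c → (j , c)) (upTo (suc (rowEnd x y z a j))))
               (upTo (nRows y z a)))

lozengesE : ℕ → ℕ → ℕ → ℕ → List Lozenge
lozengesE x y z a =
  filter (λ l → foldr (λ q b → inE x y z a q ∧ b) true (cellsOf l))
    (concatMap (λ q → hor (proj₁ q) (proj₂ q)
                      ∷ (if isUp q then [] else ver (proj₁ q) (proj₂ q) ∷ []))
               (cellsE x y z a))

-- weights of *E_{x,y,z}(a): 1/2 for a northeastern boundary lozenge (the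
-- NE-side up-triangle of a row together with the down-triangle west of it),
-- 1 otherwise.
weight : ℕ → ℕ → ℕ → ℕ → Lozenge → ℚ
weight x y z a (hor j c) = if isNEtriangle x y z a (j , suc c) then ½ else 1ℚ
weight x y z a (ver j c) = 1ℚ

sublists : {A : Set} → List A → List (List A)
sublists []       = [] ∷ []
sublists (l ∷ ls) = map (l ∷_) (sublists ls) ++ sublists ls

countCover : List Lozenge → Cell → ℕ
countCover T q = length (filter (λ l → covers l q) T)

isTilingE : ℕ → ℕ → ℕ → ℕ → List Lozenge → Bool
isTilingE x y z a T = foldr (λ q b → (countCover T q ≡ᵇ 1) ∧ b) true (cellsE x y z a)

weightOf : ℕ → ℕ → ℕ → ℕ → List Lozenge → ℚ
weightOf x y z a T = foldr (λ l r → weight x y z a l ℚ.* r) 1ℚ T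

M*E : ℕ → ℕ → ℕ → ℕ → ℚ
M*E x y z a =
  foldr ℚ._+_ 0ℚ
    (map (λ T → if isTilingE x y z a T then weightOf x y z a T else 0ℚ)
         (sublists (lozengesE x y z a)))

{-# OPTIONS --safe #-}
module Submission where

-- Scanning the cells row by row, the covering condition at each cell acts as
-- a linear relation between vectors indexed by the northeastern boundary rows, so
-- that the weighted number of tilings is a minor of the matrix
-- A(t,u) = p(x + 2t - u - 1, 2u - t), where p counts lattice paths, with
-- weight 1/2 for a final horizontal step. For a = 0 it is a corner minor, evaluated by
-- Dodgson condensation (the Andrews–Burge determinant); in general it is the minor
-- whose row set has a gap of length a, and the Plücker relation
--   M(y,a,z) M(y-1,a,z) = M(y-1,a,z+1) M(y,a,z-1) + M(y+1,a-1,z) M(y-2,a+1,z)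
-- determines it. Its solution G has a hypergeometric ratio in z, whereas E₄ has one
-- under (y,a) → (y-1,a+1), because the products over i in E₃ and K telescope for
-- that step; both ratios are quotients of products of factorials of linear forms,
-- and they are compatible.

-- The weight 1/2 is what makes the minors computable: p(l,v) = (l+2v)(l+v-1)!/(2 l! v!), and in the
-- entry A(t,u) the factor l+2v equals x+3u-1, which depends on the column alone. Pulled out, it
-- leaves a matrix from a family that shifts of rows and columns preserve, so condensation closes on
-- it. The Plücker relation is solved by dividing by the proposed closed form, which is nonzero by
-- construction. The boundary cases are z = 0 and a = 0, where the minors are corner minors, and y =
-- 0, where the matrix is block triangular. After the division only one polynomial identity with
-- three terms remains. Everything else is cancellation of factorials of affine forms and is left to
-- a reflective checker, which turns such identities into `refl`. The step in (y,a) suits E₄ because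
-- it fixes y+a: the product of the `P₃` does not change, and the formulas for even and odd y
-- alternate. In z, by contrast, the floors of z/2 enter the lengths of many factors; the parity of
-- z is therefore split off only when the two ratios are compared.

open import Defs
open import Data.Rational.Solver using () renaming (module +-*-Solver to ℚSolver)
open import Relation.Binary.PropositionalEquality

-- Determinants as iterated interior products: multilinearity, expansions, the Plücker relation.

module Determinant where

  open import Data.Rational.Base using (ℚ; 0ℚ; 1ℚ; _+_; _*_; -_; _-_)
  open import Data.Rational.Properties
  open import Data.Nat.Base using (ℕ; zero; suc)
  open import Data.List.Base using (List; []; _∷_; _++_; map; length)
  open import Data.List.Relation.Unary.All as All using (All; []; _∷_)
  open import Data.List.Relation.Unary.Any using (here; there)
  open import Data.List.Membership.Propositional using (_∈_)
  open import Data.List.Membership.Propositional.Properties using (∈-∃++)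
  open import Data.Product.Base using (_,_)

  open ℚSolver using (solve; _:+_; _:*_; _:-_; :-_; _:=_; con)
  open ≡-Reasoning

  private variable A B C : Set

  a≡-a⇒a≡0 : ∀ a → a ≡ - a → a ≡ 0ℚ
  a≡-a⇒a≡0 a eq = begin
    a                 ≡⟨ solve 1 (λ a → a := con ½ :* (a :+ a)) refl a ⟩
    ½ * (a + a)       ≡⟨ cong (λ b → ½ * (a + b)) eq ⟩
    ½ * (a + - a)     ≡⟨ solve 1 (λ a → con ½ :* (a :+ (:- a)) := con 0ℚ) refl a ⟩
    0ℚ                ∎
    where open import Data.Rational.Base using (½)

  sub-as-add : ∀ a b → a - b ≡ a + (- 1ℚ) * b
  sub-as-add = solve 2 (λ a b → a :- b := a :+ (:- con 1ℚ) :* b) refl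

  sgn : ℕ → ℚ
  sgn zero    = 1ℚ
  sgn (suc n) = - sgn n

  sgn² : ∀ n → sgn n * sgn n ≡ 1ℚ
  sgn² zero    = refl
  sgn² (suc n) = trans (solve 1 (λ s → (:- s) :* (:- s) := s :* s) refl (sgn n)) (sgn² n)

  -- E φ is the interior product by φ, acting on functions of a list of vectors.
  E : (A → ℚ) → (List A → ℚ) → List A → ℚ
  E φ F []       = 0ℚ
  E φ F (v ∷ vs) = φ v * F vs - E φ (λ ws → F (v ∷ ws)) vs

  E-cong : ∀ {φ ψ : A → ℚ} {F G : List A → ℚ} vs → All (λ v → φ v ≡ ψ v) vs →
           (∀ ws → F ws ≡ G ws) → E φ F vs ≡ E ψ G vs
  E-cong []       []       q = refl
  E-cong (v ∷ vs) (p ∷ ps) q = cong₂ _-_ (cong₂ _*_ p (q vs)) (E-cong vs ps (λ ws → q (v ∷ ws)))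

  E-congʳ : ∀ {φ : A → ℚ} {F G : List A → ℚ} vs → (∀ ws → F ws ≡ G ws) → E φ F vs ≡ E φ G vs
  E-congʳ vs = E-cong vs (All.universal (λ _ → refl) vs)

  E-linʳ : ∀ (φ : A → ℚ) F G α β vs →
           E φ (λ ws → α * F ws + β * G ws) vs ≡ α * E φ F vs + β * E φ G vs
  E-linʳ φ F G α β []       = solve 2 (λ a b → con 0ℚ := a :* con 0ℚ :+ b :* con 0ℚ) refl α β
  E-linʳ φ F G α β (v ∷ vs) = trans
    (cong (λ e → φ v * (α * F vs + β * G vs) - e) (E-linʳ φ (λ ws → F (v ∷ ws)) (λ ws → G (v ∷ ws)) α β vs))
    (solve 7 (λ p f g a b x y → p :* (a :* f :+ b :* g) :- (a :* x :+ b :* y)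
                                := a :* (p :* f :- x) :+ b :* (p :* g :- y)) refl
       (φ v) (F vs) (G vs) α β _ _)

  E-linˡ : ∀ (φ ψ : A → ℚ) F α β vs →
           E (λ v → α * φ v + β * ψ v) F vs ≡ α * E φ F vs + β * E ψ F vs
  E-linˡ φ ψ F α β []       = solve 2 (λ a b → con 0ℚ := a :* con 0ℚ :+ b :* con 0ℚ) refl α β
  E-linˡ φ ψ F α β (v ∷ vs) = trans
    (cong (λ e → (α * φ v + β * ψ v) * F vs - e) (E-linˡ φ ψ (λ ws → F (v ∷ ws)) α β vs))
    (solve 7 (λ p q f a b x y → (a :* p :+ b :* q) :* f :- (a :* x :+ b :* y)
                                := a :* (p :* f :- x) :+ b :* (q :* f :- y)) refl
       (φ v) (ψ v) (F vs) α β _ _)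

  E-zeroʳ : ∀ (φ : A → ℚ) {F : List A → ℚ} vs → (∀ ws → F ws ≡ 0ℚ) → E φ F vs ≡ 0ℚ
  E-zeroʳ φ         []       q = refl
  E-zeroʳ φ {F = F} (v ∷ vs) q = trans (cong₂ (λ f e → φ v * f - e) (q vs) (E-zeroʳ φ vs (λ ws → q (v ∷ ws))))
                              (solve 1 (λ p → p :* con 0ℚ :- con 0ℚ := con 0ℚ) refl (φ v))

  E-zeroˡ : ∀ {φ : A → ℚ} (F : List A → ℚ) vs → All (λ v → φ v ≡ 0ℚ) vs → E φ F vs ≡ 0ℚ
  E-zeroˡ F []       []       = refl
  E-zeroˡ F (v ∷ vs) (p ∷ ps) = trans (cong₂ (λ f e → f * F vs - e) p (E-zeroˡ _ vs ps))
                              (solve 1 (λ p → con 0ℚ :* p :- con 0ℚ := con 0ℚ) refl (F vs))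

  -- Deleting two vectors in either order leaves the same list, but the sign of the second deletion
  -- depends on whether the first took place before it. This replaces the bookkeeping of
  -- permutations: column exchanges are instances of it.
  E-anticomm : ∀ (φ ψ : A → ℚ) F vs → E φ (E ψ F) vs ≡ - E ψ (E φ F) vs
  E-anticomm φ ψ F []       = refl
  E-anticomm φ ψ F (v ∷ vs) = begin
    φ v * E ψ F vs - E φ (λ ws → ψ v * F ws - E ψ Fv ws) vs
      ≡⟨ cong (λ e → φ v * E ψ F vs - e) (expand φ ψ) ⟩
    φ v * E ψ F vs - (ψ v * E φ F vs - E φ (E ψ Fv) vs)
      ≡⟨ cong (λ e → φ v * E ψ F vs - (ψ v * E φ F vs - e)) (E-anticomm φ ψ Fv vs) ⟩
    φ v * E ψ F vs - (ψ v * E φ F vs - - E ψ (E φ Fv) vs)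
      ≡⟨ solve 5 (λ a b c d e → a :* b :- (c :* d :- (:- e)) := :- (c :* d :- (a :* b :- e))) refl
           (φ v) (E ψ F vs) (ψ v) (E φ F vs) (E ψ (E φ Fv) vs) ⟩
    - (ψ v * E φ F vs - (φ v * E ψ F vs - E ψ (E φ Fv) vs))
      ≡⟨ cong (λ e → - (ψ v * E φ F vs - e)) (expand ψ φ) ⟨
    - (ψ v * E φ F vs - E ψ (λ ws → φ v * F ws - E φ Fv ws) vs) ∎
    where
    Fv : List _ → ℚ
    Fv ws = F (v ∷ ws)
    expand : ∀ φ ψ → E φ (λ ws → ψ v * F ws - E ψ Fv ws) vs ≡ ψ v * E φ F vs - E φ (E ψ Fv) vs
    expand φ ψ = begin
      E φ (λ ws → ψ v * F ws - E ψ Fv ws) vs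
        ≡⟨ E-congʳ vs (λ ws → sub-as-add (ψ v * F ws) (E ψ Fv ws)) ⟩
      E φ (λ ws → ψ v * F ws + (- 1ℚ) * E ψ Fv ws) vs
        ≡⟨ E-linʳ φ F (E ψ Fv) (ψ v) (- 1ℚ) vs ⟩
      ψ v * E φ F vs + (- 1ℚ) * E φ (E ψ Fv) vs
        ≡⟨ sub-as-add (ψ v * E φ F vs) (E φ (E ψ Fv) vs) ⟨
      ψ v * E φ F vs - E φ (E ψ Fv) vs ∎

  E-self : ∀ (φ : A → ℚ) F vs → E φ (E φ F) vs ≡ 0ℚ
  E-self φ F vs = a≡-a⇒a≡0 (E φ (E φ F) vs) (E-anticomm φ φ F vs)

  -- Deletions from two different lists do not interfere, so no sign appears. This is the passage
  -- from column expansion to row expansion.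
  E-swap : ∀ (φ : A → ℚ) (ψ : B → ℚ) (K : List B → List A → ℚ) as bs →
           E φ (λ as′ → E ψ (λ bs′ → K bs′ as′) bs) as ≡ E ψ (λ bs′ → E φ (K bs′) as) bs
  E-swap φ ψ K as []       = E-zeroʳ φ as (λ _ → refl)
  E-swap φ ψ K as (b ∷ bs) = begin
    E φ (λ as′ → ψ b * K bs as′ - E ψ (λ bs′ → K (b ∷ bs′) as′) bs) as
      ≡⟨ E-congʳ as (λ as′ → sub-as-add (ψ b * K bs as′) (E ψ (λ bs′ → K (b ∷ bs′) as′) bs)) ⟩
    E φ (λ as′ → ψ b * K bs as′ + (- 1ℚ) * E ψ (λ bs′ → K (b ∷ bs′) as′) bs) as
      ≡⟨ E-linʳ φ (K bs) _ (ψ b) (- 1ℚ) as ⟩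
    ψ b * E φ (K bs) as + (- 1ℚ) * E φ (λ as′ → E ψ (λ bs′ → K (b ∷ bs′) as′) bs) as
      ≡⟨ cong (λ e → ψ b * E φ (K bs) as + (- 1ℚ) * e) (E-swap φ ψ (λ bs′ → K (b ∷ bs′)) as bs) ⟩
    ψ b * E φ (K bs) as + (- 1ℚ) * E ψ (λ bs′ → E φ (K (b ∷ bs′)) as) bs
      ≡⟨ sub-as-add (ψ b * E φ (K bs) as) (E ψ (λ bs′ → E φ (K (b ∷ bs′)) as) bs) ⟨
    ψ b * E φ (K bs) as - E ψ (λ bs′ → E φ (K (b ∷ bs′)) as) bs ∎

  E-map : ∀ (f : A → B) (φ : B → ℚ) F vs → E φ F (map f vs) ≡ E (λ v → φ (f v)) (λ ws → F (map f ws)) vs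
  E-map f φ F []       = refl
  E-map f φ F (v ∷ vs) = cong (λ e → φ (f v) * F (map f vs) - e) (E-map f φ (λ ws → F (f v ∷ ws)) vs)

  E-++ : ∀ (φ : A → ℚ) F xs ys → E φ F (xs ++ ys)
         ≡ E φ (λ ws → F (ws ++ ys)) xs + sgn (length xs) * E φ (λ ws → F (xs ++ ws)) ys
  E-++ φ F []       ys = solve 1 (λ e → e := con 0ℚ :+ con 1ℚ :* e) refl _
  E-++ φ F (x ∷ xs) ys = trans
    (cong (λ e → φ x * F (xs ++ ys) - e) (E-++ φ (λ ws → F (x ∷ ws)) xs ys))
    (solve 4 (λ a b s c → a :- (b :+ s :* c) := (a :- b) :+ (:- s) :* c) refl
       (φ x * F (xs ++ ys)) (E φ (λ ws → F (x ∷ ws ++ ys)) xs) (sgn (length xs)) (E φ (λ ws → F (x ∷ xs ++ ws)) ys))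

  Alternating : (List A → ℚ) → Set _
  Alternating F = ∀ xs a b ys → F (xs ++ a ∷ b ∷ ys) ≡ - F (xs ++ b ∷ a ∷ ys)

  -- The terms that delete `a` and `b` are exchanged and carry opposite signs; a term that deletes
  -- another vector leaves the adjacent pair to `F`.
  E-alternating : ∀ (φ : A → ℚ) {F} → Alternating F → Alternating (E φ F)
  E-alternating φ {F} alt []       a b ys = trans
    (cong (λ e → φ a * F (b ∷ ys) - (φ b * F (a ∷ ys) - e))
      (trans (E-congʳ ys (λ ws → trans (alt [] a b ws)
                (solve 1 (λ f → :- f := (:- con 1ℚ) :* f :+ con 0ℚ :* f) refl (F (b ∷ a ∷ ws)))))
             (E-linʳ φ (λ ws → F (b ∷ a ∷ ws)) (λ ws → F (b ∷ a ∷ ws)) (- 1ℚ) 0ℚ ys)))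
    (solve 3 (λ p q e → p :- (q :- ((:- con 1ℚ) :* e :+ con 0ℚ :* e)) := :- (q :- (p :- e))) refl
       (φ a * F (b ∷ ys)) (φ b * F (a ∷ ys)) (E φ (λ ws → F (b ∷ a ∷ ws)) ys))
  E-alternating φ {F} alt (x ∷ xs) a b ys = trans
    (cong₂ (λ f e → φ x * f - e) (alt xs a b ys) (E-alternating φ (λ zs → alt (x ∷ zs)) xs a b ys))
    (solve 3 (λ p f e → p :* (:- f) :- (:- e) := :- (p :* f :- e)) refl (φ x)
       (F (xs ++ b ∷ a ∷ ys)) (E φ (λ ws → F (x ∷ ws)) (xs ++ b ∷ a ∷ ys)))

  alternating-∷ : ∀ (F : List A → ℚ) x → Alternating F → Alternating (λ ws → F (x ∷ ws))
  alternating-∷ F x alt xs = alt (x ∷ xs)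

  move-front : ∀ (F : List A → ℚ) → Alternating F → ∀ xs v ys →
               F (xs ++ v ∷ ys) ≡ sgn (length xs) * F (v ∷ xs ++ ys)
  move-front F alt []       v ys = sym (*-identityˡ (F (v ∷ ys)))
  move-front F alt (x ∷ xs) v ys = begin
    F (x ∷ xs ++ v ∷ ys)                      ≡⟨ move-front (λ ws → F (x ∷ ws)) (alternating-∷ F x alt) xs v ys ⟩
    sgn (length xs) * F (x ∷ v ∷ xs ++ ys)    ≡⟨ cong (sgn (length xs) *_) (alt [] x v (xs ++ ys)) ⟩
    sgn (length xs) * - F (v ∷ x ∷ xs ++ ys)  ≡⟨ solve 2 (λ s f → s :* (:- f) := (:- s) :* f) refl (sgn (length xs)) (F (v ∷ x ∷ xs ++ ys)) ⟩
    - sgn (length xs) * F (v ∷ x ∷ xs ++ ys)  ∎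

  repeated : ∀ (F : List A → ℚ) → Alternating F → ∀ {v vs} → v ∈ vs → F (v ∷ vs) ≡ 0ℚ
  repeated F alt {v} {vs} v∈vs with ∈-∃++ v∈vs
  ... | xs , ys , refl = begin
    F (v ∷ xs ++ v ∷ ys)                      ≡⟨ move-front (λ ws → F (v ∷ ws)) (alternating-∷ F v alt) xs v ys ⟩
    sgn (length xs) * F (v ∷ v ∷ xs ++ ys)    ≡⟨ cong (sgn (length xs) *_) (a≡-a⇒a≡0 (F (v ∷ v ∷ xs ++ ys)) (alt [] v v (xs ++ ys))) ⟩
    sgn (length xs) * 0ℚ                      ≡⟨ *-zeroʳ (sgn (length xs)) ⟩
    0ℚ                                        ∎

  -- det m bs as is the determinant of the matrix m a b with rows a ∈ as and columns b ∈ bs.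
  det : (A → B → ℚ) → List B → List A → ℚ
  det m []       []       = 1ℚ
  det m []       (_ ∷ _)  = 0ℚ
  det m (b ∷ bs) as       = E (λ a → m a b) (det m bs) as

  det-alternating : ∀ (m : A → B → ℚ) bs → Alternating (det m bs)
  det-alternating m []       []       a b ys = refl
  det-alternating m []       (_ ∷ _)  a b ys = refl
  det-alternating m (b ∷ bs)                 = E-alternating _ (det-alternating m bs)

  -- The entries are known to agree only at the rows and columns that occur. The auxiliary
  -- `det-cong-E` therefore remembers that every list left after deletions lies in the original one.
  det-cong : ∀ {m m′ : A → B → ℚ} bs as → (∀ a → a ∈ as → ∀ b → b ∈ bs → m a b ≡ m′ a b) →
             det m bs as ≡ det m′ bs as
  det-cong-E : ∀ {m m′ : A → B → ℚ} (φ φ′ : A → ℚ) bs F F′ as →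
               (∀ a → a ∈ as → ∀ b → b ∈ bs → m a b ≡ m′ a b) → (∀ a → a ∈ as → φ a ≡ φ′ a) →
               (∀ ws → (∀ a → a ∈ ws → a ∈ as) → F ws ≡ F′ ws) → E φ F as ≡ E φ′ F′ as
  det-cong-E φ φ′ bs F F′ []       p q r = refl
  det-cong-E {m = m} {m′} φ φ′ bs F F′ (a ∷ as) p q r = cong₂ _-_
    (cong₂ _*_ (q a (here refl)) (r as (λ _ → there)))
    (det-cong-E {m = m} {m′} φ φ′ bs _ _ as (λ a a∈ → p a (there a∈)) (λ a a∈ → q a (there a∈))
      (λ ws s → r (a ∷ ws) (λ { _ (here e) → here e ; b (there b∈) → there (s b b∈) })))
  det-cong []       []      p = refl
  det-cong []       (_ ∷ _) p = refl
  det-cong {m = m} {m′} (b ∷ bs) as p = det-cong-E {m = m} {m′} _ _ bs _ _ as (λ a a∈ b b∈ → p a a∈ b (there b∈))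
    (λ a a∈ → p a a∈ b (here refl)) (λ ws s → det-cong bs ws (λ a a∈ b b∈ → p a (s a a∈) b (there b∈)))

  det-map-rows : ∀ (f : A → B) (m : B → C → ℚ) cs as →
                 det m cs (map f as) ≡ det (λ a → m (f a)) cs as
  det-map-rows f m []       []      = refl
  det-map-rows f m []       (_ ∷ _) = refl
  det-map-rows f m (c ∷ cs) as      = trans (E-map f _ _ as) (E-congʳ as (det-map-rows f m cs))

  det-map-cols : ∀ (f : B → C) (m : A → C → ℚ) bs as →
                 det m (map f bs) as ≡ det (λ a b → m a (f b)) bs as
  det-map-cols f m []       []      = refl
  det-map-cols f m []       (_ ∷ _) = refl
  det-map-cols f m (b ∷ bs) as      = E-congʳ as (det-map-cols f m bs)

  -- In the terms of the column expansion that do not use row `a`, the induction hypothesis expands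
  -- along `a` inside; `E-swap` brings that expansion outside.
  det-expand-row : ∀ (m : A → B → ℚ) bs a as → det m bs (a ∷ as) ≡ E (m a) (λ bs′ → det m bs′ as) bs
  det-expand-row m []       a as = refl
  det-expand-row m (b ∷ bs) a as = cong (λ e → m a b * det m bs as - e)
    (trans (E-congʳ as (λ as′ → det-expand-row m bs a as′))
           (E-swap (λ a → m a b) (m a) (λ bs′ as′ → det m bs′ as′) as bs))

  det-transpose : ∀ (m : A → B → ℚ) bs as → det m bs as ≡ det (λ b a → m a b) as bs
  det-transpose m []       []       = refl
  det-transpose m (b ∷ bs) []       = refl
  det-transpose m []       (a ∷ as) = refl
  det-transpose m (b ∷ bs) (a ∷ as) = trans (det-expand-row m (b ∷ bs) a as)
    (E-congʳ {φ = m a} (b ∷ bs) (λ bs′ → det-transpose m bs′ as))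

  det-scale-cols : ∀ (k : B → ℚ) (m : A → B → ℚ) b bs as →
                   det (λ a b → k b * m a b) (b ∷ bs) as
                   ≡ k b * E (λ a → m a b) (det (λ a b → k b * m a b) bs) as
  det-scale-cols k m b bs as = trans
    (E-cong as (All.universal (λ v → solve 2 (λ k m → k :* m := k :* m :+ con 0ℚ :* m) refl (k b) (m v b)) as) (λ _ → refl))
    (trans (E-linˡ (λ a → m a b) (λ a → m a b) (det (λ a b → k b * m a b) bs) (k b) 0ℚ as)
           (solve 2 (λ k e → k :* e :+ con 0ℚ :* e := k :* e) refl (k b) (E (λ a → m a b) (det (λ a b → k b * m a b) bs) as)))

  prodL : (B → ℚ) → List B → ℚ
  prodL k []       = 1ℚ
  prodL k (b ∷ bs) = k b * prodL k bs

  det-scale : ∀ (k : B → ℚ) (m : A → B → ℚ) bs as →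
              det (λ a b → k b * m a b) bs as ≡ prodL k bs * det m bs as
  det-scale k m []       []      = refl
  det-scale k m []       (_ ∷ _) = refl
  det-scale k m (b ∷ bs) as      = begin
    det (λ a b → k b * m a b) (b ∷ bs) as
      ≡⟨ det-scale-cols k m b bs as ⟩
    k b * E (λ a → m a b) (det (λ a b → k b * m a b) bs) as
      ≡⟨ cong (k b *_) (E-congʳ as (λ ws → trans (det-scale k m bs ws)
           (solve 2 (λ p d → p :* d := p :* d :+ con 0ℚ :* d) refl (prodL k bs) (det m bs ws)))) ⟩
    k b * E (λ a → m a b) (λ ws → prodL k bs * det m bs ws + 0ℚ * det m bs ws) as
      ≡⟨ cong (k b *_) (E-linʳ (λ a → m a b) (det m bs) (det m bs) (prodL k bs) 0ℚ as) ⟩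
    k b * (prodL k bs * E (λ a → m a b) (det m bs) as + 0ℚ * E (λ a → m a b) (det m bs) as)
      ≡⟨ solve 3 (λ k p e → k :* (p :* e :+ con 0ℚ :* e) := (k :* p) :* e) refl (k b) (prodL k bs) (E (λ a → m a b) (det m bs) as) ⟩
    (k b * prodL k bs) * E (λ a → m a b) (det m bs) as ∎

  -- Vectors are functions of the column index.
  apply : (B → ℚ) → B → ℚ
  apply v = v

  Lin : (List A → ℚ) → ℚ → ℚ → A → A → A → Set
  Lin F α β v u w = ∀ xs ys → F (xs ++ v ∷ ys) ≡ α * F (xs ++ u ∷ ys) + β * F (xs ++ w ∷ ys)

  E-Lin : ∀ (φ : A → ℚ) {F α β v u w} → φ v ≡ α * φ u + β * φ w → Lin F α β v u w → Lin (E φ F) α β v u w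
  E-Lin φ {F} {α} {β} {v} {u} {w} p l []       ys = trans
    (cong₂ (λ f e → f * F ys - e) p
       (trans (E-congʳ ys (λ ws → l [] ws)) (E-linʳ φ (λ ws → F (u ∷ ws)) (λ ws → F (w ∷ ws)) α β ys)))
    (solve 7 (λ a b p q f x y → (a :* p :+ b :* q) :* f :- (a :* x :+ b :* y)
                                := a :* (p :* f :- x) :+ b :* (q :* f :- y)) refl α β (φ u) (φ w) (F ys)
       (E φ (λ ws → F (u ∷ ws)) ys) (E φ (λ ws → F (w ∷ ws)) ys))
  E-Lin φ {F} {α} {β} {v} {u} {w} p l (x ∷ xs) ys = trans
    (cong₂ (λ f e → φ x * f - e) (l xs ys) (E-Lin φ {λ ws → F (x ∷ ws)} {α} {β} {v} {u} {w} p (λ xs ys → l (x ∷ xs) ys) xs ys))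
    (solve 7 (λ p a b f g x y → p :* (a :* f :+ b :* g) :- (a :* x :+ b :* y)
                                := a :* (p :* f :- x) :+ b :* (p :* g :- y)) refl (φ x) α β
       (F (xs ++ u ∷ ys)) (F (xs ++ w ∷ ys)) (E φ (λ ws → F (x ∷ ws)) (xs ++ u ∷ ys)) (E φ (λ ws → F (x ∷ ws)) (xs ++ w ∷ ys)))

  -- The linear relation is demanded at the columns of the determinant only. The scan depends on
  -- this, since the recurrence of the path counts is available at exit rows only.
  det-lin : ∀ {α β} {v u w : B → ℚ} bs → (∀ b → b ∈ bs → v b ≡ α * u b + β * w b) →
            Lin (det apply bs) α β v u w
  det-lin {α = α} {β} []       p []      ys = solve 2 (λ a b → con 0ℚ := a :* con 0ℚ :+ b :* con 0ℚ) refl α β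
  det-lin {α = α} {β} []       p (_ ∷ _) ys = solve 2 (λ a b → con 0ℚ := a :* con 0ℚ :+ b :* con 0ℚ) refl α β
  det-lin {α = α} {β} {v} {u} {w} (b ∷ bs) p = E-Lin (λ v → v b) {det apply bs} {α} {β} {v} {u} {w}
    (p b (here refl)) (det-lin {α = α} {β} {v} {u} {w} bs (λ b b∈ → p b (there b∈)))

  det-zero : ∀ {v : B → ℚ} bs → (∀ b → b ∈ bs → v b ≡ 0ℚ) → ∀ xs ys → det apply bs (xs ++ v ∷ ys) ≡ 0ℚ
  det-zero {v = v} bs p xs ys = trans
    (det-lin {α = 0ℚ} {0ℚ} {v} {v} {v} bs (λ b b∈ → trans (p b b∈) (solve 1 (λ x → con 0ℚ := con 0ℚ :* x :+ con 0ℚ :* x) refl (v b))) xs ys)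
    (solve 1 (λ x → con 0ℚ :* x :+ con 0ℚ :* x := con 0ℚ) refl (det apply bs (xs ++ v ∷ ys)))

  det-repeated-col : ∀ {b : B} bs → b ∈ bs → ∀ vs → E (λ v → v b) (det apply bs) vs ≡ 0ℚ
  det-repeated-col (b ∷ bs) (here refl) vs = E-self _ _ vs
  det-repeated-col {b = b} (c ∷ bs) (there b∈) vs = begin
    E (λ v → v b) (E (λ v → v c) (det apply bs)) vs    ≡⟨ E-anticomm _ _ _ vs ⟩
    - E (λ v → v c) (E (λ v → v b) (det apply bs)) vs  ≡⟨ cong -_ (E-zeroʳ _ vs (det-repeated-col bs b∈)) ⟩
    0ℚ                                                 ∎

  -- Typical members are the coordinate functionals at the columns `bs` and their combinations:
  -- contracting with one of them repeats a column.
  Annihilates : List B → ((B → ℚ) → ℚ) → Set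
  Annihilates bs φ = ∀ vs → E φ (det apply bs) vs ≡ 0ℚ

  annihilates-comb : ∀ (bs : List B) φ ψ α β → Annihilates bs φ → Annihilates bs ψ →
                     Annihilates bs (λ v → α * φ v + β * ψ v)
  annihilates-comb bs φ ψ α β p q vs = trans (E-linˡ φ ψ _ α β vs)
    (trans (cong₂ (λ x y → α * x + β * y) (p vs) (q vs))
           (solve 2 (λ a b → a :* con 0ℚ :+ b :* con 0ℚ := con 0ℚ) refl α β))

  annihilates-cong : ∀ (bs : List B) {φ ψ} → (∀ v → φ v ≡ ψ v) → Annihilates bs ψ → Annihilates bs φ
  annihilates-cong bs p q vs = trans (E-cong vs (All.universal p vs) (λ _ → refl)) (q vs)

  annihilates-E : ∀ (bs : List B) (ψ : A → ℚ) (K : List A → (B → ℚ) → ℚ) → (∀ ws → Annihilates bs (K ws)) →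
                  ∀ R → Annihilates bs (λ v → E ψ (λ ws → K ws v) R)
  annihilates-E bs ψ K p []      vs = E-zeroˡ _ vs (All.universal (λ _ → refl) vs)
  annihilates-E bs ψ K p (r ∷ R)    = annihilates-cong bs
    (λ v → sub-as-add (ψ r * K R v) (E ψ (λ ws → K (r ∷ ws) v) R))
    (annihilates-comb bs (K R) (λ v → E ψ (λ ws → K (r ∷ ws) v) R) (ψ r) (- 1ℚ) (p R) (annihilates-E bs ψ (λ ws → K (r ∷ ws)) (λ ws → p (r ∷ ws)) R))

  -- As a function of its first row, a determinant is a combination of the coordinates at its own
  -- columns, and each of these repeats a column of `bs`.
  annihilates-det : ∀ (bs bs′ : List B) → (∀ b → b ∈ bs′ → b ∈ bs) → ∀ R →
                    Annihilates bs (λ v → det apply bs′ (v ∷ R))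
  annihilates-det bs []        s R vs = E-zeroˡ _ vs (All.universal (λ _ → refl) vs)
  annihilates-det bs (b ∷ bs′) s R    = annihilates-cong bs
    (λ v → solve 3 (λ x d e → x :* d :- e := d :* x :+ (:- con 1ℚ) :* e) refl (v b) (det apply bs′ R)
             (E (λ v → v b) (λ ws → det apply bs′ (v ∷ ws)) R))
    (annihilates-comb bs (λ v → v b) (λ v → E (λ v → v b) (λ ws → det apply bs′ (v ∷ ws)) R) (det apply bs′ R) (- 1ℚ) (det-repeated-col bs (s b (here refl)))
       (annihilates-E bs (λ v → v b) (λ ws v → det apply bs′ (v ∷ ws))
          (annihilates-det bs bs′ (λ b b∈ → s b (there b∈))) R))

  -- Cramer's rule gives a linear relation between c, d, e and the vectors of S;
  -- apply the functional v ↦ det (v ∷ a ∷ S) to it.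
  plücker : ∀ (bs : List B) a c d e S → let D = det apply bs in
            D (c ∷ a ∷ S) * D (d ∷ e ∷ S) - D (d ∷ a ∷ S) * D (c ∷ e ∷ S) + D (e ∷ a ∷ S) * D (c ∷ d ∷ S) ≡ 0ℚ
  plücker bs a c d e S = begin
    φ c * D (d ∷ e ∷ S) - φ d * D (c ∷ e ∷ S) + φ e * D (c ∷ d ∷ S)
      ≡⟨ solve 3 (λ x y z → x :- y :+ z := x :- (y :- (z :- con 0ℚ))) refl
           (φ c * D (d ∷ e ∷ S)) (φ d * D (c ∷ e ∷ S)) (φ e * D (c ∷ d ∷ S)) ⟩
    φ c * D (d ∷ e ∷ S) - (φ d * D (c ∷ e ∷ S) - (φ e * D (c ∷ d ∷ S) - 0ℚ))
      ≡⟨ cong (λ z → φ c * D (d ∷ e ∷ S) - (φ d * D (c ∷ e ∷ S) - (φ e * D (c ∷ d ∷ S) - z))) (sym tail) ⟩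
    E φ D (c ∷ d ∷ e ∷ S)
      ≡⟨ annihilates-det bs bs (λ _ b∈ → b∈) (a ∷ S) (c ∷ d ∷ e ∷ S) ⟩
    0ℚ ∎
    where
    D : List _ → ℚ
    D = det apply bs
    φ : (_ → ℚ) → ℚ
    φ v = D (v ∷ a ∷ S)
    tail : E φ (λ ws → D (c ∷ d ∷ e ∷ ws)) S ≡ 0ℚ
    tail = E-zeroˡ _ S (All.tabulate (λ s∈ → repeated D (det-alternating apply bs) (there s∈)))

  det-unit : ∀ (b : B) bs (e : B → ℚ) → e b ≡ 1ℚ → (∀ c → c ∈ bs → e c ≡ 0ℚ) → ∀ vs →
             det apply (b ∷ bs) (e ∷ vs) ≡ det apply bs vs
  det-unit b bs e p q vs = trans
    (cong₂ (λ x y → x * det apply bs vs - y) p (E-zeroʳ _ vs (λ ws → det-zero bs q [] ws)))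
    (solve 1 (λ d → con 1ℚ :* d :- con 0ℚ := d) refl (det apply bs vs))

open import Data.Bool.Base using (Bool; T; _∧_; _∨_; false; if_then_else_; not; true)
open import Data.Nat.Base using (NonZero; _!; _%_; _*_; _+_; _/_; _<_; _<ᵇ_; _^_; _∸_; _≡ᵇ_; _≤_; _≤ᵇ_; suc; s≤s; zero; z≤n; ℕ; ⌊_/2⌋)
open import Data.Nat.Properties as ℕ using (<-irrefl; <ᵇ⇒<; <⇒<ᵇ; m≤n⇒m≤1+n; n≤1+n; ≡ᵇ⇒≡; ≤-refl; ≤-trans; ≤ᵇ⇒≤; ≤⇒≤ᵇ)
open import Data.Rational.Base as ℚ using (0ℚ; 1ℚ; toℚᵘ; ½; ℚ)
open import Data.Rational.Properties as ℚ using ()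
open import Data.List.Base using (List; []; _++_; _∷_; applyUpTo; concatMap; downFrom; foldr; length; map; upTo)
open import Data.Product.Base using (_,_; _×_; proj₁; proj₂; ∃)
open import Data.Sum.Base using (_⊎_; inj₁; inj₂)
open import Data.Empty using (⊥; ⊥-elim)
open import Data.Unit.Base using (tt)
open import Function.Base using (_∘_)
open import Data.Bool.Properties using (∧-identityʳ; ∧-zeroʳ; ∨-zeroʳ)
open import Data.List.Properties using (++-assoc; ++-identityʳ; map-++)
open import Data.Nat.Solver using () renaming (module +-*-Solver to ℕSolver)

-- Scanning a region cell by cell: weighted tilings as a determinant of path counts.

module RowSweep where

  open Determinant
  open import Data.List.Relation.Unary.All as All using (All; []; _∷_)
  open import Data.List.Relation.Unary.All.Properties using (++⁺)
  open import Data.List.Relation.Unary.Any using (here; there)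
  open import Data.List.Membership.Propositional using (_∈_)

  open ℚSolver using (solve; _:+_; _:*_; _:-_; :-_; _:=_; con)

  true≢false : true ≢ false
  true≢false ()

  isUp-2+ : ∀ n → (suc n % 2 ≡ᵇ 1) ≡ not (n % 2 ≡ᵇ 1)
  isUp-2+ zero          = refl
  isUp-2+ (suc zero)    = refl
  isUp-2+ (suc (suc n)) = isUp-2+ n

  isUp-row : ∀ j c → isUp (suc j , c) ≡ not (isUp (j , c))
  isUp-row j c = isUp-2+ (j + c)

  isUp-col : ∀ j c → isUp (j , suc c) ≡ not (isUp (j , c))
  isUp-col j c = trans (cong (λ n → n % 2 ≡ᵇ 1) (ℕ.+-suc j c)) (isUp-2+ (j + c))

  ≡ᵇ-refl : ∀ n → (n ≡ᵇ n) ≡ true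
  ≡ᵇ-refl zero    = refl
  ≡ᵇ-refl (suc n) = ≡ᵇ-refl n

  ≡ᶜ-refl : ∀ q → (q ≡ᶜ q) ≡ true
  ≡ᶜ-refl (j , c) rewrite ≡ᵇ-refl j | ≡ᵇ-refl c = refl

  ≡ᶜ⇒≡ : ∀ q r → (q ≡ᶜ r) ≡ true → q ≡ r
  ≡ᶜ⇒≡ (j , c) (j′ , c′) e with j ≡ᵇ j′ in p | c ≡ᵇ c′ in r
  ... | true | true = cong₂ _,_ (≡ᵇ⇒≡ j j′ (subst (λ b → Data.Bool.Base.T b) (sym p) tt))
                                (≡ᵇ⇒≡ c c′ (subst (λ b → Data.Bool.Base.T b) (sym r) tt))

  covers⇒∈ : ∀ l q → covers l q ≡ true → q ∈ cellsOf l
  covers⇒∈ l q = go (cellsOf l)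
    where
    go : ∀ qs → foldr (λ q′ b → (q′ ≡ᶜ q) ∨ b) false qs ≡ true → q ∈ qs
    go (r ∷ qs) e with r ≡ᶜ q in p
    ... | true  = here (sym (≡ᶜ⇒≡ r q p))
    ... | false = there (go qs e)

  ∈⇒covers : ∀ l q → q ∈ cellsOf l → covers l q ≡ true
  ∈⇒covers l q = go (cellsOf l)
    where
    go : ∀ qs → q ∈ qs → foldr (λ q′ b → (q′ ≡ᶜ q) ∨ b) false qs ≡ true
    go (r ∷ qs) (here refl) rewrite ≡ᶜ-refl q = refl
    go (r ∷ qs) (there q∈)  rewrite go qs q∈ = ∨-zeroʳ (r ≡ᶜ q)

  ∉⇒covers : ∀ l q → (q ∈ cellsOf l → 1 ≡ 0) → covers l q ≡ false
  ∉⇒covers l q ne with covers l q in e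
  ... | true  with () ← ne (covers⇒∈ l q e)
  ... | false = refl

  -- The sum over all subsets in the form of a decision tree, so that lozenges can be accepted or
  -- refused one at a time.
  sumSub : {A : Set} → (List A → ℚ) → List A → ℚ
  sumSub g []       = g []
  sumSub g (l ∷ ls) = sumSub (g ∘ (l ∷_)) ls ℚ.+ sumSub g ls

  sum-map-++ : {A : Set} (g : A → ℚ) (xs ys : List A) →
    foldr ℚ._+_ 0ℚ (map g (xs ++ ys)) ≡ foldr ℚ._+_ 0ℚ (map g xs) ℚ.+ foldr ℚ._+_ 0ℚ (map g ys)
  sum-map-++ g []       ys = sym (ℚ.+-identityˡ _)
  sum-map-++ g (x ∷ xs) ys = trans (cong (g x ℚ.+_) (sum-map-++ g xs ys)) (sym (ℚ.+-assoc (g x) _ _))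

  sum-sublists : {A : Set} (g : List A → ℚ) (ls : List A) →
    foldr ℚ._+_ 0ℚ (map g (sublists ls)) ≡ sumSub g ls
  sum-sublists g []       = ℚ.+-identityʳ (g [])
  sum-sublists g (l ∷ ls) = trans (sum-map-++ g (map (l ∷_) (sublists ls)) (sublists ls))
    (cong₂ ℚ._+_ (trans (cong (foldr ℚ._+_ 0ℚ) (map-map (sublists ls))) (sum-sublists (g ∘ (l ∷_)) ls)) (sum-sublists g ls))
    where
    map-map : ∀ Ts → map g (map (l ∷_) Ts) ≡ map (g ∘ (l ∷_)) Ts
    map-map []       = refl
    map-map (T ∷ Ts) = cong (_ ∷_) (map-map Ts)

  sumSub-cong : {A : Set} {g h : List A → ℚ} (ls : List A) → (∀ T → g T ≡ h T) → sumSub g ls ≡ sumSub h ls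
  sumSub-cong []       p = p []
  sumSub-cong (l ∷ ls) p = cong₂ ℚ._+_ (sumSub-cong ls (p ∘ (l ∷_))) (sumSub-cong ls p)

  sumSub-zero : {A : Set} {g : List A → ℚ} (P : A → Set) (ls : List A) → All P ls →
    (∀ T → All P T → g T ≡ 0ℚ) → sumSub g ls ≡ 0ℚ
  sumSub-zero P []       []       p = p [] []
  sumSub-zero P (l ∷ ls) (q ∷ qs) p = cong₂ ℚ._+_ (sumSub-zero P ls qs (λ T r → p (l ∷ T) (q ∷ r)))
                                                  (sumSub-zero P ls qs p)

  sumSub-scale : {A : Set} (k : ℚ) (g : List A → ℚ) (ls : List A) →
    sumSub (λ T → k ℚ.* g T) ls ≡ k ℚ.* sumSub g ls
  sumSub-scale k g []       = refl
  sumSub-scale k g (l ∷ ls) = trans (cong₂ ℚ._+_ (sumSub-scale k (g ∘ (l ∷_)) ls) (sumSub-scale k g ls))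
                                    (sym (ℚ.*-distribˡ-+ k (sumSub (g ∘ (l ∷_)) ls) (sumSub g ls)))

  toℕ : Bool → ℕ
  toℕ true  = 1
  toℕ false = 0

  -- The demand on the lozenges that are still undecided: a cell marked `true` must be covered by
  -- exactly one of them, any other cell by none.
  Need : Set
  Need = Cell → Bool

  _∖_ : Need → Lozenge → Need
  (need ∖ l) q = if covers l q then false else need q

  module Covering (cells : List Cell) (wt : Lozenge → ℚ) where

    meets : Need → List Lozenge → Bool
    meets need T = foldr (λ q b → (countCover T q ≡ᵇ toℕ (need q)) ∧ b) true cells

    weightL : List Lozenge → ℚ
    weightL T = foldr (λ l r → wt l ℚ.* r) 1ℚ T

    term : Need → List Lozenge → ℚ
    term need T = if meets need T then weightL T else 0ℚ

    Z : Need → List Lozenge → ℚ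
    Z need ls = sumSub (term need) ls

    meets-cong : ∀ need need′ T T′ → (∀ q → q ∈ cells →
      (countCover T q ≡ᵇ toℕ (need q)) ≡ (countCover T′ q ≡ᵇ toℕ (need′ q))) → meets need T ≡ meets need′ T′
    meets-cong need need′ T T′ = go cells
      where
      go : ∀ qs → (∀ q → q ∈ qs → (countCover T q ≡ᵇ toℕ (need q)) ≡ (countCover T′ q ≡ᵇ toℕ (need′ q))) →
           foldr (λ q b → (countCover T q ≡ᵇ toℕ (need q)) ∧ b) true qs ≡
           foldr (λ q b → (countCover T′ q ≡ᵇ toℕ (need′ q)) ∧ b) true qs
      go []       p = refl
      go (q ∷ qs) p = cong₂ _∧_ (p q (here refl)) (go qs (λ r r∈ → p r (there r∈)))

    meets-false : ∀ need T q → q ∈ cells → (countCover T q ≡ᵇ toℕ (need q)) ≡ false → meets need T ≡ false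
    meets-false need T q q∈ e = go cells q∈
      where
      go : ∀ qs → q ∈ qs → foldr (λ q b → (countCover T q ≡ᵇ toℕ (need q)) ∧ b) true qs ≡ false
      go (_ ∷ qs) (here refl) rewrite e = refl
      go (r ∷ qs) (there q∈)  rewrite go qs q∈ = ∧-zeroʳ _

    Z-nil : ∀ need → (∀ q → q ∈ cells → need q ≡ false) → Z need [] ≡ 1ℚ
    Z-nil need p = cong (λ b → if b then 1ℚ else 0ℚ) (go cells p)
      where
      go : ∀ qs → (∀ q → q ∈ qs → need q ≡ false) →
           foldr (λ q b → (countCover [] q ≡ᵇ toℕ (need q)) ∧ b) true qs ≡ true
      go []       p = refl
      go (q ∷ qs) p rewrite p q (here refl) = go qs (λ r r∈ → p r (there r∈))

    Z-dead : ∀ need ls q → q ∈ cells → need q ≡ true → All (λ l → covers l q ≡ false) ls → Z need ls ≡ 0ℚ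
    Z-dead need ls q q∈ e ps = sumSub-zero _ ls ps
      (λ T r → cong (λ b → if b then weightL T else 0ℚ)
         (meets-false need T q q∈ (subst (λ n → (n ≡ᵇ toℕ (need q)) ≡ false) (sym (uncovered T r))
            (subst (λ b → (0 ≡ᵇ toℕ b) ≡ false) (sym e) refl))))
      where
      uncovered : ∀ T → All (λ l → covers l q ≡ false) T → countCover T q ≡ 0
      uncovered []      []       = refl
      uncovered (l ∷ T) (p ∷ ps) rewrite p = uncovered T ps

    Z-skip : ∀ need l ls q → q ∈ cells → q ∈ cellsOf l → need q ≡ false → Z need (l ∷ ls) ≡ Z need ls
    Z-skip need l ls q q∈ q∈l e = trans
      (cong (ℚ._+ Z need ls) (sumSub-zero (λ _ → 1 ≡ 1) ls (All.universal (λ _ → refl) ls)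
        (λ T _ → cong (λ b → if b then weightL (l ∷ T) else 0ℚ) (meets-false need (l ∷ T) q q∈ (clash T)))))
      (ℚ.+-identityˡ _)
      where
      clash : ∀ T → (countCover (l ∷ T) q ≡ᵇ toℕ (need q)) ≡ false
      clash T rewrite e | ∈⇒covers l q q∈l = refl

    Z-take : ∀ need l ls → (∀ q → q ∈ cellsOf l → need q ≡ true) →
             Z need (l ∷ ls) ≡ wt l ℚ.* Z (need ∖ l) ls ℚ.+ Z need ls
    Z-take need l ls p = cong (ℚ._+ Z need ls) (trans (sumSub-cong ls step) (sumSub-scale (wt l) (term (need ∖ l)) ls))
      where
      same : ∀ T q → (countCover (l ∷ T) q ≡ᵇ toℕ (need q)) ≡ (countCover T q ≡ᵇ toℕ ((need ∖ l) q))
      same T q with covers l q in e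
      ... | false = refl
      ... | true  rewrite p q (covers⇒∈ l q e) = refl
      step : ∀ T → term need (l ∷ T) ≡ wt l ℚ.* term (need ∖ l) T
      step T rewrite meets-cong need (need ∖ l) (l ∷ T) T (λ q _ → same T q) with meets (need ∖ l) T
      ... | true  = refl
      ... | false = sym (ℚ.*-zeroʳ (wt l))

  -- Left-justified rows of widths W; each row marked NE ends with an up-triangle
  -- where a path of lozenges leaves the region. π j c i is the weighted number of such
  -- paths from the down-triangle (j , c) to the exit of row i. During the scan, an
  -- uncovered down-triangle (j , c) contributes the row π j c to a determinant, and a
  -- covered up-triangle (j , c) the row π j (c + 1).
  module Scan
    (cells : List Cell) (wt : Lozenge → ℚ) (W : ℕ → ℕ) (NE : ℕ → Bool) (π : ℕ → ℕ → ℕ → ℚ) (R : ℕ)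
    (∈cells : ∀ j c → c < W j → (j , c) ∈ cells)
    (cells∈ : ∀ j c → (j , c) ∈ cells → c < W j × j < R)
    (W-R : W R ≡ 0)
    (isUp-end : ∀ j → j < R → isUp (j , W j) ≡ not (NE j))
    (wt-up : ∀ j c → isUp (j , c) ≡ true → wt (hor j c) ≡ 1ℚ)
    (wt-ver : ∀ j c → wt (ver j c) ≡ 1ℚ)
    (π-step : ∀ j c i → isUp (j , c) ≡ false → c < W j → j ≤ i → NE i ≡ true →
              π j c i ≡ wt (hor j c) ℚ.* π j (2 + c) i ℚ.+ 1ℚ ℚ.* π (suc j) (suc c) i)
    (π-right : ∀ j c i → isUp (j , c) ≡ false → suc c ≡ W j → j ≤ i → NE i ≡ true → π j (2 + c) i ≡ 0ℚ)
    (π-above : ∀ j c i → isUp (j , c) ≡ false → c < W j → W (suc j) ≤ c → j ≤ i → NE i ≡ true →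
               π (suc j) (suc c) i ≡ 0ℚ)
    (π-end : ∀ j → NE j ≡ true → π j (W j) j ≡ 1ℚ)
    (π-end′ : ∀ j i → NE j ≡ true → j < i → NE i ≡ true → π j (W j) i ≡ 0ℚ)
    (π-below : ∀ j c i → i < j → π j c i ≡ 0ℚ)
    where

    open Covering cells wt

    okL : Lozenge → Bool
    okL l = foldr (λ q b → (proj₂ q <ᵇ W (proj₁ q)) ∧ b) true (cellsOf l)

    chunk : ℕ → ℕ → List Lozenge
    chunk j c = filter okL (hor j c ∷ (if isUp (j , c) then [] else ver j c ∷ []))

    rowLoz : ℕ → ℕ → ℕ → List Lozenge
    rowLoz j c zero    = []
    rowLoz j c (suc m) = chunk j c ++ rowLoz j (suc c) m

    rowsLoz : ℕ → ℕ → List Lozenge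
    rowsLoz j zero    = []
    rowsLoz j (suc n) = rowLoz j 0 (W j) ++ rowsLoz (suc j) n

    Vec′ : Set
    Vec′ = ℕ → ℚ

    single : ℕ → ℕ → Need → List Vec′
    single j c need = if isUp (j , c) ∧ not (need (j , c)) then π j (suc c) ∷ [] else []

    current : ℕ → ℕ → Need → List Vec′
    current j c need = if not (isUp (j , c)) ∧ need (j , c) then π j c ∷ [] else []

    before : ℕ → ℕ → Need → List Vec′
    before j zero    need = []
    before j (suc c) need = single j c need ++ before j c need

    after : ℕ → ℕ → ℕ → Need → List Vec′
    after j c zero    need = []
    after j c (suc m) need = after j (suc c) m need ++ single j c need

    -- A down-triangle in column 0 has no western neighbour, so the scan always finds it uncovered,
    -- and a path starts there.
    west : ℕ → ℕ → List Vec′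
    west j zero    = []
    west j (suc n) = (if isUp (j , 0) then [] else π j 0 ∷ []) ++ west (suc j) n

    exits : ℕ → ℕ → List ℕ
    exits j zero    = []
    exits j (suc n) = if NE j then j ∷ exits (suc j) n else exits (suc j) n

    -- Cells outside the region count as needed. Hence an up-triangle outside contributes no vector,
    -- while the down-triangle just past the end of an exit row counts as uncovered and contributes
    -- the vector that closes this exit.
    record Inv (j c : ℕ) (need : Need) : Set where
      field
        past  : ∀ j′ c′ → c′ < W j′ → j′ < j ⊎ (j′ ≡ j × c′ < c) → need (j′ , c′) ≡ false
        out   : ∀ j′ c′ → W j′ ≤ c′ → need (j′ , c′) ≡ true
        down  : ∀ c′ → c < c′ → isUp (j , c′) ≡ false → need (j , c′) ≡ true
        next  : ∀ c′ → c ≤ c′ → need (suc j , c′) ≡ true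
        nextD : ∀ c′ → isUp (suc j , c′) ≡ false → need (suc j , c′) ≡ true
        far   : ∀ j′ c′ → 2 + j ≤ j′ → need (j′ , c′) ≡ true
    open Inv

    exits-≥ : ∀ j n i → i ∈ exits j n → j ≤ i × NE i ≡ true
    exits-≥ j (suc n) i i∈ with NE j in e
    exits-≥ j (suc n) i (here refl) | true = ≤-refl , e
    exits-≥ j (suc n) i (there i∈)  | true with (p , q) ← exits-≥ (suc j) n i i∈ = ≤-trans (n≤1+n j) p , q
    exits-≥ j (suc n) i i∈          | false with (p , q) ← exits-≥ (suc j) n i i∈ = ≤-trans (n≤1+n j) p , q

    <ᵇ-true : ∀ {m n} → m < n → (m <ᵇ n) ≡ true
    <ᵇ-true {zero}  {suc n} p = refl
    <ᵇ-true {suc m} {suc n} (s≤s p) = <ᵇ-true p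

    <ᵇ-false : ∀ {m n} → n ≤ m → (m <ᵇ n) ≡ false
    <ᵇ-false {m}     {zero}  p       = refl
    <ᵇ-false {suc m} {suc n} (s≤s p) = <ᵇ-false p

    chunk-covers : ∀ j c q → (proj₁ q < j ⊎ (proj₁ q ≡ j × proj₂ q < c)) → All (λ l → covers l q ≡ false) (chunk j c)
    chunk-covers j c q lt = keep (hor j c ∷ _) (∉⇒covers (hor j c) q horP ∷ rest)
      where
      Passed : Cell → Set
      Passed q = proj₁ q < j ⊎ (proj₁ q ≡ j × proj₂ q < c)
      here≢ : Passed (j , c) → 1 ≡ 0
      here≢ (inj₁ p)       = ⊥-elim (<-irrefl refl p)
      here≢ (inj₂ (_ , p)) = ⊥-elim (<-irrefl refl p)
      right≢ : Passed (j , suc c) → 1 ≡ 0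
      right≢ (inj₁ p)       = ⊥-elim (<-irrefl refl p)
      right≢ (inj₂ (_ , p)) = ⊥-elim (<-irrefl refl (≤-trans (n≤1+n _) p))
      above≢ : Passed (suc j , c) → 1 ≡ 0
      above≢ (inj₁ p)       = ⊥-elim (<-irrefl refl (≤-trans (n≤1+n _) p))
      above≢ (inj₂ (p , _)) = ⊥-elim (ℕ.1+n≢n p)
      horP : q ∈ cellsOf (hor j c) → 1 ≡ 0
      horP (here refl)         = here≢ lt
      horP (there (here refl)) = right≢ lt
      verP : q ∈ cellsOf (ver j c) → 1 ≡ 0
      verP (here refl)         = here≢ lt
      verP (there (here refl)) = above≢ lt
      rest : All (λ l → covers l q ≡ false) (if isUp (j , c) then [] else ver j c ∷ [])
      rest with isUp (j , c)
      ... | true  = []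
      ... | false = ∉⇒covers (ver j c) q verP ∷ []
      keep : ∀ ls → All (λ l → covers l q ≡ false) ls → All (λ l → covers l q ≡ false) (filter okL ls)
      keep []       []       = []
      keep (l ∷ ls) (p ∷ ps) with okL l
      ... | true  = p ∷ keep ls ps
      ... | false = keep ls ps

    rowLoz-covers : ∀ j c m q → (proj₁ q < j ⊎ (proj₁ q ≡ j × proj₂ q < c)) → All (λ l → covers l q ≡ false) (rowLoz j c m)
    rowLoz-covers j c zero    q lt = []
    rowLoz-covers j c (suc m) q lt = ++⁺ (chunk-covers j c q lt) (rowLoz-covers j (suc c) m q (later lt))
      where
      later : proj₁ q < j ⊎ (proj₁ q ≡ j × proj₂ q < c) → proj₁ q < j ⊎ (proj₁ q ≡ j × proj₂ q < suc c)
      later (inj₁ p)       = inj₁ p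
      later (inj₂ (p , r)) = inj₂ (p , m≤n⇒m≤1+n r)

    rowsLoz-covers : ∀ j n q → proj₁ q < j → All (λ l → covers l q ≡ false) (rowsLoz j n)
    rowsLoz-covers j zero    q lt = []
    rowsLoz-covers j (suc n) q lt = ++⁺ (rowLoz-covers j 0 (W j) q (inj₁ lt)) (rowsLoz-covers (suc j) n q (m≤n⇒m≤1+n lt))

    passed : ∀ j c m n → All (λ l → covers l (j , c) ≡ false) (rowLoz j (suc c) m ++ rowsLoz (suc j) n)
    passed j c m n = ++⁺ (rowLoz-covers j (suc c) m (j , c) (inj₂ (refl , ≤-refl))) (rowsLoz-covers (suc j) n (j , c) ≤-refl)

    single-cong : ∀ j c need need′ → (isUp (j , c) ≡ true → need (j , c) ≡ need′ (j , c)) →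
                  single j c need ≡ single j c need′
    single-cong j c need need′ p with isUp (j , c)
    ... | true  rewrite p refl = refl
    ... | false = refl

    after-cong : ∀ j c m need need′ → (∀ c′ → c ≤ c′ → isUp (j , c′) ≡ true → need (j , c′) ≡ need′ (j , c′)) →
                 after j c m need ≡ after j c m need′
    after-cong j c zero    need need′ p = refl
    after-cong j c (suc m) need need′ p = cong₂ _++_
      (after-cong j (suc c) m need need′ (λ c′ le → p c′ (≤-trans (n≤1+n c) le)))
      (single-cong j c need need′ (p c ≤-refl))

    before-cong : ∀ j c need need′ → (∀ c′ → c′ < c → isUp (j , c′) ≡ true → need (j , c′) ≡ need′ (j , c′)) →
                  before j c need ≡ before j c need′
    before-cong j zero    need need′ p = refl
    before-cong j (suc c) need need′ p = cong₂ _++_ (single-cong j c need need′ (p c ≤-refl))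
      (before-cong j c need need′ (λ c′ lt → p c′ (m≤n⇒m≤1+n lt)))

    after-before : ∀ j c m need → after j c m need ++ before j c need ≡ before j (m + c) need
    after-before j c zero    need = refl
    after-before j c (suc m) need = trans (++-assoc (after j (suc c) m need) _ _)
      (trans (after-before j (suc c) m need) (cong (λ k → before j k need) (ℕ.+-suc m c)))

    single-needed : ∀ j c need → need (j , c) ≡ true → single j c need ≡ []
    single-needed j c need p with isUp (j , c)
    ... | true  rewrite p = refl
    ... | false = refl

    before-extend : ∀ j c d need → (∀ c′ → c ≤ c′ → need (j , c′) ≡ true) → before j (d + c) need ≡ before j c need
    before-extend j c zero    need p = refl
    before-extend j c (suc d) need p rewrite single-needed j (d + c) need (p (d + c) (ℕ.m≤n+m c d)) =
      before-extend j c d need p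

    -- Beyond either bound every cell is needed and contributes nothing. At the change of rows this
    -- reconciles the width of row j, up to which row j+1 was recorded, with the width of row j+1.
    before-widths : ∀ j c c′ need → (∀ k → c ≤ k → need (j , k) ≡ true) → (∀ k → c′ ≤ k → need (j , k) ≡ true) →
                    before j c need ≡ before j c′ need
    before-widths j c c′ need p q with ℕ.≤-total c c′
    ... | inj₁ le = sym (subst (λ k → before j k need ≡ before j c need) (ℕ.m∸n+n≡m le) (before-extend j c (c′ ∸ c) need p))
    ... | inj₂ le = subst (λ k → before j k need ≡ before j c′ need) (ℕ.m∸n+n≡m le) (before-extend j c′ (c ∸ c′) need q)

    off-hor : ∀ need j c q → q ≢ (j , c) → q ≢ (j , suc c) → (need ∖ hor j c) q ≡ need q
    off-hor need j c q p r = cong (λ b → if b then false else need q)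
      (∉⇒covers (hor j c) q λ { (here e) → ⊥-elim (p e) ; (there (here e)) → ⊥-elim (r e) })

    off-ver : ∀ need j c q → q ≢ (j , c) → q ≢ (suc j , c) → (need ∖ ver j c) q ≡ need q
    off-ver need j c q p r = cong (λ b → if b then false else need q)
      (∉⇒covers (ver j c) q λ { (here e) → ⊥-elim (p e) ; (there (here e)) → ⊥-elim (r e) })

    on : ∀ need l q → q ∈ cellsOf l → (need ∖ l) q ≡ false
    on need l q q∈ rewrite ∈⇒covers l q q∈ = refl

    not-true : ∀ {b} → not b ≡ false → b ≡ true
    not-true {true} e = refl

    up⇒down : ∀ j c → isUp (j , c) ≡ true → isUp (j , suc c) ≡ false
    up⇒down j c e = trans (isUp-col j c) (cong not e)

    down⇒up : ∀ j c → isUp (j , c) ≡ false → isUp (j , suc c) ≡ true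
    down⇒up j c e = trans (isUp-col j c) (cong not e)

    inv-pass : ∀ j c need → need (j , c) ≡ false → Inv j c need → Inv j (suc c) need
    inv-pass j c need e I = record
      { past  = λ { j′ c′ w (inj₁ lt) → past I j′ c′ w (inj₁ lt)
                  ; j′ c′ w (inj₂ (refl , s≤s lt)) → pst c′ w (ℕ.m≤n⇒m<n∨m≡n lt) }
      ; out   = out I
      ; down  = λ c′ lt → down I c′ (≤-trans (n≤1+n _) lt)
      ; next  = λ c′ le → next I c′ (≤-trans (n≤1+n _) le)
      ; nextD = nextD I
      ; far   = far I }
      where
      pst : ∀ c′ → c′ < W j → c′ < c ⊎ c′ ≡ c → need (j , c′) ≡ false
      pst c′ w (inj₁ lt)   = past I j c′ w (inj₂ (refl , lt))
      pst c′ w (inj₂ refl) = e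

    ∖-false : ∀ need l q → need q ≡ false → (need ∖ l) q ≡ false
    ∖-false need l q e rewrite e with covers l q
    ... | true  = refl
    ... | false = refl

    inv-hor : ∀ j c need → suc c < W j → Inv j c need → Inv j (suc c) (need ∖ hor j c)
    inv-hor j c need w I = record
      { past  = λ { j′ c′ w (inj₁ lt) → ∖-false need (hor j c) _ (past I j′ c′ w (inj₁ lt))
                  ; j′ c′ w (inj₂ (refl , s≤s lt)) → pst c′ w (ℕ.m≤n⇒m<n∨m≡n lt) }
      ; out   = λ j′ c′ le → trans (off-hor need j c _
                   (λ { refl → <-irrefl refl (≤-trans (≤-trans (n≤1+n _) w) le) }) (λ { refl → <-irrefl refl (≤-trans w le) }))
                   (out I j′ c′ le)
      ; down  = λ c′ lt e → trans (off-hor need j c _ (λ { refl → <-irrefl refl (≤-trans (n≤1+n _) lt) })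
                   (λ { refl → <-irrefl refl lt })) (down I c′ (≤-trans (n≤1+n _) lt) e)
      ; next  = λ c′ le → trans (off-hor need j c _ (λ ()) (λ ())) (next I c′ (≤-trans (n≤1+n _) le))
      ; nextD = λ c′ e → trans (off-hor need j c _ (λ ()) (λ ())) (nextD I c′ e)
      ; far   = λ j′ c′ le → trans (off-hor need j c _ (λ { refl → <-irrefl refl (≤-trans (n≤1+n _) le) })
                   (λ { refl → <-irrefl refl (≤-trans (n≤1+n _) le) })) (far I j′ c′ le) }
      where
      pst : ∀ c′ → c′ < W j → c′ < c ⊎ c′ ≡ c → (need ∖ hor j c) (j , c′) ≡ false
      pst c′ w (inj₁ lt)   = ∖-false need (hor j c) _ (past I j c′ w (inj₂ (refl , lt)))
      pst c′ w (inj₂ refl) = on need (hor j c) _ (here refl)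

    inv-ver : ∀ j c need → isUp (j , c) ≡ false → c < W j → c < W (suc j) → Inv j c need → Inv j (suc c) (need ∖ ver j c)
    inv-ver j c need d w w′ I = record
      { past  = λ { j′ c′ w (inj₁ lt) → ∖-false need (ver j c) _ (past I j′ c′ w (inj₁ lt))
                  ; j′ c′ w (inj₂ (refl , s≤s lt)) → pst c′ w (ℕ.m≤n⇒m<n∨m≡n lt) }
      ; out   = λ j′ c′ le → trans (off-ver need j c _
                   (λ { refl → <-irrefl refl (≤-trans w le) }) (λ { refl → <-irrefl refl (≤-trans w′ le) }))
                   (out I j′ c′ le)
      ; down  = λ c′ lt e → trans (off-ver need j c _ (λ { refl → <-irrefl refl (≤-trans (n≤1+n _) lt) })
                   (λ ())) (down I c′ (≤-trans (n≤1+n _) lt) e)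
      ; next  = λ c′ le → trans (off-ver need j c _ (λ ()) (λ { refl → <-irrefl refl le })) (next I c′ (≤-trans (n≤1+n _) le))
      ; nextD = λ c′ e → trans (off-ver need j c _ (λ ()) (λ { refl → true≢false (trans (sym (trans (isUp-row j c) (cong not d))) e) })) (nextD I c′ e)
      ; far   = λ j′ c′ le → trans (off-ver need j c _ (λ { refl → <-irrefl refl (≤-trans (n≤1+n _) le) })
                   (λ { refl → <-irrefl refl le })) (far I j′ c′ le) }
      where
      pst : ∀ c′ → c′ < W j → c′ < c ⊎ c′ ≡ c → (need ∖ ver j c) (j , c′) ≡ false
      pst c′ w (inj₁ lt)   = ∖-false need (ver j c) _ (past I j c′ w (inj₂ (refl , lt)))
      pst c′ w (inj₂ refl) = on need (ver j c) _ (here refl)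

    Z-skip-chunk : ∀ j c need ls → c < W j → need (j , c) ≡ false → Z need (chunk j c ++ ls) ≡ Z need ls
    Z-skip-chunk j c need ls w e with okL (hor j c) | isUp (j , c)
    ... | false | true  = refl
    ... | true  | true  = Z-skip need (hor j c) ls (j , c) (∈cells j c w) (here refl) e
    ... | false | false with okL (ver j c)
    ...   | false = refl
    ...   | true  = Z-skip need (ver j c) ls (j , c) (∈cells j c w) (here refl) e
    Z-skip-chunk j c need ls w e | true  | false with okL (ver j c)
    ...   | false = Z-skip need (hor j c) ls (j , c) (∈cells j c w) (here refl) e
    ...   | true  = trans (Z-skip need (hor j c) (ver j c ∷ ls) (j , c) (∈cells j c w) (here refl) e)
                          (Z-skip need (ver j c) ls (j , c) (∈cells j c w) (here refl) e)

    okL-hor : ∀ j c → c < W j → suc c < W j → okL (hor j c) ≡ true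
    okL-hor j c p q rewrite <ᵇ-true p | <ᵇ-true q = refl

    okL-hor′ : ∀ j c → W j ≤ suc c → okL (hor j c) ≡ false
    okL-hor′ j c q rewrite <ᵇ-false q = ∧-zeroʳ (c <ᵇ W j)

    okL-ver : ∀ j c → c < W j → c < W (suc j) → okL (ver j c) ≡ true
    okL-ver j c p q rewrite <ᵇ-true p | <ᵇ-true q = refl

    okL-ver′ : ∀ j c → W (suc j) ≤ c → okL (ver j c) ≡ false
    okL-ver′ j c q rewrite <ᵇ-false q = ∧-zeroʳ (c <ᵇ W j)

    D : ℕ → ℕ → List Vec′ → ℚ
    D j n = det apply (exits j n)

    -- The front between decided and undecided cells, read from the east end of row j westward to
    -- the scan position and on to the west along row j+1. In this order the vectors exchanged in a
    -- step stand in the same place, so the scan produces no signs.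
    state : ℕ → ℕ → ℕ → Need → List Vec′
    state j c m need = after j c m need ++ current j c need ++ before (suc j) c need

    current-U : ∀ j c need → isUp (j , c) ≡ true → current j c need ≡ []
    current-U j c need e rewrite e = refl

    current-covered : ∀ j c need → need (j , c) ≡ false → current j c need ≡ []
    current-covered j c need e rewrite e with isUp (j , c)
    ... | true  = refl
    ... | false = refl

    current-D : ∀ j c need → isUp (j , c) ≡ false → need (j , c) ≡ true → current j c need ≡ π j c ∷ []
    current-D j c need e f rewrite e | f = refl

    single-U : ∀ j c need → isUp (j , c) ≡ true → need (j , c) ≡ false → single j c need ≡ π j (suc c) ∷ []
    single-U j c need e f rewrite e | f = refl

    single-D : ∀ j c need → isUp (j , c) ≡ false → single j c need ≡ []
    single-D j c need e rewrite e = refl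

    -- Paths never descend.
    west-below : ∀ j n i → i < j → ∀ v → v ∈ west j n → v i ≡ 0ℚ
    west-below j (suc n) i lt v v∈ with isUp (j , 0)
    west-below j (suc n) i lt v v∈          | true  = west-below (suc j) n i (m≤n⇒m≤1+n lt) v v∈
    west-below j (suc n) i lt v (here refl) | false = π-below j 0 i lt
    west-below j (suc n) i lt v (there v∈)  | false = west-below (suc j) n i (m≤n⇒m≤1+n lt) v v∈

    single-below : ∀ j c need i → i < j → All (λ v → v i ≡ 0ℚ) (single j c need)
    single-below j c need i lt with isUp (j , c) ∧ not (need (j , c))
    ... | true  = π-below j (suc c) i lt ∷ []
    ... | false = []

    before-below : ∀ j c need i → i < j → All (λ v → v i ≡ 0ℚ) (before j c need)
    before-below j zero    need i lt = []
    before-below j (suc c) need i lt = ++⁺ (single-below j c need i lt) (before-below j c need i lt)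

    below : ∀ j c n need → All (λ v → v j ≡ 0ℚ) (before (suc j) c need ++ west (suc j) n)
    below j c n need = ++⁺ (before-below (suc j) c need j ≤-refl) (All.tabulate (λ {v} → west-below (suc j) n j ≤-refl v))

    -- The vectors left belong to rows above j and vanish at exit j, so a column is zero. This
    -- mirrors a dead end of the scan: the last up-triangle of an exit row stays uncovered.
    D-exit-missing : ∀ j c n need → NE j ≡ true → D j (suc n) (before (suc j) c need ++ west (suc j) n) ≡ 0ℚ
    D-exit-missing j c n need e rewrite e = E-zeroˡ _ _ (below j c n need)

    -- The vector just past the end of the row is 1 at exit j and 0 at all later exits: it stands
    -- for a path that has just left the region.
    D-exit : ∀ j n vs → NE j ≡ true → D j (suc n) (π j (W j) ∷ vs) ≡ D (suc j) n vs
    D-exit j n vs e rewrite e = det-unit j (exits (suc j) n) (π j (W j)) (π-end j e)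
      (λ i i∈ → π-end′ j i e (proj₁ (exits-≥ (suc j) n i i∈)) (proj₂ (exits-≥ (suc j) n i i∈))) vs

    D-no-exit : ∀ j n vs → NE j ≡ false → D j (suc n) vs ≡ D (suc j) n vs
    D-no-exit j n vs e rewrite e = refl

    assoc₃ : ∀ {A : Set} (xs ys zs ws : List A) → (xs ++ ys ++ zs) ++ ws ≡ xs ++ (ys ++ (zs ++ ws))
    assoc₃ xs ys zs ws = trans (++-assoc xs (ys ++ zs) ws) (cong (xs ++_) (++-assoc ys zs ws))

    Above : ℕ → ℕ → Set
    Above j n = ∀ need → Inv (suc j) 0 need → (∀ c′ → isUp (suc j , c′) ≡ false → need (suc j , c′) ≡ true) →
                Z need (rowsLoz (suc j) n) ≡ D (suc j) n (before (suc j) (W (suc j)) need ++ west (suc j) n)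

    -- Rows j, j+1, …, j+n remain, of which row j has been scanned up to column c.
    ScanFrom : ℕ → ℕ → ℕ → Set
    ScanFrom j n m = ∀ c need → m + c ≡ W j → Inv j c need →
      Z need (rowLoz j c m ++ rowsLoz (suc j) n) ≡ D j (suc n) (state j c m need ++ west (suc j) n)

    -- A covered up-triangle hands its vector on to the down-triangle east of it, since both stand
    -- for `π j (suc c)`. The list of vectors changes only at an uncovered down-triangle, where the
    -- choice between two lozenges is the recurrence of `π`.
    scan-cell : ∀ j n → j < R → ∀ m → ScanFrom j n m → ∀ c need → suc m + c ≡ W j → Inv j c need →
                ∀ b b′ → isUp (j , c) ≡ b → need (j , c) ≡ b′ →
                Z need (rowLoz j c (suc m) ++ rowsLoz (suc j) n) ≡ D j (suc n) (state j c (suc m) need ++ west (suc j) n)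
    scan-cell j n j<R m IH c need eq I true false u e = trans (cong (λ ls → Z need ls) (++-assoc (chunk j c) (rowLoz j (suc c) m) (rowsLoz (suc j) n)))
      (trans (Z-skip-chunk j c need (rowLoz j (suc c) m ++ rowsLoz (suc j) n) c<W e)
      (trans (IH (suc c) need eq′ (inv-pass j c need e I))
      (cong (λ us → D j (suc n) (us ++ west (suc j) n)) lists)))
      where
      eq′ = trans (ℕ.+-suc m c) eq
      c<W : c < W j
      c<W = subst (c <_) eq (s≤s (ℕ.m≤n+m c m))
      lists : state j (suc c) m need ≡ state j c (suc m) need
      lists = trans (cong₂ (λ us vs → after j (suc c) m need ++ us ++ vs)
                (current-D j (suc c) need (up⇒down j c u) (down I (suc c) ≤-refl (up⇒down j c u)))
                (cong (_++ before (suc j) c need) (single-D (suc j) c need (trans (isUp-row j c) (cong not u)))))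
              (sym (trans (cong₂ (λ us vs → (after j (suc c) m need ++ us) ++ vs ++ before (suc j) c need)
                (single-U j c need u e) (current-U j c need u))
                (++-assoc (after j (suc c) m need) _ _)))
    -- An uncovered up-triangle must be joined to its right neighbour.
    scan-cell j n j<R zero IH c need eq I true true u e =
      trans (cong (λ ls → Z need ls) (++-assoc (chunk j c) [] _))
      (trans (cong (λ ls → Z need (ls ++ rowsLoz (suc j) n)) empty)
      (trans (Z-dead need (rowsLoz (suc j) n) (j , c) (∈cells j c (subst (c <_) eq ≤-refl)) e (rowsLoz-covers (suc j) n _ ≤-refl))
      (trans (sym (D-exit-missing j c n need ne))
      (cong (λ us → D j (suc n) (us ++ west (suc j) n)) lists))))
      where
      empty : chunk j c ≡ []
      empty rewrite okL-hor′ j c (ℕ.≤-reflexive (sym eq)) | u = refl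
      ne : NE j ≡ true
      ne = not-true (trans (sym (isUp-end j j<R)) (subst (λ k → isUp (j , k) ≡ false) eq (up⇒down j c u)))
      lists : before (suc j) c need ≡ state j c 1 need
      lists = sym (cong₂ (λ us vs → us ++ vs ++ before (suc j) c need)
                (single-needed j c need e) (current-U j c need u))
    scan-cell j n j<R (suc m) IH c need eq I true true u e =
      trans (cong (λ ls → Z need (ls ++ rowsLoz (suc j) n)) (cong (_++ rowLoz j (suc c) (suc m)) one))
      (trans (Z-take need (hor j c) ls₀ (λ { _ (here refl) → e ; _ (there (here refl)) → down I (suc c) ≤-refl (up⇒down j c u) }))
      (trans (cong₂ (λ s t → s ℚ.* Z (need ∖ hor j c) ls₀ ℚ.+ t) (wt-up j c u)
                    (Z-dead need ls₀ (j , c) (∈cells j c (≤-trans (n≤1+n _) c+1<W)) e (passed j c (suc m) n)))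
      (trans (solve 1 (λ s → con 1ℚ :* s :+ con 0ℚ := s) refl (Z (need ∖ hor j c) ls₀))
      (trans (IH (suc c) (need ∖ hor j c) eq′ (inv-hor j c need c+1<W I))
      (cong (λ us → D j (suc n) (us ++ west (suc j) n)) lists)))))
      where
      need′ = need ∖ hor j c
      ls₀ = rowLoz j (suc c) (suc m) ++ rowsLoz (suc j) n
      eq′ = trans (ℕ.+-suc (suc m) c) eq
      c+1<W : suc c < W j
      c+1<W = subst (suc c <_) eq (s≤s (s≤s (ℕ.m≤n+m c m)))
      one : chunk j c ≡ hor j c ∷ []
      one rewrite okL-hor j c (≤-trans (n≤1+n _) c+1<W) c+1<W | u = refl
      lists : state j (suc c) (suc m) need′ ≡ state j c (suc (suc m)) need
      lists = trans (cong₂ _++_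
          (after-cong j (suc c) (suc m) need′ need (λ c′ le v → off-hor need j c _ (λ { refl → <-irrefl refl le })
             (λ { refl → true≢false (trans (sym v) (up⇒down j c u)) })))
          (cong₂ _++_ (current-covered j (suc c) need′ (on need (hor j c) _ (there (here refl))))
             (trans (cong (_++ before (suc j) c need′) (single-D (suc j) c need′ (trans (isUp-row j c) (cong not u))))
                (before-cong (suc j) c need′ need (λ c′ _ _ → off-hor need j c _ (λ ()) (λ ()))))))
        (sym (cong₂ (λ us vs → us ++ vs ++ before (suc j) c need)
           (trans (cong (after j (suc c) (suc m) need ++_) (single-needed j c need e)) (++-identityʳ _))
           (current-U j c need u)))
    scan-cell j n j<R m IH c need eq I false false u e = trans (cong (λ ls → Z need ls) (++-assoc (chunk j c) (rowLoz j (suc c) m) (rowsLoz (suc j) n)))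
      (trans (Z-skip-chunk j c need (rowLoz j (suc c) m ++ rowsLoz (suc j) n) c<W e)
      (trans (IH (suc c) need eq′ (inv-pass j c need e I))
      (cong (λ us → D j (suc n) (us ++ west (suc j) n)) lists)))
      where
      eq′ = trans (ℕ.+-suc m c) eq
      c<W : c < W j
      c<W = subst (c <_) eq (s≤s (ℕ.m≤n+m c m))
      lists : state j (suc c) m need ≡ state j c (suc m) need
      lists = trans (cong₂ (λ us vs → after j (suc c) m need ++ us ++ vs)
                (current-U j (suc c) need (down⇒up j c u))
                (cong (_++ before (suc j) c need) (single-needed (suc j) c need (next I c ≤-refl))))
              (sym (cong₂ (λ us vs → us ++ vs ++ before (suc j) c need)
                (trans (cong (after j (suc c) m need ++_) (single-D j c need u)) (++-identityʳ _))
                (current-covered j c need e)))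
    -- Linearity in the row π j c = wt · π j (c+2) + π (j+1) (c+1)
    scan-cell j n j<R m IH c need eq I false true u e = begin
      Z need ((chunk j c ++ rowLoz j (suc c) m) ++ rowsLoz (suc j) n)  ≡⟨ cong (Z need) (++-assoc (chunk j c) (rowLoz j (suc c) m) (rowsLoz (suc j) n)) ⟩
      Z need (chunk j c ++ ls₀)                                        ≡⟨ split ⟩
      wt (hor j c) ℚ.* Dn (π j (2 + c)) ℚ.+ 1ℚ ℚ.* Dn (π (suc j) (suc c))
        ≡⟨ det-lin {α = wt (hor j c)} {1ℚ} {π j c} {π j (2 + c)} {π (suc j) (suc c)} (exits j (suc n))
             (λ i i∈ → π-step j c i u c<W (proj₁ (exits-≥ j (suc n) i i∈)) (proj₂ (exits-≥ j (suc n) i i∈))) A (bf ++ w) ⟨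
      Dn (π j c)                                                       ≡⟨ cong (D j (suc n)) lists ⟨
      D j (suc n) (state j c (suc m) need ++ west (suc j) n)           ∎
      where
      open ≡-Reasoning
      ls₀ = rowLoz j (suc c) m ++ rowsLoz (suc j) n
      eq′ = trans (ℕ.+-suc m c) eq
      c<W : c < W j
      c<W = subst (c <_) eq (s≤s (ℕ.m≤n+m c m))
      A  = after j (suc c) m need
      bf = before (suc j) c need
      w  = west (suc j) n
      Dn : Vec′ → ℚ
      Dn v = D j (suc n) (A ++ v ∷ (bf ++ w))
      lists : state j c (suc m) need ++ w ≡ A ++ π j c ∷ (bf ++ w)
      lists = trans (cong₂ (λ us vs → (us ++ vs ++ bf) ++ w)
                (trans (cong (A ++_) (single-D j c need u)) (++-identityʳ A)) (current-D j c need u e))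
                (assoc₃ A (π j c ∷ []) bf w)
      upAbove : isUp (suc j , c) ≡ true
      upAbove = trans (isUp-row j c) (cong not u)
      dead : Z need ls₀ ≡ 0ℚ
      dead = Z-dead need ls₀ (j , c) (∈cells j c c<W) e (passed j c m n)

      ver-part : ∀ ls → ls ≡ filter okL (ver j c ∷ []) → Z need (ls ++ ls₀) ≡ Dn (π (suc j) (suc c))
      ver-part ls refl with ℕ.<-≤-connex c (W (suc j))
      -- There is no cell above: the vertical term is missing from the sum, and its vector is zero
      -- at all exits by `π-above`.
      ... | inj₂ le rewrite okL-ver′ j c le = trans dead
              (sym (det-zero (exits j (suc n)) (λ i i∈ → π-above j c i u c<W le (proj₁ (exits-≥ j (suc n) i i∈))
                      (proj₂ (exits-≥ j (suc n) i i∈))) A (bf ++ w)))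
      ... | inj₁ lt rewrite okL-ver j c c<W lt =
        trans (Z-take need (ver j c) ls₀ (λ { _ (here refl) → e ; _ (there (here refl)) → next I c ≤-refl }))
        (trans (cong₂ (λ s t → s ℚ.* Z need′ ls₀ ℚ.+ t) (wt-ver j c) dead)
        (trans (solve 1 (λ s → con 1ℚ :* s :+ con 0ℚ := s) refl (Z need′ ls₀))
        (trans (IH (suc c) need′ eq′ (inv-ver j c need u c<W lt I))
        (cong (D j (suc n)) lists′))))
        where
        need′ = need ∖ ver j c
        lists′ : state j (suc c) m need′ ++ w ≡ A ++ π (suc j) (suc c) ∷ (bf ++ w)
        lists′ = trans (cong (_++ w) (cong₂ _++_
            (after-cong j (suc c) m need′ need (λ c′ le v → off-ver need j c _ (λ { refl → <-irrefl refl le }) (λ ())))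
            (cong₂ _++_ (current-U j (suc c) need′ (down⇒up j c u))
               (cong₂ _++_ (single-U (suc j) c need′ upAbove (on need (ver j c) _ (there (here refl))))
                  (before-cong (suc j) c need′ need (λ c′ lt _ → off-ver need j c _ (λ ()) (λ { refl → <-irrefl refl lt })))))))
          (++-assoc A _ w)

      hor-absent : ∀ v → D j (suc n) (A ++ v ∷ (bf ++ w)) ≡ 0ℚ → Dn (π (suc j) (suc c)) ≡ wt (hor j c) ℚ.* D j (suc n) (A ++ v ∷ (bf ++ w)) ℚ.+ 1ℚ ℚ.* Dn (π (suc j) (suc c))
      hor-absent v z = trans (solve 2 (λ k d → d := k :* con 0ℚ :+ con 1ℚ :* d) refl (wt (hor j c)) (Dn (π (suc j) (suc c))))
        (cong (λ t → wt (hor j c) ℚ.* t ℚ.+ 1ℚ ℚ.* Dn (π (suc j) (suc c))) (sym z))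

      split : Z need (chunk j c ++ ls₀) ≡ wt (hor j c) ℚ.* Dn (π j (2 + c)) ℚ.+ 1ℚ ℚ.* Dn (π (suc j) (suc c))
      split = trans (cong (λ ls → Z need (ls ++ ls₀)) shape) (go m refl _ refl)
        where
        shape : chunk j c ≡ (if okL (hor j c) then hor j c ∷ filter okL (ver j c ∷ []) else filter okL (ver j c ∷ []))
        shape rewrite u = refl
        go : ∀ k → k ≡ m → ∀ b → need (j , suc c) ≡ b → Z need ((if okL (hor j c) then hor j c ∷ filter okL (ver j c ∷ []) else filter okL (ver j c ∷ [])) ++ ls₀)
             ≡ wt (hor j c) ℚ.* Dn (π j (2 + c)) ℚ.+ 1ℚ ℚ.* Dn (π (suc j) (suc c))
        -- Last cell of the row: there is no horizontal lozenge, and by `π-right` a path that takes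
        -- this step misses every exit.
        go zero refl _ _ rewrite okL-hor′ j c (ℕ.≤-reflexive (sym eq)) = trans (ver-part (filter okL (ver j c ∷ [])) refl)
          (hor-absent (π j (2 + c)) (det-zero (exits j (suc n)) (λ i i∈ → π-right j c i u eq (proj₁ (exits-≥ j (suc n) i i∈))
                      (proj₂ (exits-≥ j (suc n) i i∈))) A (bf ++ w)))
        -- The eastern neighbour is already covered. Its vector `π j (2 + c)` then stands in the
        -- list, and the horizontal term has two equal adjacent rows.
        go (suc k) refl false e′ rewrite okL-hor j c c<W (subst (suc c <_) eq (s≤s (s≤s (ℕ.m≤n+m c k)))) =
          trans (Z-skip need (hor j c) (filter okL (ver j c ∷ []) ++ ls₀) (j , suc c) (∈cells j (suc c) (subst (suc c <_) eq (s≤s (s≤s (ℕ.m≤n+m c k))))) (there (here refl)) e′)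
          (trans (ver-part (filter okL (ver j c ∷ [])) refl) (hor-absent (π j (2 + c)) (trans (cong (λ us → D j (suc n) (us ++ π j (2 + c) ∷ (bf ++ w))) endA)
            (trans (cong (D j (suc n)) (++-assoc (after j (2 + c) k need) _ _))
               (a≡-a⇒a≡0 (D j (suc n) (after j (2 + c) k need ++ π j (2 + c) ∷ π j (2 + c) ∷ (bf ++ w))) (det-alternating apply (exits j (suc n)) (after j (2 + c) k need) (π j (2 + c)) (π j (2 + c)) (bf ++ w)))))))
          where
          endA : A ≡ after j (2 + c) k need ++ π j (2 + c) ∷ []
          endA = cong (after j (2 + c) k need ++_) (single-U j (suc c) need (down⇒up j c u) e′)
        go (suc k) refl true e′ rewrite okL-hor j c c<W (subst (suc c <_) eq (s≤s (s≤s (ℕ.m≤n+m c k)))) =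
          trans (Z-take need (hor j c) (filter okL (ver j c ∷ []) ++ ls₀) (λ { _ (here refl) → e ; _ (there (here refl)) → e′ }))
          (trans (cong₂ (λ s t → wt (hor j c) ℚ.* s ℚ.+ t) horZ (ver-part (filter okL (ver j c ∷ [])) refl))
            (solve 3 (λ k a b → k :* a :+ b := k :* a :+ con 1ℚ :* b) refl (wt (hor j c)) (Dn (π j (2 + c))) (Dn (π (suc j) (suc c)))))
          where
          c+1<W : suc c < W j
          c+1<W = subst (suc c <_) eq (s≤s (s≤s (ℕ.m≤n+m c k)))
          need′ = need ∖ hor j c
          skipV : Z need′ (filter okL (ver j c ∷ []) ++ ls₀) ≡ Z need′ ls₀
          skipV with okL (ver j c)
          ... | false = refl
          ... | true  = Z-skip need′ (ver j c) ls₀ (j , c) (∈cells j c c<W) (here refl) (on need (hor j c) _ (here refl))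
          lists′ : state j (suc c) m need′ ++ w ≡ A ++ π j (2 + c) ∷ (bf ++ w)
          lists′ = trans (cong (_++ w) (cong₂ _++_
              (cong₂ _++_ (after-cong j (2 + c) k need′ need (λ c′ le v → off-hor need j c _
                              (λ { refl → <-irrefl refl (≤-trans (n≤1+n _) le) }) (λ { refl → <-irrefl refl le })))
                          (single-U j (suc c) need′ (down⇒up j c u) (on need (hor j c) _ (there (here refl)))))
              (cong₂ _++_ (current-U j (suc c) need′ (down⇒up j c u))
                 (cong₂ _++_ (single-needed (suc j) c need′ (trans (off-hor need j c _ (λ ()) (λ ())) (next I c ≤-refl)))
                    (before-cong (suc j) c need′ need (λ c′ lt _ → off-hor need j c _ (λ ()) (λ ())))))))
            (trans (++-assoc (after j (2 + c) k need ++ π j (2 + c) ∷ []) bf w)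
            (trans (++-assoc (after j (2 + c) k need) (π j (2 + c) ∷ []) (bf ++ w))
            (cong (λ us → us ++ π j (2 + c) ∷ (bf ++ w)) (sym (trans (cong (after j (2 + c) k need ++_)
               (single-needed j (suc c) need e′)) (++-identityʳ _))))))
          horZ : Z need′ (filter okL (ver j c ∷ []) ++ ls₀) ≡ Dn (π j (2 + c))
          horZ = trans skipV (trans (IH (suc c) need′ eq′ (inv-hor j c need c+1<W I)) (cong (D j (suc n)) lists′))

    scan-row : ∀ j n → Above j n → j < R → ∀ m → ScanFrom j n m
    scan-row j n rest j<R zero c need refl I = trans (rest need inv′ (nextD I)) (sym (list (NE j) refl))
      where
      inv′ : Inv (suc j) 0 need
      inv′ = record
        { past  = λ { j′ c′ w (inj₁ (s≤s le)) → pst j′ c′ w (ℕ.m≤n⇒m<n∨m≡n le) ; j′ c′ w (inj₂ (_ , ())) }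
        ; out   = out I
        ; down  = λ c′ _ → nextD I c′
        ; next  = λ c′ _ → far I (2 + j) c′ ≤-refl
        ; nextD = λ c′ _ → far I (2 + j) c′ ≤-refl
        ; far   = λ j′ c′ le → far I j′ c′ (≤-trans (n≤1+n _) le) }
        where
        pst : ∀ j′ c′ → c′ < W j′ → j′ < j ⊎ j′ ≡ j → need (j′ , c′) ≡ false
        pst j′ c′ w (inj₁ lt)   = past I j′ c′ w (inj₁ lt)
        pst j′ c′ w (inj₂ refl) = past I j c′ w (inj₂ (refl , w))
      bef : before (suc j) (W j) need ≡ before (suc j) (W (suc j)) need
      bef = before-widths (suc j) (W j) (W (suc j)) need (next I) (out I (suc j))
      list : ∀ b → NE j ≡ b → D j (suc n) (state j (W j) 0 need ++ west (suc j) n) ≡ D (suc j) n (before (suc j) (W (suc j)) need ++ west (suc j) n)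
      -- The row is finished. By `out` the down-triangle outside, at column `W j`, counts as
      -- uncovered, so `current` supplies the vector that removes column j.
      list true  e = trans (cong (λ us → D j (suc n) ((us ++ before (suc j) (W j) need) ++ west (suc j) n))
                            (current-D j (W j) need (trans (isUp-end j j<R) (cong not e)) (out I j (W j) ≤-refl)))
                    (trans (D-exit j n _ e) (cong (λ us → D (suc j) n (us ++ west (suc j) n)) bef))
      list false e = trans (cong (λ us → D j (suc n) ((us ++ before (suc j) (W j) need) ++ west (suc j) n))
                            (current-U j (W j) need (trans (isUp-end j j<R) (cong not e))))
                    (trans (D-no-exit j n _ e) (cong (λ us → D (suc j) n (us ++ west (suc j) n)) bef))
    scan-row j n rest j<R (suc m) c need eq I = scan-cell j n j<R m (scan-row j n rest j<R m) c need eq I _ _ refl refl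

    scan-rows : ∀ n j need → n + j ≡ R → Inv j 0 need → (∀ c → isUp (j , c) ≡ false → need (j , c) ≡ true) →
                Z need (rowsLoz j n) ≡ D j n (before j (W j) need ++ west j n)
    scan-rows zero j need refl I fresh = trans
      (Z-nil need (λ { (j′ , c′) q∈ → past I j′ c′ (proj₁ (cells∈ j′ c′ q∈)) (inj₁ (proj₂ (cells∈ j′ c′ q∈))) }))
      (cong (λ k → det apply [] (before j k need ++ [])) (sym W-R))
    scan-rows (suc n) j need eq I fresh = trans
      (scan-row j n (λ need′ I′ f → scan-rows n (suc j) need′ (trans (ℕ.+-suc n j) eq) I′ f) (subst (j <_) eq (s≤s (ℕ.m≤n+m j n)))
        (W j) 0 need (ℕ.+-identityʳ (W j)) I)
      (cong (D j (suc n)) lists)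
      where
      cur : current j 0 need ≡ (if isUp (j , 0) then [] else π j 0 ∷ [])
      cur with isUp (j , 0) in u | need (j , 0) in e
      ... | true  | _ = refl
      ... | false | true = refl
      ... | false | false = ⊥-elim (true≢false (trans (sym (fresh 0 u)) e))
      lists : state j 0 (W j) need ++ west (suc j) n ≡ before j (W j) need ++ west j (suc n)
      lists = trans (cong (λ us → (after j 0 (W j) need ++ us ++ []) ++ west (suc j) n) cur)
        (trans (assoc₃ (after j 0 (W j) need) (if isUp (j , 0) then [] else π j 0 ∷ []) [] (west (suc j) n))
        (cong (_++ (west j (suc n)))
          (trans (sym (++-identityʳ _)) (trans (after-before j 0 (W j) need) (cong (λ k → before j k need) (ℕ.+-identityʳ (W j)))))))

-- The region: its rows, exits and path counts, and the matrix A.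

module Region where

  open Determinant
  open RowSweep
  open import Data.List.Relation.Unary.Any using (here; there)
  open import Data.List.Membership.Propositional using (_∈_; lose)
  open import Data.List.Membership.Propositional.Properties using (∈-concatMap⁺; ∈-upTo⁺; ∈-map⁺)

  open ℕSolver using (solve; _:+_; _:*_; _:=_; con)

  -- p l v counts the lattice paths with l horizontal and v vertical steps; the
  -- last step has weight 1/2 if it is horizontal.
  p : ℕ → ℕ → ℚ
  p zero    v       = 1ℚ
  p (suc l) zero    = ½
  p (suc l) (suc v) = p l (suc v) ℚ.+ p (suc l) v

  -- A horizontal step advances by two columns, so half of the distance is the number of horizontal
  -- steps; `B` is meant to include the `v` columns gained by the vertical steps.
  pathsTo : ℕ → ℕ → ℕ → ℚ
  pathsTo A B v = if B ≤ᵇ A then p ⌊ A ∸ B /2⌋ v else 0ℚ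

  T⇒true : ∀ {b} → T b → b ≡ true
  T⇒true {true} _ = refl

  true⇒T : ∀ {b} → b ≡ true → T b
  true⇒T refl = tt

  ≤ᵇ-true : ∀ {m n} → m ≤ n → (m ≤ᵇ n) ≡ true
  ≤ᵇ-true le = T⇒true (≤⇒≤ᵇ le)

  ≤ᵇ-false : ∀ {m n} → n < m → (m ≤ᵇ n) ≡ false
  ≤ᵇ-false {m} {n} lt with m ≤ᵇ n in e
  ... | false = refl
  ... | true  = ⊥-elim (ℕ.<⇒≱ lt (≤ᵇ⇒≤ m n (true⇒T e)))

  <ᵇ-true′ : ∀ {m n} → m < n → (m <ᵇ n) ≡ true
  <ᵇ-true′ lt = T⇒true (<⇒<ᵇ lt)

  <ᵇ-false′ : ∀ {m n} → n ≤ m → (m <ᵇ n) ≡ false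
  <ᵇ-false′ {m} {n} le with m <ᵇ n in e
  ... | false = refl
  ... | true  = ⊥-elim (ℕ.<⇒≱ (<ᵇ⇒< m n (true⇒T e)) le)

  ∧-true₁ : ∀ b b′ → b ∧ b′ ≡ true → b ≡ true
  ∧-true₁ true _ _ = refl

  ∧-true₂ : ∀ b b′ → b ∧ b′ ≡ true → b′ ≡ true
  ∧-true₂ true _ e = e

  lt-by : ∀ {m n} k → n ≡ suc (m + k) → m < n
  lt-by {m} k refl = s≤s (ℕ.m≤m+n m k)

  pathsTo-lt : ∀ A B v → A < B → pathsTo A B v ≡ 0ℚ
  pathsTo-lt A B v lt rewrite ≤ᵇ-false lt = refl

  pathsTo-eq : ∀ A B v l → A ≡ (l + l) + B → pathsTo A B v ≡ p l v
  pathsTo-eq _ B v l refl rewrite ≤ᵇ-true (ℕ.m≤n+m B (l + l)) | ℕ.m+n∸n≡m (l + l) B =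
    cong (λ k → p k v) (sym (ℕ.n≡⌊n+n/2⌋ l))

  odd? : ℕ → Bool
  odd? n = n % 2 ≡ᵇ 1

  odd?-+2 : ∀ n k → odd? (n + (k + k)) ≡ odd? n
  odd?-+2 n zero    = cong odd? (ℕ.+-identityʳ n)
  odd?-+2 n (suc k) = trans (cong odd? (solve 2 (λ n k → n :+ (con 1 :+ k :+ (con 1 :+ k)) := con 2 :+ (n :+ (k :+ k))) refl n k))
                            (odd?-+2 n k)

  even-difference : ∀ A B → odd? A ≡ odd? B → A < B ⊎ ∃ λ l → A ≡ (l + l) + B
  even-difference zero          zero          e = inj₂ (0 , refl)
  even-difference zero          (suc B)       e = inj₁ (s≤s z≤n)
  even-difference (suc (suc A)) zero          e with even-difference A zero e
  ... | inj₂ (l , q) = inj₂ (suc l , trans (cong (2 +_) q) (solve 1 (λ l → con 2 :+ (l :+ l :+ con 0) := con 1 :+ l :+ (con 1 :+ l) :+ con 0) refl l))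
  even-difference (suc A)       (suc B)       e with even-difference A B (trans (sym (not-not (odd? A)))
    (trans (cong not (trans (sym (isUp-2+ A)) (trans e (isUp-2+ B)))) (not-not (odd? B))))
    where
    not-not : ∀ b → not (not b) ≡ b
    not-not true  = refl
    not-not false = refl
  ... | inj₁ lt       = inj₁ (s≤s lt)
  ... | inj₂ (l , q)  = inj₂ (l , trans (cong suc q) (sym (ℕ.+-suc (l + l) B)))

  ∈-filter⁺ : {A : Set} (f : A → Bool) (xs : List A) {x : A} → x ∈ xs → f x ≡ true → x ∈ filter f xs
  ∈-filter⁺ f (x ∷ xs) (here refl) e rewrite e = here refl
  ∈-filter⁺ f (y ∷ xs) (there x∈)  e with f y
  ... | true  = there (∈-filter⁺ f xs x∈ e)
  ... | false = ∈-filter⁺ f xs x∈ e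

  ∈-filter⁻ : {A : Set} (f : A → Bool) (xs : List A) {x : A} → x ∈ filter f xs → f x ≡ true
  ∈-filter⁻ f (y ∷ xs) x∈ with f y in e
  ∈-filter⁻ f (y ∷ xs) (here refl) | true  = e
  ∈-filter⁻ f (y ∷ xs) (there x∈)  | true  = ∈-filter⁻ f xs x∈
  ∈-filter⁻ f (y ∷ xs) x∈          | false = ∈-filter⁻ f xs x∈

  filter-cong : {A : Set} {f g : A → Bool} (xs : List A) → (∀ x → f x ≡ g x) → filter f xs ≡ filter g xs
  filter-cong []       q = refl
  filter-cong (x ∷ xs) q rewrite q x = cong (λ ys → if _ then x ∷ ys else ys) (filter-cong xs q)

  filter-++ : {A : Set} (f : A → Bool) (xs ys : List A) → filter f (xs ++ ys) ≡ filter f xs ++ filter f ys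
  filter-++ f []       ys = refl
  filter-++ f (x ∷ xs) ys with f x
  ... | true  = cong (x ∷_) (filter-++ f xs ys)
  ... | false = filter-++ f xs ys

  -- The indices q+n, …, q+1, in this order.
  desc : ℕ → ℕ → List ℕ
  desc q zero    = []
  desc q (suc n) = q + suc n ∷ desc q n

  -- The tests say that both step numbers x+2t-u-1 and 2u-t are non-negative; without them truncated
  -- subtraction would give nonzero entries where no path exists.
  A[_] : ℕ → ℕ → ℕ → ℚ
  A[ x ] t u = if (t ≤ᵇ 2 * u) ∧ (u <ᵇ x + 2 * t) then p (x + 2 * t ∸ suc u) (2 * u ∸ t) else 0ℚ

  det-reindex : ∀ (g : ℕ → ℕ → ℚ) (f : ℕ → ℕ) Ts Us {Es Ws} → Es ≡ map f Ts → Ws ≡ map g Us →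
                det apply Es Ws ≡ det (λ t u → g u (f t)) Us Ts
  det-reindex g f Ts Us refl refl = begin
    det apply (map f Ts) (map g Us)  ≡⟨ det-map-rows g apply (map f Ts) Us ⟩
    det g (map f Ts) Us              ≡⟨ det-map-cols f g Ts Us ⟩
    det (λ u t → g u (f t)) Ts Us    ≡⟨ det-transpose (λ u t → g u (f t)) Ts Us ⟩
    det (λ t u → g u (f t)) Us Ts    ∎
    where open ≡-Reasoning

  module Tilings (x y z a s : ℕ) (yz : y + z ≡ suc s) where

    R N : ℕ
    R = nRows y z a
    N = s + a

    R≡ : R ≡ N + N
    R≡ rewrite yz = trans (cong (_∸ 1) (trans (cong (s + a +_) (ℕ.+-identityʳ (suc (s + a)))) (ℕ.+-suc N N))) refl

    nSE≡ : nSE y z ≡ s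
    nSE≡ = cong (_∸ 1) yz

    nNE≡ : nNE y z a ≡ s + 2 * a
    nNE≡ rewrite yz = refl

    E₀ : ℕ
    E₀ = 2 * x + 3 * (s + 2 * a ∸ 1)

    end : ℕ → ℕ
    end = rowEnd x y z a

    rm : ℕ → Bool
    rm j = (y + a ≤ᵇ topIndex y z a j) ∧ (topIndex y z a j + 1 ≤ᵇ y + 2 * a)

    ner : ℕ → Bool
    ner = inNERow y z a

    W : ℕ → ℕ
    W j = if j <ᵇ R then (if ner j ∧ rm j then end j else suc (end j)) else 0

    NE : ℕ → Bool
    NE j = ner j ∧ not (rm j)

    -- On the northeastern side the end of a row is measured from the top, with `d` rows above it;
    -- on the southeastern side from the corner, `e` rows below the top row of that side. Both
    -- descriptions are affine and free of subtraction.
    data RowKind (j : ℕ) : Set where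
      ne : ∀ d → R ≡ suc (j + d) → s ≤ j → end j ≡ 2 * x + 3 * d → ner j ≡ true → RowKind j
      se : ∀ e → s ≡ suc (j + e) → end j + e ≡ E₀ → ner j ≡ false → RowKind j

    rowKind : ∀ j → j < R → RowKind j
    rowKind j lt with ℕ.<-≤-connex j s
    ... | inj₂ s≤j = ne (R ∸ suc j) (sym (ℕ.m+[n∸m]≡n lt)) s≤j
            (trans (cong (λ b → if b then 2 * x + 3 * (topIndex y z a j ∸ 1) else 2 * x + 3 * (nNE y z a ∸ 1) ∸ (nSE y z ∸ suc j)) nse)
                   (cong (λ k → 2 * x + 3 * k) (trans (ℕ.∸-+-assoc R j 1) (cong (R ∸_) (ℕ.+-comm j 1)))))
            (cong₂ _∧_ nse (<ᵇ-true′ lt))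
      where
      nse : (nSE y z ≤ᵇ j) ≡ true
      nse rewrite nSE≡ = ≤ᵇ-true s≤j
    ... | inj₁ j<s = se (s ∸ suc j) (sym (ℕ.m+[n∸m]≡n j<s))
            (trans (cong (_+ (s ∸ suc j)) (trans
               (cong (λ b → if b then 2 * x + 3 * (topIndex y z a j ∸ 1) else 2 * x + 3 * (nNE y z a ∸ 1) ∸ (nSE y z ∸ suc j)) nse)
               (cong₂ (λ k l → 2 * x + 3 * (k ∸ 1) ∸ (l ∸ suc j)) nNE≡ nSE≡)))
               (ℕ.m∸n+n≡m big))
            (cong (_∧ (j <ᵇ R)) nse)
      where
      nse : (nSE y z ≤ᵇ j) ≡ false
      nse rewrite nSE≡ = ≤ᵇ-false j<s
      big : s ∸ suc j ≤ E₀
      big = ≤-trans (ℕ.∸-monoʳ-≤ s (s≤s (z≤n {j}))) (≤-trans (ℕ.∸-monoˡ-≤ 1 (ℕ.m≤m+n s (2 * a)))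
              (≤-trans (ℕ.m≤m+n (s + 2 * a ∸ 1) _) (ℕ.m≤n+m _ (2 * x))))

    isUp-ne : ∀ j d → R ≡ suc (j + d) → end j ≡ 2 * x + 3 * d → isUp (j , end j) ≡ true
    isUp-ne j d q e = lem (odd? (j + end j)) (trans (sym (isUp-2+ (j + end j)))
      (trans (cong odd? (trans (cong (λ k → suc (j + k)) e) (trans (solve 3 (λ j x d → con 1 :+ (j :+ (con 2 :* x :+ con 3 :* d))
          := (con 1 :+ (j :+ d)) :+ ((x :+ d) :+ (x :+ d))) refl j x d) (cong (_+ ((x + d) + (x + d))) (trans (sym q) R≡)))))
        (trans (odd?-+2 (N + N) (x + d)) (odd?-+2 0 N))))
      where
      lem : ∀ b → not b ≡ false → b ≡ true
      lem true _ = refl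

    -- The last row of the straight southeastern side continues the northeastern side.
    corner : ∀ {j} → j < s → ∃ λ d → R ≡ suc (s + d) × E₀ ≡ 2 * x + 3 * d
    corner {j} j<s = s + 2 * a ∸ 1 , trans R≡ (trans (solve 2 (λ s a → s :+ a :+ (s :+ a) := s :+ (s :+ con 2 :* a)) refl s a)
        (trans (cong (s +_) (sym (ℕ.m+[n∸m]≡n {1} {s + 2 * a} pos))) (ℕ.+-suc s (s + 2 * a ∸ 1)))) , refl
      where
      pos : 1 ≤ s + 2 * a
      pos = ≤-trans (≤-trans (s≤s z≤n) j<s) (ℕ.m≤m+n s (2 * a))

    isUp-se : ∀ j e → s ≡ suc (j + e) → end j + e ≡ E₀ → isUp (j , suc (end j)) ≡ true
    isUp-se j e q w with corner {j} (lt-by e q)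
    ... | d , r , E≡ = trans (cong odd? (ℕ.+-suc j (end j))) (trans (isUp-2+ (j + end j)) (cong not (trans (sym (odd?-+2 (j + end j) (suc e)))
        (trans (cong odd? sum) (odd?-+2 0 (N + x + d))))))
      where
      sum : j + end j + (suc e + suc e) ≡ N + x + d + (N + x + d)
      sum = begin
        j + end j + (suc e + suc e)          ≡⟨ solve 3 (λ j f e → j :+ f :+ (con 1 :+ e :+ (con 1 :+ e)) := con 1 :+ ((con 1 :+ (j :+ e)) :+ (f :+ e))) refl j (end j) e ⟩
        suc (suc (j + e) + (end j + e))      ≡⟨ cong₂ (λ u v → suc (u + v)) (sym q) (trans w E≡) ⟩
        suc (s + (2 * x + 3 * d))            ≡⟨ solve 3 (λ s x d → con 1 :+ (s :+ (con 2 :* x :+ con 3 :* d)) := (con 1 :+ (s :+ d)) :+ (con 2 :* x :+ con 2 :* d)) refl s x d ⟩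
        suc (s + d) + (2 * x + 2 * d)        ≡⟨ cong (_+ (2 * x + 2 * d)) (trans (sym r) R≡) ⟩
        N + N + (2 * x + 2 * d)              ≡⟨ solve 3 (λ n x d → n :+ n :+ (con 2 :* x :+ con 2 :* d) := n :+ x :+ d :+ (n :+ x :+ d)) refl N x d ⟩
        N + x + d + (N + x + d)              ∎
        where open ≡-Reasoning

    W-in : ∀ j → j < R → W j ≡ (if ner j ∧ rm j then end j else suc (end j))
    W-in j lt rewrite <ᵇ-true′ lt = refl

    W-R : W R ≡ 0
    W-R rewrite <ᵇ-false′ (≤-refl {R}) = refl

    in-row : ∀ j c → c < W j → j < R
    in-row j c lt with j <ᵇ R in e
    ... | true  = <ᵇ⇒< j R (true⇒T e)
    in-row j c () | false

    W-NE : ∀ j → NE j ≡ true → j < R × W j ≡ suc (end j) × ner j ≡ true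
    W-NE j e = lt , trans (W-in j lt) (cong (λ b → if b then end j else suc (end j))
                   (trans (cong (_∧ rm j) nr) (not-true′ (rm j) (∧-true₂ (ner j) (not (rm j)) e)))) , nr
      where
      not-true′ : ∀ b → not b ≡ true → b ≡ false
      not-true′ false _ = refl
      nr : ner j ≡ true
      nr = ∧-true₁ (ner j) (not (rm j)) e
      lt : j < R
      lt = <ᵇ⇒< j R (true⇒T (∧-true₂ (nSE y z ≤ᵇ j) (j <ᵇ R) nr))

    isUp-end : ∀ j → j < R → isUp (j , W j) ≡ not (NE j)
    isUp-end j lt with rowKind j lt
    ... | se e q w f = trans (cong (λ k → isUp (j , k)) (trans (W-in j lt) (cong (λ b → if b ∧ rm j then end j else suc (end j)) f)))
                         (trans (isUp-se j e q w) (cong (λ b → not (b ∧ not (rm j))) (sym f)))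
    ... | ne d q _ w f = trans (cong (λ k → isUp (j , k)) (trans (W-in j lt) (cong (λ b → if b ∧ rm j then end j else suc (end j)) f)))
                         (trans (go (rm j)) (cong (λ b → not (b ∧ not (rm j))) (sym f)))
      where
      go : ∀ b → isUp (j , (if b then end j else suc (end j))) ≡ not (not b)
      go true  = isUp-ne j d q w
      go false = trans (isUp-col j (end j)) (cong not (isUp-ne j d q w))

    W≥ : ∀ j → j < R → end j ≤ W j
    W≥ j lt rewrite W-in j lt with ner j ∧ rm j
    ... | true  = ≤-refl
    ... | false = n≤1+n _

    W-se : ∀ j → j < R → ner j ≡ false → W j ≡ suc (end j)
    W-se j lt f = trans (W-in j lt) (cong (λ b → if b ∧ rm j then end j else suc (end j)) f)

    ne-of : ∀ i → NE i ≡ true → ∃ λ d → R ≡ suc (i + d) × s ≤ i × end i ≡ 2 * x + 3 * d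
    ne-of i e with rowKind i (proj₁ (W-NE i e))
    ... | ne d q le w _ = d , q , le , w
    ... | se _ _ _ f    = ⊥-elim (true≢false (trans (sym (proj₂ (proj₂ (W-NE i e)))) f))

    end-diff : ∀ j v d d′ → R ≡ suc (j + d) → R ≡ suc (j + v + d′) → end j ≡ 2 * x + 3 * d → end (j + v) ≡ 2 * x + 3 * d′ →
               end j ≡ end (j + v) + 3 * v
    end-diff j v d d′ q q′ w w′ = trans w (trans (cong (λ k → 2 * x + 3 * k) (ℕ.+-cancelˡ-≡ j d (v + d′) (trans
        (ℕ.suc-injective (trans (sym q) q′)) (ℕ.+-assoc j v d′))))
      (trans (solve 3 (λ x v d → con 2 :* x :+ con 3 :* (v :+ d) := con 2 :* x :+ con 3 :* d :+ con 3 :* v) refl x v d′)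
        (cong (_+ 3 * v) (sym w′))))

    -- Going up one row along the northeastern side, the end moves three columns west, whereas a
    -- vertical step gains one column. Along the southeastern side both gain one column. So a path
    -- past the east end of row j has missed every exit from row j upwards.
    exit-right : ∀ j v → NE (j + v) ≡ true → end (j + v) < W j + v
    exit-right j v e = go (rowKind j j<R) (ne-of (j + v) e)
      where
      j<R : j < R
      j<R = ℕ.≤-<-trans (ℕ.m≤m+n j v) (proj₁ (W-NE (j + v) e))
      go : RowKind j → (∃ λ d → R ≡ suc (j + v + d) × s ≤ j + v × end (j + v) ≡ 2 * x + 3 * d) → end (j + v) < W j + v
      go (ne d q le w g) (d′ , q′ , le′ , w′) = go′ v refl
        where
        go′ : ∀ k → k ≡ v → end (j + v) < W j + v
        go′ zero    refl = ℕ.≤-reflexive (trans (cong (suc ∘ end) (ℕ.+-identityʳ j)) (trans (sym (proj₁ (proj₂ (W-NE j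
                              (subst (λ k → NE k ≡ true) (ℕ.+-identityʳ j) e))))) (sym (ℕ.+-identityʳ (W j)))))
        go′ (suc k) refl = ≤-trans (lt-by (3 * k + 3 + k) (trans (cong (_+ v) (end-diff j v d d′ q q′ w w′))
            (solve 2 (λ f k → f :+ con 3 :* (con 1 :+ k) :+ (con 1 :+ k) := con 1 :+ (f :+ (con 3 :* k :+ con 3 :+ k))) refl (end (j + v)) k)))
            (ℕ.+-monoˡ-≤ v (W≥ j j<R))
      go (se f q w g) (d′ , q′ , le′ , w′) = go′ (corner {j} (lt-by f q))
       where
       go′ : (∃ λ d → R ≡ suc (s + d) × E₀ ≡ 2 * x + 3 * d) → end (j + v) < W j + v
       go′ (d , r , E≡) = lt-by (suc (2 * k) + 2 * k) (trans (cong (_+ v) (W-se j j<R g)) (cong suc (trans fin (ℕ.+-assoc (end (j + v)) _ _))))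
        where
        open ≡-Reasoning
        v≥ : suc f ≤ v
        v≥ = ℕ.+-cancelˡ-≤ j (suc f) v (subst (_≤ j + v) (trans q (sym (ℕ.+-suc j f))) le′)
        k = v ∸ suc f
        v≡ : v ≡ suc f + k
        v≡ = sym (ℕ.m+[n∸m]≡n v≥)
        dd : d ≡ k + d′
        dd = ℕ.+-cancelˡ-≡ s d (k + d′) (trans (ℕ.suc-injective (trans (sym r) q′)) (trans (cong (λ n → j + n + d′) v≡)
               (trans (solve 4 (λ j f k d → j :+ (con 1 :+ f :+ k) :+ d := con 1 :+ (j :+ f) :+ (k :+ d)) refl j f k d′)
                 (cong (_+ (k + d′)) (sym q)))))
        fin : end j + v ≡ end (j + v) + suc (2 * k) + 2 * k
        fin = begin
          end j + v                          ≡⟨ cong (end j +_) v≡ ⟩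
          end j + (suc f + k)                ≡⟨ solve 3 (λ e f k → e :+ (con 1 :+ f :+ k) := e :+ f :+ (con 1 :+ k)) refl (end j) f k ⟩
          end j + f + suc k                  ≡⟨ cong (_+ suc k) (trans w (trans E≡ (cong (λ n → 2 * x + 3 * n) dd))) ⟩
          2 * x + 3 * (k + d′) + suc k       ≡⟨ solve 3 (λ x k d → con 2 :* x :+ con 3 :* (k :+ d) :+ (con 1 :+ k) := con 2 :* x :+ con 3 :* d :+ (con 1 :+ con 2 :* k) :+ con 2 :* k) refl x k d′ ⟩
          2 * x + 3 * d′ + suc (2 * k) + 2 * k  ≡⟨ cong (λ n → n + suc (2 * k) + 2 * k) (sym w′) ⟩
          end (j + v) + suc (2 * k) + 2 * k  ∎

    exit-above : ∀ j v → NE j ≡ true → NE (j + suc v) ≡ true → suc (end (j + suc v)) < W j + suc v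
    exit-above j v e e′ with ne-of j e | ne-of (j + suc v) e′
    ... | d , q , _ , w | d′ , q′ , _ , w′ = lt-by (3 * v + 3 + v) (trans (cong (_+ suc v) (trans (proj₁ (proj₂ (W-NE j e)))
          (cong suc (end-diff j (suc v) d d′ q q′ w w′))))
        (solve 2 (λ f k → con 1 :+ (f :+ con 3 :* (con 1 :+ k)) :+ (con 1 :+ k) := con 1 :+ (con 1 :+ f :+ (con 3 :* k :+ con 3 :+ k))) refl
           (end (j + suc v)) v))

    wt : Lozenge → ℚ
    wt = weight x y z a

    -- The boundary triangles point up, and a horizontal lozenge that starts at an up-triangle ends
    -- at a down-triangle.
    wt-up : ∀ j c → isUp (j , c) ≡ true → wt (hor j c) ≡ 1ℚ
    wt-up j c u with isNEtriangle x y z a (j , suc c) in e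
    ... | false = refl
    ... | true  = ⊥-elim (go (rowKind j (<ᵇ⇒< j R (true⇒T (∧-true₂ (nSE y z ≤ᵇ j) (j <ᵇ R) nr)))))
      where
      nr : ner j ≡ true
      nr = ∧-true₁ (ner j) _ e
      last : suc c ≡ end j
      last = ℕ.≡ᵇ⇒≡ (suc c) (end j) (true⇒T (∧-true₂ (ner j) _ e))
      go : RowKind j → ⊥
      go (se _ _ _ g)   = true≢false (trans (sym nr) g)
      go (ne d q _ w _) = true≢false (trans (sym (isUp-ne j d q w)) (trans (cong (λ k → isUp (j , k)) (sym last))
                            (trans (isUp-col j c) (cong not u))))

    wt-inner : ∀ j c → suc c ≢ end j → wt (hor j c) ≡ 1ℚ
    wt-inner j c neq with isNEtriangle x y z a (j , suc c) in e
    ... | false = refl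
    ... | true  = ⊥-elim (neq (ℕ.≡ᵇ⇒≡ (suc c) (end j) (true⇒T (∧-true₂ (ner j) _ e))))

    wt-last : ∀ j c → ner j ≡ true → suc c ≡ end j → wt (hor j c) ≡ ½
    wt-last j c nr e = cong (λ b → if b then ½ else 1ℚ)
      (trans (cong (_∧ (suc c ≡ᵇ end j)) nr) (trans (cong (suc c ≡ᵇ_) (sym e)) (≡ᵇ-refl (suc c))))

    wt-se : ∀ j c → ner j ≡ false → wt (hor j c) ≡ 1ℚ
    wt-se j c nr = cong (λ b → if b ∧ (suc c ≡ᵇ end j) then ½ else 1ℚ) nr

    -- Counts lattice paths without asking that they stay in the region. This is harmless: by
    -- `exit-right` a path that has left the region on the east can no longer reach an exit in the
    -- same or a higher row.
    π : ℕ → ℕ → ℕ → ℚ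
    π j c i = if j ≤ᵇ i then pathsTo (suc (end i)) (c + (i ∸ j)) (i ∸ j) else 0ℚ

    π-below : ∀ j c i → i < j → π j c i ≡ 0ℚ
    π-below j c i lt rewrite ≤ᵇ-false lt = refl

    π-at : ∀ j c v → π j c (j + v) ≡ pathsTo (suc (end (j + v))) (c + v) v
    π-at j c v rewrite ≤ᵇ-true (ℕ.m≤m+n j v) | ℕ.m+n∸m≡n j v = refl

    with-diff : (P : ℕ → Set) → ∀ j → (∀ v → P (j + v)) → ∀ i → j ≤ i → P i
    with-diff P j q i le = subst P (ℕ.m+[n∸m]≡n le) (q (i ∸ j))

    π-lt : ∀ j c v → suc (end (j + v)) < c + v → π j c (j + v) ≡ 0ℚ
    π-lt j c v lt = trans (π-at j c v) (pathsTo-lt _ _ v lt)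

    π-end : ∀ j → NE j ≡ true → π j (W j) j ≡ 1ℚ
    π-end j e = subst (λ k → π j (W j) k ≡ 1ℚ) (ℕ.+-identityʳ j) (trans (π-at j (W j) 0)
      (pathsTo-eq _ _ 0 0 (trans (cong (suc ∘ end) (ℕ.+-identityʳ j)) (trans (sym (proj₁ (proj₂ (W-NE j e)))) (sym (ℕ.+-identityʳ (W j)))))))

    π-end′ : ∀ j i → NE j ≡ true → j < i → NE i ≡ true → π j (W j) i ≡ 0ℚ
    π-end′ j i e lt = with-diff (λ i → NE i ≡ true → π j (W j) i ≡ 0ℚ) (suc j)
      (λ v e′ → subst (λ i → NE i ≡ true → π j (W j) i ≡ 0ℚ) (ℕ.+-suc j v)
         (λ e′ → π-lt j (W j) (suc v) (exit-above j v e e′)) e′) i lt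

    π-right : ∀ j c i → isUp (j , c) ≡ false → suc c ≡ W j → j ≤ i → NE i ≡ true → π j (2 + c) i ≡ 0ℚ
    π-right j c i _ w le = with-diff (λ i → NE i ≡ true → π j (2 + c) i ≡ 0ℚ) j
      (λ v e → π-lt j (2 + c) v (s≤s (subst (λ k → end (j + v) < k + v) (sym w) (exit-right j v e)))) i le

    π-above : ∀ j c i → isUp (j , c) ≡ false → c < W j → W (suc j) ≤ c → j ≤ i → NE i ≡ true →
              π (suc j) (suc c) i ≡ 0ℚ
    π-above j c i _ _ w le e = go (ℕ.m≤n⇒m<n∨m≡n le)
      where
      go : j < i ⊎ j ≡ i → π (suc j) (suc c) i ≡ 0ℚ
      go (inj₂ refl) = π-below (suc j) (suc c) j ≤-refl
      go (inj₁ lt)   = with-diff (λ i → NE i ≡ true → π (suc j) (suc c) i ≡ 0ℚ) (suc j)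
        (λ v e → π-lt (suc j) (suc c) v (s≤s (≤-trans (exit-right (suc j) v e) (ℕ.+-monoˡ-≤ v w)))) i lt e

    isUp-exit : ∀ i → NE i ≡ true → odd? (suc (end i)) ≡ odd? i
    isUp-exit i e with ne-of i e
    ... | d , q , _ , w = trans (sym (odd?-+2 (suc (end i)) i)) (trans (cong odd? (solve 2 (λ f i → con 1 :+ f :+ (i :+ i) := con 1 :+ (i :+ f) :+ i) refl (end i) i))
         (flip (i + end i) i (isUp-ne i d q w)))
      where
      flip : ∀ m n → odd? m ≡ true → odd? (suc m + n) ≡ odd? n
      flip (suc zero)    n _ = refl
      flip (suc (suc m)) n o = flip m n o

    π-step-at : ∀ j c v → isUp (j , c) ≡ false → c < W j → NE (j + v) ≡ true →
                π j c (j + v) ≡ wt (hor j c) ℚ.* π j (2 + c) (j + v) ℚ.+ 1ℚ ℚ.* π (suc j) (suc c) (j + v)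
    π-step-at j c v u w e with even-difference (suc (end (j + v))) (c + v)
        (trans (isUp-exit (j + v) e) (parity j c v u))
      where
      parity : ∀ j c v → odd? (j + c) ≡ false → odd? (j + v) ≡ odd? (c + v)
      parity j c v u = trans (sym (odd?-+2 (j + v) c)) (trans (cong odd? (solve 3 (λ j c v → j :+ v :+ (c :+ c) := j :+ c :+ (c :+ v)) refl j c v)) (evens (j + c) (c + v) u))
        where
        evens : ∀ m n → odd? m ≡ false → odd? (m + n) ≡ odd? n
        evens zero          n _ = refl
        evens (suc (suc m)) n o = evens m n o
    ... | inj₁ lt = trans (π-lt j c v lt) (sym (trans (cong₂ (λ s t → wt (hor j c) ℚ.* s ℚ.+ 1ℚ ℚ.* t)
          (π-lt j (2 + c) v (≤-trans lt (ℕ.m≤n+m _ 2))) (upper v e lt))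
          (trans (cong (ℚ._+ 1ℚ ℚ.* 0ℚ) (ℚ.*-zeroʳ (wt (hor j c)))) refl)))
      where
      upper : ∀ v → NE (j + v) ≡ true → suc (end (j + v)) < c + v → π (suc j) (suc c) (j + v) ≡ 0ℚ
      upper zero    e lt = π-below (suc j) (suc c) (j + 0) (s≤s (ℕ.≤-reflexive (ℕ.+-identityʳ j)))
      upper (suc v) e lt = subst (λ i → π (suc j) (suc c) i ≡ 0ℚ) (sym (ℕ.+-suc j v))
        (π-lt (suc j) (suc c) v (subst₂ (λ i k → suc (end i) < k) (ℕ.+-suc j v) (ℕ.+-suc c v) lt))
    ... | inj₂ (l , q) = go l v e q
      where
      above : ∀ l v → suc (end (j + suc v)) ≡ l + l + (c + suc v) → π (suc j) (suc c) (j + suc v) ≡ p l v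
      above l v q = subst (λ i → π (suc j) (suc c) i ≡ p l v) (sym (ℕ.+-suc j v)) (trans (π-at (suc j) (suc c) v)
        (pathsTo-eq _ _ v l (subst₂ (λ i k → suc (end i) ≡ l + l + k) (ℕ.+-suc j v) (ℕ.+-suc c v) q)))
      right : ∀ l v → suc (end (j + v)) ≡ suc l + suc l + (c + v) → π j (2 + c) (j + v) ≡ p l v
      right l v q = trans (π-at j (2 + c) v) (pathsTo-eq _ _ v l (trans q
        (solve 2 (λ l k → con 1 :+ l :+ (con 1 :+ l) :+ k := l :+ l :+ (con 2 :+ k)) refl l (c + v))))
      here′ : ∀ l v → suc (end (j + v)) ≡ l + l + (c + v) → π j c (j + v) ≡ p l v
      here′ l v q = trans (π-at j c v) (pathsTo-eq _ _ v l q)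
      beyond : ∀ v → suc (end (j + v)) ≡ c + v → π j (2 + c) (j + v) ≡ 0ℚ
      beyond v q = π-lt j (2 + c) v (s≤s (ℕ.≤-trans (ℕ.≤-reflexive q) (n≤1+n _)))
      low : π (suc j) (suc c) (j + 0) ≡ 0ℚ
      low = π-below (suc j) (suc c) (j + 0) (s≤s (ℕ.≤-reflexive (ℕ.+-identityʳ j)))
      Goal : ℕ → Set
      Goal v = π j c (j + v) ≡ wt (hor j c) ℚ.* π j (2 + c) (j + v) ℚ.+ 1ℚ ℚ.* π (suc j) (suc c) (j + v)
      combine : ∀ v {α β γ k} → π j c (j + v) ≡ α → wt (hor j c) ≡ k → π j (2 + c) (j + v) ≡ β → π (suc j) (suc c) (j + v) ≡ γ →
                α ≡ k ℚ.* β ℚ.+ 1ℚ ℚ.* γ → Goal v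
      combine v {α} {β} {γ} {k} q₁ q₂ q₃ q₄ q = trans q₁ (trans q (sym (cong₂ ℚ._+_ (cong₂ ℚ._*_ q₂ q₃) (cong (1ℚ ℚ.*_) q₄))))
      j0 : ∀ {P : ℕ → Set} → P (j + 0) → P j
      j0 {P} = subst P (ℕ.+-identityʳ j)
      go : ∀ l v → NE (j + v) ≡ true → suc (end (j + v)) ≡ l + l + (c + v) → Goal v
      go zero zero e q = ⊥-elim (<-irrefl refl (subst (c <_) (trans (proj₁ (proj₂ (W-NE j (j0 {λ k → NE k ≡ true} e)))) (trans (j0 {λ k → suc (end k) ≡ c + 0} q) (ℕ.+-identityʳ c))) w))
      go zero (suc v) e q = trans (here′ 0 (suc v) q) (sym (trans (cong₂ (λ s t → wt (hor j c) ℚ.* s ℚ.+ 1ℚ ℚ.* t) (beyond (suc v) q) (above 0 v q))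
        (cong (ℚ._+ 1ℚ) (ℚ.*-zeroʳ (wt (hor j c))))))
      -- One horizontal step left in the exit row: this is the boundary lozenge of weight 1/2.
      -- Earlier horizontal steps in that row weigh 1, so `p (suc l) 0` remains `½`.
      go (suc zero) zero e q = combine 0 (here′ 1 0 q)
        (wt-last j c (proj₂ (proj₂ (W-NE j (j0 {λ k → NE k ≡ true} e)))) (sym (ℕ.suc-injective (trans (j0 {λ k → suc (end k) ≡ 2 + (c + 0)} q) (cong (2 +_) (ℕ.+-identityʳ c))))))
        (right 0 0 q) low refl
      go (suc (suc l)) zero e q = combine 0 (here′ (2 + l) 0 q)
        (wt-inner j c (λ r → far r (trans (j0 {λ k → suc (end k) ≡ 2 + l + (2 + l) + (c + 0)} q)
            (solve 2 (λ l c → con 2 :+ l :+ (con 2 :+ l) :+ (c :+ con 0) := con 1 :+ (con 3 :+ l :+ l :+ c)) refl l c))))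
        (right (suc l) 0 q) low refl
        where
        far : suc c ≡ end j → suc (end j) ≡ suc (3 + l + l + c) → ⊥
        far r t = <-irrefl (trans r (ℕ.suc-injective t)) (lt-by (suc (l + l)) (solve 2 (λ l c → con 3 :+ l :+ l :+ c := con 1 :+ (con 1 :+ c :+ (con 1 :+ (l :+ l)))) refl l c))
      -- The exit lies in a higher row and is still within reach, so this lozenge cannot be the
      -- boundary lozenge of row j and weighs 1.
      go (suc l) (suc v) e q = combine (suc v) (here′ (suc l) (suc v) q) (inner (rowKind j (in-row j c w)))
        (right l (suc v) q) (above (suc l) v q) (sym (cong₂ ℚ._+_ (ℚ.*-identityˡ (p l (suc v))) (ℚ.*-identityˡ (p (suc l) v))))
        where
        inner : RowKind j → wt (hor j c) ≡ 1ℚ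
        inner (se _ _ _ g) = wt-se j c g
        inner (ne d r _ f _) = wt-inner j c (λ t → lem t (ne-of (j + suc v) e))
          where
          lem : suc c ≡ end j → (∃ λ d → R ≡ suc (j + suc v + d) × s ≤ j + suc v × end (j + suc v) ≡ 2 * x + 3 * d) → ⊥
          lem t (d′ , r′ , _ , f′) = <-irrefl (trans t (trans (end-diff j (suc v) d d′ r r′ f f′) (cong (_+ 3 * suc v) (ℕ.suc-injective q))))
            (lt-by (l + l + 4 * v + 3) (solve 3 (λ c v l → l :+ (con 1 :+ l) :+ (c :+ (con 1 :+ v)) :+ con 3 :* (con 1 :+ v)
               := con 1 :+ (con 1 :+ c :+ (l :+ l :+ con 4 :* v :+ con 3))) refl c v l))

    π-step : ∀ j c i → isUp (j , c) ≡ false → c < W j → j ≤ i → NE i ≡ true →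
             π j c i ≡ wt (hor j c) ℚ.* π j (2 + c) i ℚ.+ 1ℚ ℚ.* π (suc j) (suc c) i
    π-step j c i u w le = with-diff (λ i → NE i ≡ true → π j c i ≡ wt (hor j c) ℚ.* π j (2 + c) i ℚ.+ 1ℚ ℚ.* π (suc j) (suc c) i) j
      (λ v → π-step-at j c v u w) i le

    -- Only the last cell of a row can be removed, so every row is an initial interval of columns,
    -- determined by its width.
    inE≡ : ∀ q → inE x y z a q ≡ (proj₂ q <ᵇ W (proj₁ q))
    inE≡ (j , c) with j <ᵇ R | ner j | rm j
    ... | false | _     | _     = refl
    ... | true  | false | _     = trans (∧-identityʳ (c ≤ᵇ end j)) (≤ᵇ-suc c (end j))
      where
      ≤ᵇ-suc : ∀ m n → (m ≤ᵇ n) ≡ (m <ᵇ suc n)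
      ≤ᵇ-suc zero    n = refl
      ≤ᵇ-suc (suc m) n = refl
    ... | true  | true  | false = trans (cong (λ b → (c ≤ᵇ end j) ∧ not b) (∧-zeroʳ (c ≡ᵇ end j))) (trans (∧-identityʳ (c ≤ᵇ end j)) (≤ᵇ-suc c (end j)))
      where
      ≤ᵇ-suc : ∀ m n → (m ≤ᵇ n) ≡ (m <ᵇ suc n)
      ≤ᵇ-suc zero    n = refl
      ≤ᵇ-suc (suc m) n = refl
    ... | true  | true  | true  = trans (cong (λ b → (c ≤ᵇ end j) ∧ not b) (∧-identityʳ (c ≡ᵇ end j))) (strict c (end j))
      where
      strict : ∀ m n → ((m ≤ᵇ n) ∧ not (m ≡ᵇ n)) ≡ (m <ᵇ n)
      strict zero          zero    = refl
      strict zero          (suc n) = refl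
      strict (suc m)       zero    = refl
      strict (suc zero)    (suc zero)    = refl
      strict (suc zero)    (suc (suc n)) = refl
      strict (suc (suc m)) (suc n) = strict (suc m) n

    pentagon : List Cell
    pentagon = concatMap (λ j → map (λ c → (j , c)) (upTo (suc (end j)))) (upTo R)

    cells : List Cell
    cells = cellsE x y z a

    ∈cells : ∀ j c → c < W j → (j , c) ∈ cells
    ∈cells j c lt = ∈-filter⁺ (λ q → inE x y z a q) pentagon
      (∈-concatMap⁺ _ (lose (∈-upTo⁺ (in-row j c lt)) (∈-map⁺ (j ,_) (∈-upTo⁺ (≤-trans lt W≤)))))
      (trans (inE≡ (j , c)) (<ᵇ-true′ lt))
      where
      W≤ : W j ≤ suc (end j)
      W≤ with j <ᵇ R | ner j ∧ rm j
      ... | true  | true  = n≤1+n _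
      ... | true  | false = ≤-refl
      ... | false | _     = z≤n

    cells∈ : ∀ j c → (j , c) ∈ cells → c < W j × j < R
    cells∈ j c q∈ = lt , in-row j c lt
      where
      lt : c < W j
      lt = <ᵇ⇒< c (W j) (true⇒T (trans (sym (inE≡ (j , c))) (∈-filter⁻ (λ q → inE x y z a q) pentagon q∈)))

    open Scan cells wt W NE π R ∈cells cells∈ W-R isUp-end wt-up (λ _ _ → refl) π-step π-right π-above π-end π-end′ π-below
    open Covering cells wt using (Z; term)

    okE : Lozenge → Bool
    okE l = foldr (λ q b → inE x y z a q ∧ b) true (cellsOf l)

    lozengesAt : Cell → List Lozenge
    lozengesAt q = hor (proj₁ q) (proj₂ q) ∷ (if isUp q then [] else ver (proj₁ q) (proj₂ q) ∷ [])

    okE≡okL : ∀ l → okE l ≡ okL l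
    okE≡okL (hor j c) = cong₂ (λ b b′ → b ∧ b′ ∧ true) (inE≡ (j , c)) (inE≡ (j , suc c))
    okE≡okL (ver j c) = cong₂ (λ b b′ → b ∧ b′ ∧ true) (inE≡ (j , c)) (inE≡ (suc j , c))

    outside : ∀ q → inE x y z a q ≡ false → filter okE (lozengesAt q) ≡ []
    outside (j , c) e with isUp (j , c)
    ... | true  rewrite e = refl
    ... | false rewrite e = refl

    filter-inside : ∀ qs → filter okE (concatMap lozengesAt (filter (λ q → inE x y z a q) qs)) ≡ concatMap (λ q → filter okE (lozengesAt q)) qs
    filter-inside []       = refl
    filter-inside (q ∷ qs) = go (inE x y z a q) refl
      where
      go : ∀ b → inE x y z a q ≡ b → filter okE (concatMap lozengesAt (if b then q ∷ filter (λ q → inE x y z a q) qs else filter (λ q → inE x y z a q) qs))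
           ≡ filter okE (lozengesAt q) ++ concatMap (λ q → filter okE (lozengesAt q)) qs
      go true  e = trans (filter-++ okE (lozengesAt q) _) (cong (filter okE (lozengesAt q) ++_) (filter-inside qs))
      go false e = trans (filter-inside qs) (cong (_++ concatMap (λ q → filter okE (lozengesAt q)) qs) (sym (outside q e)))

    row-chunks : ∀ j c m (g : ℕ → ℕ) → (∀ i → g i ≡ c + i) →
                 concatMap (λ q → filter okE (lozengesAt q)) (map (λ c → (j , c)) (applyUpTo g m)) ≡ rowLoz j c m
    row-chunks j c zero    g e = refl
    row-chunks j c (suc m) g e = cong₂ _++_
      (trans (cong (λ c → filter okE (lozengesAt (j , c))) (trans (e 0) (ℕ.+-identityʳ c))) (filter-cong (lozengesAt (j , c)) okE≡okL))
      (row-chunks j (suc c) m (g ∘ suc) (λ i → trans (e (suc i)) (ℕ.+-suc c i)))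

    rowLoz-snoc : ∀ j c m → rowLoz j c (suc m) ≡ rowLoz j c m ++ chunk j (m + c)
    rowLoz-snoc j c zero    = ++-identityʳ (chunk j c)
    rowLoz-snoc j c (suc m) = trans (cong (chunk j c ++_) (trans (rowLoz-snoc j (suc c) m) (cong (λ k → rowLoz j (suc c) m ++ chunk j k) (ℕ.+-suc m c))))
                                    (sym (++-assoc (chunk j c) (rowLoz j (suc c) m) (chunk j (suc m + c))))

    row-width : ∀ j → j < R → rowLoz j 0 (suc (end j)) ≡ rowLoz j 0 (W j)
    row-width j lt = trans (go (ner j ∧ rm j) refl) (cong (rowLoz j 0) (sym (W-in j lt)))
      where
      go : ∀ b → ner j ∧ rm j ≡ b → rowLoz j 0 (suc (end j)) ≡ rowLoz j 0 (if b then end j else suc (end j))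
      go false e = refl
      go true  e = trans (rowLoz-snoc j 0 (end j)) (trans (cong (rowLoz j 0 (end j) ++_)
        (trans (sym (filter-cong (lozengesAt (j , end j + 0)) okE≡okL)) (outside (j , end j + 0) (trans (inE≡ (j , end j + 0))
           (<ᵇ-false′ (ℕ.≤-trans (ℕ.≤-reflexive (trans (W-in j lt) (cong (λ b → if b then end j else suc (end j)) e))) (ℕ.m≤m+n (end j) 0)))))))
        (++-identityʳ _))

    concat-++ : {A B : Set} (h : A → List B) (xs ys : List A) → concatMap h (xs ++ ys) ≡ concatMap h xs ++ concatMap h ys
    concat-++ h []       ys = refl
    concat-++ h (x ∷ xs) ys = trans (cong (h x ++_) (concat-++ h xs ys)) (sym (++-assoc (h x) _ _))

    rows-chunks : ∀ j n (g : ℕ → ℕ) → (∀ i → g i ≡ j + i) → n + j ≤ R →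
                  concatMap (λ q → filter okE (lozengesAt q)) (concatMap (λ j → map (λ c → (j , c)) (upTo (suc (end j)))) (applyUpTo g n))
                  ≡ rowsLoz j n
    rows-chunks j zero    g e le = refl
    rows-chunks j (suc n) g e le = trans (concat-++ _ (map (λ c → (g 0 , c)) (upTo (suc (end (g 0))))) _) (cong₂ _++_
      (trans (cong (λ j → concatMap (λ q → filter okE (lozengesAt q)) (map (λ c → (j , c)) (upTo (suc (end j))))) (trans (e 0) (ℕ.+-identityʳ j)))
        (trans (row-chunks j 0 (suc (end j)) (λ i → i) (λ _ → refl)) (row-width j (≤-trans (s≤s (ℕ.m≤n+m j n)) le))))
      (rows-chunks (suc j) n (g ∘ suc) (λ i → trans (e (suc i)) (ℕ.+-suc j i)) (subst (_≤ R) (sym (ℕ.+-suc n j)) le)))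

    lozenges≡ : lozengesE x y z a ≡ rowsLoz 0 R
    lozenges≡ = trans (filter-inside pentagon) (rows-chunks 0 R (λ i → i) (λ _ → refl) (ℕ.≤-reflexive (ℕ.+-identityʳ R)))

    M≡det-exits : M*E x y z a ≡ det apply (exits 0 R) (west 0 R)
    M≡det-exits = begin
      M*E x y z a                                ≡⟨ sum-sublists (term (λ _ → true)) (lozengesE x y z a) ⟩
      Z (λ _ → true) (lozengesE x y z a)         ≡⟨ cong (Z (λ _ → true)) lozenges≡ ⟩
      Z (λ _ → true) (rowsLoz 0 R)               ≡⟨ scan-rows R 0 (λ _ → true) (ℕ.+-identityʳ R) start (λ _ _ → refl) ⟩
      D 0 R (before 0 (W 0) (λ _ → true) ++ west 0 R)  ≡⟨ cong (λ us → D 0 R (us ++ west 0 R)) (none (W 0)) ⟩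
      det apply (exits 0 R) (west 0 R)           ∎
      where
      open ≡-Reasoning
      start : Inv 0 0 (λ _ → true)
      start = record { past = λ { _ _ _ (inj₁ ()) ; _ _ _ (inj₂ (_ , ())) } ; out = λ _ _ _ → refl ; down = λ _ _ _ → refl
                     ; next = λ _ _ → refl ; nextD = λ _ _ → refl ; far = λ _ _ _ → refl }
      none : ∀ k → before 0 k (λ _ → true) ≡ []
      none zero    = refl
      none (suc k) = trans (cong (_++ before 0 k (λ _ → true)) (single-needed 0 k (λ _ → true) refl)) (none k)

    keep : ℕ → Bool
    keep t = not ((y + a ≤ᵇ t) ∧ (t + 1 ≤ᵇ y + 2 * a))

    exitRows : ℕ → List ℕ
    exitRows zero    = []
    exitRows (suc t) = if keep (suc t) then suc t ∷ exitRows t else exitRows t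

    nNE≡′ : R ≡ s + (s + 2 * a)
    nNE≡′ = trans R≡ (solve 2 (λ s a → s :+ a :+ (s :+ a) := s :+ (s :+ con 2 :* a)) refl s a)

    exits-NE : ∀ n j → n + j ≡ R → n ≤ s + 2 * a → exits j n ≡ map (R ∸_) (exitRows n)
    exits-NE zero    j e le = refl
    exits-NE (suc n) j e le = go (rowKind j j<R)
      where
      j<R : j < R
      j<R = subst (j <_) e (s≤s (ℕ.m≤n+m j n))
      s≤j : s ≤ j
      s≤j = ℕ.+-cancelʳ-≤ (suc n) s j (ℕ.≤-trans (ℕ.+-monoʳ-≤ s le) (ℕ.≤-reflexive (trans (sym nNE≡′) (trans (sym e) (ℕ.+-comm (suc n) j)))))
      top : topIndex y z a j ≡ suc n
      top = trans (cong (_∸ j) (sym e)) (ℕ.m+n∸n≡m (suc n) j)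
      bottom : j ≡ R ∸ suc n
      bottom = sym (trans (cong (_∸ suc n) (sym e)) (ℕ.m+n∸m≡n (suc n) j))
      IH : exits (suc j) n ≡ map (R ∸_) (exitRows n)
      IH = exits-NE n (suc j) (trans (ℕ.+-suc n j) e) (≤-trans (n≤1+n n) le)
      go : RowKind j → exits j (suc n) ≡ map (R ∸_) (exitRows (suc n))
      go (se f q _ _) = ⊥-elim (ℕ.<⇒≱ (lt-by f q) s≤j)
      go (ne d _ _ _ nr) = trans (cong (λ b → if b then j ∷ exits (suc j) n else exits (suc j) n)
          (trans (cong (_∧ not (rm j)) nr) (cong (λ t → not ((y + a ≤ᵇ t) ∧ (t + 1 ≤ᵇ y + 2 * a))) top))) (split (keep (suc n)))
        where
        split : ∀ b → (if b then j ∷ exits (suc j) n else exits (suc j) n) ≡ map (R ∸_) (if b then suc n ∷ exitRows n else exitRows n)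
        split true  = cong₂ _∷_ bottom IH
        split false = IH

    exits-all : ∀ k j → k + j ≡ s → exits j (k + (s + 2 * a)) ≡ map (R ∸_) (exitRows (s + 2 * a))
    exits-all zero    j refl = exits-NE (s + 2 * a) s (trans (ℕ.+-comm (s + 2 * a) s) (sym nNE≡′)) ≤-refl
    exits-all (suc k) j e    = trans (cong (λ b → if b then j ∷ exits (suc j) (k + (s + 2 * a)) else exits (suc j) (k + (s + 2 * a))) (notNE (rowKind j j<R)))
                                     (exits-all k (suc j) (trans (ℕ.+-suc k j) e))
      where
      j<s : j < s
      j<s = subst (j <_) e (s≤s (ℕ.m≤n+m j k))
      j<R : j < R
      j<R = ≤-trans j<s (ℕ.≤-trans (ℕ.m≤m+n s _) (ℕ.≤-reflexive (sym nNE≡′)))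
      notNE : RowKind j → NE j ≡ false
      notNE (ne _ _ le _ _) = ⊥-elim (ℕ.<⇒≱ j<s le)
      notNE (se _ _ _ g)    = cong (_∧ not (rm j)) g

    exits≡ : exits 0 R ≡ map (R ∸_) (exitRows (s + 2 * a))
    exits≡ = trans (cong (exits 0) nNE≡′) (exits-all s 0 (ℕ.+-identityʳ s))

    odd?-even : ∀ k → isUp (k + k , 0) ≡ false
    odd?-even k = trans (cong odd? (ℕ.+-identityʳ (k + k))) (odd?-+2 0 k)

    west-pair : ∀ j m → isUp (j , 0) ≡ false → west j (suc (suc m)) ≡ π j 0 ∷ west (2 + j) m
    west-pair j m u = cong₂ (λ b b′ → (if b then [] else π j 0 ∷ []) ++ (if b′ then [] else π (suc j) 0 ∷ []) ++ west (2 + j) m)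
      u (trans (isUp-row j 0) (cong not u))

    -- Column 0 points down exactly in the even rows. Row 2k is relabelled u = N - k, so that
    -- sources, like exits, are counted from the top.
    west≡ : ∀ n k → n + k ≡ N → west (k + k) (n + n) ≡ map (λ u → π ((N ∸ u) + (N ∸ u)) 0) (desc 0 n)
    west≡ zero    k e = refl
    west≡ (suc n) k e = trans (cong (λ m → west (k + k) (suc m)) (ℕ.+-suc n n)) (trans (west-pair (k + k) (n + n) (odd?-even k))
      (cong₂ _∷_ (cong (λ m → π (m + m) 0) (sym (trans (cong (_∸ suc n) (sym e)) (ℕ.m+n∸m≡n (suc n) k))))
        (trans (cong (λ m → west (suc m) (n + n)) (sym (ℕ.+-suc k k))) (west≡ n (suc k) (trans (ℕ.+-suc n k) e)))))

    exitRows-keep : ∀ q n → (∀ i → i < n → keep (q + suc i) ≡ true) → exitRows (q + n) ≡ desc q n ++ exitRows q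
    exitRows-keep q zero    e = cong exitRows (ℕ.+-identityʳ q)
    exitRows-keep q (suc n) e = trans (cong exitRows (ℕ.+-suc q n)) (trans
      (cong (λ b → if b then suc (q + n) ∷ exitRows (q + n) else exitRows (q + n)) (trans (cong keep (sym (ℕ.+-suc q n))) (e n ≤-refl)))
      (cong₂ _∷_ (sym (ℕ.+-suc q n)) (exitRows-keep q n (λ i lt → e i (≤-trans lt (n≤1+n n))))))

    exitRows-drop : ∀ q n → (∀ i → i < n → keep (q + suc i) ≡ false) → exitRows (q + n) ≡ exitRows q
    exitRows-drop q zero    e = cong exitRows (ℕ.+-identityʳ q)
    exitRows-drop q (suc n) e = trans (cong exitRows (ℕ.+-suc q n)) (trans
      (cong (λ b → if b then suc (q + n) ∷ exitRows (q + n) else exitRows (q + n)) (trans (cong keep (sym (ℕ.+-suc q n))) (e n ≤-refl)))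
      (exitRows-drop q n (λ i lt → e i (≤-trans lt (n≤1+n n)))))

    -- Exit t lies in row 2N - t at column 2x+3(t-1), and source u in row 2(N-u) at column 0. Hence
    -- there are 2u-t vertical steps, and half of the remaining distance gives x+2t-u-1 horizontal
    -- ones.
    entry : ∀ t u → 1 ≤ t → t ≤ s + 2 * a → NE (R ∸ t) ≡ true → u ≤ N → π ((N ∸ u) + (N ∸ u)) 0 (R ∸ t) ≡ A[ x ] t u
    entry t u 1≤t t≤ ne? u≤ with ne-of (R ∸ t) ne?
    ... | d , q , _ , w = trans (cong (λ b → if b then pathsTo (suc (end (R ∸ t))) (0 + ((R ∸ t) ∸ (k + k))) ((R ∸ t) ∸ (k + k)) else 0ℚ) first)
                          (go (t ≤ᵇ 2 * u) refl)
      where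
      k = N ∸ u
      k+u : k + u ≡ N
      k+u = ℕ.m∸n+n≡m u≤
      t≤R : t ≤ R
      t≤R = ≤-trans t≤ (ℕ.≤-trans (ℕ.m≤n+m _ s) (ℕ.≤-reflexive (sym nNE≡′)))
      r+t : (R ∸ t) + t ≡ (k + k) + 2 * u
      r+t = trans (ℕ.m∸n+n≡m t≤R) (trans R≡ (trans (cong (λ n → n + n) (sym k+u)) (solve 2 (λ k u → k :+ u :+ (k :+ u) := k :+ k :+ con 2 :* u) refl k u)))
      first : (k + k ≤ᵇ (R ∸ t)) ≡ (t ≤ᵇ 2 * u)
      first with ℕ.<-≤-connex (2 * u) t
      ... | inj₂ le = trans (≤ᵇ-true (ℕ.+-cancelʳ-≤ t (k + k) (R ∸ t) (≤-trans (ℕ.+-monoʳ-≤ (k + k) le) (ℕ.≤-reflexive (sym r+t))))) (sym (≤ᵇ-true le))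
      ... | inj₁ lt = trans (≤ᵇ-false (ℕ.+-cancelʳ-< t (R ∸ t) (k + k) (subst (_< k + k + t) (sym r+t) (ℕ.+-monoʳ-< (k + k) lt)))) (sym (≤ᵇ-false lt))
      t≡ : t ≡ suc d
      t≡ = ℕ.+-cancelˡ-≡ (R ∸ t) t (suc d) (trans (ℕ.m∸n+n≡m t≤R) (trans q (sym (ℕ.+-suc (R ∸ t) d))))
      go : ∀ b → (t ≤ᵇ 2 * u) ≡ b → (if b then pathsTo (suc (end (R ∸ t))) ((R ∸ t) ∸ (k + k)) ((R ∸ t) ∸ (k + k)) else 0ℚ)
           ≡ (if b ∧ (u <ᵇ x + 2 * t) then p (x + 2 * t ∸ suc u) (2 * u ∸ t) else 0ℚ)
      go false e = refl
      go true  e = trans (cong (λ m → pathsTo (suc (end (R ∸ t))) m m) diff) (go′ (ℕ.<-≤-connex u (x + 2 * t)))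
        where
        v = 2 * u ∸ t
        v+t : v + t ≡ 2 * u
        v+t = ℕ.m∸n+n≡m (≤ᵇ⇒≤ t (2 * u) (true⇒T e))
        diff : (R ∸ t) ∸ (k + k) ≡ v
        diff = trans (cong (_∸ (k + k)) (ℕ.+-cancelʳ-≡ t (R ∸ t) (k + k + v) (trans r+t (trans (cong (k + k +_) (sym v+t)) (sym (ℕ.+-assoc (k + k) v t))))))
                     (ℕ.m+n∸m≡n (k + k) v)
        end≡ : suc (end (R ∸ t)) + t + 2 ≡ 2 * (x + 2 * t)
        end≡ = trans (cong₂ (λ m n → suc m + n + 2) w t≡) (trans (solve 2 (λ x d → con 1 :+ (con 2 :* x :+ con 3 :* d) :+ (con 1 :+ d) :+ con 2
                 := con 2 :* (x :+ con 2 :* (con 1 :+ d))) refl x d) (cong (λ n → 2 * (x + 2 * n)) (sym t≡)))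
        go′ : u < x + 2 * t ⊎ x + 2 * t ≤ u → pathsTo (suc (end (R ∸ t))) v v ≡ (if (u <ᵇ x + 2 * t) then p (x + 2 * t ∸ suc u) v else 0ℚ)
        go′ (inj₁ lt) rewrite <ᵇ-true′ lt = pathsTo-eq _ v v l (ℕ.+-cancelʳ-≡ (t + 2) _ (l + l + v)
            (trans (sym (ℕ.+-assoc _ t 2)) (trans end≡ (trans (cong (2 *_) (sym (ℕ.m∸n+n≡m lt)))
              (trans (solve 2 (λ l u → con 2 :* (l :+ (con 1 :+ u)) := l :+ l :+ con 2 :* u :+ con 2) refl l u)
                (trans (cong (λ n → l + l + n + 2) (sym v+t)) (solve 3 (λ l v t → l :+ l :+ (v :+ t) :+ con 2 := l :+ l :+ v :+ (t :+ con 2)) refl l v t)))))))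
          where l = x + 2 * t ∸ suc u
        go′ (inj₂ ge) rewrite <ᵇ-false′ ge = pathsTo-lt _ v v (ℕ.+-cancelʳ-< (t + 2) _ v (subst₂ _<_ (trans (sym end≡) (ℕ.+-assoc _ t 2)) (ℕ.+-assoc v t 2)
            (≤-trans (s≤s (ℕ.*-monoʳ-≤ 2 ge)) (ℕ.≤-trans (ℕ.≤-reflexive (cong suc (sym v+t))) (ℕ.≤-trans (n≤1+n _) (ℕ.≤-reflexive (ℕ.+-comm 2 (v + t))))))))

    exitRows-∈ : ∀ n t → t ∈ exitRows n → 1 ≤ t × t ≤ n × keep t ≡ true
    exitRows-∈ (suc n) t t∈ = go (keep (suc n)) refl t∈
      where
      go : ∀ b → keep (suc n) ≡ b → t ∈ (if b then suc n ∷ exitRows n else exitRows n) → 1 ≤ t × t ≤ suc n × keep t ≡ true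
      go true  e (here refl) = s≤s z≤n , ≤-refl , e
      go true  e (there t∈) with (p , q , r) ← exitRows-∈ n t t∈ = p , ≤-trans q (n≤1+n n) , r
      go false e t∈         with (p , q , r) ← exitRows-∈ n t t∈ = p , ≤-trans q (n≤1+n n) , r

    desc-∈ : ∀ n u → u ∈ desc 0 n → u ≤ n
    desc-∈ (suc n) u (here refl) = ≤-refl
    desc-∈ (suc n) u (there u∈)  = ≤-trans (desc-∈ n u u∈) (n≤1+n n)

    NE-exit : ∀ t → 1 ≤ t → t ≤ s + 2 * a → keep t ≡ true → NE (R ∸ t) ≡ true
    NE-exit (suc t) _ t≤ e = go (rowKind j j<R)
      where
      j = R ∸ suc t
      t≤R : suc t ≤ R
      t≤R = ≤-trans t≤ (ℕ.≤-trans (ℕ.m≤n+m _ s) (ℕ.≤-reflexive (sym nNE≡′)))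
      j<R : j < R
      j<R = subst (j <_) (ℕ.m∸n+n≡m t≤R) (subst (j <_) (sym (ℕ.+-suc j t)) (s≤s (ℕ.m≤m+n j t)))
      go : RowKind j → NE j ≡ true
      go (ne _ _ _ _ nr) = trans (cong (_∧ not (rm j)) nr) (trans (cong (λ t → not ((y + a ≤ᵇ t) ∧ (t + 1 ≤ᵇ y + 2 * a))) (ℕ.m∸[m∸n]≡n t≤R)) e)
      go (se f q _ _) = ⊥-elim (ℕ.<⇒≱ (lt-by f q) (ℕ.+-cancelʳ-≤ (suc t) s j (ℕ.≤-trans (ℕ.+-monoʳ-≤ s t≤)
                          (ℕ.≤-reflexive (trans (sym nNE≡′) (sym (ℕ.m∸n+n≡m t≤R)))))))

    M≡det : M*E x y z a ≡ det A[ x ] (desc 0 N) (exitRows (s + 2 * a))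
    M≡det = trans M≡det-exits (trans
      (det-reindex (λ u → π ((N ∸ u) + (N ∸ u)) 0) (R ∸_) (exitRows (s + 2 * a)) (desc 0 N) exits≡
        (trans (cong (west 0) R≡) (west≡ N 0 (ℕ.+-identityʳ N))))
      (det-cong (desc 0 N) (exitRows (s + 2 * a)) entries))
      where
      entries : ∀ t → t ∈ exitRows (s + 2 * a) → ∀ u → u ∈ desc 0 N → π ((N ∸ u) + (N ∸ u)) 0 (R ∸ t) ≡ A[ x ] t u
      entries t t∈ u u∈ with exitRows-∈ (s + 2 * a) t t∈
      ... | p , q , r = entry t u p q (NE-exit t p q r) (desc-∈ N u u∈)

-- A reflective checker for identities between products of factorials, double factorials, linear
-- factors and powers of two.

module Monomial where

  open import Data.Integer.Base as ℤ using (ℤ; +_)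
  open import Data.Integer.Properties as ℤ using ()
  open import Data.Rational.Unnormalised.Base as ℚᵘ using (mkℚᵘ; *≡*; _≃_)
  open import Data.Rational.Unnormalised.Properties as ℚᵘ using ()
  open import Data.Maybe.Base using (Maybe; just; nothing)
  open import Relation.Nullary using (yes; no)

  module Arith where
    open ℕSolver

    half-dot : ∀ h v d → 2 * h * v + 2 * d ≡ 2 * (h * v + d)
    half-dot = solve 3 (λ h v d → con 2 :* h :* v :+ con 2 :* d := con 2 :* (h :* v :+ d)) refl

    half-lin : ∀ h d → 2 + (2 * h + 2 * d) ≡ 2 * suc (h + d)
    half-lin = solve 2 (λ h d → con 2 :+ (con 2 :* h :+ con 2 :* d) := con 2 :* (con 1 :+ (h :+ d))) refl

    scale-dot : ∀ c d v e → c * d * v + c * e ≡ c * (d * v + e)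
    scale-dot = solve 4 (λ c d v e → c :* d :* v :+ c :* e := c :* (d :* v :+ e)) refl

    add-dot : ∀ c d v e f → (c + d) * v + (e + f) ≡ (c * v + e) + (d * v + f)
    add-dot = solve 5 (λ c d v e f → (c :+ d) :* v :+ (e :+ f) := (c :* v :+ e) :+ (d :* v :+ f)) refl

    +-interchange : ∀ k l c d → k + l + (c + d) ≡ (k + c) + (l + d)
    +-interchange = solve 4 (λ k l c d → k :+ l :+ (c :+ d) := (k :+ c) :+ (l :+ d)) refl

  open ℚSolver using (solve; _:*_; _:=_; con)

  opaque
    -- Opaque, so that elsewhere conversion treats `ι n` as an atom instead of normalising fractions
    -- with factorials in them.
    ι : ℕ → ℚ
    ι n = ⟦ n ⟧ℕ

    ⟦⟧≡ι : ∀ n → ⟦ + n ⟧ ≡ ι n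
    ⟦⟧≡ι n = refl

    ι-1 : ι 1 ≡ 1ℚ
    ι-1 = refl

    toℚᵘ-ι : ∀ n → toℚᵘ (ι n) ≃ mkℚᵘ (+ n) 0
    toℚᵘ-ι n = ℚ.toℚᵘ-fromℚᵘ (mkℚᵘ (+ n) 0)

    ι-* : ∀ m n → ι (m * n) ≡ ι m ℚ.* ι n
    ι-* m n = ℚ.toℚᵘ-injective (ℚᵘ.≃-trans (toℚᵘ-ι (m * n)) (ℚᵘ.≃-sym (ℚᵘ.≃-trans (ℚ.toℚᵘ-homo-* (ι m) (ι n))
      (ℚᵘ.≃-trans (ℚᵘ.*-cong (toℚᵘ-ι m) (toℚᵘ-ι n)) (*≡* (cong (ℤ._* + 1) (sym (ℤ.pos-* m n))))))))

    ι-+ : ∀ m n → ι (m + n) ≡ ι m ℚ.+ ι n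
    ι-+ m n = ℚ.toℚᵘ-injective (ℚᵘ.≃-trans (toℚᵘ-ι (m + n)) (ℚᵘ.≃-sym (ℚᵘ.≃-trans (ℚ.toℚᵘ-homo-+ (ι m) (ι n))
      (ℚᵘ.≃-trans (ℚᵘ.+-cong (toℚᵘ-ι m) (toℚᵘ-ι n)) (*≡* (cong (ℤ._* + 1)
         (cong₂ ℤ._+_ (ℤ.*-identityʳ (+ m)) (ℤ.*-identityʳ (+ n)))))))))

    ι-suc≢0 : ∀ n → ι (suc n) ≢ 0ℚ
    ι-suc≢0 n e with ℚᵘ.≃-trans (ℚᵘ.≃-sym (toℚᵘ-ι (suc n))) (ℚ.toℚᵘ-cong e)
    ... | *≡* ()

  ι≢0 : ∀ n .{{_ : NonZero n}} → ι n ≢ 0ℚ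
  ι≢0 (suc n) = ι-suc≢0 n

  inv-inverse : ∀ p → p ≢ 0ℚ → p ℚ.* inv p ≡ 1ℚ
  inv-inverse p p≢0 with p ℚ.≟ 0ℚ
  ... | yes e = ⊥-elim (p≢0 e)
  ... | no  _ = ℚ.*-inverseʳ p {{_}}

  *≢0 : ∀ p q → p ≢ 0ℚ → q ≢ 0ℚ → p ℚ.* q ≢ 0ℚ
  *≢0 p q p≢0 q≢0 e = q≢0 (begin
    q                     ≡⟨ solve 1 (λ q → q := q :* con 1ℚ) refl q ⟩
    q ℚ.* 1ℚ              ≡⟨ cong (q ℚ.*_) (inv-inverse p p≢0) ⟨
    q ℚ.* (p ℚ.* inv p)   ≡⟨ solve 3 (λ q p i → q :* (p :* i) := (p :* q) :* i) refl q p (inv p) ⟩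
    (p ℚ.* q) ℚ.* inv p   ≡⟨ cong (ℚ._* inv p) e ⟩
    0ℚ ℚ.* inv p          ≡⟨ ℚ.*-zeroˡ (inv p) ⟩
    0ℚ                    ∎)
    where open ≡-Reasoning

  *-cancelˡ : ∀ p q r → p ≢ 0ℚ → p ℚ.* q ≡ p ℚ.* r → q ≡ r
  *-cancelˡ p q r p≢0 e = begin
    q                     ≡⟨ lem q ⟨
    inv p ℚ.* (p ℚ.* q)   ≡⟨ cong (inv p ℚ.*_) e ⟩
    inv p ℚ.* (p ℚ.* r)   ≡⟨ lem r ⟩
    r                     ∎
    where
    open ≡-Reasoning
    lem : ∀ q → inv p ℚ.* (p ℚ.* q) ≡ q
    lem q = trans (solve 3 (λ i p q → i :* (p :* q) := (p :* i) :* q) refl (inv p) p q)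
           (trans (cong (ℚ._* q) (inv-inverse p p≢0)) (ℚ.*-identityˡ q))

  inv≢0 : ∀ p → p ≢ 0ℚ → inv p ≢ 0ℚ
  inv≢0 p p≢0 e with trans (sym (inv-inverse p p≢0)) (trans (cong (p ℚ.*_) e) (ℚ.*-zeroʳ p))
  ... | ()

  inv-unique : ∀ p q → p ℚ.* q ≡ 1ℚ → inv p ≡ q
  inv-unique p q e = *-cancelˡ p (inv p) q p≢0 (trans (inv-inverse p p≢0) (sym e))
    where
    p≢0 : p ≢ 0ℚ
    p≢0 refl with trans (sym e) (ℚ.*-zeroˡ q)
    ... | ()

  inv-* : ∀ p q → p ≢ 0ℚ → q ≢ 0ℚ → inv (p ℚ.* q) ≡ inv p ℚ.* inv q
  inv-* p q p≢0 q≢0 = inv-unique (p ℚ.* q) (inv p ℚ.* inv q) (trans (solve 4 (λ p q i j → (p :* q) :* (i :* j) := (p :* i) :* (q :* j)) refl p q (inv p) (inv q))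
    (cong₂ ℚ._*_ (inv-inverse p p≢0) (inv-inverse q q≢0)))

  -- The double factorial (2n-1)!!, which plays for the symbols [x]_n with odd x the role of the
  -- factorial for (x)_n.
  oddf : ℕ → ℕ
  oddf zero    = 1
  oddf (suc n) = suc (2 * n) * oddf n

  instance
    oddf-nonZero : ∀ {n} → NonZero (oddf n)
    oddf-nonZero {zero}  = _
    oddf-nonZero {suc n} = ℕ.m*n≢0 (suc (2 * n)) (oddf n) {{_}} {{oddf-nonZero {n}}}

  -- An affine form: coefficients of the variables, and the constant.
  Form : Set
  Form = List ℕ × ℕ

  -- The clauses are arranged so that ⟪ 0 ∷ 1 ∷ [] , k ⟫ (x ∷ y ∷ ρ) reduces to k + y.
  mul : ℕ → ℕ → ℕ
  mul zero    v = v
  mul (suc c) v = v + mul c v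

  dot : List ℕ → List ℕ → ℕ
  dot []           _        = 0
  dot (_ ∷ _)      []       = 0
  dot (zero ∷ cs)  (v ∷ vs) = dot cs vs
  dot (suc c ∷ cs) (v ∷ vs) = dot cs vs + mul c v

  mul≡ : ∀ c v → mul c v ≡ suc c * v
  mul≡ zero    v = sym (ℕ.+-identityʳ v)
  mul≡ (suc c) v = cong (λ n → v + n) (mul≡ c v)

  dot-∷ : ∀ c cs v vs → dot (c ∷ cs) (v ∷ vs) ≡ c * v + dot cs vs
  dot-∷ zero    cs v vs = refl
  dot-∷ (suc c) cs v vs = trans (cong (λ n → dot cs vs + n) (mul≡ c v)) (ℕ.+-comm (dot cs vs) (suc c * v))

  ⟪_⟫ : Form → List ℕ → ℕ
  ⟪ cs , k ⟫ ρ = k + dot cs ρ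

  -- lin f denotes 1 + f.
  data Atom : Set where
    fac odd lin p2 : Form → Atom

  evalA : Atom → List ℕ → ℕ
  evalA (fac f) ρ = (⟪ f ⟫ ρ) !
  evalA (odd f) ρ = oddf (⟪ f ⟫ ρ)
  evalA (lin f) ρ = suc (⟪ f ⟫ ρ)
  evalA (p2 f)  ρ = 2 ^ ⟪ f ⟫ ρ

  evalA-nonZero : ∀ a ρ → NonZero (evalA a ρ)
  evalA-nonZero (fac f) ρ = (⟪ f ⟫ ρ) ℕ.!≢0
  evalA-nonZero (odd f) ρ = oddf-nonZero {⟪ f ⟫ ρ}
  evalA-nonZero (lin f) ρ = _
  evalA-nonZero (p2 f)  ρ = ℕ.m^n≢0 2 (⟪ f ⟫ ρ)

  data Signed : Set where
    ↑ ↓ : Atom → Signed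

  Mono : Set
  Mono = List Signed

  evalS : Signed → List ℕ → ℚ
  evalS (↑ a) ρ = ι (evalA a ρ)
  evalS (↓ a) ρ = inv (ι (evalA a ρ))

  eval : Mono → List ℕ → ℚ
  eval []      ρ = 1ℚ
  eval (s ∷ m) ρ = evalS s ρ ℚ.* eval m ρ

  ιA≢0 : ∀ a ρ → ι (evalA a ρ) ≢ 0ℚ
  ιA≢0 a ρ = ι≢0 (evalA a ρ) {{evalA-nonZero a ρ}}

  evalS≢0 : ∀ s ρ → evalS s ρ ≢ 0ℚ
  evalS≢0 (↑ a) ρ = ιA≢0 a ρ
  evalS≢0 (↓ a) ρ = inv≢0 (ι (evalA a ρ)) (ιA≢0 a ρ)

  1≢0 : 1ℚ ≢ 0ℚ
  1≢0 ()

  eval≢0 : ∀ m ρ → eval m ρ ≢ 0ℚ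
  eval≢0 []      ρ = 1≢0
  eval≢0 (s ∷ m) ρ = *≢0 (evalS s ρ) (eval m ρ) (evalS≢0 s ρ) (eval≢0 m ρ)

  eval-++ : ∀ m n ρ → eval (m ++ n) ρ ≡ eval m ρ ℚ.* eval n ρ
  eval-++ []      n ρ = sym (ℚ.*-identityˡ (eval n ρ))
  eval-++ (s ∷ m) n ρ = trans (cong (evalS s ρ ℚ.*_) (eval-++ m n ρ)) (sym (ℚ.*-assoc (evalS s ρ) (eval m ρ) (eval n ρ)))

  opp : Signed → Signed
  opp (↑ a) = ↓ a
  opp (↓ a) = ↑ a

  opp-inverse : ∀ s ρ → evalS s ρ ℚ.* evalS (opp s) ρ ≡ 1ℚ
  opp-inverse (↑ a) ρ = inv-inverse (ι (evalA a ρ)) (ιA≢0 a ρ)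
  opp-inverse (↓ a) ρ = trans (ℚ.*-comm (inv (ι (evalA a ρ))) (ι (evalA a ρ))) (inv-inverse (ι (evalA a ρ)) (ιA≢0 a ρ))

  flip : Mono → Mono
  flip = map opp

  flip-inverse : ∀ m ρ → eval m ρ ℚ.* eval (flip m) ρ ≡ 1ℚ
  flip-inverse []      ρ = refl
  flip-inverse (s ∷ m) ρ = trans (solve 4 (λ s m s′ m′ → (s :* m) :* (s′ :* m′) := (s :* s′) :* (m :* m′)) refl
      (evalS s ρ) (eval m ρ) (evalS (opp s) ρ) (eval (flip m) ρ))
    (cong₂ ℚ._*_ (opp-inverse s ρ) (flip-inverse m ρ))

  inv-eval : ∀ m ρ → inv (eval m ρ) ≡ eval (flip m) ρ
  inv-eval m ρ = inv-unique (eval m ρ) (eval (flip m) ρ) (flip-inverse m ρ)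

  prodA : List Atom → List ℕ → ℕ
  prodA []       ρ = 1
  prodA (a ∷ as) ρ = evalA a ρ * prodA as ρ

  prodA-++ : ∀ as bs ρ → prodA (as ++ bs) ρ ≡ prodA as ρ * prodA bs ρ
  prodA-++ []       bs ρ = sym (ℕ.+-identityʳ (prodA bs ρ))
  prodA-++ (a ∷ as) bs ρ = trans (cong (evalA a ρ *_) (prodA-++ as bs ρ)) (sym (ℕ.*-assoc (evalA a ρ) (prodA as ρ) (prodA bs ρ)))

  half? : ℕ → Maybe ℕ
  half? zero          = just 0
  half? (suc zero)    = nothing
  half? (suc (suc n)) with half? n
  ... | just h  = just (suc h)
  ... | nothing = nothing

  halves? : List ℕ → Maybe (List ℕ)
  halves? []       = just []
  halves? (c ∷ cs) with half? c | halves? cs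
  ... | just h | just hs = just (h ∷ hs)
  ... | _      | _       = nothing

  half-sound : ∀ n h → half? n ≡ just h → n ≡ 2 * h
  half-sound zero          .0 refl = refl
  half-sound (suc (suc n)) h e with half? n in q
  half-sound (suc (suc n)) .(suc h) refl | just h = trans (cong (λ n → 2 + n) (half-sound n h q)) (sym (ℕ.*-suc 2 h))

  halves-sound : ∀ cs hs ρ → halves? cs ≡ just hs → dot cs ρ ≡ 2 * dot hs ρ
  halves-sound []       .[] ρ refl = refl
  halves-sound (c ∷ cs) hs ρ e with half? c in q | halves? cs in q′
  halves-sound (c ∷ cs) .(h ∷ hs) []      refl | just h | just hs = refl
  halves-sound (c ∷ cs) .(h ∷ hs) (v ∷ ρ) refl | just h | just hs = trans (dot-∷ c cs v ρ)
    (trans (cong₂ (λ m n → m * v + n) (half-sound c h q) (halves-sound cs hs ρ q′))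
      (trans (Arith.half-dot h v (dot hs ρ)) (cong (2 *_) (sym (dot-∷ h hs v ρ)))))

  allZero : List ℕ → Bool
  allZero []           = true
  allZero (zero ∷ cs)  = allZero cs
  allZero (suc _ ∷ cs) = false

  allZero-sound : ∀ cs ρ → allZero cs ≡ true → dot cs ρ ≡ 0
  allZero-sound []          ρ       e = refl
  allZero-sound (zero ∷ cs) []      e = refl
  allZero-sound (zero ∷ cs) (v ∷ ρ) e = allZero-sound cs ρ e

  two : Atom
  two = lin ([] , 1)

  -- Factors 2 are split off as long as 1 + f is visibly even, so that proportional linear factors
  -- acquire a common normal form. The fuel bounds the number of halvings.
  linE : ℕ → Form → List Atom
  linE zero       f            = lin f ∷ []
  linE (suc fuel) (cs , zero)  = if allZero cs then [] else lin (cs , zero) ∷ []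
  linE (suc fuel) (cs , suc k) with half? k | halves? cs
  ... | just h | just hs = two ∷ linE fuel (hs , h)
  ... | _      | _       = lin (cs , suc k) ∷ []

  linE-sound : ∀ fuel f ρ → prodA (linE fuel f) ρ ≡ suc (⟪ f ⟫ ρ)
  linE-sound zero       f            ρ = ℕ.*-identityʳ _
  linE-sound (suc fuel) (cs , zero)  ρ with allZero cs in e
  ... | true  = cong suc (sym (allZero-sound cs ρ e))
  ... | false = ℕ.*-identityʳ _
  linE-sound (suc fuel) (cs , suc k) ρ with half? k in q | halves? cs in r
  ... | nothing | _       = ℕ.*-identityʳ _
  ... | just h  | nothing = ℕ.*-identityʳ _
  ... | just h  | just hs = trans (cong (2 *_) (linE-sound fuel (hs , h) ρ))
    (sym (trans (cong₂ (λ m n → 2 + (m + n)) (half-sound k h q) (halves-sound cs hs ρ r))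
          (Arith.half-lin h (dot hs ρ))))

  -- Normal form of a factorial: the constant of its argument is peeled off as linear factors, so
  -- that factorials whose arguments differ by a constant share the factorial of one homogeneous
  -- form.
  facE : List ℕ → ℕ → List Atom
  facE cs zero    = if allZero cs then [] else fac (cs , 0) ∷ []
  facE cs (suc k) = linE 9 (cs , k) ++ facE cs k

  facE-sound : ∀ cs k ρ → prodA (facE cs k) ρ ≡ (k + dot cs ρ) !
  facE-sound cs zero ρ with allZero cs in e
  ... | true  = cong _! (sym (allZero-sound cs ρ e))
  ... | false = ℕ.*-identityʳ _
  facE-sound cs (suc k) ρ = trans (prodA-++ (linE 9 (cs , k)) (facE cs k) ρ)
    (cong₂ _*_ (linE-sound 9 (cs , k) ρ) (facE-sound cs k ρ))

  scale : ℕ → List ℕ → List ℕ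
  scale c = map (c *_)

  dot-scale : ∀ c cs ρ → dot (scale c cs) ρ ≡ c * dot cs ρ
  dot-scale c []       ρ       = sym (ℕ.*-zeroʳ c)
  dot-scale c (d ∷ cs) []      = sym (ℕ.*-zeroʳ c)
  dot-scale c (d ∷ cs) (v ∷ ρ) = trans (dot-∷ (c * d) (scale c cs) v ρ) (trans (cong (λ n → c * d * v + n) (dot-scale c cs ρ))
    (trans (Arith.scale-dot c d v (dot cs ρ))
      (cong (c *_) (sym (dot-∷ d cs v ρ)))))

  oddE : List ℕ → ℕ → List Atom
  oddE cs zero    = if allZero cs then [] else odd (cs , 0) ∷ []
  oddE cs (suc k) = linE 9 (scale 2 cs , 2 * k) ++ oddE cs k

  oddE-sound : ∀ cs k ρ → prodA (oddE cs k) ρ ≡ oddf (k + dot cs ρ)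
  oddE-sound cs zero ρ with allZero cs in e
  ... | true  = cong oddf (sym (allZero-sound cs ρ e))
  ... | false = ℕ.*-identityʳ _
  oddE-sound cs (suc k) ρ = trans (prodA-++ (linE 9 (scale 2 cs , 2 * k)) (oddE cs k) ρ)
    (cong₂ _*_ (trans (linE-sound 9 (scale 2 cs , 2 * k) ρ) (cong suc (trans (cong (λ n → 2 * k + n) (dot-scale 2 cs ρ)) (sym (ℕ.*-distribˡ-+ 2 k (dot cs ρ))))))
               (oddE-sound cs k ρ))

  unit : ℕ → List ℕ
  unit zero    = 1 ∷ []
  unit (suc n) = 0 ∷ unit n

  rep : {A : Set} → ℕ → A → List A → List A
  rep zero    a as = as
  rep (suc n) a as = a ∷ rep n a as

  prodA-rep : ∀ n a as ρ → prodA (rep n a as) ρ ≡ evalA a ρ ^ n * prodA as ρ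
  prodA-rep zero    a as ρ = sym (ℕ.+-identityʳ (prodA as ρ))
  prodA-rep (suc n) a as ρ = trans (cong (evalA a ρ *_) (prodA-rep n a as ρ)) (sym (ℕ.*-assoc (evalA a ρ) _ _))

  from : ℕ → List ℕ → List ℕ
  from zero    ρ       = ρ
  from (suc n) []      = []
  from (suc n) (_ ∷ ρ) = from n ρ

  head₀ : List ℕ → ℕ
  head₀ []      = 0
  head₀ (v ∷ _) = v

  dot-unit : ∀ n ρ → dot (unit n) ρ ≡ head₀ (from n ρ)
  dot-unit zero    []      = refl
  dot-unit zero    (v ∷ ρ) = refl
  dot-unit (suc n) []      = refl
  dot-unit (suc n) (v ∷ ρ) = dot-unit n ρ

  dot-from : ∀ c cs n ρ → dot (c ∷ cs) (from n ρ) ≡ c * head₀ (from n ρ) + dot cs (from (suc n) ρ)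
  dot-from c cs zero    []      = sym (trans (cong (λ n → n + dot cs []) (ℕ.*-zeroʳ c)) (dot-[] cs))
    where
    dot-[] : ∀ cs → dot cs [] ≡ 0
    dot-[] []      = refl
    dot-[] (_ ∷ _) = refl
  dot-from c cs zero    (v ∷ ρ) = dot-∷ c cs v ρ
  dot-from c cs (suc n) []      = sym (trans (cong (λ n → n + dot cs []) (ℕ.*-zeroʳ c)) (dot-[] cs))
    where
    dot-[] : ∀ cs → dot cs [] ≡ 0
    dot-[] []      = refl
    dot-[] (_ ∷ _) = refl
  dot-from c cs (suc n) (v ∷ ρ) = dot-from c cs n ρ

  p2cs : ℕ → List ℕ → List Atom
  p2cs n []       = []
  p2cs n (c ∷ cs) = rep c (p2 (unit n , 0)) (p2cs (suc n) cs)

  p2cs-sound : ∀ n cs ρ → prodA (p2cs n cs) ρ ≡ 2 ^ dot cs (from n ρ)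
  p2cs-sound n []       ρ = refl
  p2cs-sound n (c ∷ cs) ρ = trans (prodA-rep c (p2 (unit n , 0)) (p2cs (suc n) cs) ρ) (trans
    (cong₂ _*_ (trans (cong (λ v → (2 ^ v) ^ c) (dot-unit n ρ)) (trans (ℕ.^-*-assoc 2 (head₀ (from n ρ)) c) (cong (2 ^_) (ℕ.*-comm _ c))))
               (p2cs-sound (suc n) cs ρ))
    (trans (sym (ℕ.^-distribˡ-+-* 2 (c * head₀ (from n ρ)) (dot cs (from (suc n) ρ)))) (cong (2 ^_) (sym (dot-from c cs n ρ)))))

  expA : Atom → List Atom
  expA (fac (cs , k)) = facE cs k
  expA (odd (cs , k)) = oddE cs k
  expA (lin f)        = linE 9 f
  expA (p2 (cs , k))  = rep k two (p2cs 0 cs)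

  expA-sound : ∀ a ρ → prodA (expA a) ρ ≡ evalA a ρ
  expA-sound (fac (cs , k)) ρ = facE-sound cs k ρ
  expA-sound (odd (cs , k)) ρ = oddE-sound cs k ρ
  expA-sound (lin f)        ρ = linE-sound 9 f ρ
  expA-sound (p2 (cs , k))  ρ = trans (prodA-rep k two (p2cs 0 cs) ρ) (trans (cong (2 ^ k *_) (p2cs-sound 0 cs ρ))
    (sym (ℕ.^-distribˡ-+-* 2 k (dot cs ρ))))

  eval-↑ : ∀ as ρ → eval (map ↑ as) ρ ≡ ι (prodA as ρ)
  eval-↑ []       ρ = sym ι-1
  eval-↑ (a ∷ as) ρ = trans (cong (ι (evalA a ρ) ℚ.*_) (eval-↑ as ρ)) (sym (ι-* (evalA a ρ) (prodA as ρ)))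

  flip-↑ : ∀ as → flip (map ↑ as) ≡ map ↓ as
  flip-↑ []       = refl
  flip-↑ (a ∷ as) = cong (↓ a ∷_) (flip-↑ as)

  expS : Signed → Mono
  expS (↑ a) = map ↑ (expA a)
  expS (↓ a) = map ↓ (expA a)

  expS-sound : ∀ s ρ → eval (expS s) ρ ≡ evalS s ρ
  expS-sound (↑ a) ρ = trans (eval-↑ (expA a) ρ) (cong ι (expA-sound a ρ))
  expS-sound (↓ a) ρ = trans (cong (λ m → eval m ρ) (sym (flip-↑ (expA a)))) (trans (sym (inv-eval (map ↑ (expA a)) ρ))
    (cong inv (trans (eval-↑ (expA a) ρ) (cong ι (expA-sound a ρ)))))

  expand : Mono → Mono
  expand []      = []
  expand (s ∷ m) = expS s ++ expand m

  expand-sound : ∀ m ρ → eval (expand m) ρ ≡ eval m ρ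
  expand-sound []      ρ = refl
  expand-sound (s ∷ m) ρ = trans (eval-++ (expS s) (expand m) ρ) (cong₂ ℚ._*_ (expS-sound s ρ) (expand-sound m ρ))

  eqCs : List ℕ → List ℕ → Bool
  eqCs []       ds       = allZero ds
  eqCs (c ∷ cs) []       = allZero (c ∷ cs)
  eqCs (c ∷ cs) (d ∷ ds) = (c ≡ᵇ d) ∧ eqCs cs ds

  ∧-split : ∀ {b c} → b ∧ c ≡ true → b ≡ true × c ≡ true
  ∧-split {true} e = refl , e

  ≡ᵇ-sound : ∀ {m n} → (m ≡ᵇ n) ≡ true → m ≡ n
  ≡ᵇ-sound {zero}  {zero}  e = refl
  ≡ᵇ-sound {suc m} {suc n} e = cong suc (≡ᵇ-sound {m} {n} e)

  eqCs-sound : ∀ cs ds ρ → eqCs cs ds ≡ true → dot cs ρ ≡ dot ds ρ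
  eqCs-sound []       ds       ρ       e = sym (allZero-sound ds ρ e)
  eqCs-sound (c ∷ cs) []       ρ       e = allZero-sound (c ∷ cs) ρ e
  eqCs-sound (c ∷ cs) (d ∷ ds) []      e = refl
  eqCs-sound (c ∷ cs) (d ∷ ds) (v ∷ ρ) e with (p , q) ← ∧-split {c ≡ᵇ d} e = trans (dot-∷ c cs v ρ)
    (trans (cong₂ (λ m n → m * v + n) (≡ᵇ-sound {c} {d} p) (eqCs-sound cs ds ρ q)) (sym (dot-∷ d ds v ρ)))

  eqF : Form → Form → Bool
  eqF (cs , k) (ds , l) = (k ≡ᵇ l) ∧ eqCs cs ds

  eqF-sound : ∀ f g ρ → eqF f g ≡ true → ⟪ f ⟫ ρ ≡ ⟪ g ⟫ ρ
  eqF-sound (cs , k) (ds , l) ρ e with (p , q) ← ∧-split {k ≡ᵇ l} e = cong₂ _+_ (≡ᵇ-sound {k} {l} p) (eqCs-sound cs ds ρ q)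

  eqS : Signed → Signed → Bool
  eqS (↑ (fac f)) (↑ (fac g)) = eqF f g
  eqS (↑ (odd f)) (↑ (odd g)) = eqF f g
  eqS (↑ (lin f)) (↑ (lin g)) = eqF f g
  eqS (↑ (p2 f))  (↑ (p2 g))  = eqF f g
  eqS (↓ (fac f)) (↓ (fac g)) = eqF f g
  eqS (↓ (odd f)) (↓ (odd g)) = eqF f g
  eqS (↓ (lin f)) (↓ (lin g)) = eqF f g
  eqS (↓ (p2 f))  (↓ (p2 g))  = eqF f g
  eqS _           _           = false

  eqS-sound : ∀ s t ρ → eqS s t ≡ true → evalS s ρ ≡ evalS t ρ
  eqS-sound (↑ (fac f)) (↑ (fac g)) ρ e = cong (λ n → ι (n !)) (eqF-sound f g ρ e)
  eqS-sound (↑ (odd f)) (↑ (odd g)) ρ e = cong (λ n → ι (oddf n)) (eqF-sound f g ρ e)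
  eqS-sound (↑ (lin f)) (↑ (lin g)) ρ e = cong (λ n → ι (suc n)) (eqF-sound f g ρ e)
  eqS-sound (↑ (p2 f))  (↑ (p2 g))  ρ e = cong (λ n → ι (2 ^ n)) (eqF-sound f g ρ e)
  eqS-sound (↓ (fac f)) (↓ (fac g)) ρ e = cong (λ n → inv (ι (n !))) (eqF-sound f g ρ e)
  eqS-sound (↓ (odd f)) (↓ (odd g)) ρ e = cong (λ n → inv (ι (oddf n))) (eqF-sound f g ρ e)
  eqS-sound (↓ (lin f)) (↓ (lin g)) ρ e = cong (λ n → inv (ι (suc n))) (eqF-sound f g ρ e)
  eqS-sound (↓ (p2 f))  (↓ (p2 g))  ρ e = cong (λ n → inv (ι (2 ^ n))) (eqF-sound f g ρ e)

  remove : Signed → Mono → Maybe Mono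
  remove s []      = nothing
  remove s (t ∷ m) = if eqS s t then just m else again (remove s m)
    where
    again : Maybe Mono → Maybe Mono
    again (just m′) = just (t ∷ m′)
    again nothing   = nothing

  remove-sound : ∀ s m m′ ρ → remove s m ≡ just m′ → eval m ρ ≡ evalS s ρ ℚ.* eval m′ ρ
  remove-sound s (t ∷ m) m′ ρ e with eqS s t in q
  remove-sound s (t ∷ m) .m ρ refl | true = cong (ℚ._* eval m ρ) (sym (eqS-sound s t ρ q))
  ... | false with remove s m in r
  remove-sound s (t ∷ m) .(t ∷ m′) ρ refl | false | just m′ = trans (cong (evalS t ρ ℚ.*_) (remove-sound s m m′ ρ r))
    (solve 3 (λ t s m → t :* (s :* m) := s :* (t :* m)) refl (evalS t ρ) (evalS s ρ) (eval m′ ρ))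

  push : Signed → Mono → Mono
  push s m with remove (opp s) m
  ... | just m′ = m′
  ... | nothing = s ∷ m

  push-sound : ∀ s m ρ → eval (push s m) ρ ≡ evalS s ρ ℚ.* eval m ρ
  push-sound s m ρ with remove (opp s) m in r
  ... | nothing = refl
  ... | just m′ = sym (trans (cong (evalS s ρ ℚ.*_) (remove-sound (opp s) m m′ ρ r))
    (trans (solve 3 (λ s t m → s :* (t :* m) := (s :* t) :* m) refl (evalS s ρ) (evalS (opp s) ρ) (eval m′ ρ))
      (trans (cong (ℚ._* eval m′ ρ) (opp-inverse s ρ)) (ℚ.*-identityˡ (eval m′ ρ)))))

  cancel : Mono → Mono
  cancel []      = []
  cancel (s ∷ m) = push s (cancel m)

  cancel-sound : ∀ m ρ → eval (cancel m) ρ ≡ eval m ρ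
  cancel-sound []      ρ = refl
  cancel-sound (s ∷ m) ρ = trans (push-sound s (cancel m) ρ) (cong (evalS s ρ ℚ.*_) (cancel-sound m ρ))

  residue : Mono → Mono → Mono
  residue m n = cancel (expand (m ++ flip n))

  -- For concrete `m` and `n` the hypothesis is proved by `refl`: conversion normalises all factors
  -- and cancels them in pairs, uniformly in the values `ρ`. All hypergeometric identities below are
  -- reduced to this.
  mono : ∀ m n ρ → residue m n ≡ [] → eval m ρ ≡ eval n ρ
  mono m n ρ e = begin
    eval m ρ                                                ≡⟨ ℚ.*-identityʳ (eval m ρ) ⟨
    eval m ρ ℚ.* 1ℚ                                         ≡⟨ cong (eval m ρ ℚ.*_) (flip-inverse n ρ) ⟨
    eval m ρ ℚ.* (eval n ρ ℚ.* eval (flip n) ρ)             ≡⟨ solve 3 (λ m n f → m :* (n :* f) := (m :* f) :* n) refl (eval m ρ) (eval n ρ) (eval (flip n) ρ) ⟩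
    (eval m ρ ℚ.* eval (flip n) ρ) ℚ.* eval n ρ             ≡⟨ cong (ℚ._* eval n ρ) (eval-++ m (flip n) ρ) ⟨
    eval (m ++ flip n) ρ ℚ.* eval n ρ                       ≡⟨ cong (ℚ._* eval n ρ) (trans (sym (expand-sound (m ++ flip n) ρ)) (sym (cancel-sound (expand (m ++ flip n)) ρ))) ⟩
    eval (residue m n) ρ ℚ.* eval n ρ                       ≡⟨ cong (λ r → eval r ρ ℚ.* eval n ρ) e ⟩
    1ℚ ℚ.* eval n ρ                                         ≡⟨ ℚ.*-identityˡ (eval n ρ) ⟩
    eval n ρ                                                ∎
    where open ≡-Reasoning

  addC : List ℕ → List ℕ → List ℕ
  addC []       ds       = ds
  addC (c ∷ cs) []       = c ∷ cs
  addC (c ∷ cs) (d ∷ ds) = c + d ∷ addC cs ds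

  dot-addC : ∀ cs ds ρ → dot (addC cs ds) ρ ≡ dot cs ρ + dot ds ρ
  dot-addC []       ds       ρ       = refl
  dot-addC (c ∷ cs) []       ρ       = sym (ℕ.+-identityʳ _)
  dot-addC (c ∷ cs) (d ∷ ds) []      = refl
  dot-addC (c ∷ cs) (d ∷ ds) (v ∷ ρ) = trans (dot-∷ (c + d) (addC cs ds) v ρ) (trans (cong (λ n → (c + d) * v + n) (dot-addC cs ds ρ))
    (trans (Arith.add-dot c d v (dot cs ρ) (dot ds ρ))
      (sym (cong₂ _+_ (dot-∷ c cs v ρ) (dot-∷ d ds v ρ)))))

  infixl 6 _⊕_
  infixr 7 _⊛_

  _⊕_ : Form → Form → Form
  (cs , k) ⊕ (ds , l) = addC cs ds , k + l

  _⊛_ : ℕ → Form → Form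
  c ⊛ (cs , k) = scale c cs , c * k

  ⟪⊕⟫ : ∀ f g ρ → ⟪ f ⊕ g ⟫ ρ ≡ ⟪ f ⟫ ρ + ⟪ g ⟫ ρ
  ⟪⊕⟫ (cs , k) (ds , l) ρ = trans (cong (λ n → k + l + n) (dot-addC cs ds ρ))
    (Arith.+-interchange k l (dot cs ρ) (dot ds ρ))

  ⟪⊛⟫ : ∀ c f ρ → ⟪ c ⊛ f ⟫ ρ ≡ c * ⟪ f ⟫ ρ
  ⟪⊛⟫ c (cs , k) ρ = trans (cong (λ n → c * k + n) (dot-scale c cs ρ)) (sym (ℕ.*-distribˡ-+ c k (dot cs ρ)))

  comb : List ℕ → List Form → Form
  comb []       _        = [] , 0
  comb (_ ∷ _)  []       = [] , 0
  comb (c ∷ cs) (g ∷ gs) = (c ⊛ g) ⊕ comb cs gs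

  comb-sound : ∀ cs σ ρ → ⟪ comb cs σ ⟫ ρ ≡ dot cs (map (λ g → ⟪ g ⟫ ρ) σ)
  comb-sound []       σ        ρ = refl
  comb-sound (c ∷ cs) []       ρ = refl
  comb-sound (c ∷ cs) (g ∷ gs) ρ = trans (⟪⊕⟫ (c ⊛ g) (comb cs gs) ρ) (trans (cong₂ _+_ (⟪⊛⟫ c g ρ) (comb-sound cs gs ρ))
    (sym (dot-∷ c cs (⟪ g ⟫ ρ) (map (λ g → ⟪ g ⟫ ρ) gs))))

  subF : List Form → Form → Form
  subF σ (cs , k) = ([] , k) ⊕ comb cs σ

  subF-sound : ∀ σ f ρ → ⟪ subF σ f ⟫ ρ ≡ ⟪ f ⟫ (map (λ g → ⟪ g ⟫ ρ) σ)
  subF-sound σ (cs , k) ρ = trans (⟪⊕⟫ ([] , k) (comb cs σ) ρ) (cong₂ _+_ (ℕ.+-identityʳ k) (comb-sound cs σ ρ))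

  subA : List Form → Atom → Atom
  subA σ (fac f) = fac (subF σ f)
  subA σ (odd f) = odd (subF σ f)
  subA σ (lin f) = lin (subF σ f)
  subA σ (p2 f)  = p2 (subF σ f)

  subA-sound : ∀ σ a ρ → evalA (subA σ a) ρ ≡ evalA a (map (λ g → ⟪ g ⟫ ρ) σ)
  subA-sound σ (fac f) ρ = cong _! (subF-sound σ f ρ)
  subA-sound σ (odd f) ρ = cong oddf (subF-sound σ f ρ)
  subA-sound σ (lin f) ρ = cong suc (subF-sound σ f ρ)
  subA-sound σ (p2 f)  ρ = cong (2 ^_) (subF-sound σ f ρ)

  sub : List Form → Mono → Mono
  sub σ []        = []
  sub σ (↑ a ∷ m) = ↑ (subA σ a) ∷ sub σ m
  sub σ (↓ a ∷ m) = ↓ (subA σ a) ∷ sub σ m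

  -- A shift of the variables, such as z to z+1, is a substitution by affine forms; this brings
  -- factors taken at shifted arguments to one list of values before `mono` is applied.
  eval-sub : ∀ m σ ρ → eval m (map (λ g → ⟪ g ⟫ ρ) σ) ≡ eval (sub σ m) ρ
  eval-sub []        σ ρ = refl
  eval-sub (↑ a ∷ m) σ ρ = cong₂ (λ n e → ι n ℚ.* e) (sym (subA-sound σ a ρ)) (eval-sub m σ ρ)
  eval-sub (↓ a ∷ m) σ ρ = cong₂ (λ n e → inv (ι n) ℚ.* e) (sym (subA-sound σ a ρ)) (eval-sub m σ ρ)

-- Dodgson condensation and the Andrews-Burge determinant.

module Condensation where

  open Determinant
  open Monomial
  open import Data.List.Membership.Propositional using (_∈_)
  open import Data.List.Membership.Propositional.Properties using (∈-++⁻; ∈-map⁻; ∈-downFrom⁻)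
  open import Data.List.Relation.Unary.Any using (here; there)

  module CondensationArith where
    open ℕSolver

    2+2 : ∀ X i → X + (suc i + suc i) ≡ suc (suc (X + (i + i)))
    2+2 = solve 2 (λ X i → X :+ (con 1 :+ i :+ (con 1 :+ i)) := con 2 :+ (X :+ (i :+ i))) refl

    sum↘ : ∀ X Y i j → X + Y + suc i + suc j ∸ 1 ≡ suc X + suc Y + i + j ∸ 1
    sum↘ X Y i j = cong (_∸ 1) (solve 4 (λ X Y i j → X :+ Y :+ (con 1 :+ i) :+ (con 1 :+ j) := con 1 :+ X :+ (con 1 :+ Y) :+ i :+ j) refl X Y i j)

    sum↓ : ∀ X Y i j → X + suc Y + suc i + j ∸ 1 ≡ suc (suc X) + Y + i + j ∸ 1
    sum↓ X Y i j = cong (_∸ 1) (solve 4 (λ X Y i j → X :+ (con 1 :+ Y) :+ (con 1 :+ i) :+ j := con 2 :+ X :+ Y :+ i :+ j) refl X Y i j)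

    sum→ : ∀ X Y i j → suc X + Y + i + suc j ∸ 1 ≡ X + suc (suc Y) + i + j ∸ 1
    sum→ X Y i j = cong (_∸ 1) (solve 4 (λ X Y i j → con 1 :+ X :+ Y :+ i :+ (con 1 :+ j) := X :+ (con 2 :+ Y) :+ i :+ j) refl X Y i j)

    polynomial : ∀ X Y m → let W = suc (Y + X) in
      (2 + (m + W)) * ((2 + (m + m + suc X)) * ((2 + (m + m + suc Y)) * 1))
      ≡ (1 + m) * ((3 + (m + m + W + suc X)) * ((3 + (m + m + W + suc Y)) * 1)) + (1 + X) * ((1 + Y) * ((2 + (Y + X)) * 1))
    polynomial = solve 3 (λ X Y m → let W = con 1 :+ (Y :+ X) in
      (con 2 :+ (m :+ W)) :* ((con 2 :+ (m :+ m :+ (con 1 :+ X))) :* ((con 2 :+ (m :+ m :+ (con 1 :+ Y))) :* con 1))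
      := (con 1 :+ m) :* ((con 3 :+ (m :+ m :+ W :+ (con 1 :+ X))) :* ((con 3 :+ (m :+ m :+ W :+ (con 1 :+ Y))) :* con 1))
         :+ (con 1 :+ X) :* ((con 1 :+ Y) :* ((con 2 :+ (Y :+ X)) :* con 1))) refl

    polynomial-X0 : ∀ Y m →
      (2 + (m + Y)) * ((2 + (m + m + 0)) * ((2 + (m + m + suc Y)) * 1)) ≡ (1 + m) * ((3 + (m + m + Y + 0)) * ((3 + (m + m + Y + suc Y)) * 1))
    polynomial-X0 = solve 2 (λ Y m →
      (con 2 :+ (m :+ Y)) :* ((con 2 :+ (m :+ m :+ con 0)) :* ((con 2 :+ (m :+ m :+ (con 1 :+ Y))) :* con 1))
      := (con 1 :+ m) :* ((con 3 :+ (m :+ m :+ Y :+ con 0)) :* ((con 3 :+ (m :+ m :+ Y :+ (con 1 :+ Y))) :* con 1))) refl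

    polynomial-Y0 : ∀ X m →
      (2 + (m + X)) * ((2 + (m + m + suc X)) * ((2 + (m + m + 0)) * 1)) ≡ (1 + m) * ((3 + (m + m + X + suc X)) * ((3 + (m + m + X + 0)) * 1))
    polynomial-Y0 = solve 2 (λ X m →
      (con 2 :+ (m :+ X)) :* ((con 2 :+ (m :+ m :+ (con 1 :+ X))) :* ((con 2 :+ (m :+ m :+ con 0)) :* con 1))
      := (con 1 :+ m) :* ((con 3 :+ (m :+ m :+ X :+ (con 1 :+ X))) :* ((con 3 :+ (m :+ m :+ X :+ con 0)) :* con 1))) refl

    sum : ∀ X Y → suc (suc (suc (Y + X))) ≡ X + suc (suc (suc Y))
    sum = solve 2 (λ X Y → con 3 :+ (Y :+ X) := X :+ (con 3 :+ Y)) refl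

  open CondensationArith
  open ℚSolver using (solve; _:+_; _:*_; _:-_; :-_; _:=_; con)
  open ≡-Reasoning

  e[_] : ℕ → ℕ → ℚ
  e[ c ] b = if b ≡ᵇ c then 1ℚ else 0ℚ

  e-on : ∀ c → e[ c ] c ≡ 1ℚ
  e-on zero    = refl
  e-on (suc c) = e-on c

  e-off : ∀ c b → b ≢ c → e[ c ] b ≡ 0ℚ
  e-off zero    zero    ne = ⊥-elim (ne refl)
  e-off zero    (suc b) ne = refl
  e-off (suc c) zero    ne = refl
  e-off (suc c) (suc b) ne = e-off c b (λ q → ne (cong suc q))

  E-scale : ∀ {A : Set} (φ : A → ℚ) F α vs → E φ (λ ws → α ℚ.* F ws) vs ≡ α ℚ.* E φ F vs
  E-scale φ F α vs = trans (E-congʳ vs (λ ws → solve 2 (λ a f → a :* f := a :* f :+ con 0ℚ :* f) refl α (F ws)))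
    (trans (E-linʳ φ F F α 0ℚ vs) (solve 2 (λ a e → a :* e :+ con 0ℚ :* e := a :* e) refl α (E φ F vs)))

  det-move-col : ∀ {A B : Set} (m : A → B → ℚ) xs b ys vs →
                 det m (xs ++ b ∷ ys) vs ≡ sgn (length xs) ℚ.* det m (b ∷ xs ++ ys) vs
  det-move-col m []       b ys vs = sym (ℚ.*-identityˡ (det m (b ∷ ys) vs))
  det-move-col m (x ∷ xs) b ys vs = begin
    E (λ a → m a x) (det m (xs ++ b ∷ ys)) vs
      ≡⟨ E-congʳ vs (det-move-col m xs b ys) ⟩
    E (λ a → m a x) (λ ws → sgn (length xs) ℚ.* det m (b ∷ xs ++ ys) ws) vs
      ≡⟨ E-scale _ (det m (b ∷ xs ++ ys)) (sgn (length xs)) vs ⟩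
    sgn (length xs) ℚ.* E (λ a → m a x) (E (λ a → m a b) (det m (xs ++ ys))) vs
      ≡⟨ cong (sgn (length xs) ℚ.*_) (E-anticomm (λ a → m a x) (λ a → m a b) (det m (xs ++ ys)) vs) ⟩
    sgn (length xs) ℚ.* (ℚ.- E (λ a → m a b) (E (λ a → m a x) (det m (xs ++ ys))) vs)
      ≡⟨ solve 2 (λ s d → s :* (:- d) := (:- s) :* d) refl (sgn (length xs)) (det m (b ∷ x ∷ xs ++ ys) vs) ⟩
    (ℚ.- sgn (length xs)) ℚ.* det m (b ∷ x ∷ xs ++ ys) vs ∎

  -- The Plücker relation in which one of the four vectors is the unit vector of
  -- the first column, so that three of the minors lose that column.
  plücker-col : ∀ c cs → (∀ b → b ∈ cs → b ≢ c) → ∀ (v₁ v₂ v₃ : ℕ → ℚ) S →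
    let D = det apply (c ∷ cs); D′ = det apply cs in
    D′ (v₁ ∷ S) ℚ.* D (v₂ ∷ v₃ ∷ S) ℚ.- D′ (v₂ ∷ S) ℚ.* D (v₁ ∷ v₃ ∷ S) ℚ.+ D′ (v₃ ∷ S) ℚ.* D (v₁ ∷ v₂ ∷ S) ≡ 0ℚ
  plücker-col c cs c∉ v₁ v₂ v₃ S = begin
    D′ (v₁ ∷ S) ℚ.* p₁ ℚ.- D′ (v₂ ∷ S) ℚ.* p₂ ℚ.+ D′ (v₃ ∷ S) ℚ.* p₃
      ≡⟨ solve 6 (λ a b c p q r → a :* p :- b :* q :+ c :* r := :- ((:- a) :* p :- (:- b) :* q :+ (:- c) :* r)) refl
           (D′ (v₁ ∷ S)) (D′ (v₂ ∷ S)) (D′ (v₃ ∷ S)) p₁ p₂ p₃ ⟩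
    ℚ.- ((ℚ.- D′ (v₁ ∷ S)) ℚ.* p₁ ℚ.- (ℚ.- D′ (v₂ ∷ S)) ℚ.* p₂ ℚ.+ (ℚ.- D′ (v₃ ∷ S)) ℚ.* p₃)
      ≡⟨ cong ℚ.-_ (cong₂ (λ x y → x ℚ.+ y) (cong₂ (λ x y → x ℚ.* p₁ ℚ.- y ℚ.* p₂) (sym (drop v₁)) (sym (drop v₂)))
           (cong (ℚ._* p₃) (sym (drop v₃)))) ⟩
    ℚ.- (D (v₁ ∷ e[ c ] ∷ S) ℚ.* p₁ ℚ.- D (v₂ ∷ e[ c ] ∷ S) ℚ.* p₂ ℚ.+ D (v₃ ∷ e[ c ] ∷ S) ℚ.* p₃)
      ≡⟨ cong ℚ.-_ (plücker (c ∷ cs) e[ c ] v₁ v₂ v₃ S) ⟩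
    0ℚ ∎
    where
    D D′ : List (ℕ → ℚ) → ℚ
    D  = det apply (c ∷ cs)
    D′ = det apply cs
    p₁ = D (v₂ ∷ v₃ ∷ S)
    p₂ = D (v₁ ∷ v₃ ∷ S)
    p₃ = D (v₁ ∷ v₂ ∷ S)
    drop : ∀ v → D (v ∷ e[ c ] ∷ S) ≡ ℚ.- D′ (v ∷ S)
    drop v = trans (det-alternating apply (c ∷ cs) [] v e[ c ] S)
      (cong ℚ.-_ (det-unit c cs e[ c ] (e-on c) (λ b b∈ → e-off c b (c∉ b b∈)) (v ∷ S)))

  det-unit-last : ∀ cs b → (∀ c → c ∈ cs → c ≢ b) → ∀ vs →
                  det apply (cs ++ b ∷ []) (e[ b ] ∷ vs) ≡ sgn (length cs) ℚ.* det apply cs vs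
  det-unit-last cs b b∉ vs = trans (det-move-col apply cs b [] (e[ b ] ∷ vs)) (cong (sgn (length cs) ℚ.*_)
    (trans (cong (λ ds → det apply (b ∷ ds) (e[ b ] ∷ vs)) (++-identityʳ cs)) (det-unit b cs e[ b ] (e-on b) (λ c c∈ → e-off b c (b∉ c c∈)) vs)))
    where open import Data.List.Properties using (++-identityʳ)

  sgn-cancel : ∀ n {a b} → sgn n ℚ.* a ≡ sgn n ℚ.* b → a ≡ b
  sgn-cancel n {a} {b} e = trans (lem a) (trans (cong (sgn n ℚ.*_) e) (sym (lem b)))
    where
    lem : ∀ a → a ≡ sgn n ℚ.* (sgn n ℚ.* a)
    lem a = trans (sym (ℚ.*-identityˡ a)) (trans (cong (ℚ._* a) (sym (sgn² n))) (ℚ.*-assoc (sgn n) (sgn n) a))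

  -- The Desnanot-Jacobi identity is the Plücker relation for `u`, `w` and the unit vectors of the
  -- outer columns `c` and `b`, since a unit vector among the rows deletes its column. The sign from
  -- column `b` is common to all terms and cancels.
  dodgson-vectors : ∀ c C b → (∀ d → d ∈ C ++ b ∷ [] → d ≢ c) → (∀ d → d ∈ C → d ≢ b) → c ≢ b → ∀ u S w →
    det apply (c ∷ C ++ b ∷ []) (u ∷ S ++ w ∷ []) ℚ.* det apply C S
    ≡ det apply (C ++ b ∷ []) (S ++ w ∷ []) ℚ.* det apply (c ∷ C) (u ∷ S)
      ℚ.- det apply (C ++ b ∷ []) (u ∷ S) ℚ.* det apply (c ∷ C) (S ++ w ∷ [])
  dodgson-vectors c C b c∉ b∉ c≢b u S w = begin
    D (u ∷ S ++ w ∷ []) ℚ.* D₀ S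
      ≡⟨ cong (ℚ._* D₀ S) (move (λ ws → D (u ∷ ws)) (alternating-∷ D u (det-alternating apply (c ∷ C ++ b ∷ [])))) ⟩
    (s ℚ.* D (u ∷ w ∷ S)) ℚ.* D₀ S
      ≡⟨ solve 3 (λ s d x → (s :* d) :* x := s :* (x :* d)) refl s (D (u ∷ w ∷ S)) (D₀ S) ⟩
    s ℚ.* (D₀ S ℚ.* D (u ∷ w ∷ S))
      ≡⟨ cong (s ℚ.*_) rel ⟩
    s ℚ.* (D′ (w ∷ S) ℚ.* Dc (u ∷ S) ℚ.- D′ (u ∷ S) ℚ.* Dc (w ∷ S))
      ≡⟨ solve 5 (λ s a b c d → s :* (a :* b :- c :* d) := (s :* a) :* b :- c :* (s :* d)) refl s (D′ (w ∷ S)) (Dc (u ∷ S)) (D′ (u ∷ S)) (Dc (w ∷ S)) ⟩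
    (s ℚ.* D′ (w ∷ S)) ℚ.* Dc (u ∷ S) ℚ.- D′ (u ∷ S) ℚ.* (s ℚ.* Dc (w ∷ S))
      ≡⟨ cong₂ (λ x y → x ℚ.* Dc (u ∷ S) ℚ.- D′ (u ∷ S) ℚ.* y) (move D′ (det-alternating apply (C ++ b ∷ []))) (move Dc (det-alternating apply (c ∷ C))) ⟨
    D′ (S ++ w ∷ []) ℚ.* Dc (u ∷ S) ℚ.- D′ (u ∷ S) ℚ.* Dc (S ++ w ∷ []) ∎
    where
    open import Data.List.Properties using (++-identityʳ)
    D D′ Dc D₀ : List (ℕ → ℚ) → ℚ
    D  = det apply (c ∷ C ++ b ∷ [])
    D′ = det apply (C ++ b ∷ [])
    Dc = det apply (c ∷ C)
    D₀ = det apply C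
    s t : ℚ
    s = sgn (length S)
    t = sgn (length C)
    move : ∀ F → Alternating F → F (S ++ w ∷ []) ≡ s ℚ.* F (w ∷ S)
    move F alt = trans (move-front F alt S w []) (cong (λ ws → s ℚ.* F (w ∷ ws)) (++-identityʳ S))
    last : ∀ v → D (v ∷ e[ b ] ∷ S) ≡ t ℚ.* Dc (v ∷ S)
    last v = trans (det-alternating apply (c ∷ C ++ b ∷ []) [] v e[ b ] S) (trans (cong ℚ.-_
      (det-unit-last (c ∷ C) b (λ { d (here refl) → c≢b ; d (there d∈) → b∉ d d∈ }) (v ∷ S)))
      (solve 2 (λ t d → :- ((:- t) :* d) := t :* d) refl t (Dc (v ∷ S))))
    rel : D₀ S ℚ.* D (u ∷ w ∷ S) ≡ D′ (w ∷ S) ℚ.* Dc (u ∷ S) ℚ.- D′ (u ∷ S) ℚ.* Dc (w ∷ S)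
    rel = sgn-cancel (length C) (begin
      t ℚ.* (D₀ S ℚ.* D (u ∷ w ∷ S))
        ≡⟨ solve 5 (λ t z d x y → t :* (z :* d) := (x :- y :+ (t :* z) :* d) :- (x :- y)) refl t (D₀ S) (D (u ∷ w ∷ S))
             (D′ (u ∷ S) ℚ.* D (w ∷ e[ b ] ∷ S)) (D′ (w ∷ S) ℚ.* D (u ∷ e[ b ] ∷ S)) ⟩
      (D′ (u ∷ S) ℚ.* D (w ∷ e[ b ] ∷ S) ℚ.- D′ (w ∷ S) ℚ.* D (u ∷ e[ b ] ∷ S) ℚ.+ (t ℚ.* D₀ S) ℚ.* D (u ∷ w ∷ S))
        ℚ.- (D′ (u ∷ S) ℚ.* D (w ∷ e[ b ] ∷ S) ℚ.- D′ (w ∷ S) ℚ.* D (u ∷ e[ b ] ∷ S))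
        ≡⟨ cong₂ ℚ._-_ (trans (cong (λ x → D′ (u ∷ S) ℚ.* D (w ∷ e[ b ] ∷ S) ℚ.- D′ (w ∷ S) ℚ.* D (u ∷ e[ b ] ∷ S) ℚ.+ x ℚ.* D (u ∷ w ∷ S))
               (sym (det-unit-last C b b∉ S))) (plücker-col c (C ++ b ∷ []) c∉ u w e[ b ] S))
             (cong₂ (λ x y → D′ (u ∷ S) ℚ.* x ℚ.- D′ (w ∷ S) ℚ.* y) (last w) (last u)) ⟩
      0ℚ ℚ.- (D′ (u ∷ S) ℚ.* (t ℚ.* Dc (w ∷ S)) ℚ.- D′ (w ∷ S) ℚ.* (t ℚ.* Dc (u ∷ S)))
        ≡⟨ solve 5 (λ t a b c d → con 0ℚ :- (a :* (t :* b) :- c :* (t :* d)) := t :* (c :* d :- a :* b)) refl t (D′ (u ∷ S)) (Dc (w ∷ S)) (D′ (w ∷ S)) (Dc (u ∷ S)) ⟩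
      t ℚ.* (D′ (w ∷ S) ℚ.* Dc (u ∷ S) ℚ.- D′ (u ∷ S) ℚ.* Dc (w ∷ S)) ∎)

  downFrom-suc : ∀ n → downFrom (suc n) ≡ map suc (downFrom n) ++ 0 ∷ []
  downFrom-suc zero    = refl
  downFrom-suc (suc n) = cong (suc n ∷_) (downFrom-suc n)

  -- Rows and columns are both listed downwards, so the two reversal signs cancel.
  Δ : (ℕ → ℕ → ℚ) → ℕ → ℚ
  Δ m n = det m (downFrom n) (downFrom n)

  dodgson : ∀ (m : ℕ → ℕ → ℚ) n →
    Δ m (2 + n) ℚ.* Δ (λ i j → m (suc i) (suc j)) n
    ≡ Δ m (1 + n) ℚ.* Δ (λ i j → m (suc i) (suc j)) (1 + n)
      ℚ.- Δ (λ i j → m (suc i) j) (1 + n) ℚ.* Δ (λ i j → m i (suc j)) (1 + n)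
  dodgson m n = begin
    Δ m (2 + n) ℚ.* Δ (λ i j → m (suc i) (suc j)) n
      ≡⟨ cong₂ ℚ._*_ (trans (cong₂ (λ cs rs → det m (suc n ∷ cs) (suc n ∷ rs)) (downFrom-suc n) (downFrom-suc n))
                         (vec (suc n ∷ C ++ 0 ∷ []) (suc n) (C ++ 0 ∷ []) (snoc C)))
                    (trans (inner (downFrom n) (downFrom n)) (sym (det-map-rows m apply C C))) ⟩
    det apply (suc n ∷ C ++ 0 ∷ []) (m (suc n) ∷ S ++ m 0 ∷ []) ℚ.* det apply C S
      ≡⟨ dodgson-vectors (suc n) C 0 c∉ b∉ (λ ()) (m (suc n)) S (m 0) ⟩
    det apply (C ++ 0 ∷ []) (S ++ m 0 ∷ []) ℚ.* det apply (suc n ∷ C) (m (suc n) ∷ S)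
      ℚ.- det apply (C ++ 0 ∷ []) (m (suc n) ∷ S) ℚ.* det apply (suc n ∷ C) (S ++ m 0 ∷ [])
      ≡⟨ cong₂ ℚ._-_ (cong₂ ℚ._*_ (trans (sym (rows (C ++ 0 ∷ []) (C ++ 0 ∷ []) (S ++ m 0 ∷ []) (snoc C))) (cong₂ (det m) (sym (downFrom-suc n)) (sym (downFrom-suc n))))
                              (trans (det-map-rows m apply (suc n ∷ C) (suc n ∷ C)) (sym (inner (downFrom (suc n)) (downFrom (suc n))))))
                   (cong₂ ℚ._*_ (trans (det-map-rows m apply (C ++ 0 ∷ []) (suc n ∷ C)) (trans (cong (λ cs → det m cs (suc n ∷ C)) (sym (downFrom-suc n)))
                                   (det-map-rows suc m (downFrom (suc n)) (downFrom (suc n)))))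
                              (trans (sym (rows (suc n ∷ C) (C ++ 0 ∷ []) (S ++ m 0 ∷ []) (snoc C))) (trans (cong (det m (suc n ∷ C)) (sym (downFrom-suc n)))
                                   (det-map-cols suc m (downFrom (suc n)) (downFrom (suc n)))))) ⟩
    Δ m (1 + n) ℚ.* Δ (λ i j → m (suc i) (suc j)) (1 + n)
      ℚ.- Δ (λ i j → m (suc i) j) (1 + n) ℚ.* Δ (λ i j → m i (suc j)) (1 + n) ∎
    where
    C = map suc (downFrom n)
    S = map m C
    snoc : ∀ xs → map m (xs ++ 0 ∷ []) ≡ map m xs ++ m 0 ∷ []
    snoc xs = map-++ m xs (0 ∷ [])
    rows : ∀ cs rs vs → map m rs ≡ vs → det m cs rs ≡ det apply cs vs
    rows cs rs vs e = trans (sym (det-map-rows m apply cs rs)) (cong (det apply cs) e)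
    vec : ∀ cs r rs {vs} → map m rs ≡ vs → det m cs (r ∷ rs) ≡ det apply cs (m r ∷ vs)
    vec cs r rs e = trans (sym (det-map-rows m apply cs (r ∷ rs))) (cong (λ vs → det apply cs (m r ∷ vs)) e)
    inner : ∀ cs rs → det (λ i j → m (suc i) (suc j)) cs rs ≡ det m (map suc cs) (map suc rs)
    inner cs rs = sym (trans (det-map-rows suc m (map suc cs) rs) (det-map-cols suc (λ i → m (suc i)) cs rs))
    c∉ : ∀ d → d ∈ C ++ 0 ∷ [] → d ≢ suc n
    c∉ d d∈ refl with ∈-++⁻ C d∈
    ... | inj₂ (here ())
    ... | inj₁ d∈′ with ∈-map⁻ suc d∈′
    ...   | k , k∈ , refl = ℕ.<-irrefl refl (∈-downFrom⁻ k∈)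
    b∉ : ∀ d → d ∈ C → d ≢ 0
    b∉ d d∈ refl with ∈-map⁻ suc d∈
    ... | _ , _ , ()

  Δ-cong : ∀ {m m′ : ℕ → ℕ → ℚ} n → (∀ i j → m i j ≡ m′ i j) → Δ m n ≡ Δ m′ n
  Δ-cong n e = det-cong (downFrom n) (downFrom n) (λ i _ j _ → e i j)

  Δ-zero-row : ∀ (m : ℕ → ℕ → ℚ) n → (∀ j → m 0 j ≡ 0ℚ) → Δ m (suc n) ≡ 0ℚ
  Δ-zero-row m n z = trans (sym (det-map-rows m apply (downFrom (suc n)) (downFrom (suc n))))
    (trans (cong (det apply (downFrom (suc n))) (trans (cong (map m) (downFrom-suc n)) (map-++ m (map suc (downFrom n)) (0 ∷ []))))
      (det-zero (downFrom (suc n)) (λ j _ → z j) (map m (map suc (downFrom n))) []))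

  Δ-zero-col : ∀ (m : ℕ → ℕ → ℚ) n → (∀ i → m i 0 ≡ 0ℚ) → Δ m (suc n) ≡ 0ℚ
  Δ-zero-col m n z = trans (det-transpose m (downFrom (suc n)) (downFrom (suc n))) (Δ-zero-row (λ i j → m j i) n z)

  eval-++₃ : ∀ l m n ρ → eval l ρ ℚ.* (eval m ρ ℚ.* eval n ρ) ≡ eval (l ++ m ++ n) ρ
  eval-++₃ l m n ρ = trans (cong (eval l ρ ℚ.*_) (sym (eval-++ m n ρ))) (sym (eval-++ l (m ++ n) ρ))

  -- The tests implement the convention that 1/n! is 0 for negative n.
  quot : ℕ → ℕ → ℕ → ℕ → ℕ → ℚ
  quot P j Q i s = if (j ≤ᵇ P) ∧ (i ≤ᵇ Q) then ι (s !) ℚ.* inv (ι ((P ∸ j) !) ℚ.* ι ((Q ∸ i) !)) else 0ℚ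

  ≤ᵇ-suc-suc : ∀ m n → (suc m ≤ᵇ suc n) ≡ (m ≤ᵇ n)
  ≤ᵇ-suc-suc zero    n = refl
  ≤ᵇ-suc-suc (suc m) n = refl

  quot-suc₁ : ∀ P j Q i s → quot (suc P) (suc j) Q i s ≡ quot P j Q i s
  quot-suc₁ P j Q i s = cong (λ b → if b ∧ (i ≤ᵇ Q) then ι (s !) ℚ.* inv (ι ((P ∸ j) !) ℚ.* ι ((Q ∸ i) !)) else 0ℚ) (≤ᵇ-suc-suc j P)

  quot-suc₂ : ∀ P j Q i s → quot P j (suc Q) (suc i) s ≡ quot P j Q i s
  quot-suc₂ P j Q i s = cong (λ b → if (j ≤ᵇ P) ∧ b then ι (s !) ℚ.* inv (ι ((P ∸ j) !) ℚ.* ι ((Q ∸ i) !)) else 0ℚ) (≤ᵇ-suc-suc i Q)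

  -- (X+Y+i+j-1)! / ((X+2i-j)! (Y+2j-i)!)
  ab : ℕ → ℕ → ℕ → ℕ → ℚ
  ab X Y i j = quot (X + (i + i)) j (Y + (j + j)) i (X + Y + i + j ∸ 1)

  quot-cong : ∀ {P P′ Q Q′ s s′} j i → P ≡ P′ → Q ≡ Q′ → s ≡ s′ → quot P j Q i s ≡ quot P′ j Q′ i s′
  quot-cong j i refl refl refl = refl

  -- Condensation stays inside the family: shifting rows and columns turns (X,Y) into (X+1,Y+1),
  -- shifting rows alone into (X+2,Y-1), columns alone into (X-1,Y+2). In each case the numerator is
  -- the same function of the new parameters.
  ab↘ : ∀ X Y i j → ab X Y (suc i) (suc j) ≡ ab (suc X) (suc Y) i j
  ab↘ X Y i j = trans (quot-cong (suc j) (suc i) (2+2 X i) (2+2 Y j) (sum↘ X Y i j))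
    (trans (quot-suc₁ (suc (X + (i + i))) j (suc (suc (Y + (j + j)))) (suc i) (suc X + suc Y + i + j ∸ 1))
           (quot-suc₂ (suc (X + (i + i))) j (suc (Y + (j + j))) i (suc X + suc Y + i + j ∸ 1)))

  ab↓ : ∀ X Y i j → ab X (suc Y) (suc i) j ≡ ab (suc (suc X)) Y i j
  ab↓ X Y i j = trans (quot-cong j (suc i) (2+2 X i) (refl {x = suc Y + (j + j)}) (sum↓ X Y i j))
    (quot-suc₂ (suc (suc (X + (i + i)))) j (Y + (j + j)) i (suc (suc X) + Y + i + j ∸ 1))

  ab→ : ∀ X Y i j → ab (suc X) Y i (suc j) ≡ ab X (suc (suc Y)) i j
  ab→ X Y i j = trans (quot-cong (suc j) i (refl {x = suc X + (i + i)}) (2+2 Y j) (sum→ X Y i j))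
    (quot-suc₁ (X + (i + i)) j (suc (suc (Y + (j + j)))) i (X + suc (suc Y) + i + j ∸ 1))

  -- i! (W+i)! (W+X+3i)! (W+Y+3i)! / ((W+X+2i)! (W+Y+2i)! (X+2i)! (Y+2i)!) in the
  -- variables X, Y, W, i, where W = X+Y-1.
  hM : Mono
  hM = ↑ (fac (0 ∷ 0 ∷ 0 ∷ 1 ∷ [] , 0)) ∷ ↑ (fac (0 ∷ 0 ∷ 1 ∷ 1 ∷ [] , 0)) ∷ ↑ (fac (1 ∷ 0 ∷ 1 ∷ 3 ∷ [] , 0)) ∷ ↑ (fac (0 ∷ 1 ∷ 1 ∷ 3 ∷ [] , 0))
     ∷ ↓ (fac (1 ∷ 0 ∷ 1 ∷ 2 ∷ [] , 0)) ∷ ↓ (fac (0 ∷ 1 ∷ 1 ∷ 2 ∷ [] , 0)) ∷ ↓ (fac (1 ∷ 0 ∷ 0 ∷ 2 ∷ [] , 0)) ∷ ↓ (fac (0 ∷ 1 ∷ 0 ∷ 2 ∷ [] , 0)) ∷ []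

  -- As a separate argument, W = X+Y-1 keeps every factor a factorial of an affine form without
  -- subtraction.
  H : ℕ → ℕ → ℕ → ℕ → ℚ
  H X Y W zero    = 1ℚ
  H X Y W (suc n) = H X Y W n ℚ.* eval hM (X ∷ Y ∷ W ∷ n ∷ [])

  H≢0 : ∀ X Y W n → H X Y W n ≢ 0ℚ
  H≢0 X Y W zero    = 1≢0
  H≢0 X Y W (suc n) = *≢0 (H X Y W n) (eval hM (X ∷ Y ∷ W ∷ n ∷ [])) (H≢0 X Y W n) (eval≢0 hM (X ∷ Y ∷ W ∷ n ∷ []))

  -- r₁ - r₂ = 1, where (with e = n-1) r₁ = (W+e+1)(X+2e)(Y+2e)/den, r₂ = XY(X+Y)/den,
  -- den = e (W+X+2e+1) (W+Y+2e+1).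
  n₁M denM : List Atom
  n₁M  = lin (0 ∷ 0 ∷ 1 ∷ 1 ∷ [] , 1) ∷ lin (1 ∷ 0 ∷ 0 ∷ 2 ∷ [] , 1) ∷ lin (0 ∷ 1 ∷ 0 ∷ 2 ∷ [] , 1) ∷ []
  denM = lin (0 ∷ 0 ∷ 0 ∷ 1 ∷ [] , 0) ∷ lin (1 ∷ 0 ∷ 1 ∷ 2 ∷ [] , 2) ∷ lin (0 ∷ 1 ∷ 1 ∷ 2 ∷ [] , 2) ∷ []

  den num₁ : ℕ → ℕ → ℕ → ℕ → ℕ
  den  X Y W m = prodA denM (X ∷ Y ∷ W ∷ m ∷ [])
  num₁ X Y W m = prodA n₁M (X ∷ Y ∷ W ∷ m ∷ [])

  -- The two sides differ in one factor of each product only, so a single cancellation suffices.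
  ρ₁ : ∀ X Y W m → let ρ = X ∷ Y ∷ W ∷ m ∷ [] in
    H X Y W (1 + m) ℚ.* H (suc X) (suc Y) (2 + W) (1 + m) ℚ.* ι (den X Y W m)
    ≡ H X Y W (2 + m) ℚ.* H (suc X) (suc Y) (2 + W) m ℚ.* ι (num₁ X Y W m)
  ρ₁ X Y W m = begin
    H₁ ℚ.* (G ℚ.* eval hM (suc X ∷ suc Y ∷ 2 + W ∷ m ∷ [])) ℚ.* ι (den X Y W m)
      ≡⟨ cong₂ (λ a b → H₁ ℚ.* (G ℚ.* a) ℚ.* b) (eval-sub hM σ ρ) (sym (eval-↑ denM ρ)) ⟩
    H₁ ℚ.* (G ℚ.* eval (sub σ hM) ρ) ℚ.* eval (map ↑ denM) ρ
      ≡⟨ solve 4 (λ h g a d → h :* (g :* a) :* d := h :* g :* (a :* d)) refl H₁ G (eval (sub σ hM) ρ) (eval (map ↑ denM) ρ) ⟩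
    H₁ ℚ.* G ℚ.* (eval (sub σ hM) ρ ℚ.* eval (map ↑ denM) ρ)
      ≡⟨ cong (H₁ ℚ.* G ℚ.*_) (trans (sym (eval-++ (sub σ hM) (map ↑ denM) ρ)) (trans (mono (sub σ hM ++ map ↑ denM) (sub τ hM ++ map ↑ n₁M) ρ refl)
           (eval-++ (sub τ hM) (map ↑ n₁M) ρ))) ⟩
    H₁ ℚ.* G ℚ.* (eval (sub τ hM) ρ ℚ.* eval (map ↑ n₁M) ρ)
      ≡⟨ solve 4 (λ h g a d → h :* g :* (a :* d) := h :* a :* g :* d) refl H₁ G (eval (sub τ hM) ρ) (eval (map ↑ n₁M) ρ) ⟩
    H₁ ℚ.* eval (sub τ hM) ρ ℚ.* G ℚ.* eval (map ↑ n₁M) ρ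
      ≡⟨ cong₂ (λ a b → H₁ ℚ.* a ℚ.* G ℚ.* b) (sym (eval-sub hM τ ρ)) (eval-↑ n₁M ρ) ⟩
    H₁ ℚ.* eval hM (X ∷ Y ∷ W ∷ suc m ∷ []) ℚ.* G ℚ.* ι (num₁ X Y W m) ∎
    where
    ρ = X ∷ Y ∷ W ∷ m ∷ []
    H₁ = H X Y W (1 + m)
    G  = H (suc X) (suc Y) (2 + W) m
    σ τ : List Form
    σ = (1 ∷ [] , 1) ∷ (0 ∷ 1 ∷ [] , 1) ∷ (0 ∷ 0 ∷ 1 ∷ [] , 2) ∷ (0 ∷ 0 ∷ 0 ∷ 1 ∷ [] , 0) ∷ []
    τ = (1 ∷ [] , 0) ∷ (0 ∷ 1 ∷ [] , 0) ∷ (0 ∷ 0 ∷ 1 ∷ [] , 0) ∷ (0 ∷ 0 ∷ 0 ∷ 1 ∷ [] , 1) ∷ []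

  n₂M den′M : List Atom
  n₂M   = lin (1 ∷ [] , 0) ∷ lin (0 ∷ 1 ∷ [] , 0) ∷ lin (1 ∷ 1 ∷ [] , 1) ∷ []
  den′M = map (subA ((1 ∷ [] , 1) ∷ (0 ∷ 1 ∷ [] , 1) ∷ (1 ∷ 1 ∷ [] , 1) ∷ (0 ∷ 0 ∷ 1 ∷ [] , 0) ∷ [])) denM

  -- Here the four products have different parameters and share no factors, so the ratio is carried
  -- through an induction on m; the denominators at m and m+1 move from one side to the other.
  ρ₂ : ∀ X Y m → let W = suc (Y + X); ρ = X ∷ Y ∷ m ∷ [] in
    H (3 + X) Y (suc W) (1 + m) ℚ.* H X (3 + Y) (suc W) (1 + m) ℚ.* ι (den (suc X) (suc Y) W m)
    ≡ H (suc X) (suc Y) W (2 + m) ℚ.* H (2 + X) (2 + Y) (2 + W) m ℚ.* ι (prodA n₂M ρ)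
  ρ₂ X Y zero = begin
    (1ℚ ℚ.* a₀) ℚ.* (1ℚ ℚ.* b₀) ℚ.* ι (den (suc X) (suc Y) W 0)
      ≡⟨ cong (λ d → (1ℚ ℚ.* a₀) ℚ.* (1ℚ ℚ.* b₀) ℚ.* d) (trans (sym (eval-↑ denM (suc X ∷ suc Y ∷ W ∷ 0 ∷ []))) (eval-sub (map ↑ denM) σd ρ)) ⟩
    (1ℚ ℚ.* a₀) ℚ.* (1ℚ ℚ.* b₀) ℚ.* d₀
      ≡⟨ solve 3 (λ a b d → (con 1ℚ :* a) :* (con 1ℚ :* b) :* d := a :* (b :* d)) refl a₀ b₀ d₀ ⟩
    a₀ ℚ.* (b₀ ℚ.* d₀)
      ≡⟨ cong₂ (λ a b → a ℚ.* (b ℚ.* d₀)) (eval-sub hM σa ρ) (eval-sub hM σb ρ) ⟩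
    eval ma ρ ℚ.* (eval mb ρ ℚ.* eval md ρ)
      ≡⟨ eval-++₃ ma mb md ρ ⟩
    eval (ma ++ mb ++ md) ρ
      ≡⟨ mono (ma ++ mb ++ md) (mc ++ mc′ ++ map ↑ n₂M) ρ refl ⟩
    eval (mc ++ mc′ ++ map ↑ n₂M) ρ
      ≡⟨ eval-++₃ mc mc′ (map ↑ n₂M) ρ ⟨
    eval mc ρ ℚ.* (eval mc′ ρ ℚ.* eval (map ↑ n₂M) ρ)
      ≡⟨ cong₂ (λ a b → a ℚ.* (b ℚ.* eval (map ↑ n₂M) ρ)) (eval-sub hM σc ρ) (eval-sub hM σc′ ρ) ⟨
    c₀ ℚ.* (c₁ ℚ.* eval (map ↑ n₂M) ρ)
      ≡⟨ solve 3 (λ a b d → a :* (b :* d) := ((con 1ℚ :* a) :* b) :* con 1ℚ :* d) refl c₀ c₁ (eval (map ↑ n₂M) ρ) ⟩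
    ((1ℚ ℚ.* c₀) ℚ.* c₁) ℚ.* 1ℚ ℚ.* eval (map ↑ n₂M) ρ
      ≡⟨ cong (((1ℚ ℚ.* c₀) ℚ.* c₁) ℚ.* 1ℚ ℚ.*_) (eval-↑ n₂M ρ) ⟩
    ((1ℚ ℚ.* c₀) ℚ.* c₁) ℚ.* 1ℚ ℚ.* ι (prodA n₂M ρ) ∎
    where
    W = suc (Y + X)
    ρ = X ∷ Y ∷ 0 ∷ []
    σa σb σc σc′ σd : List Form
    σa  = (1 ∷ [] , 3) ∷ (0 ∷ 1 ∷ [] , 0) ∷ (1 ∷ 1 ∷ [] , 2) ∷ ([] , 0) ∷ []
    σb  = (1 ∷ [] , 0) ∷ (0 ∷ 1 ∷ [] , 3) ∷ (1 ∷ 1 ∷ [] , 2) ∷ ([] , 0) ∷ []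
    σc  = (1 ∷ [] , 1) ∷ (0 ∷ 1 ∷ [] , 1) ∷ (1 ∷ 1 ∷ [] , 1) ∷ ([] , 0) ∷ []
    σc′ = (1 ∷ [] , 1) ∷ (0 ∷ 1 ∷ [] , 1) ∷ (1 ∷ 1 ∷ [] , 1) ∷ ([] , 1) ∷ []
    σd  = (1 ∷ [] , 1) ∷ (0 ∷ 1 ∷ [] , 1) ∷ (1 ∷ 1 ∷ [] , 1) ∷ ([] , 0) ∷ []
    a₀ b₀ c₀ c₁ d₀ : ℚ
    a₀ = eval hM (3 + X ∷ Y ∷ suc W ∷ 0 ∷ [])
    b₀ = eval hM (X ∷ 3 + Y ∷ suc W ∷ 0 ∷ [])
    c₀ = eval hM (suc X ∷ suc Y ∷ W ∷ 0 ∷ [])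
    c₁ = eval hM (suc X ∷ suc Y ∷ W ∷ 1 ∷ [])
    ma mb mc mc′ md : Mono
    ma  = sub σa hM
    mb  = sub σb hM
    mc  = sub σc hM
    mc′ = sub σc′ hM
    md  = sub σd (map ↑ denM)
    d₀  = eval md ρ
  ρ₂ X Y (suc m) = *-cancelˡ d₀ (A ℚ.* a ℚ.* (B ℚ.* b) ℚ.* ι (den (suc X) (suc Y) W (suc m))) (C ℚ.* c ℚ.* (G ℚ.* g) ℚ.* n) (eval≢0 md ρ) (begin
    d₀ ℚ.* (A ℚ.* a ℚ.* (B ℚ.* b) ℚ.* ι (den (suc X) (suc Y) W (suc m)))
      ≡⟨ cong (λ d → d₀ ℚ.* (A ℚ.* a ℚ.* (B ℚ.* b) ℚ.* d)) (trans (sym (eval-↑ denM (suc X ∷ suc Y ∷ W ∷ suc m ∷ []))) (eval-sub (map ↑ denM) σc ρ)) ⟩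
    d₀ ℚ.* (A ℚ.* a ℚ.* (B ℚ.* b) ℚ.* d₁)
      ≡⟨ solve 6 (λ d A a B b e → d :* (A :* a :* (B :* b) :* e) := (A :* B :* d) :* (a :* (b :* e))) refl d₀ A a B b d₁ ⟩
    (A ℚ.* B ℚ.* d₀) ℚ.* (a ℚ.* (b ℚ.* d₁))
      ≡⟨ cong₂ ℚ._*_ (trans (cong (A ℚ.* B ℚ.*_) (trans (sym (eval-sub (map ↑ denM) σd ρ)) (eval-↑ denM (suc X ∷ suc Y ∷ W ∷ m ∷ [])))) (ρ₂ X Y m))
           (trans (cong₂ (λ a b → a ℚ.* (b ℚ.* d₁)) (eval-sub hM σa ρ) (eval-sub hM σb ρ)) (trans (eval-++₃ ma mb me ρ)
           (trans (mono (ma ++ mb ++ me) (mc ++ mg ++ md) ρ refl) (trans (sym (eval-++₃ mc mg md ρ))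
             (sym (cong₂ (λ a b → a ℚ.* (b ℚ.* d₀)) (eval-sub hM σc′ ρ) (eval-sub hM σg ρ))))))) ⟩
    (C ℚ.* G ℚ.* n) ℚ.* (c ℚ.* (g ℚ.* d₀))
      ≡⟨ solve 6 (λ C G n c g d → (C :* G :* n) :* (c :* (g :* d)) := d :* (C :* c :* (G :* g) :* n)) refl C G n c g d₀ ⟩
    d₀ ℚ.* (C ℚ.* c ℚ.* (G ℚ.* g) ℚ.* n) ∎)
    where
    W = suc (Y + X)
    ρ = X ∷ Y ∷ m ∷ []
    σa σb σc σc′ σd σg : List Form
    σa  = (1 ∷ [] , 3) ∷ (0 ∷ 1 ∷ [] , 0) ∷ (1 ∷ 1 ∷ [] , 2) ∷ (0 ∷ 0 ∷ 1 ∷ [] , 1) ∷ []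
    σb  = (1 ∷ [] , 0) ∷ (0 ∷ 1 ∷ [] , 3) ∷ (1 ∷ 1 ∷ [] , 2) ∷ (0 ∷ 0 ∷ 1 ∷ [] , 1) ∷ []
    σc  = (1 ∷ [] , 1) ∷ (0 ∷ 1 ∷ [] , 1) ∷ (1 ∷ 1 ∷ [] , 1) ∷ (0 ∷ 0 ∷ 1 ∷ [] , 1) ∷ []
    σc′ = (1 ∷ [] , 1) ∷ (0 ∷ 1 ∷ [] , 1) ∷ (1 ∷ 1 ∷ [] , 1) ∷ (0 ∷ 0 ∷ 1 ∷ [] , 2) ∷ []
    σd  = (1 ∷ [] , 1) ∷ (0 ∷ 1 ∷ [] , 1) ∷ (1 ∷ 1 ∷ [] , 1) ∷ (0 ∷ 0 ∷ 1 ∷ [] , 0) ∷ []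
    σg  = (1 ∷ [] , 2) ∷ (0 ∷ 1 ∷ [] , 2) ∷ (1 ∷ 1 ∷ [] , 3) ∷ (0 ∷ 0 ∷ 1 ∷ [] , 0) ∷ []
    A B C G a b c g d₀ d₁ n : ℚ
    A = H (3 + X) Y (suc W) (1 + m)
    B = H X (3 + Y) (suc W) (1 + m)
    C = H (suc X) (suc Y) W (2 + m)
    G = H (2 + X) (2 + Y) (2 + W) m
    a = eval hM (3 + X ∷ Y ∷ suc W ∷ suc m ∷ [])
    b = eval hM (X ∷ 3 + Y ∷ suc W ∷ suc m ∷ [])
    c = eval hM (suc X ∷ suc Y ∷ W ∷ 2 + m ∷ [])
    g = eval hM (2 + X ∷ 2 + Y ∷ 2 + W ∷ m ∷ [])
    n = ι (prodA n₂M ρ)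
    ma mb mc mg md me : Mono
    ma = sub σa hM
    mb = sub σb hM
    mc = sub σc′ hM
    mg = sub σg hM
    md = sub σd (map ↑ denM)
    me = sub σc (map ↑ denM)
    d₀ = eval md ρ
    d₁ = eval me ρ

  n₁≡ : ∀ X Y m → num₁ (suc X) (suc Y) (suc (Y + X)) m ≡ den (suc X) (suc Y) (suc (Y + X)) m + prodA n₂M (X ∷ Y ∷ m ∷ [])
  n₁≡ = polynomial

  n₁-X0 : ∀ Y m → num₁ 0 (suc Y) Y m ≡ den 0 (suc Y) Y m
  n₁-X0 = polynomial-X0

  n₁-Y0 : ∀ X m → num₁ (suc X) 0 X m ≡ den (suc X) 0 X m
  n₁-Y0 = polynomial-Y0

  ab₀₀ : ∀ X Y W → suc W ≡ X + Y → ab X Y 0 0 ≡ eval hM (X ∷ Y ∷ W ∷ 0 ∷ [])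
  ab₀₀ X Y W e = begin
    ι ((X + Y + 0 + 0 ∸ 1) !) ℚ.* inv (ι ((X + 0) !) ℚ.* ι ((Y + 0) !))
      ≡⟨ cong₂ (λ s t → ι (s !) ℚ.* inv t) (trans (cong (_∸ 1) (trans (ℕ.+-identityʳ (X + Y + 0)) (ℕ.+-identityʳ (X + Y)))) (cong (_∸ 1) (sym e)))
           (cong₂ (λ s t → ι (s !) ℚ.* ι (t !)) (ℕ.+-identityʳ X) (ℕ.+-identityʳ Y)) ⟩
    ι (W !) ℚ.* inv (ι (X !) ℚ.* ι (Y !))
      ≡⟨ cong (ι (W !) ℚ.*_) (trans (inv-* (ι (X !)) (ι (Y !)) (ιA≢0 (fac (1 ∷ [] , 0)) (X ∷ [])) (ιA≢0 (fac (1 ∷ [] , 0)) (Y ∷ [])))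
           (cong (inv (ι (X !)) ℚ.*_) (sym (ℚ.*-identityʳ (inv (ι (Y !))))))) ⟩
    eval (↑ (fac (0 ∷ 0 ∷ 1 ∷ [] , 0)) ∷ ↓ (fac (1 ∷ [] , 0)) ∷ ↓ (fac (0 ∷ 1 ∷ [] , 0)) ∷ []) ρ
      ≡⟨ mono (↑ (fac (0 ∷ 0 ∷ 1 ∷ [] , 0)) ∷ ↓ (fac (1 ∷ [] , 0)) ∷ ↓ (fac (0 ∷ 1 ∷ [] , 0)) ∷ []) (sub σ hM) ρ refl ⟩
    eval (sub σ hM) ρ
      ≡⟨ eval-sub hM σ ρ ⟨
    eval hM (X ∷ Y ∷ W ∷ 0 ∷ []) ∎
    where
    ρ = X ∷ Y ∷ W ∷ []
    σ : List Form
    σ = (1 ∷ [] , 0) ∷ (0 ∷ 1 ∷ [] , 0) ∷ (0 ∷ 0 ∷ 1 ∷ [] , 0) ∷ ([] , 0) ∷ []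

  den≢0 : ∀ X Y W m → ι (den X Y W m) ≢ 0ℚ
  den≢0 X Y W m = subst (_≢ 0ℚ) (eval-↑ denM (X ∷ Y ∷ W ∷ m ∷ [])) (eval≢0 (map ↑ denM) (X ∷ Y ∷ W ∷ m ∷ []))

  -- Condensation expresses the minor of size m+2 through sizes m+1 and m of the same family.
  -- Divided by the claimed product, it becomes r₁ - r₂ = 1.
  AndrewsBurge : ∀ n X Y W → suc W ≡ X + Y → Δ (ab X Y) n ≡ H X Y W n
  AndrewsBurge zero          X Y W e = refl
  AndrewsBurge (suc zero)    X Y W e = trans (solve 1 (λ a → a :* con 1ℚ :- con 0ℚ := con 1ℚ :* a) refl (ab X Y 0 0))
    (cong (1ℚ ℚ.*_) (ab₀₀ X Y W e))
  AndrewsBurge (suc (suc m)) X Y W e = *-cancelˡ G (Δ (ab X Y) (2 + m)) (H X Y W (2 + m)) (H≢0 (suc X) (suc Y) (2 + W) m)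
    (*-cancelˡ (ι (den X Y W m)) (G ℚ.* Δ (ab X Y) (2 + m)) (G ℚ.* H X Y W (2 + m)) (den≢0 X Y W m) (begin
      d ℚ.* (G ℚ.* Δ (ab X Y) (2 + m))
        ≡⟨ cong (d ℚ.*_) (trans (ℚ.*-comm G (Δ (ab X Y) (2 + m))) (trans (cong (Δ (ab X Y) (2 + m) ℚ.*_) (sym (trans (Δ-cong m (ab↘ X Y)) (IH↘ m (AndrewsBurge m)))))
             (dodgson (ab X Y) m))) ⟩
      d ℚ.* (Δ (ab X Y) (1 + m) ℚ.* Δ (λ i j → ab X Y (suc i) (suc j)) (1 + m) ℚ.- Z)
        ≡⟨ cong₂ (λ p q → d ℚ.* (p ℚ.* q ℚ.- Z)) (AndrewsBurge (suc m) X Y W e) (trans (Δ-cong (1 + m) (ab↘ X Y)) (IH↘ (1 + m) (AndrewsBurge (suc m)))) ⟩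
      d ℚ.* (H X Y W (1 + m) ℚ.* H (suc X) (suc Y) (2 + W) (1 + m) ℚ.- Z)
        ≡⟨ solve 4 (λ d a b z → d :* (a :* b :- z) := a :* b :* d :- z :* d) refl d (H X Y W (1 + m)) (H (suc X) (suc Y) (2 + W) (1 + m)) Z ⟩
      H X Y W (1 + m) ℚ.* H (suc X) (suc Y) (2 + W) (1 + m) ℚ.* d ℚ.- Z ℚ.* d
        ≡⟨ cong (ℚ._- Z ℚ.* d) (ρ₁ X Y W m) ⟩
      H X Y W (2 + m) ℚ.* G ℚ.* ι (num₁ X Y W m) ℚ.- Z ℚ.* d
        ≡⟨ remaining X Y W e (λ X Y W e → AndrewsBurge (suc m) X Y W e) ⟩
      H X Y W (2 + m) ℚ.* G ℚ.* d
        ≡⟨ solve 3 (λ h g d → h :* g :* d := d :* (g :* h)) refl (H X Y W (2 + m)) G d ⟩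
      d ℚ.* (G ℚ.* H X Y W (2 + m)) ∎))
    where
    d = ι (den X Y W m)
    G = H (suc X) (suc Y) (2 + W) m
    Z = Δ (λ i j → ab X Y (suc i) j) (1 + m) ℚ.* Δ (λ i j → ab X Y i (suc j)) (1 + m)
    IH↘ : ∀ k → (∀ X Y W → suc W ≡ X + Y → Δ (ab X Y) k ≡ H X Y W k) → Δ (ab (suc X) (suc Y)) k ≡ H (suc X) (suc Y) (2 + W) k
    IH↘ k ih = ih (suc X) (suc Y) (2 + W) (cong suc (trans (cong suc e) (sym (ℕ.+-suc X Y))))
    remaining : ∀ X Y W → suc W ≡ X + Y → (∀ X Y W → suc W ≡ X + Y → Δ (ab X Y) (1 + m) ≡ H X Y W (1 + m)) →
      let h = H X Y W (2 + m) ℚ.* H (suc X) (suc Y) (2 + W) m in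
      h ℚ.* ι (num₁ X Y W m) ℚ.- Δ (λ i j → ab X Y (suc i) j) (1 + m) ℚ.* Δ (λ i j → ab X Y i (suc j)) (1 + m) ℚ.* ι (den X Y W m)
      ≡ h ℚ.* ι (den X Y W m)
    -- For X = 0 the entries of row 0 in the columns j > 0 are multiples of 1/(-j)!, so the minor
    -- with shifted columns has a zero row and only r₁ = 1 remains. The case Y = 0 is its mirror
    -- image.
    remaining zero    (suc Y) .Y refl ih = trans (cong₂ (λ n z → h ℚ.* ι n ℚ.- Δ (λ i j → ab 0 (suc Y) (suc i) j) (1 + m) ℚ.* z ℚ.* ι (den 0 (suc Y) Y m)) (n₁-X0 Y m)
         (Δ-zero-row (λ i j → ab 0 (suc Y) i (suc j)) m (λ _ → refl)))
       (solve 4 (λ h n z d → h :* n :- z :* con 0ℚ :* d := h :* n) refl h (ι (den 0 (suc Y) Y m)) (Δ (λ i j → ab 0 (suc Y) (suc i) j) (1 + m)) (ι (den 0 (suc Y) Y m)))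
      where
      h = H 0 (suc Y) Y (2 + m) ℚ.* H 1 (2 + Y) (2 + Y) m
    remaining (suc X) zero W e ih with ℕ.suc-injective (trans e (cong suc (ℕ.+-identityʳ X)))
    ... | refl = trans (cong₂ (λ n z → h ℚ.* ι n ℚ.- z ℚ.* Δ (λ i j → ab (suc X) 0 i (suc j)) (1 + m) ℚ.* ι (den (suc X) 0 X m)) (n₁-Y0 X m)
         (Δ-zero-col (λ i j → ab (suc X) 0 (suc i) j) m (λ _ → refl)))
       (solve 4 (λ h n z d → h :* n :- con 0ℚ :* z :* d := h :* n) refl h (ι (den (suc X) 0 X m)) (Δ (λ i j → ab (suc X) 0 i (suc j)) (1 + m)) (ι (den (suc X) 0 X m)))
      where
      h = H (suc X) 0 X (2 + m) ℚ.* H (2 + X) 1 (2 + X) m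
    remaining (suc X) (suc Y) W e ih with ℕ.suc-injective (trans e (cong suc (trans (ℕ.+-suc X Y) (cong suc (ℕ.+-comm X Y)))))
    ... | refl = begin
      h ℚ.* ι (num₁ (suc X) (suc Y) W m) ℚ.- Δ (λ i j → ab (suc X) (suc Y) (suc i) j) (1 + m) ℚ.* Δ (λ i j → ab (suc X) (suc Y) i (suc j)) (1 + m) ℚ.* d′
        ≡⟨ cong₂ (λ n z → h ℚ.* n ℚ.- z ℚ.* d′) (trans (cong ι (n₁≡ X Y m)) (ι-+ (den (suc X) (suc Y) W m) (prodA n₂M (X ∷ Y ∷ m ∷ []))))
             (cong₂ ℚ._*_ (trans (Δ-cong (1 + m) (ab↓ (suc X) Y)) (ih (3 + X) Y (suc W) (cong (λ n → 3 + n) (ℕ.+-comm Y X))))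
                          (trans (Δ-cong (1 + m) (ab→ X (suc Y))) (ih X (3 + Y) (suc W) (sum X Y)))) ⟩
      h ℚ.* (d′ ℚ.+ n₂) ℚ.- H (3 + X) Y (suc W) (1 + m) ℚ.* H X (3 + Y) (suc W) (1 + m) ℚ.* d′
        ≡⟨ cong (λ z → h ℚ.* (d′ ℚ.+ n₂) ℚ.- z) (ρ₂ X Y m) ⟩
      h ℚ.* (d′ ℚ.+ n₂) ℚ.- h ℚ.* n₂
        ≡⟨ solve 3 (λ h d n → h :* (d :+ n) :- h :* n := h :* d) refl h d′ n₂ ⟩
      h ℚ.* d′ ∎
      where
      d′ = ι (den (suc X) (suc Y) (suc (Y + X)) m)
      n₂ = ι (prodA n₂M (X ∷ Y ∷ m ∷ []))
      h = H (suc X) (suc Y) (suc (Y + X)) (2 + m) ℚ.* H (2 + X) (2 + Y) (3 + (Y + X)) m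

-- The corner minors of A in closed form.

module CornerMinor where

  open Determinant
  open Monomial
  open Condensation
  open Region using (p; A[_]; desc)
  open import Data.List.Relation.Unary.All using ([]; _∷_)

  module CornerMinorArith where
    open ℕSolver

    path-sum : ∀ l v f → suc l * ((l + 2 * suc v) * f) + suc v * ((suc l + 2 * v) * f) ≡ (suc l + 2 * suc v) * (suc (l + v) * f)
    path-sum = solve 3 (λ l v f → (con 1 :+ l) :* ((l :+ con 2 :* (con 1 :+ v)) :* f) :+ (con 1 :+ v) :* ((con 1 :+ l :+ con 2 :* v) :* f)
      := (con 1 :+ l :+ con 2 :* (con 1 :+ v)) :* ((con 1 :+ (l :+ v)) :* f)) refl

    path-left : ∀ l v a b → 2 * ((suc l * a) * (suc v * b)) ≡ suc l * (2 * (a * (suc v * b)))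
    path-left = solve 4 (λ l v a b → con 2 :* (((con 1 :+ l) :* a) :* ((con 1 :+ v) :* b)) := (con 1 :+ l) :* (con 2 :* (a :* ((con 1 :+ v) :* b)))) refl

    path-right : ∀ l v a b → 2 * ((suc l * a) * (suc v * b)) ≡ suc v * (2 * ((suc l * a) * b))
    path-right = solve 4 (λ l v a b → con 2 :* (((con 1 :+ l) :* a) :* ((con 1 :+ v) :* b)) := (con 1 :+ v) :* (con 2 :* (((con 1 :+ l) :* a) :* b))) refl

    weight-numerator : ∀ l v i j x → l + j ≡ x + (i + i) → v + i ≡ suc (j + j) → l + 2 * v ≡ suc (suc (x + 3 * j))
    weight-numerator l v i j x e f = ℕ.+-cancelʳ-≡ (j + (i + i)) (l + 2 * v) (suc (suc (x + 3 * j)))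
      (trans (solve 4 (λ l v i j → l :+ con 2 :* v :+ (j :+ (i :+ i)) := (l :+ j) :+ con 2 :* (v :+ i)) refl l v i j)
        (trans (cong₂ (λ m n → m + 2 * n) e f)
          (solve 3 (λ x i j → (x :+ (i :+ i)) :+ con 2 :* (con 1 :+ (j :+ j)) := con 2 :+ (x :+ con 3 :* j) :+ (j :+ (i :+ i))) refl x i j)))

    path-length : ∀ l v i j x → l + j ≡ x + (i + i) → v + i ≡ suc (j + j) → l + v ≡ suc (x + i + j)
    path-length l v i j x e f = ℕ.+-cancelʳ-≡ (j + i) (l + v) (suc (x + i + j))
      (trans (solve 4 (λ l v i j → l :+ v :+ (j :+ i) := (l :+ j) :+ (v :+ i)) refl l v i j)
        (trans (cong₂ _+_ e f) (solve 3 (λ x i j → (x :+ (i :+ i)) :+ (con 1 :+ (j :+ j)) := con 1 :+ (x :+ i :+ j) :+ (j :+ i)) refl x i j)))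

    ∸-shift₁ : ∀ x i j → x + 2 * suc i ∸ suc (suc j) ≡ x + (i + i) ∸ j
    ∸-shift₁ x i j = cong (_∸ suc (suc j)) (solve 2 (λ x i → x :+ con 2 :* (con 1 :+ i) := con 2 :+ (x :+ (i :+ i))) refl x i)

    +-shift₁ : ∀ x i → x + 2 * suc i ≡ suc (suc (x + (i + i)))
    +-shift₁ = solve 2 (λ x i → x :+ con 2 :* (con 1 :+ i) := con 2 :+ (x :+ (i :+ i))) refl

    +-shift₂ : ∀ j → 2 * suc j ≡ suc (suc (j + j))
    +-shift₂ = solve 1 (λ j → con 2 :* (con 1 :+ j) := con 2 :+ (j :+ j)) refl

    three-lin : ∀ x j → suc (suc (x + 3 * j)) ≡ suc (suc ((j + (j + j)) + x))
    three-lin = solve 2 (λ x j → con 2 :+ (x :+ con 3 :* j) := con 2 :+ ((j :+ (j :+ j)) :+ x)) refl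

  open CornerMinorArith
  open ℚSolver using (solve; _:+_; _:*_; _:-_; :-_; _:=_; con)
  open ≡-Reasoning

  -- By the last step, p(l,v) is C(l+v-1,l) plus half of C(l+v-1,l-1), and the two binomials combine
  -- to one term with the factor l+2v. The proof checks this against the recurrence of `p`; both
  -- summands there have the factor (l+v)!, and `path-sum` adds them.
  p-closed : ∀ l v n → l + v ≡ suc n → ι (2 * (l ! * v !)) ℚ.* p l v ≡ ι ((l + 2 * v) * n !)
  p-closed zero (suc v) .v refl = trans (ℚ.*-identityʳ _) (cong ι (trans (cong (2 *_) (ℕ.+-identityʳ (suc v * v !))) (sym (ℕ.*-assoc 2 (suc v) (v !)))))
  p-closed (suc l) zero n e with ℕ.suc-injective e
  ... | refl = trans (cong (ℚ._* ½) (trans (cong ι (cong (2 *_) (ℕ.*-identityʳ (suc l * l !)))) (ι-* 2 (suc l * l !))))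
    (trans (half (ι (suc l * l !))) (cong ι (cong₂ (λ m n → m * n !) (sym (ℕ.+-identityʳ (suc l))) (sym (ℕ.+-identityʳ l)))))
    where
    ι2½ : ι 2 ℚ.* ½ ≡ 1ℚ
    ι2½ = trans (cong (ℚ._* ½) (ι-+ 1 1)) (cong (λ i → (i ℚ.+ i) ℚ.* ½) ι-1)
    half : ∀ a → (ι 2 ℚ.* a) ℚ.* ½ ≡ a
    half a = trans (solve 3 (λ t a h → (t :* a) :* h := (t :* h) :* a) refl (ι 2) a ½) (trans (cong (ℚ._* a) ι2½) (ℚ.*-identityˡ a))
  p-closed (suc l) (suc v) n e with ℕ.suc-injective (trans e refl)
  ... | refl = begin
    ι (2 * ((suc l * l !) * (suc v * v !))) ℚ.* (p l (suc v) ℚ.+ p (suc l) v)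
      ≡⟨ ℚ.*-distribˡ-+ (ι (2 * ((suc l * l !) * (suc v * v !)))) (p l (suc v)) (p (suc l) v) ⟩
    ι (2 * ((suc l * l !) * (suc v * v !))) ℚ.* p l (suc v) ℚ.+ ι (2 * ((suc l * l !) * (suc v * v !))) ℚ.* p (suc l) v
      ≡⟨ cong₂ ℚ._+_ (term (suc l) (2 * (l ! * (suc v * v !))) ((l + 2 * suc v) * (l + v) !) (p l (suc v)) (path-left l v (l !) (v !)) (p-closed l (suc v) (l + v) (ℕ.+-suc l v)))
                     (term (suc v) (2 * ((suc l * l !) * v !)) ((suc l + 2 * v) * (l + v) !) (p (suc l) v) (path-right l v (l !) (v !)) (p-closed (suc l) v (l + v) refl)) ⟩
    ι (suc l * ((l + 2 * suc v) * (l + v) !)) ℚ.+ ι (suc v * ((suc l + 2 * v) * (l + v) !))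
      ≡⟨ ι-+ (suc l * ((l + 2 * suc v) * (l + v) !)) _ ⟨
    ι (suc l * ((l + 2 * suc v) * (l + v) !) + suc v * ((suc l + 2 * v) * (l + v) !))
      ≡⟨ cong ι (trans (path-sum l v ((l + v) !)) (cong (λ n → (suc l + 2 * suc v) * n !) (sym (ℕ.+-suc l v)))) ⟩
    ι ((suc l + 2 * suc v) * (l + suc v) !) ∎
    where
    term : ∀ k s r q {m} → m ≡ k * s → ι s ℚ.* q ≡ ι r → ι m ℚ.* q ≡ ι (k * r)
    term k s r q refl h = trans (cong (ℚ._* q) (ι-* k s)) (trans (ℚ.*-assoc (ι k) (ι s) q) (trans (cong (ι k ℚ.*_) h) (sym (ι-* k r))))

  -- the value of the n-th factor P₄(x, n) / 2, as a function of x and m = n - 1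
  qM : Mono
  qM = ↑ (fac (0 ∷ 1 ∷ [] , 1)) ∷ ↑ (fac (2 ∷ 3 ∷ [] , 0)) ∷ ↑ (fac (1 ∷ 1 ∷ [] , 0)) ∷ ↑ (fac (1 ∷ 3 ∷ [] , 2))
     ∷ ↓ (fac (0 ∷ 2 ∷ [] , 2)) ∷ ↓ (fac (2 ∷ 2 ∷ [] , 0)) ∷ ↓ (fac (1 ∷ 2 ∷ [] , 1)) ∷ ↓ (fac (1 ∷ 2 ∷ [] , 0)) ∷ []

  Q : ℕ → ℕ → ℚ
  Q x zero    = 1ℚ
  Q x (suc n) = Q x n ℚ.* eval qM (x ∷ n ∷ [])

  Q≢0 : ∀ x n → Q x n ≢ 0ℚ
  Q≢0 x zero    = 1≢0
  Q≢0 x (suc n) = *≢0 (Q x n) (eval qM (x ∷ n ∷ [])) (Q≢0 x n) (eval≢0 qM (x ∷ n ∷ []))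

  -- (x + 3j + 2) / 2
  kM : Mono
  kM = ↑ (lin (1 ∷ 3 ∷ [] , 1)) ∷ ↓ two ∷ []

  κ : ℕ → ℕ → ℚ
  κ x j = eval kM (x ∷ j ∷ [])

  -- The numerator l+2v of the path count is x+3j+2, free of i, so it scales whole columns; what is
  -- left is the entry with X = x and Y = 1.
  entry-ab : ∀ x i j → A[ x ] (suc i) (suc j) ≡ κ x j ℚ.* ab x 1 i j
  entry-ab x i j = trans (cong₂ (λ b b′ → if b ∧ b′ then p (x + 2 * suc i ∸ suc (suc j)) (2 * suc j ∸ suc i) else 0ℚ) cond₂ cond₁)
      (trans (cong₂ (λ l v → if (i ≤ᵇ suc (j + j)) ∧ (j ≤ᵇ x + (i + i)) then p l v else 0ℚ) (∸-shift₁ x i j) (cong (_∸ suc i) (+-shift₂ j)))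
             (go (i ≤ᵇ suc (j + j)) (j ≤ᵇ x + (i + i)) refl refl))
    where
    cond₂ : (suc i ≤ᵇ 2 * suc j) ≡ (i ≤ᵇ suc (j + j))
    cond₂ = trans (cong (suc i ≤ᵇ_) (+-shift₂ j)) (≤ᵇ-suc-suc i (suc (j + j)))
    <ᵇ-suc : ∀ m n → (m <ᵇ suc n) ≡ (m ≤ᵇ n)
    <ᵇ-suc zero    n = refl
    <ᵇ-suc (suc m) n = refl
    cond₁ : (suc j <ᵇ x + 2 * suc i) ≡ (j ≤ᵇ x + (i + i))
    cond₁ = trans (cong (suc j <ᵇ_) (+-shift₁ x i)) (<ᵇ-suc j (x + (i + i)))
    go : ∀ b b′ → (i ≤ᵇ suc (j + j)) ≡ b → (j ≤ᵇ x + (i + i)) ≡ b′ →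
         (if b ∧ b′ then p (x + (i + i) ∸ j) (suc (j + j) ∸ i) else 0ℚ)
         ≡ κ x j ℚ.* (if b′ ∧ b then ι ((x + 1 + i + j ∸ 1) !) ℚ.* inv (ι ((x + (i + i) ∸ j) !) ℚ.* ι ((suc (j + j) ∸ i) !)) else 0ℚ)
    go false false _ _ = sym (ℚ.*-zeroʳ (κ x j))
    go false true  _ _ = sym (ℚ.*-zeroʳ (κ x j))
    go true  false _ _ = sym (ℚ.*-zeroʳ (κ x j))
    go true  true  f e = *-cancelˡ (ι (2 * (l ! * v !))) (p l v) (κ x j ℚ.* (ι ((x + 1 + i + j ∸ 1) !) ℚ.* inv (ι (l !) ℚ.* ι (v !))))
        (ι≢0 (2 * (l ! * v !)) {{ℕ.m*n≢0 2 (l ! * v !) {{_}} {{ℕ.m*n≢0 (l !) (v !) {{l ℕ.!≢0}} {{v ℕ.!≢0}}}}}})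
        (begin
          ι (2 * (l ! * v !)) ℚ.* p l v
            ≡⟨ p-closed l v (x + i + j) (path-length l v i j x l+j v+i) ⟩
          ι ((l + 2 * v) * n !)
            ≡⟨ trans (cong (λ k → ι (k * n !)) (trans (weight-numerator l v i j x l+j v+i) (three-lin x j))) (ι-* (suc (suc ((j + (j + j)) + x))) (n !)) ⟩
          ι k ℚ.* ι (n !)
            ≡⟨ solve 2 (λ k n → k :* n := (con 1ℚ :* con 1ℚ) :* (k :* con 1ℚ) :* n) refl (ι k) (ι (n !)) ⟩
          (1ℚ ℚ.* 1ℚ) ℚ.* (ι k ℚ.* 1ℚ) ℚ.* ι (n !)
            ≡⟨ cong₂ (λ a b → (a ℚ.* b) ℚ.* (ι k ℚ.* 1ℚ) ℚ.* ι (n !)) (inv-inverse (ι 2) (ι-suc≢0 1)) (inv-inverse lv lv≢0) ⟨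
          (ι 2 ℚ.* inv (ι 2)) ℚ.* (lv ℚ.* inv lv) ℚ.* (ι k ℚ.* 1ℚ) ℚ.* ι (n !)
            ≡⟨ solve 6 (λ t s l m k n → (t :* s) :* (l :* m) :* (k :* con 1ℚ) :* n := (t :* l) :* ((k :* (s :* con 1ℚ)) :* (n :* m))) refl
                 (ι 2) (inv (ι 2)) lv (inv lv) (ι k) (ι (n !)) ⟩
          (ι 2 ℚ.* lv) ℚ.* (κ x j ℚ.* (ι (n !) ℚ.* inv lv))
            ≡⟨ cong₂ (λ a b → a ℚ.* (κ x j ℚ.* (ι (b !) ℚ.* inv lv))) (sym (trans (ι-* 2 (l ! * v !)) (cong (ι 2 ℚ.*_) (ι-* (l !) (v !)))))
                 (cong (λ m → m + i + j ∸ 1) (sym (ℕ.+-comm x 1))) ⟩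
          ι (2 * (l ! * v !)) ℚ.* (κ x j ℚ.* (ι ((x + 1 + i + j ∸ 1) !) ℚ.* inv lv)) ∎)
      where
      l = x + (i + i) ∸ j
      v = suc (j + j) ∸ i
      n = x + i + j
      k = suc (suc ((j + (j + j)) + x))
      lv = ι (l !) ℚ.* ι (v !)
      lv≢0 : lv ≢ 0ℚ
      lv≢0 = *≢0 (ι (l !)) (ι (v !)) (ι≢0 (l !) {{l ℕ.!≢0}}) (ι≢0 (v !) {{v ℕ.!≢0}})
      l+j : l + j ≡ x + (i + i)
      l+j = ℕ.m∸n+n≡m (ℕ.≤ᵇ⇒≤ j (x + (i + i)) (subst Data.Bool.Base.T (sym e) _))
      v+i : v + i ≡ suc (j + j)
      v+i = ℕ.m∸n+n≡m (ℕ.≤ᵇ⇒≤ i (suc (j + j)) (subst Data.Bool.Base.T (sym f) _))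

  desc≡ : ∀ q n → desc q n ≡ map (λ i → q + suc i) (downFrom n)
  desc≡ q zero    = refl
  desc≡ q (suc n) = cong (q + suc n ∷_) (desc≡ q n)

  det-desc : ∀ (m : ℕ → ℕ → ℚ) q r n → det m (desc r n) (desc q n) ≡ Δ (λ i j → m (q + suc i) (r + suc j)) n
  det-desc m q r n = trans (cong₂ (det m) (desc≡ r n) (desc≡ q n)) (trans
    (det-map-rows (λ i → q + suc i) m (map (λ j → r + suc j) (downFrom n)) (downFrom n))
    (det-map-cols (λ j → r + suc j) (λ i → m (q + suc i)) (downFrom n) (downFrom n)))

  det-Q : ∀ x n → det A[ x ] (desc 0 n) (desc 0 n) ≡ Q x n
  det-Q x n = begin
    det A[ x ] (desc 0 n) (desc 0 n)                       ≡⟨ det-desc A[ x ] 0 0 n ⟩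
    Δ (λ i j → A[ x ] (suc i) (suc j)) n                   ≡⟨ Δ-cong n (entry-ab x) ⟩
    Δ (λ i j → κ x j ℚ.* ab x 1 i j) n                     ≡⟨ det-scale (κ x) (ab x 1) (downFrom n) (downFrom n) ⟩
    prodL (κ x) (downFrom n) ℚ.* Δ (ab x 1) n              ≡⟨ cong (prodL (κ x) (downFrom n) ℚ.*_) (AndrewsBurge n x 1 x (ℕ.+-comm 1 x)) ⟩
    prodL (κ x) (downFrom n) ℚ.* H x 1 x n                 ≡⟨ factors n ⟩
    Q x n                                                  ∎
    where
    factor : ∀ n → κ x n ℚ.* eval hM (x ∷ 1 ∷ x ∷ n ∷ []) ≡ eval qM (x ∷ n ∷ [])
    factor n = trans (cong (κ x n ℚ.*_) (eval-sub hM σ (x ∷ n ∷ []))) (trans (sym (eval-++ kM (sub σ hM) (x ∷ n ∷ [])))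
      (mono (kM ++ sub σ hM) qM (x ∷ n ∷ []) refl))
      where
      σ : List Form
      σ = (1 ∷ [] , 0) ∷ ([] , 1) ∷ (1 ∷ [] , 0) ∷ (0 ∷ 1 ∷ [] , 0) ∷ []
    factors : ∀ n → prodL (κ x) (downFrom n) ℚ.* H x 1 x n ≡ Q x n
    factors zero    = refl
    factors (suc n) = trans (solve 4 (λ k l h e → (k :* l) :* (h :* e) := (l :* h) :* (k :* e)) refl (κ x n) (prodL (κ x) (downFrom n)) (H x 1 x n) (eval hM (x ∷ 1 ∷ x ∷ n ∷ [])))
      (cong₂ ℚ._*_ (factors n) (factor n))

-- Minors with a gap in the row set: block structure and the Plücker relation.

module GapMinor where

  open Determinant
  open Monomial hiding (two)
  open Condensation
  open Region using (p; A[_]; desc; ≤ᵇ-true; ≤ᵇ-false)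
  open CornerMinor
  open import Data.List.Membership.Propositional using (_∈_)
  open import Data.List.Relation.Unary.All as All using (All; []; _∷_)
  open import Data.List.Relation.Unary.Any using (here; there)

  module GapMinorArith where
    open ℕSolver

    shift-t : ∀ a t → a + suc a + suc t ≡ t + 2 * suc a
    shift-t = solve 2 (λ a t → a :+ (con 1 :+ a) :+ (con 1 :+ t) := t :+ con 2 :* (con 1 :+ a)) refl

    shift-u : ∀ a u → 2 * (a + suc u) ≡ 2 * u + 2 * suc a
    shift-u = solve 2 (λ a u → con 2 :* (a :+ (con 1 :+ u)) := con 2 :* u :+ con 2 :* (con 1 :+ a)) refl

    shift-x : ∀ x a t → x + 2 * (a + suc a + suc t) ≡ suc (a + (x + 3 * suc a + 2 * t))
    shift-x = solve 3 (λ x a t → x :+ con 2 :* (a :+ (con 1 :+ a) :+ (con 1 :+ t)) := con 1 :+ (a :+ (x :+ con 3 :* (con 1 :+ a) :+ con 2 :* t))) refl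

    two : ∀ p → 2 * suc p ≡ p + (2 + p)
    two = solve 1 (λ p → con 2 :* (con 1 :+ p) := p :+ (con 2 :+ p)) refl

    twice : ∀ a → suc (2 * a) ≡ a + suc a
    twice = solve 1 (λ a → con 1 :+ con 2 :* a := a :+ (con 1 :+ a)) refl

    twice′ : ∀ a → 2 * suc a ≡ suc (a + suc a)
    twice′ = solve 1 (λ a → con 2 :* (con 1 :+ a) := con 1 :+ (a :+ (con 1 :+ a))) refl

    three : ∀ x a → x + 3 * suc a + 0 ≡ suc (suc (x + (a + (a + a)) + 1))
    three = solve 2 (λ x a → x :+ con 3 :* (con 1 :+ a) :+ con 0 := con 2 :+ (x :+ (a :+ (a :+ a)) :+ con 1)) refl

  open GapMinorArith
  open ℚSolver using (solve; _:+_; _:*_; _:-_; :-_; _:=_; con)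
  open ≡-Reasoning

  private variable A B : Set

  E-cong-del : ∀ {φ : A → ℚ} {F G : List A → ℚ} as →
               (∀ ws → suc (length ws) ≡ length as → (∀ a → a ∈ ws → a ∈ as) → F ws ≡ G ws) → E φ F as ≡ E φ G as
  E-cong-del []       e = refl
  E-cong-del {φ = φ} (a ∷ as) e = cong₂ (λ f g → φ a ℚ.* f ℚ.- g) (e as refl (λ _ → there))
    (E-cong-del as (λ ws l s → e (a ∷ ws) (cong suc l) (λ { _ (here q) → here q ; b (there b∈) → there (s b b∈) })))

  -- Expanding along the columns `cs` uses up at most one row of `as` each time, so some row of `as`
  -- is left that vanishes on all remaining columns.
  det-overfull : ∀ (m : A → B → ℚ) cs ds as bs → (∀ a → a ∈ as → ∀ d → d ∈ ds → m a d ≡ 0ℚ) → length cs < length as →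
                 det m (cs ++ ds) (as ++ bs) ≡ 0ℚ
  det-overfull m []       ds (a ∷ as) bs z lt = trans (det-expand-row m ds a (as ++ bs)) (E-zeroˡ _ ds (All.tabulate (λ d∈ → z a (here refl) _ d∈)))
  det-overfull m (c ∷ cs) ds as bs z lt = trans (E-++ (λ a → m a c) (det m (cs ++ ds)) as bs) (trans
    (cong₂ (λ x y → x ℚ.+ sgn (length as) ℚ.* y)
      (trans (E-cong-del {G = λ _ → 0ℚ} as (λ ws l s → det-overfull m cs ds ws bs (λ a a∈ → z a (s a a∈))
           (ℕ.≤-pred (subst (suc (suc (length cs)) ≤_) (sym l) lt)))) (E-zeroʳ _ as (λ _ → refl)))
      (E-zeroʳ (λ a → m a c) bs (λ ws → det-overfull m cs ds as ws z (ℕ.<-trans (ℕ.n<1+n _) lt))))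
    (solve 1 (λ s → con 0ℚ :+ s :* con 0ℚ := con 0ℚ) refl (sgn (length as))))

  -- If a column of `cs` is expanded along a row of `bs`, too many rows of `as` remain and
  -- `det-overfull` applies; the other terms give the product.
  det-block : ∀ (m : A → B → ℚ) cs ds as bs → (∀ a → a ∈ as → ∀ d → d ∈ ds → m a d ≡ 0ℚ) → length cs ≡ length as →
              det m (cs ++ ds) (as ++ bs) ≡ det m cs as ℚ.* det m ds bs
  det-block m []       ds []       bs z e = sym (ℚ.*-identityˡ (det m ds bs))
  det-block m (c ∷ cs) ds as bs z e = begin
    E (λ a → m a c) (det m (cs ++ ds)) (as ++ bs)
      ≡⟨ E-++ (λ a → m a c) (det m (cs ++ ds)) as bs ⟩
    E (λ a → m a c) (λ ws → det m (cs ++ ds) (ws ++ bs)) as ℚ.+ sgn (length as) ℚ.* E (λ a → m a c) (λ ws → det m (cs ++ ds) (as ++ ws)) bs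
      ≡⟨ cong₂ (λ x y → x ℚ.+ sgn (length as) ℚ.* y)
           (E-cong-del {G = λ ws → det m ds bs ℚ.* det m cs ws} as (λ ws l s → trans (det-block m cs ds ws bs (λ a a∈ → z a (s a a∈))
              (ℕ.suc-injective (trans e (sym l)))) (ℚ.*-comm (det m cs ws) (det m ds bs))))
           (E-zeroʳ (λ a → m a c) bs (λ ws → det-overfull m cs ds as ws z (ℕ.≤-reflexive e))) ⟩
    E (λ a → m a c) (λ ws → det m ds bs ℚ.* det m cs ws) as ℚ.+ sgn (length as) ℚ.* 0ℚ
      ≡⟨ cong (ℚ._+ sgn (length as) ℚ.* 0ℚ) (E-scale (λ a → m a c) (det m cs) (det m ds bs) as) ⟩
    det m ds bs ℚ.* det m (c ∷ cs) as ℚ.+ sgn (length as) ℚ.* 0ℚ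
      ≡⟨ solve 3 (λ d e s → d :* e :+ s :* con 0ℚ := e :* d) refl (det m ds bs) (det m (c ∷ cs) as) (sgn (length as)) ⟩
    det m (c ∷ cs) as ℚ.* det m ds bs ∎

  -- Each product moves two vectors past `U`, so the signs occur squared, and the rows can stay in
  -- their natural order.
  plücker-rows : ∀ c cs → (∀ b → b ∈ cs → b ≢ c) → ∀ (γ β α : ℕ → ℚ) U V → let D = det apply (c ∷ cs); D′ = det apply cs in
    D′ (γ ∷ U ++ V) ℚ.* D (U ++ β ∷ α ∷ V) ℚ.+ D′ (U ++ α ∷ V) ℚ.* D (γ ∷ U ++ β ∷ V) ≡ D′ (U ++ β ∷ V) ℚ.* D (γ ∷ U ++ α ∷ V)
  plücker-rows c cs c∉ γ β α U V = begin
    D′ (γ ∷ U ++ V) ℚ.* D (U ++ β ∷ α ∷ V) ℚ.+ D′ (U ++ α ∷ V) ℚ.* D (γ ∷ U ++ β ∷ V)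
      ≡⟨ cong₂ (λ x y → D′ (γ ∷ U ++ V) ℚ.* x ℚ.+ y) two-moves (cong₂ ℚ._*_ (move′ α) (moveγ β)) ⟩
    D′ (γ ∷ S) ℚ.* (s ℚ.* (s ℚ.* D (β ∷ α ∷ S))) ℚ.+ (s ℚ.* D′ (α ∷ S)) ℚ.* (s ℚ.* D (γ ∷ β ∷ S))
      ≡⟨ solve 5 (λ s a b c d → a :* (s :* (s :* b)) :+ (s :* c) :* (s :* d) := (s :* s) :* (a :* b :+ c :* d)) refl s (D′ (γ ∷ S)) (D (β ∷ α ∷ S)) (D′ (α ∷ S)) (D (γ ∷ β ∷ S)) ⟩
    (s ℚ.* s) ℚ.* (D′ (γ ∷ S) ℚ.* D (β ∷ α ∷ S) ℚ.+ D′ (α ∷ S) ℚ.* D (γ ∷ β ∷ S))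
      ≡⟨ cong ((s ℚ.* s) ℚ.*_) rel ⟩
    (s ℚ.* s) ℚ.* (D′ (β ∷ S) ℚ.* D (γ ∷ α ∷ S))
      ≡⟨ solve 3 (λ s a b → (s :* s) :* (a :* b) := (s :* a) :* (s :* b)) refl s (D′ (β ∷ S)) (D (γ ∷ α ∷ S)) ⟩
    (s ℚ.* D′ (β ∷ S)) ℚ.* (s ℚ.* D (γ ∷ α ∷ S))
      ≡⟨ cong₂ ℚ._*_ (move′ β) (moveγ α) ⟨
    D′ (U ++ β ∷ V) ℚ.* D (γ ∷ U ++ α ∷ V) ∎
    where
    D D′ : List (ℕ → ℚ) → ℚ
    D  = det apply (c ∷ cs)
    D′ = det apply cs
    S = U ++ V
    s = sgn (length U)
    altD : Alternating D
    altD = det-alternating apply (c ∷ cs)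
    move′ : ∀ v → D′ (U ++ v ∷ V) ≡ s ℚ.* D′ (v ∷ S)
    move′ v = move-front D′ (det-alternating apply cs) U v V
    moveγ : ∀ v → D (γ ∷ U ++ v ∷ V) ≡ s ℚ.* D (γ ∷ v ∷ S)
    moveγ v = move-front (λ ws → D (γ ∷ ws)) (alternating-∷ D γ altD) U v V
    two-moves : D (U ++ β ∷ α ∷ V) ≡ s ℚ.* (s ℚ.* D (β ∷ α ∷ S))
    two-moves = trans (move-front D altD U β (α ∷ V)) (cong (s ℚ.*_) (move-front (λ ws → D (β ∷ ws)) (alternating-∷ D β altD) U α V))
    rel : D′ (γ ∷ S) ℚ.* D (β ∷ α ∷ S) ℚ.+ D′ (α ∷ S) ℚ.* D (γ ∷ β ∷ S) ≡ D′ (β ∷ S) ℚ.* D (γ ∷ α ∷ S)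
    rel = trans (solve 3 (λ a b c → a :+ c := (a :- b :+ c) :+ b) refl (D′ (γ ∷ S) ℚ.* D (β ∷ α ∷ S)) (D′ (β ∷ S) ℚ.* D (γ ∷ α ∷ S)) (D′ (α ∷ S) ℚ.* D (γ ∷ β ∷ S)))
      (trans (cong (ℚ._+ D′ (β ∷ S) ℚ.* D (γ ∷ α ∷ S)) (plücker-col c cs c∉ γ β α S)) (ℚ.+-identityˡ _))

  -- The minor on rows 1, …, p, p+a+1, …, p+a+z and the first p+z columns.
  gap : ℕ → ℕ → ℕ → ℕ → ℚ
  gap x p a z = det A[ x ] (desc 0 (p + z)) (desc (p + a) z ++ desc 0 p)

  desc-snoc : ∀ q n → desc q (suc n) ≡ desc (suc q) n ++ suc q ∷ []
  desc-snoc q zero    = cong (_∷ []) (ℕ.+-comm q 1)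
  desc-snoc q (suc n) = cong₂ _∷_ (ℕ.+-suc q (suc n)) (desc-snoc q n)

  desc-++ : ∀ p z → desc 0 (p + z) ≡ desc p z ++ desc 0 p
  desc-++ p zero    = cong (desc 0) (ℕ.+-identityʳ p)
  desc-++ p (suc z) = trans (cong (desc 0) (ℕ.+-suc p z)) (cong₂ _∷_ (sym (ℕ.+-suc p z)) (desc-++ p z))

  desc-bounds : ∀ q n t → t ∈ desc q n → q < t × t ≤ q + n
  desc-bounds q (suc n) t (here refl) = subst (q <_) (sym (ℕ.+-suc q n)) (s≤s (ℕ.m≤m+n q n)) , ≤-refl
  desc-bounds q (suc n) t (there t∈) with (lo , hi) ← desc-bounds q n t t∈ = lo , ≤-trans hi (ℕ.+-monoʳ-≤ q (ℕ.n≤1+n n))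

  length-desc : ∀ q n → length (desc q n) ≡ n
  length-desc q zero    = refl
  length-desc q (suc n) = cong suc (length-desc q n)

  gap-0 : ∀ x p z → gap x p 0 z ≡ Q x (p + z)
  gap-0 x p z = trans (cong (λ q → det A[ x ] (desc 0 (p + z)) (desc q z ++ desc 0 p)) (ℕ.+-identityʳ p))
    (trans (cong (det A[ x ] (desc 0 (p + z))) (sym (desc-++ p z))) (det-Q x (p + z)))

  gap-empty : ∀ x p a → gap x p a 0 ≡ Q x p
  gap-empty x p a = trans (cong (λ n → det A[ x ] (desc 0 n) (desc 0 p)) (ℕ.+-identityʳ p)) (det-Q x p)

  gap-vec : ∀ x p a z n r → p + z ≡ n → p + a ≡ r →
            gap x p a z ≡ det apply (desc 0 n) (map A[ x ] (desc r z) ++ map A[ x ] (desc 0 p))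
  gap-vec x p a z _ _ refl refl = trans (sym (det-map-rows A[ x ] apply (desc 0 (p + z)) (desc (p + a) z ++ desc 0 p)))
    (cong (det apply (desc 0 (p + z))) (map-++ A[ x ] (desc (p + a) z) (desc 0 p)))

  -- The rows involved are `α`, the first row of the gap of length g+1 after p, then `β`, the first
  -- row after it, and `γ`, the row that follows its z+1 upper rows. Adding or omitting these three
  -- changes p, the gap and z; the unit vector of the last column makes up for the difference in
  -- size.
  gap-plücker : ∀ x p g z → gap x p (2 + g) (suc z) ℚ.* gap x (suc p) g (suc z) ℚ.+ gap x (suc p) (suc g) z ℚ.* gap x p (suc g) (2 + z)
                ≡ gap x p (suc g) (suc z) ℚ.* gap x (suc p) (suc g) (suc z)
  gap-plücker x p g z = begin
    gap x p (2 + g) (suc z) ℚ.* gap x (suc p) g (suc z) ℚ.+ gap x (suc p) (suc g) z ℚ.* gap x p (suc g) (2 + z)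
      ≡⟨ cong₂ ℚ._+_ (cong₂ ℚ._*_ (gap-vec x p (2 + g) (suc z) (suc (p + z)) (suc q) (ℕ.+-suc p z) (trans (ℕ.+-suc p (suc g)) (cong suc (ℕ.+-suc p g))))
                              (trans (gap-vec x (suc p) g (suc z) c q (cong suc (ℕ.+-suc p z)) refl) (cong D (tail (m α ∷ V)))))
                     (cong₂ ℚ._*_ (gap-vec x (suc p) (suc g) z (suc (p + z)) (suc q) refl (cong suc (ℕ.+-suc p g)))
                              (trans (gap-vec x p (suc g) (2 + z) c q (trans (ℕ.+-suc p (suc z)) (cong suc (ℕ.+-suc p z))) (ℕ.+-suc p g))
                                     (cong₂ (λ r us → D (m r ∷ us)) (ℕ.+-suc q (suc z)) (tail V)))) ⟩
    D′ (m γ ∷ U ++ V) ℚ.* D (U ++ m β ∷ m α ∷ V) ℚ.+ D′ (U ++ m α ∷ V) ℚ.* D (m γ ∷ U ++ m β ∷ V)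
      ≡⟨ plücker-rows c cs c∉ (m γ) (m β) (m α) U V ⟩
    D′ (U ++ m β ∷ V) ℚ.* D (m γ ∷ U ++ m α ∷ V)
      ≡⟨ cong₂ ℚ._*_ (trans (gap-vec x p (suc g) (suc z) (suc (p + z)) q (ℕ.+-suc p z) (ℕ.+-suc p g)) (cong D′ (tail V)))
                     (gap-vec x (suc p) (suc g) (suc z) c (suc q) (cong suc (ℕ.+-suc p z)) (cong suc (ℕ.+-suc p g))) ⟨
    gap x p (suc g) (suc z) ℚ.* gap x (suc p) (suc g) (suc z) ∎
    where
    q = suc p + g
    c = suc (suc (p + z))
    cs = desc 0 (suc (p + z))
    m : ℕ → ℕ → ℚ
    m = A[ x ]
    α = suc p
    β = suc q
    γ = suc q + suc z
    U = map m (desc (suc q) z)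
    V = map m (desc 0 p)
    D D′ : List (ℕ → ℚ) → ℚ
    D  = det apply (c ∷ cs)
    D′ = det apply cs
    c∉ : ∀ b → b ∈ cs → b ≢ c
    c∉ b b∈ refl = ℕ.<-irrefl refl (proj₂ (desc-bounds 0 (suc (p + z)) c b∈))
    tail : ∀ ws → map m (desc q (suc z)) ++ ws ≡ U ++ m β ∷ ws
    tail ws = trans (cong (_++ ws) (trans (cong (map m) (desc-snoc q z)) (map-++ m (desc (suc q) z) (suc q ∷ []))))
                    (++-assoc U (m β ∷ []) ws)

  A-zero : ∀ x t u → 2 * u < t → A[ x ] t u ≡ 0ℚ
  A-zero x t u lt rewrite ≤ᵇ-false lt = refl

  -- More than z rows vanish on the first p+1 columns.
  gap-overfull : ∀ x p z → gap x p (2 + p) (suc z) ≡ 0ℚ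
  gap-overfull x p z = trans (cong (λ cs → det A[ x ] cs (desc (p + (2 + p)) (suc z) ++ desc 0 p)) (trans (cong (desc 0) (ℕ.+-suc p z)) (desc-++ (suc p) z)))
    (det-overfull A[ x ] (desc (suc p) z) (desc 0 (suc p)) (desc (p + (2 + p)) (suc z)) (desc 0 p)
      (λ t t∈ u u∈ → A-zero x t u (ℕ.≤-<-trans (ℕ.≤-trans (ℕ.*-monoʳ-≤ 2 (proj₂ (desc-bounds 0 (suc p) u u∈))) (ℕ.≤-reflexive (two p))) (proj₁ (desc-bounds (p + (2 + p)) (suc z) t t∈))))
      (subst₂ _<_ (sym (length-desc (suc p) z)) (sym (length-desc (p + (2 + p)) (suc z))) ≤-refl))

  -- Moving the row by 2(a+1) and the column by a+1 keeps 2u-t and raises x+2t-u-1 by 3(a+1).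
  A-shift : ∀ x a t u → A[ x ] (a + suc a + suc t) (a + suc u) ≡ A[ x + 3 * suc a ] t u
  A-shift x a t u = trans (cong₂ (λ m n → if (m ≤ᵇ n) ∧ (a + suc u <ᵇ x + 2 * (a + suc a + suc t)) then p (x + 2 * (a + suc a + suc t) ∸ suc (a + suc u)) (n ∸ m) else 0ℚ)
       (shift-t a t) (shift-u a u))
    (trans (cong₂ (λ m n → if (t + 2 * suc a ≤ᵇ 2 * u + 2 * suc a) ∧ (m <ᵇ n) then p (n ∸ suc m) (2 * u + 2 * suc a ∸ (t + 2 * suc a)) else 0ℚ)
         (ℕ.+-suc a u) (shift-x x a t))
    (trans (cong₂ (λ b b′ → if b ∧ b′ then p (a + X ∸ suc (a + u)) (2 * u + 2 * suc a ∸ (t + 2 * suc a)) else 0ℚ) (≤ᵇ-+ t (2 * u) (2 * suc a)) (<ᵇ-+ a u X))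
    (cong₂ (λ l v → if (t ≤ᵇ 2 * u) ∧ (u <ᵇ X) then p l v else 0ℚ) (trans (cong (a + X ∸_) (sym (ℕ.+-suc a u))) (ℕ.[m+n]∸[m+o]≡n∸o a X (suc u))) ([m+o]∸[n+o] (2 * u) t (2 * suc a)))))
    where
    X = x + 3 * suc a + 2 * t
    [m+o]∸[n+o] : ∀ m n o → (m + o) ∸ (n + o) ≡ m ∸ n
    [m+o]∸[n+o] m n o = trans (cong₂ _∸_ (ℕ.+-comm m o) (ℕ.+-comm n o)) (ℕ.[m+n]∸[m+o]≡n∸o o m n)
    ≤ᵇ-+ : ∀ m n o → (m + o ≤ᵇ n + o) ≡ (m ≤ᵇ n)
    ≤ᵇ-+ m n o with ℕ.<-≤-connex n m
    ... | inj₁ lt = trans (≤ᵇ-false (ℕ.+-monoˡ-< o lt)) (sym (≤ᵇ-false lt))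
    ... | inj₂ le = trans (≤ᵇ-true (ℕ.+-monoˡ-≤ o le)) (sym (≤ᵇ-true le))
    <ᵇ-+ : ∀ o m n → (suc (o + m) <ᵇ suc (o + n)) ≡ (m <ᵇ n)
    <ᵇ-+ zero    m n = refl
    <ᵇ-+ (suc o) m n = <ᵇ-+ o m n

  det-shift : ∀ x a n → det A[ x ] (desc (suc a) n) (desc (suc (a + suc a)) n) ≡ Q (x + 3 * suc a) n
  det-shift x a n = trans (det-desc A[ x ] (suc (a + suc a)) (suc a) n)
    (trans (Δ-cong n (λ i j → trans (cong₂ A[ x ] (sym (ℕ.+-suc (a + suc a) (suc i))) (sym (ℕ.+-suc a (suc j)))) (A-shift x a (suc i) (suc j))))
      (trans (sym (det-desc A[ x + 3 * suc a ] 0 0 n)) (det-Q (x + 3 * suc a) n)))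

  -- The case y = 0: the gap is so long that the rows above it vanish on the first a columns. Of
  -- these rows only the lowest meets column a+1, in the entry 1/2 of a path with horizontal steps
  -- alone; the other rows form a translated corner.
  gap-block : ∀ x a z → gap x a (suc a) (suc z) ≡ ½ ℚ.* Q (x + 3 * suc a) z ℚ.* Q x a
  gap-block x a z = begin
    det m (desc 0 (a + suc z)) (rows ++ desc 0 a)
      ≡⟨ cong (λ cs → det m cs (rows ++ desc 0 a)) (desc-++ a (suc z)) ⟩
    det m (desc a (suc z) ++ desc 0 a) (rows ++ desc 0 a)
      ≡⟨ det-block m (desc a (suc z)) (desc 0 a) rows (desc 0 a) vanish (trans (length-desc a (suc z)) (sym (length-desc _ (suc z)))) ⟩
    det m (desc a (suc z)) rows ℚ.* det m (desc 0 a) (desc 0 a)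
      ≡⟨ cong₂ ℚ._*_ (trans (cong₂ (det m) (desc-snoc a z) (desc-snoc (a + suc a) z)) corner) (det-Q x a) ⟩
    ½ ℚ.* Q (x + 3 * suc a) z ℚ.* Q x a ∎
    where
    m = A[ x ]
    rows = desc (a + suc a) (suc z)
    vanish : ∀ t → t ∈ rows → ∀ u → u ∈ desc 0 a → m t u ≡ 0ℚ
    vanish t t∈ u u∈ = A-zero x t u (ℕ.≤-<-trans (ℕ.≤-trans (ℕ.*-monoʳ-≤ 2 (proj₂ (desc-bounds 0 a u u∈))) (ℕ.≤-trans (ℕ.n≤1+n (2 * a)) (ℕ.≤-reflexive (twice a))))
                         (proj₁ (desc-bounds (a + suc a) (suc z) t t∈)))
    vanish′ : ∀ t → t ∈ desc (suc (a + suc a)) z → ∀ u → u ∈ suc a ∷ [] → m t u ≡ 0ℚ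
    vanish′ t t∈ u (here refl) = A-zero x t u (ℕ.≤-<-trans (ℕ.≤-reflexive (twice′ a)) (proj₁ (desc-bounds (suc (a + suc a)) z t t∈)))
    one : m (suc (a + suc a)) (suc a) ≡ ½
    one = trans (cong₂ m (sym (ℕ.+-comm (a + suc a) 1)) (sym (ℕ.+-comm a 1))) (trans (A-shift x a 0 0) (base (x + 3 * suc a) positive))
      where
      positive : x + 3 * suc a + 0 ≡ suc (suc (x + (a + (a + a)) + 1))
      positive = three x a
      base : ∀ X → X + 0 ≡ suc (suc (x + (a + (a + a)) + 1)) → A[ X ] 0 0 ≡ ½
      base X e rewrite e = refl
    corner : det m (desc (suc a) z ++ suc a ∷ []) (desc (suc (a + suc a)) z ++ suc (a + suc a) ∷ []) ≡ ½ ℚ.* Q (x + 3 * suc a) z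
    corner = trans (det-block m (desc (suc a) z) (suc a ∷ []) (desc (suc (a + suc a)) z) (suc (a + suc a) ∷ []) vanish′
        (trans (length-desc (suc a) z) (sym (length-desc (suc (a + suc a)) z))))
      (trans (cong₂ ℚ._*_ (det-shift x a z) (trans (solve 1 (λ e → e :* con 1ℚ :- con 0ℚ := e) refl (m (suc (a + suc a)) (suc a))) one)) (ℚ.*-comm (Q (x + 3 * suc a) z) ½))

-- The closed form of the gap minors as a solution of the Plücker relation.

module GapFormula where

  open Monomial hiding (two)
  open Condensation using (eval-++₃)
  open CornerMinor
  open GapMinor

  module GapFormulaArith where
    open ℕSolver

    x+3a : ∀ x a → x + 3 * suc a ≡ 3 + ((a + (a + a)) + x)
    x+3a = solve 2 (λ x a → x :+ con 3 :* (con 1 :+ a) := con 3 :+ ((a :+ (a :+ a)) :+ x)) refl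

    three-term : ∀ x y a z →
      (1 + z) * ((4 + (((z + z) + (a + a)) + suc y)) * ((2 + (((z + (a + a)) + (suc y + suc y)) + x)) * ((6 + ((((z + z) + (a + (a + (a + (a + (a + a)))))) + (suc y + (suc y + suc y))) + (x + x))) * 1)))
      + (1 + a) * ((1 + y) * ((5 + (((a + (a + (a + a))) + (y + (y + y))) + (x + x))) * ((6 + ((((z + z) + (a + (a + a))) + (y + y)) + x)) * 1)))
      ≡ (2 + (z + a)) * ((2 + ((z + z) + suc y)) * ((4 + ((((z + z) + (a + (a + (a + a)))) + (suc y + (suc y + suc y))) + (x + x))) * ((3 + (((z + (a + (a + a))) + (suc y + suc y)) + x)) * 1)))
    three-term = solve 4 (λ x y a z → let y′ = con 1 :+ y in
      (con 1 :+ z) :* ((con 4 :+ (((z :+ z) :+ (a :+ a)) :+ y′)) :* ((con 2 :+ (((z :+ (a :+ a)) :+ (y′ :+ y′)) :+ x)) :* ((con 6 :+ ((((z :+ z) :+ (a :+ (a :+ (a :+ (a :+ (a :+ a)))))) :+ (y′ :+ (y′ :+ y′))) :+ (x :+ x))) :* con 1)))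
      :+ (con 1 :+ a) :* ((con 1 :+ y) :* ((con 5 :+ (((a :+ (a :+ (a :+ a))) :+ (y :+ (y :+ y))) :+ (x :+ x))) :* ((con 6 :+ ((((z :+ z) :+ (a :+ (a :+ a))) :+ (y :+ y)) :+ x)) :* con 1)))
      := (con 2 :+ (z :+ a)) :* ((con 2 :+ ((z :+ z) :+ y′)) :* ((con 4 :+ ((((z :+ z) :+ (a :+ (a :+ (a :+ a)))) :+ (y′ :+ (y′ :+ y′))) :+ (x :+ x))) :* ((con 3 :+ (((z :+ (a :+ (a :+ a))) :+ (y′ :+ y′)) :+ x)) :* con 1)))) refl

    two-term : ∀ x a z →
      (1 + z) * ((4 + (((z + z) + (a + a)) + 0)) * ((2 + (((z + (a + a)) + 0) + x)) * ((6 + ((((z + z) + (a + (a + (a + (a + (a + a)))))) + 0) + (x + x))) * 1)))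
      ≡ (2 + (z + a)) * ((2 + ((z + z) + 0)) * ((4 + ((((z + z) + (a + (a + (a + a)))) + 0) + (x + x))) * ((3 + (((z + (a + (a + a))) + 0) + x)) * 1)))
    two-term = solve 3 (λ x a z → let y = con 0 in
      (con 1 :+ z) :* ((con 4 :+ (((z :+ z) :+ (a :+ a)) :+ y)) :* ((con 2 :+ (((z :+ (a :+ a)) :+ y) :+ x)) :* ((con 6 :+ ((((z :+ z) :+ (a :+ (a :+ (a :+ (a :+ (a :+ a)))))) :+ y) :+ (x :+ x))) :* con 1)))
      := (con 2 :+ (z :+ a)) :* ((con 2 :+ ((z :+ z) :+ y)) :* ((con 4 :+ ((((z :+ z) :+ (a :+ (a :+ (a :+ a)))) :+ y) :+ (x :+ x))) :* ((con 3 :+ (((z :+ (a :+ (a :+ a))) :+ y) :+ x)) :* con 1)))) refl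

  open GapFormulaArith
  open ℚSolver using (solve; _:+_; _:*_; _:-_; :-_; _:=_; con)
  open ≡-Reasoning

  -- The ratio of the tiling generating functions for z+1 and z, as a function of
  -- x, y, a-1 and z.
  ρM : Mono
  ρM = ↓ (p2 ([] , 1))
     ∷ ↑ (fac (0 ∷ 0 ∷ 0 ∷ 1 ∷ [] , 0)) ∷ ↑ (fac (0 ∷ 1 ∷ 1 ∷ 1 ∷ [] , 1)) ∷ ↑ (fac (0 ∷ 1 ∷ 2 ∷ 2 ∷ [] , 2))
     ∷ ↑ (fac (2 ∷ 3 ∷ 4 ∷ 2 ∷ [] , 1)) ∷ ↑ (fac (2 ∷ 3 ∷ 6 ∷ 3 ∷ [] , 3)) ∷ ↑ (fac (1 ∷ 2 ∷ 3 ∷ 1 ∷ [] , 1))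
     ∷ ↑ (fac (1 ∷ 1 ∷ 2 ∷ 1 ∷ [] , 0)) ∷ ↑ (fac (1 ∷ 3 ∷ 3 ∷ 3 ∷ [] , 2))
     ∷ ↓ (fac (0 ∷ 0 ∷ 1 ∷ 1 ∷ [] , 1)) ∷ ↓ (fac (0 ∷ 1 ∷ 0 ∷ 2 ∷ [] , 0)) ∷ ↓ (fac (0 ∷ 2 ∷ 2 ∷ 2 ∷ [] , 2))
     ∷ ↓ (fac (2 ∷ 2 ∷ 4 ∷ 2 ∷ [] , 1)) ∷ ↓ (fac (2 ∷ 3 ∷ 6 ∷ 2 ∷ [] , 3)) ∷ ↓ (fac (1 ∷ 2 ∷ 2 ∷ 1 ∷ [] , 0))
     ∷ ↓ (fac (1 ∷ 2 ∷ 3 ∷ 2 ∷ [] , 2)) ∷ ↓ (fac (1 ∷ 2 ∷ 3 ∷ 2 ∷ [] , 1)) ∷ []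

  -- The third argument is the length of the gap minus one. A gap of length 0 follows another
  -- pattern, that of the corner minors `Q`, and is treated apart.
  G : ℕ → ℕ → ℕ → ℕ → ℚ
  G x y a zero    = Q x (y + a)
  G x y a (suc z) = G x y a z ℚ.* eval ρM (x ∷ y ∷ a ∷ z ∷ [])

  G≢0 : ∀ x y a z → G x y a z ≢ 0ℚ
  G≢0 x y a zero    = Q≢0 x (y + a)
  G≢0 x y a (suc z) = *≢0 (G x y a z) (eval ρM (x ∷ y ∷ a ∷ z ∷ [])) (G≢0 x y a z) (eval≢0 ρM (x ∷ y ∷ a ∷ z ∷ []))

  X₄ Y₄ A₄ Z₄ : Form
  X₄ = 1 ∷ [] , 0
  Y₄ = 0 ∷ 1 ∷ [] , 0
  A₄ = 0 ∷ 0 ∷ 1 ∷ [] , 0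
  Z₄ = 0 ∷ 0 ∷ 0 ∷ 1 ∷ [] , 0

  infixl 6 _+′_
  _+′_ : Form → ℕ → Form
  (cs , k) +′ n = cs , k + n

  eval-++₄ : ∀ k l m n ρ → eval k ρ ℚ.* (eval l ρ ℚ.* (eval m ρ ℚ.* eval n ρ)) ≡ eval (k ++ l ++ m ++ n) ρ
  eval-++₄ k l m n ρ = trans (cong (eval k ρ ℚ.*_) (eval-++₃ l m n ρ)) (sym (eval-++ k (l ++ m ++ n) ρ))

  -- Divided by its left side in the order of the overview, the Plücker relation reads num₁/den +
  -- num₂/den = 1, one summand for each product on the right. These are the linear factors that
  -- survive; `three-term` is the resulting polynomial identity.
  denA num₁A num₂A : List Atom
  denA  = lin (0 ∷ 0 ∷ 1 ∷ 1 ∷ [] , 1) ∷ lin (0 ∷ 1 ∷ 0 ∷ 2 ∷ [] , 1) ∷ lin (2 ∷ 3 ∷ 4 ∷ 2 ∷ [] , 3) ∷ lin (1 ∷ 2 ∷ 3 ∷ 1 ∷ [] , 2) ∷ []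
  num₁A = lin Z₄ ∷ lin (0 ∷ 1 ∷ 2 ∷ 2 ∷ [] , 3) ∷ lin (1 ∷ 2 ∷ 2 ∷ 1 ∷ [] , 1) ∷ lin (2 ∷ 3 ∷ 6 ∷ 2 ∷ [] , 5) ∷ []
  num₂A = lin A₄ ∷ lin Y₄ ∷ lin (2 ∷ 3 ∷ 4 ∷ [] , 4) ∷ lin (1 ∷ 2 ∷ 3 ∷ 2 ∷ [] , 5) ∷ []

  first-ratio : ∀ x y a z → let ρ = x ∷ y ∷ a ∷ z ∷ [] in
    G x (suc y) a z ℚ.* G x y a (2 + z) ℚ.* eval (map ↑ denA) ρ ≡ G x (suc y) a (suc z) ℚ.* G x y a (suc z) ℚ.* eval (map ↑ num₁A) ρ
  first-ratio x y a z = begin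
    g₁ ℚ.* (g₂ ℚ.* eval ρM (x ∷ y ∷ a ∷ suc z ∷ [])) ℚ.* eval (map ↑ denA) ρ
      ≡⟨ cong (λ e → g₁ ℚ.* (g₂ ℚ.* e) ℚ.* eval (map ↑ denA) ρ) (eval-sub ρM σ ρ) ⟩
    g₁ ℚ.* (g₂ ℚ.* eval (sub σ ρM) ρ) ℚ.* eval (map ↑ denA) ρ
      ≡⟨ solve 4 (λ g h e d → g :* (h :* e) :* d := g :* h :* (e :* d)) refl g₁ g₂ (eval (sub σ ρM) ρ) (eval (map ↑ denA) ρ) ⟩
    g₁ ℚ.* g₂ ℚ.* (eval (sub σ ρM) ρ ℚ.* eval (map ↑ denA) ρ)
      ≡⟨ cong (g₁ ℚ.* g₂ ℚ.*_) (trans (sym (eval-++ (sub σ ρM) (map ↑ denA) ρ)) (trans (mono (sub σ ρM ++ map ↑ denA) (sub τ ρM ++ map ↑ num₁A) ρ refl)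
           (eval-++ (sub τ ρM) (map ↑ num₁A) ρ))) ⟩
    g₁ ℚ.* g₂ ℚ.* (eval (sub τ ρM) ρ ℚ.* eval (map ↑ num₁A) ρ)
      ≡⟨ solve 4 (λ g h e d → g :* h :* (e :* d) := g :* e :* h :* d) refl g₁ g₂ (eval (sub τ ρM) ρ) (eval (map ↑ num₁A) ρ) ⟩
    g₁ ℚ.* eval (sub τ ρM) ρ ℚ.* g₂ ℚ.* eval (map ↑ num₁A) ρ
      ≡⟨ cong (λ e → g₁ ℚ.* e ℚ.* g₂ ℚ.* eval (map ↑ num₁A) ρ) (eval-sub ρM τ ρ) ⟨
    g₁ ℚ.* eval ρM (x ∷ suc y ∷ a ∷ z ∷ []) ℚ.* g₂ ℚ.* eval (map ↑ num₁A) ρ ∎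
    where
    ρ = x ∷ y ∷ a ∷ z ∷ []
    g₁ = G x (suc y) a z
    g₂ = G x y a (suc z)
    σ τ : List Form
    σ = X₄ ∷ Y₄ ∷ A₄ ∷ Z₄ +′ 1 ∷ []
    τ = X₄ ∷ Y₄ +′ 1 ∷ A₄ ∷ Z₄ ∷ []

  -- Induction step for a ratio of four products: the hypothesis on the old values and a
  -- cancellation among the new factors are multiplied together.
  cross : ∀ A B C D {a b c e} d n d⁺ n⁺ → d ≢ 0ℚ → A ℚ.* B ℚ.* d ≡ C ℚ.* D ℚ.* n →
          a ℚ.* (b ℚ.* (d⁺ ℚ.* n)) ≡ c ℚ.* (e ℚ.* (n⁺ ℚ.* d)) → (A ℚ.* a) ℚ.* (B ℚ.* b) ℚ.* d⁺ ≡ (C ℚ.* c) ℚ.* (D ℚ.* e) ℚ.* n⁺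
  cross A B C D {a} {b} {c} {e} d n d⁺ n⁺ d≢0 p q = *-cancelˡ d ((A ℚ.* a) ℚ.* (B ℚ.* b) ℚ.* d⁺) ((C ℚ.* c) ℚ.* (D ℚ.* e) ℚ.* n⁺) d≢0 (begin
    d ℚ.* ((A ℚ.* a) ℚ.* (B ℚ.* b) ℚ.* d⁺)  ≡⟨ solve 6 (λ d A a B b t → d :* ((A :* a) :* (B :* b) :* t) := (A :* B :* d) :* (a :* (b :* t))) refl d A a B b d⁺ ⟩
    (A ℚ.* B ℚ.* d) ℚ.* (a ℚ.* (b ℚ.* d⁺))  ≡⟨ cong (ℚ._* (a ℚ.* (b ℚ.* d⁺))) p ⟩
    (C ℚ.* D ℚ.* n) ℚ.* (a ℚ.* (b ℚ.* d⁺))  ≡⟨ solve 6 (λ C D n a b t → (C :* D :* n) :* (a :* (b :* t)) := C :* D :* (a :* (b :* (t :* n)))) refl C D n a b d⁺ ⟩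
    C ℚ.* D ℚ.* (a ℚ.* (b ℚ.* (d⁺ ℚ.* n)))  ≡⟨ cong (C ℚ.* D ℚ.*_) q ⟩
    C ℚ.* D ℚ.* (c ℚ.* (e ℚ.* (n⁺ ℚ.* d)))  ≡⟨ solve 6 (λ C D c e t d → C :* D :* (c :* (e :* (t :* d))) := d :* ((C :* c) :* (D :* e) :* t)) refl C D c e n⁺ d ⟩
    d ℚ.* ((C ℚ.* c) ℚ.* (D ℚ.* e) ℚ.* n⁺)  ∎)

  -- The neighbour with the shorter gap. When that gap closes, the minor becomes a corner minor and
  -- `G` does not apply.
  up : ℕ → ℕ → ℕ → ℕ → ℚ
  up x y zero    z = Q x (2 + (z + y))
  up x y (suc a) z = G x (3 + y) a z

  denB num₂B : Mono
  denB  = ↑ (lin (0 ∷ 0 ∷ 1 ∷ 1 ∷ [] , 0)) ∷ ↑ (lin (0 ∷ 1 ∷ 0 ∷ 2 ∷ [] , 0)) ∷ ↑ (lin (2 ∷ 3 ∷ 4 ∷ 2 ∷ [] , 4)) ∷ ↑ (lin (1 ∷ 2 ∷ 3 ∷ 1 ∷ [] , 3)) ∷ []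
  num₂B = ↑ (lin A₄) ∷ ↑ (lin Y₄) ∷ ↑ (lin (2 ∷ 3 ∷ 4 ∷ [] , 4)) ∷ ↑ (lin (1 ∷ 2 ∷ 3 ∷ 2 ∷ [] , 3)) ∷ []

  -- In contrast to `first-ratio`, the four values differ in y and a, so their factors in z are all
  -- different and the ratio is built up by induction on z, from corner minors at z = 0.
  second-ratio : ∀ x y a z → G x y (suc a) z ℚ.* up x y a z ℚ.* eval denB (x ∷ y ∷ a ∷ z ∷ [])
                 ≡ G x (2 + y) a z ℚ.* G x (suc y) a z ℚ.* eval num₂B (x ∷ y ∷ a ∷ z ∷ [])
  second-ratio x y a zero = cong₂ ℚ._*_ (trans (ℚ.*-comm (Q x (y + suc a)) (up x y a 0))
      (cong₂ ℚ._*_ (up₀ a) (cong (Q x) (ℕ.+-suc y a))))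
    (trans (eval-sub denB σ (x ∷ y ∷ a ∷ [])) (trans (mono (sub σ denB) (sub σ num₂B) (x ∷ y ∷ a ∷ []) refl) (sym (eval-sub num₂B σ (x ∷ y ∷ a ∷ [])))))
    where
    σ : List Form
    σ = X₄ ∷ Y₄ ∷ A₄ ∷ ([] , 0) ∷ []
    up₀ : ∀ a → up x y a 0 ≡ Q x (2 + y + a)
    up₀ zero    = cong (λ n → Q x (2 + n)) (sym (ℕ.+-identityʳ y))
    up₀ (suc a) = cong (λ n → Q x (2 + n)) (sym (ℕ.+-suc y a))
  second-ratio x y zero (suc z) = cross (G x y 1 z) (up x y 0 z) (G x (2 + y) 0 z) (G x (1 + y) 0 z)
      (eval denB e₀) (eval num₂B e₀) (eval denB e₁) (eval num₂B e₁) (eval≢0 denB e₀) (second-ratio x y 0 z)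
    (trans (cong₂ (λ a b → a ℚ.* (b ℚ.* (eval denB e₁ ℚ.* eval num₂B e₀))) (eval-sub ρM s₁ ρ) (eval-sub qM s₂ ρ))
    (trans (cong₂ (λ a b → eval (sub s₁ ρM) ρ ℚ.* (eval (sub s₂ qM) ρ ℚ.* (a ℚ.* b))) (eval-sub denB t₁ ρ) (eval-sub num₂B t₀ ρ))
    (trans (eval-++₄ (sub s₁ ρM) (sub s₂ qM) (sub t₁ denB) (sub t₀ num₂B) ρ)
    (trans (mono (sub s₁ ρM ++ sub s₂ qM ++ sub t₁ denB ++ sub t₀ num₂B) (sub s₃ ρM ++ sub s₄ ρM ++ sub t₁ num₂B ++ sub t₀ denB) ρ refl)
    (trans (sym (eval-++₄ (sub s₃ ρM) (sub s₄ ρM) (sub t₁ num₂B) (sub t₀ denB) ρ))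
    (sym (trans (cong₂ (λ a b → a ℚ.* (b ℚ.* (eval num₂B e₁ ℚ.* eval denB e₀))) (eval-sub ρM s₃ ρ) (eval-sub ρM s₄ ρ))
      (cong₂ (λ a b → eval (sub s₃ ρM) ρ ℚ.* (eval (sub s₄ ρM) ρ ℚ.* (a ℚ.* b))) (eval-sub num₂B t₁ ρ) (eval-sub denB t₀ ρ)))))))))
    where
    ρ e₀ e₁ : List ℕ
    ρ  = x ∷ y ∷ z ∷ []
    e₀ = x ∷ y ∷ 0 ∷ z ∷ []
    e₁ = x ∷ y ∷ 0 ∷ suc z ∷ []
    Z₃ : Form
    Z₃ = 0 ∷ 0 ∷ 1 ∷ [] , 0
    s₁ s₂ s₃ s₄ t₀ t₁ : List Form
    s₁ = X₄ ∷ Y₄ ∷ ([] , 1) ∷ Z₃ ∷ []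
    s₂ = X₄ ∷ (0 ∷ 1 ∷ 1 ∷ [] , 2) ∷ []
    s₃ = X₄ ∷ Y₄ +′ 2 ∷ ([] , 0) ∷ Z₃ ∷ []
    s₄ = X₄ ∷ Y₄ +′ 1 ∷ ([] , 0) ∷ Z₃ ∷ []
    t₀ = X₄ ∷ Y₄ ∷ ([] , 0) ∷ Z₃ ∷ []
    t₁ = X₄ ∷ Y₄ ∷ ([] , 0) ∷ Z₃ +′ 1 ∷ []
  second-ratio x y (suc a) (suc z) = cross (G x y (2 + a) z) (up x y (suc a) z) (G x (2 + y) (suc a) z) (G x (1 + y) (suc a) z)
      (eval denB e₀) (eval num₂B e₀) (eval denB e₁) (eval num₂B e₁) (eval≢0 denB e₀) (second-ratio x y (suc a) z)
    (trans (cong₂ (λ a b → a ℚ.* (b ℚ.* (eval denB e₁ ℚ.* eval num₂B e₀))) (eval-sub ρM s₁ ρ) (eval-sub ρM s₂ ρ))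
    (trans (cong₂ (λ a b → eval (sub s₁ ρM) ρ ℚ.* (eval (sub s₂ ρM) ρ ℚ.* (a ℚ.* b))) (eval-sub denB t₁ ρ) (eval-sub num₂B t₀ ρ))
    (trans (eval-++₄ (sub s₁ ρM) (sub s₂ ρM) (sub t₁ denB) (sub t₀ num₂B) ρ)
    (trans (mono (sub s₁ ρM ++ sub s₂ ρM ++ sub t₁ denB ++ sub t₀ num₂B) (sub s₃ ρM ++ sub s₄ ρM ++ sub t₁ num₂B ++ sub t₀ denB) ρ refl)
    (trans (sym (eval-++₄ (sub s₃ ρM) (sub s₄ ρM) (sub t₁ num₂B) (sub t₀ denB) ρ))
    (sym (trans (cong₂ (λ a b → a ℚ.* (b ℚ.* (eval num₂B e₁ ℚ.* eval denB e₀))) (eval-sub ρM s₃ ρ) (eval-sub ρM s₄ ρ))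
      (cong₂ (λ a b → eval (sub s₃ ρM) ρ ℚ.* (eval (sub s₄ ρM) ρ ℚ.* (a ℚ.* b))) (eval-sub num₂B t₁ ρ) (eval-sub denB t₀ ρ)))))))))
    where
    ρ e₀ e₁ : List ℕ
    ρ  = x ∷ y ∷ a ∷ z ∷ []
    e₀ = x ∷ y ∷ suc a ∷ z ∷ []
    e₁ = x ∷ y ∷ suc a ∷ suc z ∷ []
    s₁ s₂ s₃ s₄ t₀ t₁ : List Form
    s₁ = X₄ ∷ Y₄ ∷ A₄ +′ 2 ∷ Z₄ ∷ []
    s₂ = X₄ ∷ Y₄ +′ 3 ∷ A₄ ∷ Z₄ ∷ []
    s₃ = X₄ ∷ Y₄ +′ 2 ∷ A₄ +′ 1 ∷ Z₄ ∷ []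
    s₄ = X₄ ∷ Y₄ +′ 1 ∷ A₄ +′ 1 ∷ Z₄ ∷ []
    t₀ = X₄ ∷ Y₄ ∷ A₄ +′ 1 ∷ Z₄ ∷ []
    t₁ = X₄ ∷ Y₄ ∷ A₄ +′ 1 ∷ Z₄ +′ 1 ∷ []

  ½≡ : inv (ι 2) ≡ ½
  ½≡ = inv-unique (ι 2) ½ (trans (cong (ℚ._* ½) (ι-+ 1 1)) (cong (λ i → (i ℚ.+ i) ℚ.* ½) ι-1))

  -- At y = 0 the first ratio is 1/2, and every later one is the factor of `Q` at x+3(a+1): the
  -- blocks of `gap-block`.
  G-y0 : ∀ x a z → G x 0 a (suc z) ≡ ½ ℚ.* Q (x + 3 * suc a) z ℚ.* Q x a
  G-y0 x a zero = trans (cong (Q x a ℚ.*_) (trans (eval-sub ρM σ (x ∷ a ∷ [])) (trans (mono (sub σ ρM) (↓ (p2 ([] , 1)) ∷ []) (x ∷ a ∷ []) refl)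
      (trans (ℚ.*-identityʳ (inv (ι 2))) ½≡))))
    (solve 2 (λ q h → q :* h := h :* con 1ℚ :* q) refl (Q x a) ½)
    where
    σ : List Form
    σ = X₄ ∷ ([] , 0) ∷ Y₄ ∷ ([] , 0) ∷ []
  G-y0 x a (suc z) = trans (cong₂ ℚ._*_ (G-y0 x a z) (trans (eval-sub ρM σ (x ∷ a ∷ z ∷ [])) (trans (mono (sub σ ρM) (sub τ qM) (x ∷ a ∷ z ∷ []) refl)
      (trans (sym (eval-sub qM τ (x ∷ a ∷ z ∷ []))) (cong (λ X → eval qM (X ∷ z ∷ [])) (sym (x+3a x a)))))))
    (solve 4 (λ h q r e → h :* q :* r :* e := h :* (q :* e) :* r) refl ½ (Q (x + 3 * suc a) z) (Q x a) (eval qM (x + 3 * suc a ∷ z ∷ [])))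
    where
    σ τ : List Form
    σ = X₄ ∷ ([] , 0) ∷ Y₄ ∷ (0 ∷ 0 ∷ 1 ∷ [] , 1) ∷ []
    τ = (1 ∷ 3 ∷ [] , 3) ∷ (0 ∷ 0 ∷ 1 ∷ [] , 0) ∷ []

  -- The Plücker relation is linear in the wanted minor, with a nonzero coefficient. Each of the
  -- other minors has smaller p, or the same p and smaller z or a shorter gap.
  gap-step : ∀ x p a y z → suc y + a ≡ suc p → (∀ a y z → y + a ≡ p → gap x p (suc a) z ≡ G x y a z) →
             gap x (suc p) (suc a) z ≡ G x (suc y) a z →
             (∀ a′ y → a ≡ suc a′ → y + a′ ≡ suc p → gap x (suc p) (suc a′) (suc z) ≡ G x y a′ (suc z)) →
             gap x (suc p) (suc a) (suc z) ≡ G x (suc y) a (suc z)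
  gap-step x p a y z e ih-p ih-z ih-a =
    *-cancelˡ (G x y a (suc z)) (gap x (suc p) (suc a) (suc z)) (G x (suc y) a (suc z)) (G≢0 x y a (suc z))
    (*-cancelˡ d (g ℚ.* gap x (suc p) (suc a) (suc z)) (g ℚ.* h) (eval≢0 (map ↑ denA) ρ) (begin
      d ℚ.* (g ℚ.* gap x (suc p) (suc a) (suc z))
        ≡⟨ cong (λ t → d ℚ.* (t ℚ.* gap x (suc p) (suc a) (suc z))) (ih-p a y (suc z) y+a) ⟨
      d ℚ.* (gap x p (suc a) (suc z) ℚ.* gap x (suc p) (suc a) (suc z))
        ≡⟨ cong (d ℚ.*_) (gap-plücker x p a z) ⟨
      d ℚ.* (gap x p (2 + a) (suc z) ℚ.* gap x (suc p) a (suc z) ℚ.+ gap x (suc p) (suc a) z ℚ.* gap x p (suc a) (2 + z))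
        ≡⟨ cong₂ (λ s t → d ℚ.* (gap x p (2 + a) (suc z) ℚ.* gap x (suc p) a (suc z) ℚ.+ s ℚ.* t)) ih-z (ih-p a y (2 + z) y+a) ⟩
      d ℚ.* (gap x p (2 + a) (suc z) ℚ.* gap x (suc p) a (suc z) ℚ.+ G x (suc y) a z ℚ.* G x y a (2 + z))
        ≡⟨ solve 4 (λ d s t u → d :* (s :+ t :* u) := t :* u :* d :+ s :* d) refl d (gap x p (2 + a) (suc z) ℚ.* gap x (suc p) a (suc z)) (G x (suc y) a z) (G x y a (2 + z)) ⟩
      G x (suc y) a z ℚ.* G x y a (2 + z) ℚ.* d ℚ.+ gap x p (2 + a) (suc z) ℚ.* gap x (suc p) a (suc z) ℚ.* d
        ≡⟨ cong₂ ℚ._+_ (first-ratio x y a z) (rest y e) ⟩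
      h ℚ.* g ℚ.* eval (map ↑ num₁A) ρ ℚ.+ h ℚ.* g ℚ.* second y
        ≡⟨ solve 4 (λ h g m n → h :* g :* m :+ h :* g :* n := (m :+ n) :* (g :* h)) refl h g (eval (map ↑ num₁A) ρ) (second y) ⟩
      (eval (map ↑ num₁A) ρ ℚ.+ second y) ℚ.* (g ℚ.* h)
        ≡⟨ cong (ℚ._* (g ℚ.* h)) (total y) ⟩
      d ℚ.* (g ℚ.* h) ∎))
    where
    ρ = x ∷ y ∷ a ∷ z ∷ []
    d = eval (map ↑ denA) ρ
    g = G x y a (suc z)
    h = G x (suc y) a (suc z)
    y+a : y + a ≡ p
    y+a = ℕ.suc-injective e
    second : ℕ → ℚ
    second zero    = 0ℚ
    second (suc y) = eval (map ↑ num₂A) (x ∷ y ∷ a ∷ z ∷ [])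
    total : ∀ y → eval (map ↑ num₁A) (x ∷ y ∷ a ∷ z ∷ []) ℚ.+ second y ≡ eval (map ↑ denA) (x ∷ y ∷ a ∷ z ∷ [])
    total zero    = trans (ℚ.+-identityʳ _) (trans (eval-↑ num₁A (x ∷ 0 ∷ a ∷ z ∷ [])) (trans (cong ι (two-term x a z)) (sym (eval-↑ denA (x ∷ 0 ∷ a ∷ z ∷ [])))))
    total (suc y) = trans (cong₂ ℚ._+_ (eval-↑ num₁A (x ∷ suc y ∷ a ∷ z ∷ [])) (eval-↑ num₂A (x ∷ y ∷ a ∷ z ∷ [])))
      (trans (sym (ι-+ (prodA num₁A (x ∷ suc y ∷ a ∷ z ∷ [])) (prodA num₂A (x ∷ y ∷ a ∷ z ∷ []))))
        (trans (cong ι (three-term x y a z)) (sym (eval-↑ denA (x ∷ suc y ∷ a ∷ z ∷ [])))))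
    gap-up : ∀ b y → a ≡ b → suc (suc y) + b ≡ suc p → gap x (suc p) b (suc z) ≡ up x y b (suc z)
    gap-up zero    y r e = trans (gap-0 x (suc p) (suc z)) (cong (Q x)
      (trans (cong (_+ suc z) (trans (sym e) (ℕ.+-identityʳ (2 + y)))) (cong (λ n → 2 + n) (ℕ.+-comm y (suc z)))))
    gap-up (suc b) y r e = ih-a b (3 + y) r (trans (sym (ℕ.+-suc (2 + y) b)) e)
    rest : ∀ y → suc y + a ≡ suc p → gap x p (2 + a) (suc z) ℚ.* gap x (suc p) a (suc z) ℚ.* eval (map ↑ denA) (x ∷ y ∷ a ∷ z ∷ [])
           ≡ G x (suc y) a (suc z) ℚ.* G x y a (suc z) ℚ.* second y
    -- Here the minor with the longer gap would have y = -1; it vanishes by `gap-overfull`, and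
    -- accordingly the second summand is absent.
    rest zero refl = trans (cong (λ s → s ℚ.* gap x (suc a) a (suc z) ℚ.* eval (map ↑ denA) (x ∷ 0 ∷ a ∷ z ∷ [])) (gap-overfull x a z))
      (solve 4 (λ s t u v → con 0ℚ :* s :* t := u :* v :* con 0ℚ) refl (gap x (suc a) a (suc z)) (eval (map ↑ denA) (x ∷ 0 ∷ a ∷ z ∷ [])) (G x 1 a (suc z)) (G x 0 a (suc z)))
    rest (suc y) e = trans (cong₂ (λ s t → s ℚ.* t) (cong₂ ℚ._*_ (ih-p (suc a) y (suc z) (trans (ℕ.+-suc y a) (ℕ.suc-injective e))) (gap-up a y refl e)) den≡)
      (trans (second-ratio x y a (suc z)) (cong (G x (2 + y) a (suc z) ℚ.* G x (suc y) a (suc z) ℚ.*_) num≡))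
      where
      ρ′ = x ∷ y ∷ a ∷ z ∷ []
      σ τ : List Form
      σ = X₄ ∷ Y₄ +′ 1 ∷ A₄ ∷ Z₄ ∷ []
      τ = X₄ ∷ Y₄ ∷ A₄ ∷ Z₄ +′ 1 ∷ []
      den≡ : eval (map ↑ denA) (x ∷ suc y ∷ a ∷ z ∷ []) ≡ eval denB (x ∷ y ∷ a ∷ suc z ∷ [])
      den≡ = trans (eval-sub (map ↑ denA) σ ρ′) (trans (mono (sub σ (map ↑ denA)) (sub τ denB) ρ′ refl) (sym (eval-sub denB τ ρ′)))
      num≡ : eval num₂B (x ∷ y ∷ a ∷ suc z ∷ []) ≡ eval (map ↑ num₂A) (x ∷ y ∷ a ∷ z ∷ [])
      num≡ = trans (eval-sub num₂B τ ρ′) (mono (sub τ num₂B) (map ↑ num₂A) ρ′ refl)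

  -- Lexicographic induction on p, the length of the gap and z. Carrying p = y+a as an argument
  -- makes this order visible, since y grows when the gap shrinks.
  gap≡G : ∀ x p a y z → y + a ≡ p → gap x p (suc a) z ≡ G x y a z
  gap≡G x p       a       y       zero    e    = trans (gap-empty x p (suc a)) (cong (Q x) (sym e))
  gap≡G x p       a       zero    (suc z) refl = trans (gap-block x a z) (sym (G-y0 x a z))
  gap≡G x (suc p) zero    (suc y) (suc z) e    = gap-step x p zero y z e (gap≡G x p) (gap≡G x (suc p) zero (suc y) z e) (λ _ _ ())
  gap≡G x (suc p) (suc a) (suc y) (suc z) e    = gap-step x p (suc a) y z e (gap≡G x p) (gap≡G x (suc p) (suc a) (suc y) z e)
    (λ b y′ r e′ → subst (λ c → gap x (suc p) (suc c) (suc z) ≡ G x y′ c (suc z)) (ℕ.suc-injective r)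
      (gap≡G x (suc p) a y′ (suc z) (trans (cong (y′ +_) (ℕ.suc-injective r)) e′)))

-- Pochhammer symbols as quotients of factorials, telescoping products, and the function f.

module Pochhammer where

  open Monomial
  open import Data.Nat.DivMod using (m*n/n≡m; +-distrib-/)
  open import Data.Integer.Base as ℤ using (ℤ; +_; -[1+_])
  open import Data.Integer.Properties as ℤ using ()

  open ℚSolver using (solve; _:+_; _:*_; _:-_; :-_; _:=_; con)
  open ≡-Reasoning

  infixl 6 _∔_
  infixl 7 _·_

  -- Syntax whose evaluation is definitionally the arithmetic as written in the formulas, so that
  -- `linear` can identify it with an affine form by `refl`.
  data LExp : Set where
    var : ℕ → LExp
    n#  : ℕ → LExp
    _∔_ : LExp → LExp → LExp
    _·_ : ℕ → LExp → LExp
    frm : Form → LExp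

  nth : ℕ → List ℕ → ℕ
  nth _       []      = 0
  nth zero    (x ∷ _) = x
  nth (suc i) (_ ∷ ρ) = nth i ρ

  ⟦_⟧L : LExp → List ℕ → ℕ
  ⟦ var i ⟧L   ρ = nth i ρ
  ⟦ n# k ⟧L  ρ = k
  ⟦ e ∔ f ⟧L ρ = ⟦ e ⟧L ρ + ⟦ f ⟧L ρ
  ⟦ c · e ⟧L ρ = c * ⟦ e ⟧L ρ
  ⟦ frm f ⟧L ρ = ⟪ f ⟫ ρ

  formL : LExp → Form
  formL (var i)   = unit i , 0
  formL (n# k)  = [] , k
  formL (e ∔ f) = formL e ⊕ formL f
  formL (c · e) = c ⊛ formL e
  formL (frm f) = f

  head₀-from : ∀ i ρ → head₀ (from i ρ) ≡ nth i ρ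
  head₀-from zero    []      = refl
  head₀-from zero    (x ∷ ρ) = refl
  head₀-from (suc i) []      = refl
  head₀-from (suc i) (x ∷ ρ) = head₀-from i ρ

  formL-sound : ∀ e ρ → ⟦ e ⟧L ρ ≡ ⟪ formL e ⟫ ρ
  formL-sound (var i)   ρ = trans (sym (head₀-from i ρ)) (sym (dot-unit i ρ))
  formL-sound (n# k)  ρ = sym (ℕ.+-identityʳ k)
  formL-sound (e ∔ f) ρ = trans (cong₂ _+_ (formL-sound e ρ) (formL-sound f ρ)) (sym (⟪⊕⟫ (formL e) (formL f) ρ))
  formL-sound (c · e) ρ = trans (cong (c *_) (formL-sound e ρ)) (sym (⟪⊛⟫ c (formL e) ρ))
  formL-sound (frm f) ρ = refl

  eqL : LExp → LExp → Bool
  eqL e f = eqF (formL e) (formL f)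

  linear : ∀ e f ρ → eqL e f ≡ true → ⟦ e ⟧L ρ ≡ ⟦ f ⟧L ρ
  linear e f ρ q = trans (formL-sound e ρ) (trans (eqF-sound (formL e) (formL f) ρ q) (sym (formL-sound f ρ)))

  ⊖-+ : ∀ {m n} c → m ≡ c + n → m ⊖ n ≡ + c
  ⊖-+ {n = n} c refl = begin
    + (c + n) ℤ.- + n          ≡⟨ cong (ℤ._- + n) (ℤ.pos-+ c n) ⟩
    (+ c ℤ.+ + n) ℤ.- + n      ≡⟨ ℤ.+-assoc (+ c) (+ n) (ℤ.- + n) ⟩
    + c ℤ.+ (+ n ℤ.- + n)      ≡⟨ cong (λ t → + c ℤ.+ t) (ℤ.+-inverseʳ (+ n)) ⟩
    + c ℤ.+ + 0                ≡⟨ ℤ.+-identityʳ (+ c) ⟩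
    + c                        ∎

  ⊖-neg : ∀ {m n} c → n ≡ suc c + m → m ⊖ n ≡ -[1+ c ]
  ⊖-neg {m} {n} c e = begin
    + m ℤ.- + n                ≡⟨ ℤ.neg-involutive (+ m ℤ.- + n) ⟨
    ℤ.- (ℤ.- (+ m ℤ.- + n))    ≡⟨ cong ℤ.-_ (trans (ℤ.neg-distrib-+ (+ m) (ℤ.- + n)) (trans (cong (λ t → ℤ.- + m ℤ.+ t) (ℤ.neg-involutive (+ n))) (ℤ.+-comm (ℤ.- + m) (+ n)))) ⟩
    ℤ.- (n ⊖ m)                ≡⟨ cong ℤ.-_ (⊖-+ (suc c) e) ⟩
    -[1+ c ]                   ∎

  ⊖-eq : ∀ {p q n m} → p + m ≡ n + q → p ⊖ q ≡ n ⊖ m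
  ⊖-eq {p} {q} {n} {m} e = begin
    + p ℤ.- + q
      ≡⟨ cong (ℤ._- + q) (trans (sym (ℤ.+-identityʳ (+ p))) (trans (cong (λ t → + p ℤ.+ t) (sym (ℤ.+-inverseʳ (+ m)))) (sym (ℤ.+-assoc (+ p) (+ m) (ℤ.- + m))))) ⟩
    (+ p ℤ.+ + m ℤ.- + m) ℤ.- + q
      ≡⟨ cong (λ t → t ℤ.- + m ℤ.- + q) (trans (sym (ℤ.pos-+ p m)) (trans (cong +_ e) (ℤ.pos-+ n q))) ⟩
    (+ n ℤ.+ + q ℤ.- + m) ℤ.- + q
      ≡⟨ trans (ℤ.+-assoc (+ n ℤ.+ + q) (ℤ.- + m) (ℤ.- + q)) (trans (cong (λ t → + n ℤ.+ + q ℤ.+ t) (ℤ.+-comm (ℤ.- + m) (ℤ.- + q))) (sym (ℤ.+-assoc (+ n ℤ.+ + q) (ℤ.- + q) (ℤ.- + m)))) ⟩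
    (+ n ℤ.+ + q ℤ.- + q) ℤ.- + m
      ≡⟨ cong (ℤ._- + m) (trans (ℤ.+-assoc (+ n) (+ q) (ℤ.- + q)) (trans (cong (λ t → + n ℤ.+ t) (ℤ.+-inverseʳ (+ q))) (ℤ.+-identityʳ (+ n)))) ⟩
    + n ℤ.- + m ∎

  ∏-cong : ∀ n {g h : ℕ → ℚ} → (∀ i → i < n → g (suc i) ≡ h (suc i)) → ∏[1‥ n ] g ≡ ∏[1‥ n ] h
  ∏-cong zero    e = refl
  ∏-cong (suc n) e = cong₂ ℚ._*_ (∏-cong n (λ i lt → e i (ℕ.m≤n⇒m≤1+n lt))) (e n ≤-refl)

  ∏-head : ∀ n (g : ℕ → ℚ) → ∏[1‥ suc n ] g ≡ g 1 ℚ.* ∏[1‥ n ] (λ i → g (suc i))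
  ∏-head zero    g = ℚ.*-comm 1ℚ (g 1)
  ∏-head (suc n) g = trans (cong (ℚ._* g (suc (suc n))) (∏-head n g)) (ℚ.*-assoc (g 1) (∏[1‥ n ] (λ i → g (suc i))) (g (suc (suc n))))

  ∏-* : ∀ n (g h : ℕ → ℚ) → ∏[1‥ n ] (λ i → g i ℚ.* h i) ≡ ∏[1‥ n ] g ℚ.* ∏[1‥ n ] h
  ∏-* zero    g h = refl
  ∏-* (suc n) g h = trans (cong (ℚ._* (g (suc n) ℚ.* h (suc n))) (∏-* n g h))
    (solve 4 (λ a b c d → a :* b :* (c :* d) := a :* c :* (b :* d)) refl (∏[1‥ n ] g) (∏[1‥ n ] h) (g (suc n)) (h (suc n)))

  ∏≢0 : ∀ n (g : ℕ → ℚ) → (∀ i → i < n → g (suc i) ≢ 0ℚ) → ∏[1‥ n ] g ≢ 0ℚ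
  ∏≢0 zero    g e = 1≢0
  ∏≢0 (suc n) g e = *≢0 (∏[1‥ n ] g) (g (suc n)) (∏≢0 n g (λ i lt → e i (ℕ.m≤n⇒m≤1+n lt))) (e n ≤-refl)

  telescope : ∀ n (g h U : ℕ → ℚ) → (∀ i → i < n → g (suc i) ℚ.* U i ≡ h (suc i) ℚ.* U (suc i)) →
              ∏[1‥ n ] g ℚ.* U 0 ≡ ∏[1‥ n ] h ℚ.* U n
  telescope zero    g h U e = refl
  telescope (suc n) g h U e = begin
    ∏[1‥ n ] g ℚ.* g (suc n) ℚ.* U 0   ≡⟨ solve 3 (λ p g u → p :* g :* u := (p :* u) :* g) refl (∏[1‥ n ] g) (g (suc n)) (U 0) ⟩
    ∏[1‥ n ] g ℚ.* U 0 ℚ.* g (suc n)   ≡⟨ cong (ℚ._* g (suc n)) (telescope n g h U (λ i lt → e i (ℕ.m≤n⇒m≤1+n lt))) ⟩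
    ∏[1‥ n ] h ℚ.* U n ℚ.* g (suc n)   ≡⟨ solve 3 (λ p g u → p :* u :* g := p :* (g :* u)) refl (∏[1‥ n ] h) (g (suc n)) (U n) ⟩
    ∏[1‥ n ] h ℚ.* (g (suc n) ℚ.* U n) ≡⟨ cong (∏[1‥ n ] h ℚ.*_) (e n ≤-refl) ⟩
    ∏[1‥ n ] h ℚ.* (h (suc n) ℚ.* U (suc n)) ≡⟨ ℚ.*-assoc (∏[1‥ n ] h) (h (suc n)) (U (suc n)) ⟨
    ∏[1‥ n ] h ℚ.* h (suc n) ℚ.* U (suc n) ∎

  telescope′ : ∀ n (g h U : ℕ → ℚ) → U 0 ≢ 0ℚ → (∀ i → i < n → g (suc i) ℚ.* U i ≡ h (suc i) ℚ.* U (suc i)) →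
               ∏[1‥ n ] g ≡ ∏[1‥ n ] h ℚ.* (U n ℚ.* inv (U 0))
  telescope′ n g h U U≢0 e = *-cancelˡ (U 0) (∏[1‥ n ] g) (∏[1‥ n ] h ℚ.* (U n ℚ.* inv (U 0))) U≢0 (begin
    U 0 ℚ.* ∏[1‥ n ] g                              ≡⟨ ℚ.*-comm (U 0) (∏[1‥ n ] g) ⟩
    ∏[1‥ n ] g ℚ.* U 0                              ≡⟨ telescope n g h U e ⟩
    ∏[1‥ n ] h ℚ.* U n                              ≡⟨ ℚ.*-identityˡ (∏[1‥ n ] h ℚ.* U n) ⟨
    1ℚ ℚ.* (∏[1‥ n ] h ℚ.* U n)                     ≡⟨ cong (ℚ._* (∏[1‥ n ] h ℚ.* U n)) (inv-inverse (U 0) U≢0) ⟨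
    U 0 ℚ.* inv (U 0) ℚ.* (∏[1‥ n ] h ℚ.* U n)      ≡⟨ solve 4 (λ u i h w → u :* i :* (h :* w) := u :* (h :* (w :* i))) refl (U 0) (inv (U 0)) (∏[1‥ n ] h) (U n) ⟩
    U 0 ℚ.* (∏[1‥ n ] h ℚ.* (U n ℚ.* inv (U 0)))    ∎)

  rising : ∀ (φ : ℕ → ℚ) (g : ℕ → ℚ) m k → φ m ≢ 0ℚ → (∀ i → i < k → φ (suc (i + m)) ≡ φ (i + m) ℚ.* g (suc i)) →
           ∏[1‥ k ] g ≡ φ (k + m) ℚ.* inv (φ m)
  rising φ g m k φ≢0 e = trans (telescope′ k g (λ _ → 1ℚ) (λ i → φ (i + m)) φ≢0 (λ i lt → trans (ℚ.*-comm (g (suc i)) (φ (i + m)))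
      (trans (sym (e i lt)) (sym (ℚ.*-identityˡ (φ (suc (i + m))))))))
    (trans (cong (ℚ._* (φ (k + m) ℚ.* inv (φ m))) (ones k)) (ℚ.*-identityˡ (φ (k + m) ℚ.* inv (φ m))))
    where
    ones : ∀ k → ∏[1‥ k ] (λ _ → 1ℚ) ≡ 1ℚ
    ones zero    = refl
    ones (suc k) = trans (ℚ.*-identityʳ (∏[1‥ k ] (λ _ → 1ℚ))) (ones k)

  falling : ∀ (φ : ℕ → ℚ) (g : ℕ → ℚ) n k → (∀ j → φ j ≢ 0ℚ) → (∀ i r → suc i + r ≡ k → φ (suc (r + n)) ≡ φ (r + n) ℚ.* g (suc i)) →
            ∏[1‥ k ] g ℚ.* φ n ≡ φ (k + n)
  falling φ g n zero    φ≢0 e = ℚ.*-identityˡ (φ n)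
  falling φ g n (suc k) φ≢0 e = begin
    ∏[1‥ suc k ] g ℚ.* φ n                            ≡⟨ cong (ℚ._* φ n) (∏-head k g) ⟩
    g 1 ℚ.* ∏[1‥ k ] (λ i → g (suc i)) ℚ.* φ n        ≡⟨ ℚ.*-assoc (g 1) (∏[1‥ k ] (λ i → g (suc i))) (φ n) ⟩
    g 1 ℚ.* (∏[1‥ k ] (λ i → g (suc i)) ℚ.* φ n)      ≡⟨ cong (g 1 ℚ.*_) (falling φ (λ i → g (suc i)) n k φ≢0 (λ i r q → e (suc i) r (cong suc q))) ⟩
    g 1 ℚ.* φ (k + n)                                 ≡⟨ ℚ.*-comm (g 1) (φ (k + n)) ⟩
    φ (k + n) ℚ.* g 1                                 ≡⟨ e 0 k refl ⟨
    φ (suc (k + n))                                   ∎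

  -- Treats both signs of the index at once: the symbol is φ(n)/φ(m) for a primitive φ without
  -- zeros, the product climbing from m to n or its reciprocal descending from m to n. The
  -- primitives are n!, (2n-1)!! and 2^n.
  val-quotient : ∀ (φ : ℕ → ℚ) → (∀ j → φ j ≢ 0ℚ) → (P : ℤ → ℚ) (g g′ : ℕ → ℚ) (m : ℕ) →
    (∀ k → P (+ k) ≡ ∏[1‥ k ] g) → (∀ k → P -[1+ k ] ≡ inv (∏[1‥ suc k ] g′)) →
    (∀ i → φ (suc (i + m)) ≡ φ (i + m) ℚ.* g (suc i)) →
    (∀ i r → suc i + r ≡ m → φ (suc r) ≡ φ r ℚ.* g′ (suc i)) →
    ∀ n {L} → L ≡ n ⊖ m → P L ≡ φ n ℚ.* inv (φ m)
  val-quotient φ φ≢0 P g g′ m P⁺ P⁻ up down n refl with ℕ.<-≤-connex n m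
  ... | inj₂ m≤n = trans (cong P (⊖-+ (n ∸ m) (sym (ℕ.m∸n+n≡m m≤n)))) (trans (P⁺ (n ∸ m))
        (trans (rising φ g m (n ∸ m) (φ≢0 m) (λ i _ → up i)) (cong (λ k → φ k ℚ.* inv (φ m)) (ℕ.m∸n+n≡m m≤n))))
  ... | inj₁ n<m = trans (cong P (⊖-neg (m ∸ suc n) (trans (sym (ℕ.m∸n+n≡m n<m)) (ℕ.+-suc (m ∸ suc n) n)))) (trans (P⁻ (m ∸ suc n)) (inv-unique Π (φ n ℚ.* inv (φ m))
        (trans (sym (ℚ.*-assoc Π (φ n) (inv (φ m)))) (trans (cong (ℚ._* inv (φ m)) (trans (falling φ g′ n (suc (m ∸ suc n)) φ≢0
          (λ i r q → down i (r + n) (trans (sym (ℕ.+-assoc (suc i) r n)) (trans (cong (_+ n) q) m≡)))) (cong φ m≡))) (inv-inverse (φ m) (φ≢0 m))))))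
    where
    Π = ∏[1‥ suc (m ∸ suc n) ] g′
    m≡ : suc (m ∸ suc n) + n ≡ m
    m≡ = trans (sym (ℕ.+-suc (m ∸ suc n) n)) (ℕ.m∸n+n≡m n<m)

  fact≢0 : ∀ n → ι (n !) ≢ 0ℚ
  fact≢0 n = ι≢0 (n !) {{n ℕ.!≢0}}

  oddf≢0 : ∀ n → ι (oddf n) ≢ 0ℚ
  oddf≢0 n = ι≢0 (oddf n) {{oddf-nonZero {n}}}

  ι-step : ∀ k F {z} → z ≡ + k → ι (k * F) ≡ ι F ℚ.* ⟦ z ⟧
  ι-step k F refl = trans (ι-* k F) (trans (ℚ.*-comm (ι k) (ι F)) (cong (ι F ℚ.*_) (sym (⟦⟧≡ι k))))

  poch-quotient : ∀ m n {X L} → X ≡ + suc m → L ≡ n ⊖ m → poch X L ≡ ι (n !) ℚ.* inv (ι (m !))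
  poch-quotient m n {L = L} refl e = val-quotient (λ j → ι (j !)) fact≢0 (poch (+ suc m)) (λ i → ⟦ + suc m ℤ.+ (i ⊖ 1) ⟧) (λ i → ⟦ + suc m ℤ.- + i ⟧) m
      (λ _ → refl) (λ _ → refl) (λ i → ι-step (suc (i + m)) ((i + m) !) (up i)) (λ i r q → ι-step (suc r) (r !) (down i r q)) n {L} e
    where
    up : ∀ i → + suc m ℤ.+ (suc i ⊖ 1) ≡ + suc (i + m)
    up i = trans (cong (λ t → + suc m ℤ.+ t) (⊖-+ {suc i} i (ℕ.+-comm 1 i)))
      (trans (sym (ℤ.pos-+ (suc m) i)) (cong (λ t → + suc t) (ℕ.+-comm m i)))
    down : ∀ i r → suc i + r ≡ m → + suc m ℤ.- + suc i ≡ + suc r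
    down i r refl = ⊖-+ (suc r) (cong suc (trans (cong suc (ℕ.+-comm i r)) (sym (ℕ.+-suc r i))))

  poch2-quotient : ∀ m n {X L} → X ≡ + suc (2 * m) → L ≡ n ⊖ m → poch2 X L ≡ ι (oddf n) ℚ.* inv (ι (oddf m))
  poch2-quotient m n {L = L} refl e = val-quotient (λ j → ι (oddf j)) oddf≢0 (poch2 (+ suc (2 * m))) (λ i → ⟦ + suc (2 * m) ℤ.+ ((2 * i) ⊖ 2) ⟧) (λ i → ⟦ + suc (2 * m) ℤ.- + (2 * i) ⟧) m
      (λ _ → refl) (λ _ → refl) (λ i → ι-step (suc (2 * (i + m))) (oddf (i + m)) (up i)) (λ i r q → ι-step (suc (2 * r)) (oddf r) (down i r q)) n {L} e
    where
    up : ∀ i → + suc (2 * m) ℤ.+ ((2 * suc i) ⊖ 2) ≡ + suc (2 * (i + m))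
    up i = trans (cong (λ t → + suc (2 * m) ℤ.+ t) (⊖-+ {2 * suc i} (2 * i) (trans (ℕ.*-suc 2 i) (ℕ.+-comm 2 (2 * i)))))
      (trans (sym (ℤ.pos-+ (suc (2 * m)) (2 * i))) (cong (λ t → + suc t) (trans (sym (ℕ.*-distribˡ-+ 2 m i)) (cong (2 *_) (ℕ.+-comm m i)))))
    down : ∀ i r → suc i + r ≡ m → + suc (2 * m) ℤ.- + (2 * suc i) ≡ + suc (2 * r)
    down i r refl = ⊖-+ (suc (2 * r)) (cong suc (trans (ℕ.*-distribˡ-+ 2 (suc i) r) (ℕ.+-comm (2 * suc i) (2 * r))))

  pow2-quotient : ∀ p q → pow2 (p ⊖ q) ≡ ι (2 ^ p) ℚ.* inv (ι (2 ^ q))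
  pow2-quotient p q = val-quotient (λ j → ι (2 ^ j)) 2^≢0 pow2 (λ _ → ⟦ + 2 ⟧) (λ _ → ⟦ + 2 ⟧) q (λ _ → refl) (λ _ → refl) (λ i → step (i + q)) (λ _ r _ → step r) p refl
    where
    2^≢0 : ∀ n → ι (2 ^ n) ≢ 0ℚ
    2^≢0 n = ι≢0 (2 ^ n) {{ℕ.m^n≢0 2 n}}
    step : ∀ r → ι (2 ^ suc r) ≡ ι (2 ^ r) ℚ.* ⟦ + 2 ⟧
    step r = trans (ι-* 2 (2 ^ r)) (trans (ℚ.*-comm (ι 2) (ι (2 ^ r))) (cong (ι (2 ^ r) ℚ.*_) (sym (⟦⟧≡ι 2))))

  pair : ∀ (a b : Atom) ρ → ι (evalA a ρ) ℚ.* inv (ι (evalA b ρ)) ≡ eval (↑ a ∷ ↓ b ∷ []) ρ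
  pair a b ρ = cong (ι (evalA a ρ) ℚ.*_) (sym (ℚ.*-identityʳ (inv (ι (evalA b ρ)))))

  poch⁺ : ∀ fm fn P p q ρ → eqL P (n# 1 ∔ frm fm) ≡ true → eqL (p ∔ frm fm) (frm fn ∔ q) ≡ true →
          poch (+ ⟦ P ⟧L ρ) (⟦ p ⟧L ρ ⊖ ⟦ q ⟧L ρ) ≡ eval (↑ (fac fn) ∷ ↓ (fac fm) ∷ []) ρ
  poch⁺ fm fn P p q ρ e e′ = trans (poch-quotient (⟪ fm ⟫ ρ) (⟪ fn ⟫ ρ) (cong +_ (linear P (n# 1 ∔ frm fm) ρ e))
    (⊖-eq {⟦ p ⟧L ρ} {⟦ q ⟧L ρ} {⟪ fn ⟫ ρ} {⟪ fm ⟫ ρ} (linear (p ∔ frm fm) (frm fn ∔ q) ρ e′))) (pair (fac fn) (fac fm) ρ)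

  poch⁻ : ∀ fm fn P Q p q ρ → eqL P (n# 1 ∔ frm fm ∔ Q) ≡ true → eqL (p ∔ frm fm) (frm fn ∔ q) ≡ true →
          poch (⟦ P ⟧L ρ ⊖ ⟦ Q ⟧L ρ) (⟦ p ⟧L ρ ⊖ ⟦ q ⟧L ρ) ≡ eval (↑ (fac fn) ∷ ↓ (fac fm) ∷ []) ρ
  poch⁻ fm fn P Q p q ρ e e′ = trans (poch-quotient (⟪ fm ⟫ ρ) (⟪ fn ⟫ ρ) (⊖-+ (suc (⟪ fm ⟫ ρ)) (linear P (n# 1 ∔ frm fm ∔ Q) ρ e))
    (⊖-eq {⟦ p ⟧L ρ} {⟦ q ⟧L ρ} {⟪ fn ⟫ ρ} {⟪ fm ⟫ ρ} (linear (p ∔ frm fm) (frm fn ∔ q) ρ e′))) (pair (fac fn) (fac fm) ρ)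

  poch2⁺ : ∀ fm fn P p q ρ → eqL P (n# 1 ∔ 2 · frm fm) ≡ true → eqL (p ∔ frm fm) (frm fn ∔ q) ≡ true →
           poch2 (+ ⟦ P ⟧L ρ) (⟦ p ⟧L ρ ⊖ ⟦ q ⟧L ρ) ≡ eval (↑ (odd fn) ∷ ↓ (odd fm) ∷ []) ρ
  poch2⁺ fm fn P p q ρ e e′ = trans (poch2-quotient (⟪ fm ⟫ ρ) (⟪ fn ⟫ ρ) (cong +_ (linear P (n# 1 ∔ 2 · frm fm) ρ e))
    (⊖-eq {⟦ p ⟧L ρ} {⟦ q ⟧L ρ} {⟪ fn ⟫ ρ} {⟪ fm ⟫ ρ} (linear (p ∔ frm fm) (frm fn ∔ q) ρ e′))) (pair (odd fn) (odd fm) ρ)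

  poch2⁻ : ∀ fm fn P Q p q ρ → eqL P (n# 1 ∔ 2 · frm fm ∔ Q) ≡ true → eqL (p ∔ frm fm) (frm fn ∔ q) ≡ true →
           poch2 (⟦ P ⟧L ρ ⊖ ⟦ Q ⟧L ρ) (⟦ p ⟧L ρ ⊖ ⟦ q ⟧L ρ) ≡ eval (↑ (odd fn) ∷ ↓ (odd fm) ∷ []) ρ
  poch2⁻ fm fn P Q p q ρ e e′ = trans (poch2-quotient (⟪ fm ⟫ ρ) (⟪ fn ⟫ ρ) (⊖-+ (suc (2 * ⟪ fm ⟫ ρ)) (linear P (n# 1 ∔ 2 · frm fm ∔ Q) ρ e))
    (⊖-eq {⟦ p ⟧L ρ} {⟦ q ⟧L ρ} {⟪ fn ⟫ ρ} {⟪ fm ⟫ ρ} (linear (p ∔ frm fm) (frm fn ∔ q) ρ e′))) (pair (odd fn) (odd fm) ρ)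

  half-even : ∀ n → (n + n) / 2 ≡ n
  half-even n = trans (cong (_/ 2) (trans (cong (λ m → n + m) (sym (ℕ.+-identityʳ n))) (ℕ.*-comm 2 n))) (m*n/n≡m n 2)

  half-suc : ∀ n → suc (suc n) / 2 ≡ suc (n / 2)
  half-suc n = trans (+-distrib-/ 2 n (mod n)) refl
    where
    open import Data.Nat.DivMod using (m%n<n)
    mod : ∀ n → (2 % 2) + (n % 2) < 2
    mod n = m%n<n n 2

  half-odd : ∀ n → suc (n + n) / 2 ≡ n
  half-odd zero    = refl
  half-odd (suc n) = trans (cong (λ m → suc (suc m) / 2) (ℕ.+-suc n n)) (trans (half-suc (suc (n + n))) (cong suc (half-odd n)))

  data Parity : ℕ → Set where
    even : ∀ k → Parity (k + k)
    odd  : ∀ k → Parity (suc (k + k))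

  parity : ∀ n → Parity n
  parity zero = even 0
  parity (suc n) with parity n
  ... | even k = odd k
  ... | odd k  = subst Parity (cong suc (ℕ.+-suc k k)) (even (suc k))

  half-sum : ∀ n → n / 2 + (n + 1) / 2 ≡ n
  half-sum n with parity n
  ... | even k = cong₂ _+_ (half-even k) (trans (cong (_/ 2) (ℕ.+-comm (k + k) 1)) (half-odd k))
  ... | odd k  = trans (cong₂ _+_ (half-odd k) (trans (cong (_/ 2) (ℕ.+-comm (suc (k + k)) 1)) (trans (half-suc (k + k)) (cong suc (half-even k))))) (ℕ.+-suc k k)

  f-2+ : ∀ n → f (2 + n) ≡ 3 + f n
  f-2+ n = trans (cong₂ (λ s t → 2 * s + t) (half-suc (n + 1)) (half-suc n))
    (S.solve 2 (λ s t → S.con 2 S.:* (S.con 1 S.:+ s) S.:+ (S.con 1 S.:+ t) S.:= S.con 3 S.:+ (S.con 2 S.:* s S.:+ t)) refl ((n + 1) / 2) (n / 2))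
    where module S = ℕSolver

  f-even : ∀ k → f (k + k) ≡ k + k + k
  f-even zero    = refl
  f-even (suc k) = trans (cong (λ m → f (suc m)) (ℕ.+-suc k k)) (trans (f-2+ (k + k)) (trans (cong (λ m → 3 + m) (f-even k))
    (S.solve 1 (λ k → S.con 3 S.:+ (k S.:+ k S.:+ k) S.:= S.con 1 S.:+ k S.:+ (S.con 1 S.:+ k) S.:+ (S.con 1 S.:+ k)) refl k)))
    where module S = ℕSolver

  f-odd : ∀ k → f (suc (k + k)) ≡ 2 + (k + k + k)
  f-odd zero    = refl
  f-odd (suc k) = trans (cong (λ m → f (suc (suc m))) (ℕ.+-suc k k)) (trans (f-2+ (suc (k + k))) (trans (cong (λ m → 3 + m) (f-odd k))
    (S.solve 1 (λ k → S.con 5 S.:+ (k S.:+ k S.:+ k) S.:= S.con 2 S.:+ (S.con 1 S.:+ k S.:+ (S.con 1 S.:+ k) S.:+ (S.con 1 S.:+ k))) refl k)))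
    where module S = ℕSolver

  -- One of m and n is even and the other odd, and f(2k) = 3k, f(2k+1) = 3k+2.
  f-sum : ∀ m n d → m + n ≡ suc (d + d) → f m + f n ≡ 2 + (d + d + d)
  f-sum zero          n d refl = f-odd d
  f-sum (suc zero)    n d e with ℕ.suc-injective e
  ... | refl = cong (λ t → 2 + t) (f-even d)
  f-sum (suc (suc m)) n zero    ()
  f-sum (suc (suc m)) n (suc d) e = trans (cong (_+ f n) (f-2+ m)) (trans (cong (λ t → 3 + t) (f-sum m n d (ℕ.suc-injective (ℕ.suc-injective (trans e (cong (λ t → 2 + t) (ℕ.+-suc d d)))))))
    (S.solve 1 (λ d → S.con 5 S.:+ (d S.:+ d S.:+ d) S.:= S.con 2 S.:+ (S.con 1 S.:+ d S.:+ (S.con 1 S.:+ d) S.:+ (S.con 1 S.:+ d))) refl d))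
    where module S = ℕSolver

-- The factors of E₃ as formal products.

module Factors where

  open Monomial
  open Pochhammer
  open import Data.Integer.Base using (+_)

  -- Names for the factors in `E3even` and `E3odd`, definitionally equal to them, so that each
  -- product can be treated by itself.
  f1E f2E f1O f2O : ℕ → ℕ → ℕ → ℕ → ℚ
  f1E x k a i = poch2 ((2 * x + 6 * k + 2 * f (a + i ∸ 1)) ⊖ 1) (f (a + 2 ∸ 3 * i) ⊖ 1)
  f2E x k a i = poch (+ (x + 3 * k + f (a + i ∸ 2) + 1)) (f (a + 1 ∸ 3 * i) ⊖ 1)
  f1O x k a i = poch2 ((2 * x + 6 * k + 2 * f (a + i)) ⊖ 1) (f (a + 1 ∸ 3 * i) ⊖ 1)
  f2O x k a i = poch (+ (x + 3 * k + f (a + i ∸ 1) + 1)) (f (a + 2 ∸ 3 * i) ⊖ 1)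

  h1E h2E h1O h2O aE aO : ℕ → ℕ → ℕ → ℕ → ℕ → ℚ
  h1E x k z a i =
    poch2 ((2 * x + 6 * k + 2 * z + 4 * a + 4 * i) ⊖ 5) ((z / 2 + a + 4) ⊖ (5 * i))
    ℚ.* poch ((x + 3 * k + z + 2 * a + 2 * i) ⊖ 3) (((z + 1) / 2 + a + 4) ⊖ (5 * i))
  h2E x k z a i =
    poch2 ((2 * x + 6 * k + 2 * z + 4 * a + 4 * i) ⊖ 3) (((z + 1) / 2 + a + 1) ⊖ (5 * i))
    ℚ.* poch ((x + 3 * k + z + 2 * a + 2 * i) ⊖ 2) ((z / 2 + a + 2) ⊖ (5 * i))
  h1O x k z a i =
    poch2 ((2 * x + 6 * k + 2 * z + 4 * a + 4 * i) ⊖ 3) (((z + 1) / 2 + a + 4) ⊖ (5 * i))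
    ℚ.* poch ((x + 3 * k + z + 2 * a + 2 * i) ⊖ 1) ((z / 2 + a + 4) ⊖ (5 * i))
  h2O x k z a i =
    poch2 ((2 * x + 6 * k + 2 * z + 4 * a + 4 * i) ⊖ 1) ((z / 2 + a + 2) ⊖ (5 * i))
    ℚ.* poch (+ (x + 3 * k + z + 2 * a + 2 * i)) (((z + 1) / 2 + a + 1) ⊖ (5 * i))
  aE x k z a i =
    poch2 ((2 * k + 2 * i) ⊖ 1) ((z + a + 1) ⊖ (2 * i)) ℚ.* poch (+ (k + i)) ((z + a + 1) ⊖ (2 * i))
    ℚ.* inv (poch (+ i) ((z + a + 1) ⊖ (2 * i))
             ℚ.* poch2 ((2 * x + 4 * k + 2 * a + 2 * i) ⊖ 3) ((z + a + 1) ⊖ (2 * i))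
             ℚ.* poch ((x + 4 * k + z + 2 * a + i) ⊖ 2) ((z + a + 1) ⊖ (2 * i)))
  aO x k z a i =
    poch2 (+ (2 * k + 2 * i + 1)) ((z + a + 1) ⊖ (2 * i)) ℚ.* poch (+ (k + i)) ((z + a + 1) ⊖ (2 * i))
    ℚ.* inv (poch (+ i) ((z + a + 1) ⊖ (2 * i))
             ℚ.* poch2 ((2 * x + 4 * k + 2 * a + 2 * i) ⊖ 1) ((z + a + 1) ⊖ (2 * i))
             ℚ.* poch (+ (x + 4 * k + z + 2 * a + i)) ((z + a + 1) ⊖ (2 * i)))

  eval-pair : ∀ l m ρ {a b} → a ≡ eval l ρ → b ≡ eval m ρ → a ℚ.* b ≡ eval (l ++ m) ρ
  eval-pair l m ρ refl refl = sym (eval-++ l m ρ)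

  eval-quint : ∀ l m n o q ρ {a b c d e} → a ≡ eval l ρ → b ≡ eval m ρ → c ≡ eval n ρ → d ≡ eval o ρ → e ≡ eval q ρ →
               a ℚ.* b ℚ.* inv (c ℚ.* d ℚ.* e) ≡ eval (l ++ m ++ flip (n ++ o ++ q)) ρ
  eval-quint l m n o q ρ refl refl refl refl refl = begin
    eval l ρ ℚ.* eval m ρ ℚ.* inv (eval n ρ ℚ.* eval o ρ ℚ.* eval q ρ)
      ≡⟨ cong (λ t → eval l ρ ℚ.* eval m ρ ℚ.* inv t) (trans (ℚ.*-assoc (eval n ρ) (eval o ρ) (eval q ρ))
           (trans (cong (eval n ρ ℚ.*_) (sym (eval-++ o q ρ))) (sym (eval-++ n (o ++ q) ρ)))) ⟩
    eval l ρ ℚ.* eval m ρ ℚ.* inv (eval (n ++ o ++ q) ρ)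
      ≡⟨ cong (eval l ρ ℚ.* eval m ρ ℚ.*_) (inv-eval (n ++ o ++ q) ρ) ⟩
    eval l ρ ℚ.* eval m ρ ℚ.* eval (flip (n ++ o ++ q)) ρ
      ≡⟨ ℚ.*-assoc (eval l ρ) (eval m ρ) (eval (flip (n ++ o ++ q)) ρ) ⟩
    eval l ρ ℚ.* (eval m ρ ℚ.* eval (flip (n ++ o ++ q)) ρ)
      ≡⟨ cong (eval l ρ ℚ.*_) (sym (eval-++ m (flip (n ++ o ++ q)) ρ)) ⟩
    eval l ρ ℚ.* eval (m ++ flip (n ++ o ++ q)) ρ
      ≡⟨ eval-++ l (m ++ flip (n ++ o ++ q)) ρ ⟨
    eval (l ++ m ++ flip (n ++ o ++ q)) ρ ∎
    where open ≡-Reasoning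

  minusC : List ℕ → List ℕ → List ℕ
  minusC (c ∷ cs) (d ∷ ds) = c ∸ d ∷ minusC cs ds
  minusC cs       _        = cs

  _⊝_ : Form → Form → Form
  (cs , k) ⊝ (ds , l) = minusC cs ds , k ∸ l

  halveF : Form → Form
  halveF (cs , k) = map ⌊_/2⌋ cs , ⌊ k /2⌋

  -- The symbols (P)ₙ, (P - Q)ₙ, [P]ₙ and [P - Q]ₙ with n = p - q.
  data Symbol : Set where
    P₁⁺ P₂⁺ : (P p q : LExp) → Symbol
    P₁⁻ P₂⁻ : (P Q p q : LExp) → Symbol

  value : Symbol → List ℕ → ℚ
  value (P₁⁺ P p q)   ρ = poch (+ ⟦ P ⟧L ρ) (⟦ p ⟧L ρ ⊖ ⟦ q ⟧L ρ)
  value (P₂⁺ P p q)   ρ = poch2 (+ ⟦ P ⟧L ρ) (⟦ p ⟧L ρ ⊖ ⟦ q ⟧L ρ)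
  value (P₁⁻ P Q p q) ρ = poch (⟦ P ⟧L ρ ⊖ ⟦ Q ⟧L ρ) (⟦ p ⟧L ρ ⊖ ⟦ q ⟧L ρ)
  value (P₂⁻ P Q p q) ρ = poch2 (⟦ P ⟧L ρ ⊖ ⟦ Q ⟧L ρ) (⟦ p ⟧L ρ ⊖ ⟦ q ⟧L ρ)

  low₁ low₂ : LExp → Form
  low₁ P = formL P ⊝ ([] , 1)
  low₂ P = halveF (low₁ P)

  -- The symbol is φ(high)/φ(low). For base P and length n, `low` is P-1, halved for the symbols
  -- with step 2, and `high` is `low` plus n.
  low : Symbol → Form
  low (P₁⁺ P p q)   = low₁ P
  low (P₂⁺ P p q)   = low₂ P
  low (P₁⁻ P Q p q) = low₁ P ⊝ formL Q
  low (P₂⁻ P Q p q) = halveF (low₁ P ⊝ formL Q)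

  high : Symbol → Form
  high t@(P₁⁺ P p q)   = (low t ⊕ formL p) ⊝ formL q
  high t@(P₂⁺ P p q)   = (low t ⊕ formL p) ⊝ formL q
  high t@(P₁⁻ P Q p q) = (low t ⊕ formL p) ⊝ formL q
  high t@(P₂⁻ P Q p q) = (low t ⊕ formL p) ⊝ formL q

  quot : Symbol → Mono
  quot t@(P₁⁺ _ _ _)   = ↑ (fac (high t)) ∷ ↓ (fac (low t)) ∷ []
  quot t@(P₂⁺ _ _ _)   = ↑ (odd (high t)) ∷ ↓ (odd (low t)) ∷ []
  quot t@(P₁⁻ _ _ _ _) = ↑ (fac (high t)) ∷ ↓ (fac (low t)) ∷ []
  quot t@(P₂⁻ _ _ _ _) = ↑ (odd (high t)) ∷ ↓ (odd (low t)) ∷ []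

  -- Guards against the truncated subtractions and halvings in low and high.
  exact : Symbol → Bool
  exact t@(P₁⁺ P p q)   = eqL P (n# 1 ∔ frm (low t)) ∧ eqL (p ∔ frm (low t)) (frm (high t) ∔ q)
  exact t@(P₂⁺ P p q)   = eqL P (n# 1 ∔ 2 · frm (low t)) ∧ eqL (p ∔ frm (low t)) (frm (high t) ∔ q)
  exact t@(P₁⁻ P Q p q) = eqL P (n# 1 ∔ frm (low t) ∔ Q) ∧ eqL (p ∔ frm (low t)) (frm (high t) ∔ q)
  exact t@(P₂⁻ P Q p q) = eqL P (n# 1 ∔ 2 · frm (low t) ∔ Q) ∧ eqL (p ∔ frm (low t)) (frm (high t) ∔ q)

  value-quot : ∀ t ρ → exact t ≡ true → value t ρ ≡ eval (quot t) ρ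
  value-quot t@(P₁⁺ P p q)   ρ e with (e₁ , e₂) ← ∧-split {eqL P (n# 1 ∔ frm (low t))} e         = poch⁺ (low t) (high t) P p q ρ e₁ e₂
  value-quot t@(P₂⁺ P p q)   ρ e with (e₁ , e₂) ← ∧-split {eqL P (n# 1 ∔ 2 · frm (low t))} e     = poch2⁺ (low t) (high t) P p q ρ e₁ e₂
  value-quot t@(P₁⁻ P Q p q) ρ e with (e₁ , e₂) ← ∧-split {eqL P (n# 1 ∔ frm (low t) ∔ Q)} e     = poch⁻ (low t) (high t) P Q p q ρ e₁ e₂
  value-quot t@(P₂⁻ P Q p q) ρ e with (e₁ , e₂) ← ∧-split {eqL P (n# 1 ∔ 2 · frm (low t) ∔ Q)} e = poch2⁻ (low t) (high t) P Q p q ρ e₁ e₂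

  X Z L R I D : LExp
  X = var 0
  Z = var 2
  L = var 3
  R = var 4
  I = var 5
  D = var 6

  -- The variables of the summands; k, a and i themselves are given by expressions K, A, J.
  env : ℕ → ℕ → ℕ → ℕ → ℕ → List ℕ
  env x k z i d = x ∷ k ∷ z ∷ z / 2 ∷ (z + 1) / 2 ∷ i ∷ d ∷ []

  module _ (K A J : LExp) where

    h1E-α h1E-β : Symbol
    h1E-α = P₂⁻ (2 · X ∔ 6 · K ∔ 2 · Z ∔ 4 · A ∔ 4 · J) (n# 5) (L ∔ A ∔ n# 4) (5 · J)
    h1E-β = P₁⁻ (X ∔ 3 · K ∔ Z ∔ 2 · A ∔ 2 · J) (n# 3) (R ∔ A ∔ n# 4) (5 · J)

    h1E-M : Mono
    h1E-M = quot h1E-α ++ quot h1E-β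

    h1E-eval : ∀ x k z i d → exact h1E-α ≡ true → exact h1E-β ≡ true →
      h1E x (⟦ K ⟧L (env x k z i d)) z (⟦ A ⟧L (env x k z i d)) (⟦ J ⟧L (env x k z i d)) ≡ eval h1E-M (env x k z i d)
    h1E-eval x k z i d e₁ e₂ = eval-pair (quot h1E-α) (quot h1E-β) ρ (value-quot h1E-α ρ e₁) (value-quot h1E-β ρ e₂)
      where ρ = env x k z i d

    h2E-α h2E-β : Symbol
    h2E-α = P₂⁻ (2 · X ∔ 6 · K ∔ 2 · Z ∔ 4 · A ∔ 4 · J) (n# 3) (R ∔ A ∔ n# 1) (5 · J)
    h2E-β = P₁⁻ (X ∔ 3 · K ∔ Z ∔ 2 · A ∔ 2 · J) (n# 2) (L ∔ A ∔ n# 2) (5 · J)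

    h2E-M : Mono
    h2E-M = quot h2E-α ++ quot h2E-β

    h2E-eval : ∀ x k z i d → exact h2E-α ≡ true → exact h2E-β ≡ true →
      h2E x (⟦ K ⟧L (env x k z i d)) z (⟦ A ⟧L (env x k z i d)) (⟦ J ⟧L (env x k z i d)) ≡ eval h2E-M (env x k z i d)
    h2E-eval x k z i d e₁ e₂ = eval-pair (quot h2E-α) (quot h2E-β) ρ (value-quot h2E-α ρ e₁) (value-quot h2E-β ρ e₂)
      where ρ = env x k z i d

    h1O-α h1O-β : Symbol
    h1O-α = P₂⁻ (2 · X ∔ 6 · K ∔ 2 · Z ∔ 4 · A ∔ 4 · J) (n# 3) (R ∔ A ∔ n# 4) (5 · J)
    h1O-β = P₁⁻ (X ∔ 3 · K ∔ Z ∔ 2 · A ∔ 2 · J) (n# 1) (L ∔ A ∔ n# 4) (5 · J)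

    h1O-M : Mono
    h1O-M = quot h1O-α ++ quot h1O-β

    h1O-eval : ∀ x k z i d → exact h1O-α ≡ true → exact h1O-β ≡ true →
      h1O x (⟦ K ⟧L (env x k z i d)) z (⟦ A ⟧L (env x k z i d)) (⟦ J ⟧L (env x k z i d)) ≡ eval h1O-M (env x k z i d)
    h1O-eval x k z i d e₁ e₂ = eval-pair (quot h1O-α) (quot h1O-β) ρ (value-quot h1O-α ρ e₁) (value-quot h1O-β ρ e₂)
      where ρ = env x k z i d

    h2O-α h2O-β : Symbol
    h2O-α = P₂⁻ (2 · X ∔ 6 · K ∔ 2 · Z ∔ 4 · A ∔ 4 · J) (n# 1) (L ∔ A ∔ n# 2) (5 · J)
    h2O-β = P₁⁺ (X ∔ 3 · K ∔ Z ∔ 2 · A ∔ 2 · J) (R ∔ A ∔ n# 1) (5 · J)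

    h2O-M : Mono
    h2O-M = quot h2O-α ++ quot h2O-β

    h2O-eval : ∀ x k z i d → exact h2O-α ≡ true → exact h2O-β ≡ true →
      h2O x (⟦ K ⟧L (env x k z i d)) z (⟦ A ⟧L (env x k z i d)) (⟦ J ⟧L (env x k z i d)) ≡ eval h2O-M (env x k z i d)
    h2O-eval x k z i d e₁ e₂ = eval-pair (quot h2O-α) (quot h2O-β) ρ (value-quot h2O-α ρ e₁) (value-quot h2O-β ρ e₂)
      where ρ = env x k z i d

    aE-α aE-β aE-γ aE-δ aE-ε : Symbol
    aE-α = P₂⁻ (2 · K ∔ 2 · J) (n# 1) (Z ∔ A ∔ n# 1) (2 · J)
    aE-β = P₁⁺ (K ∔ J) (Z ∔ A ∔ n# 1) (2 · J)
    aE-γ = P₁⁺ J (Z ∔ A ∔ n# 1) (2 · J)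
    aE-δ = P₂⁻ (2 · X ∔ 4 · K ∔ 2 · A ∔ 2 · J) (n# 3) (Z ∔ A ∔ n# 1) (2 · J)
    aE-ε = P₁⁻ (X ∔ 4 · K ∔ Z ∔ 2 · A ∔ J) (n# 2) (Z ∔ A ∔ n# 1) (2 · J)

    aE-M : Mono
    aE-M = quot aE-α ++ quot aE-β ++ flip (quot aE-γ ++ quot aE-δ ++ quot aE-ε)

    aE-eval : ∀ x k z i d → exact aE-α ≡ true → exact aE-β ≡ true → exact aE-γ ≡ true → exact aE-δ ≡ true → exact aE-ε ≡ true →
      aE x (⟦ K ⟧L (env x k z i d)) z (⟦ A ⟧L (env x k z i d)) (⟦ J ⟧L (env x k z i d)) ≡ eval aE-M (env x k z i d)
    aE-eval x k z i d e₁ e₂ e₃ e₄ e₅ = eval-quint (quot aE-α) (quot aE-β) (quot aE-γ) (quot aE-δ) (quot aE-ε) ρ (value-quot aE-α ρ e₁) (value-quot aE-β ρ e₂) (value-quot aE-γ ρ e₃) (value-quot aE-δ ρ e₄) (value-quot aE-ε ρ e₅)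
      where ρ = env x k z i d

    aO-α aO-β aO-γ aO-δ aO-ε : Symbol
    aO-α = P₂⁺ (2 · K ∔ 2 · J ∔ n# 1) (Z ∔ A ∔ n# 1) (2 · J)
    aO-β = P₁⁺ (K ∔ J) (Z ∔ A ∔ n# 1) (2 · J)
    aO-γ = P₁⁺ J (Z ∔ A ∔ n# 1) (2 · J)
    aO-δ = P₂⁻ (2 · X ∔ 4 · K ∔ 2 · A ∔ 2 · J) (n# 1) (Z ∔ A ∔ n# 1) (2 · J)
    aO-ε = P₁⁺ (X ∔ 4 · K ∔ Z ∔ 2 · A ∔ J) (Z ∔ A ∔ n# 1) (2 · J)

    aO-M : Mono
    aO-M = quot aO-α ++ quot aO-β ++ flip (quot aO-γ ++ quot aO-δ ++ quot aO-ε)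

    aO-eval : ∀ x k z i d → exact aO-α ≡ true → exact aO-β ≡ true → exact aO-γ ≡ true → exact aO-δ ≡ true → exact aO-ε ≡ true →
      aO x (⟦ K ⟧L (env x k z i d)) z (⟦ A ⟧L (env x k z i d)) (⟦ J ⟧L (env x k z i d)) ≡ eval aO-M (env x k z i d)
    aO-eval x k z i d e₁ e₂ e₃ e₄ e₅ = eval-quint (quot aO-α) (quot aO-β) (quot aO-γ) (quot aO-δ) (quot aO-ε) ρ (value-quot aO-α ρ e₁) (value-quot aO-β ρ e₂) (value-quot aO-γ ρ e₃) (value-quot aO-δ ρ e₄) (value-quot aO-ε ρ e₅)
      where ρ = env x k z i d

  -- For i < a put a = 1+d+i, so that a - i is affine. `A₁` and `A₂` are then a and a+1, while `J₁`
  -- and `J₂` are i+1 and i+2.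
  K₀ K₁ A₁ A₂ J₁ J₂ : LExp
  K₀ = var 1
  K₁ = n# 1 ∔ var 1
  A₁ = n# 1 ∔ D ∔ I
  A₂ = n# 2 ∔ D ∔ I
  J₁ = n# 1 ∔ I
  J₂ = n# 2 ∔ I

  h1E-firstM aE-firstM h1O-firstM aO-firstM : Mono
  h1E-firstM = h1E-M K₁ (n# 1 ∔ D) (n# 1)
  aE-firstM  = aE-M K₁ (n# 1 ∔ D) (n# 1)
  h1O-firstM = h1O-M K₀ (n# 1 ∔ D) (n# 1)
  aO-firstM  = aO-M K₀ (n# 1 ∔ D) (n# 1)

-- The products of E₃ whose number of factors is about a/3.

module ThirdProduct where

  open Monomial
  open Pochhammer
  open import Data.Nat.DivMod using (m*n/n≡m; +-distrib-/; m%n<n)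
  open import Data.Integer.Base using (+_; -[1+_])

  module ThirdArith where
    open ℕSolver

    third-lem : ∀ b → b + b + b ≡ b * 3
    third-lem = solve 1 (λ b → b :+ b :+ b := b :* con 3) refl

    triple-suc : ∀ b → suc b + suc b + suc b ≡ 3 + (b + b + b)
    triple-suc = solve 1 (λ b → con 1 :+ b :+ (con 1 :+ b) :+ (con 1 :+ b) := con 3 :+ (b :+ b :+ b)) refl

    3*suc : ∀ i → 3 * suc i ≡ 3 + 3 * i
    3*suc = solve 1 (λ i → con 3 :* (con 1 :+ i) := con 3 :+ con 3 :* i) refl

    3* : ∀ b → 3 * b ≡ b + b + b
    3* = solve 1 (λ b → con 3 :* b := b :+ b :+ b) refl

    fsum-index : ∀ i r → (r + 3 * suc i + suc i) + (r + 1) ≡ suc ((r + (i + i + 2)) + (r + (i + i + 2)))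
    fsum-index = solve 2 (λ i r → (r :+ con 3 :* (con 1 :+ i) :+ (con 1 :+ i)) :+ (r :+ con 1) := con 1 :+ ((r :+ (i :+ i :+ con 2)) :+ (r :+ (i :+ i :+ con 2)))) refl

    a∸i : ∀ i r → r + 3 * suc i ≡ (r + (i + i + 2)) + suc i
    a∸i = solve 2 (λ i r → r :+ con 3 :* (con 1 :+ i) := (r :+ (i :+ i :+ con 2)) :+ (con 1 :+ i)) refl

    a∸i′ : ∀ i r → r + 3 * suc i ≡ suc (r + (i + i + 2)) + i
    a∸i′ = solve 2 (λ i r → r :+ con 3 :* (con 1 :+ i) := con 1 :+ (r :+ (i :+ i :+ con 2)) :+ i) refl

    index-h : ∀ c w g d → g + w ≡ 2 + (d + d + d) → w + (c + g) ≡ suc (c + 3 * d) + 1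
    index-h c w g d e = trans (solve 3 (λ c w g → w :+ (c :+ g) := c :+ (g :+ w)) refl c w g)
      (trans (cong (λ t → c + t) e) (solve 2 (λ c d → c :+ (con 2 :+ (d :+ d :+ d)) := con 1 :+ (c :+ con 3 :* d) :+ con 1) refl c d))

    index-g : ∀ c w g d → g + w ≡ 2 + (d + d + d) → (3 + w) + (c + g) ≡ suc (c + 3 * suc d) + 1
    index-g c w g d e = trans (cong (λ t → 3 + t) (index-h c w g d e))
      (solve 2 (λ c d → con 3 :+ (con 1 :+ (c :+ con 3 :* d) :+ con 1) := con 1 :+ (c :+ con 3 :* (con 1 :+ d)) :+ con 1) refl c d)

    idx₁ : ∀ b → suc (b + b + b) + suc b ≡ (b + b + 1) + (b + b + 1)
    idx₁ = solve 1 (λ b → con 1 :+ (b :+ b :+ b) :+ (con 1 :+ b) := (b :+ b :+ con 1) :+ (b :+ b :+ con 1)) refl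

    idx₂ : ∀ b → suc (suc (b + b + b)) + suc b ≡ suc ((b + b + 1) + (b + b + 1))
    idx₂ = solve 1 (λ b → con 2 :+ (b :+ b :+ b) :+ (con 1 :+ b) := con 1 :+ ((b :+ b :+ con 1) :+ (b :+ b :+ con 1))) refl

    end₀ : ∀ c b → suc (c + 3 * (b + b)) ≡ suc (c + 2 * (b + b + b))
    end₀ = solve 2 (λ c b → con 1 :+ (c :+ con 3 :* (b :+ b)) := con 1 :+ (c :+ con 2 :* (b :+ b :+ b))) refl

    last₁ : ∀ c b → 2 + (c + ((b + b + 1) + (b + b + 1) + (b + b + 1))) ≡ suc (c + 3 * suc (b + b)) + 1
    last₁ = solve 2 (λ c b → con 2 :+ (c :+ ((b :+ b :+ con 1) :+ (b :+ b :+ con 1) :+ (b :+ b :+ con 1))) := con 1 :+ (c :+ con 3 :* (con 1 :+ (b :+ b))) :+ con 1) refl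

    start₁ : ∀ c b → c + ((b + b + 1) + (b + b + 1) + (b + b + 1)) ≡ suc (c + 2 * suc (b + b + b))
    start₁ = solve 2 (λ c b → c :+ ((b :+ b :+ con 1) :+ (b :+ b :+ con 1) :+ (b :+ b :+ con 1)) := con 1 :+ (c :+ con 2 :* (con 1 :+ (b :+ b :+ b)))) refl

    last₂ : ∀ c b → 3 + (c + (2 + ((b + b + 1) + (b + b + 1) + (b + b + 1)))) ≡ suc (c + 3 * suc (suc (b + b))) + 1
    last₂ = solve 2 (λ c b → con 3 :+ (c :+ (con 2 :+ ((b :+ b :+ con 1) :+ (b :+ b :+ con 1) :+ (b :+ b :+ con 1)))) := con 1 :+ (c :+ con 3 :* (con 2 :+ (b :+ b))) :+ con 1) refl

    start₂ : ∀ c b → c + (2 + ((b + b + 1) + (b + b + 1) + (b + b + 1))) ≡ suc (c + 2 * suc (suc (b + b + b)))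
    start₂ = solve 2 (λ c b → c :+ (con 2 :+ ((b :+ b :+ con 1) :+ (b :+ b :+ con 1) :+ (b :+ b :+ con 1))) := con 1 :+ (c :+ con 2 :* (con 2 :+ (b :+ b :+ b)))) refl

  open ThirdArith
  open ℚSolver using (solve; _:+_; _:*_; _:-_; :-_; _:=_; con)
  open ≡-Reasoning

  third : ∀ b → (b + b + b) / 3 ≡ b
  third b = trans (cong (_/ 3) (third-lem b)) (m*n/n≡m b 3)

  third-suc : ∀ n → (3 + n) / 3 ≡ suc (n / 3)
  third-suc n = +-distrib-/ 3 n (m%n<n n 3)

  third₁ : ∀ b → suc (b + b + b) / 3 ≡ b
  third₁ zero    = refl
  third₁ (suc b) = trans (cong (λ m → suc m / 3) (triple-suc b)) (trans (third-suc (suc (b + b + b))) (cong suc (third₁ b)))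

  third₂ : ∀ b → suc (suc (b + b + b)) / 3 ≡ b
  third₂ zero    = refl
  third₂ (suc b) = trans (cong (λ m → suc (suc m) / 3) (triple-suc b)) (trans (third-suc (suc (suc (b + b + b)))) (cong suc (third₂ b)))

  data Mod3 : ℕ → Set where
    mod₀ : ∀ b → Mod3 (b + b + b)
    mod₁ : ∀ b → Mod3 (suc (b + b + b))
    mod₂ : ∀ b → Mod3 (suc (suc (b + b + b)))

  mod3 : ∀ n → Mod3 n
  mod3 zero = mod₀ 0
  mod3 (suc n) with mod3 n
  ... | mod₀ b = mod₁ b
  ... | mod₁ b = mod₂ b
  ... | mod₂ b = subst Mod3 (triple-suc b) (mod₀ (suc b))

  -- The products over i ≤ ⌊(a+2)/3⌋ and i ≤ ⌊a/3⌋ whose factors have the same base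
  -- c + f(a+i) and lengths that differ by 3 in each factor; since
  -- f(a+i) + f(a+1-3i) = 3(a-i) + 2, their quotient telescopes.
  module FProduct (φ : ℕ → ℚ) (φ≢0 : ∀ n → φ n ≢ 0ℚ) (c a : ℕ) (g h : ℕ → ℚ)
    (g-val : ∀ i n → f (suc a + 2 ∸ 3 * i) + (c + f (a + i)) ≡ n + 1 → g i ≡ φ n ℚ.* inv (φ (c + f (a + i))))
    (h-val : ∀ i n → 3 * suc i ≤ a → f (a + 1 ∸ 3 * suc i) + (c + f (a + suc i)) ≡ n + 1 → h (suc i) ≡ φ n ℚ.* inv (φ (c + f (a + suc i))))
    where

    -- Factors of `g` and `h` with the same index have the same denominator; their numerators are φ
    -- at 1+c+3(d+1) and at 1+c+3d, consecutive values of `U`.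
    U : ℕ → ℚ
    U j = φ (suc (c + 3 * (a ∸ j)))

    step : ∀ i → 3 * suc i ≤ a → h (suc i) ℚ.* U i ≡ g (suc i) ℚ.* U (suc i)
    step i le = begin
      h (suc i) ℚ.* U i                       ≡⟨ cong₂ ℚ._*_ (h-val i (suc (c + 3 * d)) le (trans (cong (λ t → f t + (c + f (a + suc i))) w≡) (index-h c (f (r + 1)) (f (a + suc i)) d fs)))
                                                   (cong (λ t → φ (suc (c + 3 * t))) (trans (cong (_∸ i) (trans a≡ (a∸i′ i r))) (ℕ.m+n∸n≡m (suc d) i))) ⟩
      φ (suc (c + 3 * d)) ℚ.* inv M ℚ.* φ (suc (c + 3 * suc d))
        ≡⟨ solve 3 (λ x m y → x :* m :* y := y :* m :* x) refl (φ (suc (c + 3 * d))) (inv M) (φ (suc (c + 3 * suc d))) ⟩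
      φ (suc (c + 3 * suc d)) ℚ.* inv M ℚ.* φ (suc (c + 3 * d))
        ≡⟨ cong₂ ℚ._*_ (g-val (suc i) (suc (c + 3 * suc d)) (trans (cong (λ t → t + (c + f (a + suc i))) (trans (cong f w′≡) (f-2+ (r + 1)))) (index-g c (f (r + 1)) (f (a + suc i)) d fs)))
             (cong (λ t → φ (suc (c + 3 * t))) (trans (cong (_∸ suc i) (trans a≡ (a∸i i r))) (ℕ.m+n∸n≡m d (suc i)))) ⟨
      g (suc i) ℚ.* U (suc i) ∎
      where
      r = a ∸ 3 * suc i
      d = r + (i + i + 2)
      M = φ (c + f (a + suc i))
      a≡ : a ≡ r + 3 * suc i
      a≡ = sym (ℕ.m∸n+n≡m le)
      w≡ : a + 1 ∸ 3 * suc i ≡ r + 1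
      w≡ = ℕ.+-∸-comm 1 le
      w′≡ : suc a + 2 ∸ 3 * suc i ≡ 2 + (r + 1)
      w′≡ = trans (cong (_∸ 3 * suc i) (trans (cong suc (ℕ.+-comm a 2)) (ℕ.+-comm 3 a))) (trans (ℕ.+-∸-comm 3 le) (trans (ℕ.+-comm r 3) (cong (λ t → 2 + t) (ℕ.+-comm 1 r))))
      fs : f (a + suc i) + f (r + 1) ≡ 2 + (d + d + d)
      fs = f-sum (a + suc i) (r + 1) d (trans (cong (λ t → t + suc i + (r + 1)) a≡) (fsum-index i r))

    common : ∀ b → b + b + b ≤ a → ∏[1‥ b ] h ℚ.* φ (suc (c + 3 * a)) ≡ ∏[1‥ b ] g ℚ.* U b
    common b le = telescope b h g U (λ i lt → step i (≤-trans (ℕ.*-monoʳ-≤ 3 lt) (≤-trans (ℕ.≤-reflexive (3* b)) le)))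

    -- Unless 3 divides a, the product of the `g` has one factor more than that of the `h`; its
    -- numerator is the value of `U` at which the telescoping stops.
    last : ∀ b w → b + b + b ≤ a → a ≡ w + b → f (suc a + 2 ∸ 3 * suc b) + (c + f (a + suc b)) ≡ suc (c + 3 * w) + 1 →
           c + f (a + suc b) ≡ suc (c + 2 * a) → ∏[1‥ suc b ] g ℚ.* φ (suc (c + 2 * a)) ≡ ∏[1‥ b ] h ℚ.* φ (suc (c + 3 * a))
    last b w le a≡ n≡ m≡ = begin
      ∏[1‥ b ] g ℚ.* g (suc b) ℚ.* φ (suc (c + 2 * a))
        ≡⟨ cong₂ (λ s t → ∏[1‥ b ] g ℚ.* s ℚ.* t) (g-val (suc b) (suc (c + 3 * w)) n≡) (cong φ (sym m≡)) ⟩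
      ∏[1‥ b ] g ℚ.* (φ (suc (c + 3 * w)) ℚ.* inv M) ℚ.* M
        ≡⟨ solve 4 (λ p x i m → p :* (x :* i) :* m := p :* x :* (m :* i)) refl (∏[1‥ b ] g) (φ (suc (c + 3 * w))) (inv M) M ⟩
      ∏[1‥ b ] g ℚ.* φ (suc (c + 3 * w)) ℚ.* (M ℚ.* inv M)
        ≡⟨ cong₂ ℚ._*_ (cong (λ t → ∏[1‥ b ] g ℚ.* φ (suc (c + 3 * t))) (sym (trans (cong (_∸ b) a≡) (ℕ.m+n∸n≡m w b)))) (inv-inverse M (φ≢0 _)) ⟩
      ∏[1‥ b ] g ℚ.* U b ℚ.* 1ℚ
        ≡⟨ trans (ℚ.*-identityʳ (∏[1‥ b ] g ℚ.* U b)) (sym (common b le)) ⟩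
      ∏[1‥ b ] h ℚ.* φ (suc (c + 3 * a)) ∎
      where
      M = φ (c + f (a + suc b))

    total : ∏[1‥ (a + 2) / 3 ] g ℚ.* φ (suc (c + 2 * a)) ≡ ∏[1‥ a / 3 ] h ℚ.* φ (suc (c + 3 * a))
    total = go a refl (mod3 a)
      where
      go : ∀ n → n ≡ a → Mod3 n → ∏[1‥ (a + 2) / 3 ] g ℚ.* φ (suc (c + 2 * a)) ≡ ∏[1‥ a / 3 ] h ℚ.* φ (suc (c + 3 * a))
      go n refl (mod₀ b) = trans (cong₂ (λ m s → ∏[1‥ m ] g ℚ.* φ s) (trans (cong (_/ 3) (ℕ.+-comm (b + b + b) 2)) (third₂ b))
          (sym (trans (cong (λ t → suc (c + 3 * t)) (ℕ.m+n∸n≡m (b + b) b)) (end₀ c b))))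
        (trans (sym (common b ≤-refl)) (cong (λ m → ∏[1‥ m ] h ℚ.* φ (suc (c + 3 * a))) (sym (third b))))
      go n refl (mod₁ b) = trans (cong (λ m → ∏[1‥ m ] g ℚ.* φ (suc (c + 2 * a))) (trans (cong (_/ 3) (ℕ.+-comm (suc (b + b + b)) 2)) (trans (third-suc (b + b + b)) (cong suc (third b)))))
        (trans (last b (suc (b + b)) (ℕ.n≤1+n _) refl
            (trans (cong₂ (λ s t → f s + (c + t)) idx (trans (cong f (idx₁ b)) (f-even (b + b + 1)))) (last₁ c b))
            (trans (cong (λ t → c + t) (trans (cong f (idx₁ b)) (f-even (b + b + 1)))) (start₁ c b)))
          (cong (λ m → ∏[1‥ m ] h ℚ.* φ (suc (c + 3 * a))) (sym (third₁ b))))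
        where
        idx : suc (suc (b + b + b)) + 2 ∸ 3 * suc b ≡ 1
        idx = trans (cong₂ _∸_ (trans (ℕ.+-comm (suc (suc (b + b + b))) 2) (ℕ.+-comm 4 (b + b + b))) (trans (3*suc b) (trans (cong (λ t → 3 + t) (3* b)) (ℕ.+-comm 3 (b + b + b))))) (ℕ.[m+n]∸[m+o]≡n∸o (b + b + b) 4 3)
      go n refl (mod₂ b) = trans (cong (λ m → ∏[1‥ m ] g ℚ.* φ (suc (c + 2 * a))) (trans (cong (_/ 3) (ℕ.+-comm (suc (suc (b + b + b))) 2)) (trans (third-suc (suc (b + b + b))) (cong suc (third₁ b)))))
        (trans (last b (suc (suc (b + b))) (ℕ.m≤n+m _ 2) refl
            (trans (cong₂ (λ s t → f s + (c + t)) idx (trans (cong f (idx₂ b)) (f-odd (b + b + 1)))) (last₂ c b))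
            (trans (cong (λ t → c + t) (trans (cong f (idx₂ b)) (f-odd (b + b + 1)))) (start₂ c b)))
          (cong (λ m → ∏[1‥ m ] h ℚ.* φ (suc (c + 3 * a))) (sym (third₂ b))))
        where
        idx : suc (suc (suc (b + b + b))) + 2 ∸ 3 * suc b ≡ 2
        idx = trans (cong₂ _∸_ (trans (ℕ.+-comm (suc (suc (suc (b + b + b)))) 2) (ℕ.+-comm 5 (b + b + b))) (trans (3*suc b) (trans (cong (λ t → 3 + t) (3* b)) (ℕ.+-comm 3 (b + b + b))))) (ℕ.[m+n]∸[m+o]≡n∸o (b + b + b) 5 3)

-- Telescoping of the remaining products of E₃ as (y+1,a) becomes (y,a+1).

module Telescoping where

  open Monomial
  open Pochhammer
  open Factors
  open ThirdProduct
  open import Data.Nat.DivMod using (m/n≤m)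
  open import Data.Integer.Base using (+_; -[1+_])

  open ℚSolver using (solve; _:+_; _:*_; _:-_; :-_; _:=_; con)
  open ≡-Reasoning

  by-ratio : ∀ m n r ρ {a b c} → residue m (n ++ r) ≡ [] → a ≡ eval m ρ → b ≡ eval n ρ → c ≡ eval r ρ → a ≡ b ℚ.* c
  by-ratio m n r ρ e refl refl refl = trans (mono m (n ++ r) ρ e) (eval-++ n r ρ)

  by-cross : ∀ m n r s ρ {a b c d} → residue (m ++ n) (r ++ s) ≡ [] → a ≡ eval m ρ → b ≡ eval n ρ → c ≡ eval r ρ → d ≡ eval s ρ → a ℚ.* b ≡ c ℚ.* d
  by-cross m n r s ρ e refl refl refl refl = trans (sym (eval-++ m n ρ)) (trans (mono (m ++ n) (r ++ s) ρ e) (eval-++ r s ρ))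

  interleave-even : ∀ k (r : ℕ → ℚ) → ∏[1‥ k ] (λ i → r (i + i)) ℚ.* ∏[1‥ k ] (λ i → r (i + i ∸ 1)) ≡ ∏[1‥ k + k ] r
  interleave-even zero    r = refl
  interleave-even (suc k) r = begin
    ∏[1‥ k ] (λ i → r (i + i)) ℚ.* r (suc k + suc k) ℚ.* (∏[1‥ k ] (λ i → r (i + i ∸ 1)) ℚ.* r (k + suc k))
      ≡⟨ solve 4 (λ a b c d → a :* b :* (c :* d) := a :* c :* d :* b) refl (∏[1‥ k ] (λ i → r (i + i))) (r (suc k + suc k)) (∏[1‥ k ] (λ i → r (i + i ∸ 1))) (r (k + suc k)) ⟩
    ∏[1‥ k ] (λ i → r (i + i)) ℚ.* ∏[1‥ k ] (λ i → r (i + i ∸ 1)) ℚ.* r (k + suc k) ℚ.* r (suc k + suc k)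
      ≡⟨ cong (λ p → p ℚ.* r (k + suc k) ℚ.* r (suc k + suc k)) (interleave-even k r) ⟩
    ∏[1‥ k + k ] r ℚ.* r (k + suc k) ℚ.* r (suc k + suc k)
      ≡⟨ cong (λ n → ∏[1‥ k + k ] r ℚ.* r n ℚ.* r (suc n)) (ℕ.+-suc k k) ⟩
    ∏[1‥ suc (suc (k + k)) ] r
      ≡⟨ cong (λ n → ∏[1‥ suc n ] r) (ℕ.+-suc k k) ⟨
    ∏[1‥ suc k + suc k ] r ∎

  interleave : ∀ a (r : ℕ → ℚ) → ∏[1‥ a / 2 ] (λ i → r (i + i)) ℚ.* ∏[1‥ (a + 1) / 2 ] (λ i → r (i + i ∸ 1)) ≡ ∏[1‥ a ] r
  interleave a r with parity a
  ... | even k = trans (cong₂ (λ m n → ∏[1‥ m ] (λ i → r (i + i)) ℚ.* ∏[1‥ n ] (λ i → r (i + i ∸ 1))) (half-even k)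
                   (trans (cong (_/ 2) (ℕ.+-comm (k + k) 1)) (half-odd k))) (interleave-even k r)
  ... | odd k  = trans (cong₂ (λ m n → ∏[1‥ m ] (λ i → r (i + i)) ℚ.* ∏[1‥ n ] (λ i → r (i + i ∸ 1))) (half-odd k)
                   (trans (cong (_/ 2) (ℕ.+-comm (suc (k + k)) 1)) (trans (half-suc (k + k)) (cong suc (half-even k)))))
                 (trans (sym (ℚ.*-assoc (∏[1‥ k ] (λ i → r (i + i))) (∏[1‥ k ] (λ i → r (i + i ∸ 1))) (r (k + suc k))))
                   (cong₂ ℚ._*_ (interleave-even k r) (cong r (ℕ.+-suc k k))))

  half₂ : ∀ a → (suc a + 1) / 2 ≡ suc (a / 2)
  half₂ a = trans (cong (λ n → suc n / 2) (ℕ.+-comm a 1)) (half-suc a)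

  half₁ : ∀ a → suc a / 2 ≡ (a + 1) / 2
  half₁ a = cong (_/ 2) (ℕ.+-comm 1 a)

  half-≤ : ∀ a → (a + 1) / 2 ≤ a
  half-≤ a = ℕ.≤-trans (ℕ.m≤n+m ((a + 1) / 2) (a / 2)) (ℕ.≤-reflexive (half-sum a))

  split-< : ∀ {i a} → i < a → a ≡ suc (a ∸ suc i) + i
  split-< {i} {a} lt = trans (sym (ℕ.m∸n+n≡m lt)) (ℕ.+-suc (a ∸ suc i) i)

  -- for a ratio r j = V j / V (j-1)
  tele-ratio : ∀ n (r V : ℕ → ℚ) → (∀ j → V j ≢ 0ℚ) → (∀ i → i < n → r (suc i) ℚ.* V i ≡ V (suc i)) → ∏[1‥ n ] r ≡ V n ℚ.* inv (V 0)
  tele-ratio n r V V≢0 e = trans (telescope′ n r (λ _ → 1ℚ) V (V≢0 0) (λ i lt → trans (e i lt) (sym (ℚ.*-identityˡ (V (suc i))))))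
    (trans (cong (ℚ._* (V n ℚ.* inv (V 0))) (ones n)) (ℚ.*-identityˡ (V n ℚ.* inv (V 0))))
    where
    ones : ∀ k → ∏[1‥ k ] (λ _ → 1ℚ) ≡ 1ℚ
    ones zero    = refl
    ones (suc k) = trans (ℚ.*-identityʳ (∏[1‥ k ] (λ _ → 1ℚ))) (ones k)

  -- variables x, k, z, a, j; the ratio is rM and its primitive is vM
  module HProduct (x k z a : ℕ) (g₁ g₂ h₁ h₂ : ℕ → ℚ) (rM vM : Mono) (first : ℚ)
    (r-step : residue (rM ++ vM) (sub ((1 ∷ [] , 0) ∷ (0 ∷ 1 ∷ [] , 0) ∷ (0 ∷ 0 ∷ 1 ∷ [] , 0) ∷ (0 ∷ 0 ∷ 0 ∷ 1 ∷ [] , 0) ∷ (0 ∷ 0 ∷ 0 ∷ 0 ∷ 1 ∷ [] , 1) ∷ []) vM) ≡ [])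
    (g₁-first : g₁ 1 ≡ first)
    (g₁-step : ∀ i d → a ≡ suc d + i → g₁ (2 + i) ≡ h₂ (suc i) ℚ.* eval rM (x ∷ k ∷ z ∷ a ∷ 1 + (i + i) ∷ []))
    (g₂-step : ∀ i d → a ≡ suc d + i → g₂ (suc i) ≡ h₁ (suc i) ℚ.* eval rM (x ∷ k ∷ z ∷ a ∷ i + i ∷ []))
    where

    r V : ℕ → ℚ
    r j = eval rM (x ∷ k ∷ z ∷ a ∷ j ∸ 1 ∷ [])
    V j = eval vM (x ∷ k ∷ z ∷ a ∷ j ∷ [])

    -- The step exchanges the two products: after its first factor, `g₁` is matched with `h₂`, and
    -- `g₂` with `h₁`. The ratios at even indices come from the first matching and those at odd
    -- indices from the second; interleaved, they form one telescoping sequence.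
    total : ∏[1‥ (suc a + 1) / 2 ] g₁ ℚ.* ∏[1‥ suc a / 2 ] g₂
            ≡ ∏[1‥ (a + 1) / 2 ] h₁ ℚ.* ∏[1‥ a / 2 ] h₂ ℚ.* (first ℚ.* (V a ℚ.* inv (V 0)))
    total = begin
      ∏[1‥ (suc a + 1) / 2 ] g₁ ℚ.* ∏[1‥ suc a / 2 ] g₂
        ≡⟨ cong₂ (λ m n → ∏[1‥ m ] g₁ ℚ.* ∏[1‥ n ] g₂) (half₂ a) (half₁ a) ⟩
      ∏[1‥ suc (a / 2) ] g₁ ℚ.* ∏[1‥ (a + 1) / 2 ] g₂
        ≡⟨ cong₂ ℚ._*_ (trans (∏-head (a / 2) g₁) (cong₂ ℚ._*_ g₁-first (trans (∏-cong (a / 2) (λ i lt → trans (g₁-step i (a ∸ suc i) (split-< (≤-trans lt (m/n≤m a 2))))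
                 (cong (λ j → h₂ (suc i) ℚ.* eval rM (x ∷ k ∷ z ∷ a ∷ j ∷ [])) (sym (ℕ.+-suc i i)))))
               (∏-* (a / 2) h₂ (λ i → r (i + i))))))
             (trans (∏-cong ((a + 1) / 2) (λ i lt → trans (g₂-step i (a ∸ suc i) (split-< (≤-trans lt (half-≤ a))))
                 (cong (λ j → h₁ (suc i) ℚ.* eval rM (x ∷ k ∷ z ∷ a ∷ j ∸ 1 ∷ [])) (sym (ℕ.+-suc i i)))))
               (∏-* ((a + 1) / 2) h₁ (λ i → r (i + i ∸ 1)))) ⟩
      first ℚ.* (∏h₂ ℚ.* ∏[1‥ a / 2 ] (λ i → r (i + i))) ℚ.* (∏h₁ ℚ.* ∏[1‥ (a + 1) / 2 ] (λ i → r (i + i ∸ 1)))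
        ≡⟨ solve 5 (λ f b p c q → f :* (b :* p) :* (c :* q) := c :* b :* (f :* (p :* q))) refl first ∏h₂ (∏[1‥ a / 2 ] (λ i → r (i + i))) ∏h₁ (∏[1‥ (a + 1) / 2 ] (λ i → r (i + i ∸ 1))) ⟩
      ∏h₁ ℚ.* ∏h₂ ℚ.* (first ℚ.* (∏[1‥ a / 2 ] (λ i → r (i + i)) ℚ.* ∏[1‥ (a + 1) / 2 ] (λ i → r (i + i ∸ 1))))
        ≡⟨ cong (λ p → ∏h₁ ℚ.* ∏h₂ ℚ.* (first ℚ.* p)) (trans (interleave a r) (tele-ratio a r V (λ j → eval≢0 vM (x ∷ k ∷ z ∷ a ∷ j ∷ []))
             (λ i _ → trans (sym (eval-++ rM vM (ρ i))) (trans (mono (rM ++ vM) (sub σ vM) (ρ i) r-step) (sym (eval-sub vM σ (ρ i))))))) ⟩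
      ∏h₁ ℚ.* ∏h₂ ℚ.* (first ℚ.* (V a ℚ.* inv (V 0))) ∎
      where
      ∏h₁ = ∏[1‥ (a + 1) / 2 ] h₁
      ∏h₂ = ∏[1‥ a / 2 ] h₂
      ρ : ℕ → List ℕ
      ρ i = x ∷ k ∷ z ∷ a ∷ i ∷ []
      σ : List Form
      σ = (1 ∷ [] , 0) ∷ (0 ∷ 1 ∷ [] , 0) ∷ (0 ∷ 0 ∷ 1 ∷ [] , 0) ∷ (0 ∷ 0 ∷ 0 ∷ 1 ∷ [] , 0) ∷ (0 ∷ 0 ∷ 0 ∷ 0 ∷ 1 ∷ [] , 1) ∷ []

  -- in the variables x, k, z, a, j (with ratio index j+1), for c = x + 3(k+1) + z + 2a
  hrE hvE hrO hvO : Mono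
  hrE = ↑ (odd (1 ∷ 3 ∷ 1 ∷ 2 ∷ 1 ∷ [] , 3)) ∷ ↑ (fac (1 ∷ 3 ∷ 1 ∷ 2 ∷ 1 ∷ [] , 3)) ∷ ↓ (odd (1 ∷ 3 ∷ 1 ∷ 2 ∷ 1 ∷ [] , 5)) ∷ ↓ (fac (1 ∷ 3 ∷ 1 ∷ 2 ∷ 1 ∷ [] , 4)) ∷ []
  hvE = ↓ (odd (1 ∷ 3 ∷ 1 ∷ 2 ∷ 1 ∷ [] , 3)) ∷ ↓ (odd (1 ∷ 3 ∷ 1 ∷ 2 ∷ 1 ∷ [] , 4)) ∷ ↓ (fac (1 ∷ 3 ∷ 1 ∷ 2 ∷ 1 ∷ [] , 3)) ∷ []
  hrO = ↑ (odd (1 ∷ 3 ∷ 1 ∷ 2 ∷ 1 ∷ [] , 2)) ∷ ↑ (fac (1 ∷ 3 ∷ 1 ∷ 2 ∷ 1 ∷ [] , 1)) ∷ ↓ (odd (1 ∷ 3 ∷ 1 ∷ 2 ∷ 1 ∷ [] , 3)) ∷ ↓ (fac (1 ∷ 3 ∷ 1 ∷ 2 ∷ 1 ∷ [] , 3)) ∷ []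
  hvO = ↓ (odd (1 ∷ 3 ∷ 1 ∷ 2 ∷ 1 ∷ [] , 2)) ∷ ↓ (fac (1 ∷ 3 ∷ 1 ∷ 2 ∷ 1 ∷ [] , 1)) ∷ ↓ (fac (1 ∷ 3 ∷ 1 ∷ 2 ∷ 1 ∷ [] , 2)) ∷ []

  σ₁ σ₀ : List Form
  σ₁ = (1 ∷ [] , 0) ∷ (0 ∷ 1 ∷ [] , 0) ∷ (0 ∷ 0 ∷ 1 ∷ [] , 0) ∷ (0 ∷ 0 ∷ 0 ∷ 0 ∷ 0 ∷ 1 ∷ 1 ∷ [] , 1) ∷ (0 ∷ 0 ∷ 0 ∷ 0 ∷ 0 ∷ 2 ∷ [] , 1) ∷ []
  σ₀ = (1 ∷ [] , 0) ∷ (0 ∷ 1 ∷ [] , 0) ∷ (0 ∷ 0 ∷ 1 ∷ [] , 0) ∷ (0 ∷ 0 ∷ 0 ∷ 0 ∷ 0 ∷ 1 ∷ 1 ∷ [] , 1) ∷ (0 ∷ 0 ∷ 0 ∷ 0 ∷ 0 ∷ 2 ∷ [] , 0) ∷ []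

  firstE firstO : ℕ → ℕ → ℕ → ℕ → ℚ
  firstE x k z a = eval h1E-firstM (x ∷ k ∷ z ∷ z / 2 ∷ (z + 1) / 2 ∷ 0 ∷ a ∷ [])
  firstO x k z a = eval h1O-firstM (x ∷ k ∷ z ∷ z / 2 ∷ (z + 1) / 2 ∷ 0 ∷ a ∷ [])

  H-even : ∀ x k z a →
    ∏[1‥ (suc a + 1) / 2 ] (h1E x (suc k) z (suc a)) ℚ.* ∏[1‥ suc a / 2 ] (h2E x (suc k) z (suc a))
    ≡ ∏[1‥ (a + 1) / 2 ] (h1O x (suc k) z a) ℚ.* ∏[1‥ a / 2 ] (h2O x (suc k) z a)
      ℚ.* (firstE x k z a ℚ.* (eval hvE (x ∷ k ∷ z ∷ a ∷ a ∷ []) ℚ.* inv (eval hvE (x ∷ k ∷ z ∷ a ∷ 0 ∷ []))))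
  H-even x k z a = HProduct.total x k z a _ _ (h1O x (suc k) z a) (h2O x (suc k) z a) hrE hvE (firstE x k z a) refl
    (h1E-eval K₁ (n# 1 ∔ D) (n# 1) x k z 0 a refl refl)
    -- Matching a with `suc d + i` makes every difference a - i affine; the first `refl` handed to
    -- `by-ratio` is the cancellation.
    (λ { i d refl → by-ratio (h1E-M K₁ A₂ J₂) (h2O-M K₁ A₁ J₁) (sub σ₁ hrE) (ρ i d) refl (h1E-eval K₁ A₂ J₂ x k z i d refl refl) (h2O-eval K₁ A₁ J₁ x k z i d refl refl) (eval-sub hrE σ₁ (ρ i d)) })
    (λ { i d refl → by-ratio (h2E-M K₁ A₂ J₁) (h1O-M K₁ A₁ J₁) (sub σ₀ hrE) (ρ i d) refl (h2E-eval K₁ A₂ J₁ x k z i d refl refl) (h1O-eval K₁ A₁ J₁ x k z i d refl refl) (eval-sub hrE σ₀ (ρ i d)) })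
    where
    ρ : ℕ → ℕ → List ℕ
    ρ i d = x ∷ k ∷ z ∷ z / 2 ∷ (z + 1) / 2 ∷ i ∷ d ∷ []

  H-odd : ∀ x k z a →
    ∏[1‥ (suc a + 1) / 2 ] (h1O x k z (suc a)) ℚ.* ∏[1‥ suc a / 2 ] (h2O x k z (suc a))
    ≡ ∏[1‥ (a + 1) / 2 ] (h1E x (suc k) z a) ℚ.* ∏[1‥ a / 2 ] (h2E x (suc k) z a)
      ℚ.* (firstO x k z a ℚ.* (eval hvO (x ∷ k ∷ z ∷ a ∷ a ∷ []) ℚ.* inv (eval hvO (x ∷ k ∷ z ∷ a ∷ 0 ∷ []))))
  H-odd x k z a = HProduct.total x k z a _ _ (h1E x (suc k) z a) (h2E x (suc k) z a) hrO hvO (firstO x k z a) refl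
    (h1O-eval K₀ (n# 1 ∔ D) (n# 1) x k z 0 a refl refl)
    (λ { i d refl → by-ratio (h1O-M K₀ A₂ J₂) (h2E-M K₁ A₁ J₁) (sub σ₁ hrO) (ρ i d) refl (h1O-eval K₀ A₂ J₂ x k z i d refl refl) (h2E-eval K₁ A₁ J₁ x k z i d refl refl) (eval-sub hrO σ₁ (ρ i d)) })
    (λ { i d refl → by-ratio (h2O-M K₀ A₂ J₁) (h1E-M K₁ A₁ J₁) (sub σ₀ hrO) (ρ i d) refl (h2O-eval K₀ A₂ J₁ x k z i d refl refl) (h1E-eval K₁ A₁ J₁ x k z i d refl refl) (eval-sub hrO σ₀ (ρ i d)) })
    where
    ρ : ℕ → ℕ → List ℕ
    ρ i d = x ∷ k ∷ z ∷ z / 2 ∷ (z + 1) / 2 ∷ i ∷ d ∷ []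

  -- primitives of the ratios in the last product, in the variables x, k, z, j, a - j
  auE auO : Mono
  auE = ↑ (odd (0 ∷ 1 ∷ 1 ∷ 0 ∷ 1 ∷ [] , 1)) ∷ ↓ (fac (0 ∷ 1 ∷ 0 ∷ 1 ∷ [] , 1)) ∷ ↑ (fac (0 ∷ 0 ∷ 0 ∷ 1 ∷ [] , 0))
      ∷ ↑ (odd (1 ∷ 2 ∷ 0 ∷ 2 ∷ 1 ∷ [] , 2)) ∷ ↑ (fac (1 ∷ 4 ∷ 1 ∷ 3 ∷ 2 ∷ [] , 4)) ∷ []
  auO = ↓ (odd (0 ∷ 1 ∷ 0 ∷ 1 ∷ [] , 1)) ∷ ↑ (fac (0 ∷ 1 ∷ 1 ∷ 0 ∷ 1 ∷ [] , 0)) ∷ ↑ (fac (0 ∷ 0 ∷ 0 ∷ 1 ∷ [] , 0))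
      ∷ ↑ (odd (1 ∷ 2 ∷ 0 ∷ 2 ∷ 1 ∷ [] , 1)) ∷ ↑ (fac (1 ∷ 4 ∷ 1 ∷ 3 ∷ 2 ∷ [] , 2)) ∷ []

  -- After the first factor of `g` is split off, factor i+2 of `g` meets factor i+1 of `h`. The
  -- primitive takes i and a - i as separate variables, which keeps it affine.
  module AProduct (x k z a : ℕ) (g h : ℕ → ℚ) (uM : Mono) (first : ℚ) (g-first : g 1 ≡ first)
    (step : ∀ i d → a ≡ suc d + i → g (2 + i) ℚ.* eval uM (x ∷ k ∷ z ∷ i ∷ suc d ∷ []) ≡ h (suc i) ℚ.* eval uM (x ∷ k ∷ z ∷ suc i ∷ d ∷ []))
    where
    total : ∏[1‥ suc a ] g ≡ ∏[1‥ a ] h ℚ.* (first ℚ.* (eval uM (x ∷ k ∷ z ∷ a ∷ 0 ∷ []) ℚ.* inv (eval uM (x ∷ k ∷ z ∷ 0 ∷ a ∷ []))))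
    total = begin
      ∏[1‥ suc a ] g                                       ≡⟨ ∏-head a g ⟩
      g 1 ℚ.* ∏[1‥ a ] (λ i → g (suc i))                   ≡⟨ cong₂ ℚ._*_ g-first (telescope′ a (λ i → g (suc i)) h U (eval≢0 uM (x ∷ k ∷ z ∷ 0 ∷ a ∷ [])) move) ⟩
      first ℚ.* (∏[1‥ a ] h ℚ.* (U a ℚ.* inv (U 0)))       ≡⟨ cong (λ e → first ℚ.* (∏[1‥ a ] h ℚ.* (eval uM (x ∷ k ∷ z ∷ a ∷ e ∷ []) ℚ.* inv (U 0)))) (ℕ.n∸n≡0 a) ⟩
      first ℚ.* (∏[1‥ a ] h ℚ.* (eval uM (x ∷ k ∷ z ∷ a ∷ 0 ∷ []) ℚ.* inv (U 0)))
        ≡⟨ solve 4 (λ f h u i → f :* (h :* (u :* i)) := h :* (f :* (u :* i))) refl first (∏[1‥ a ] h) (eval uM (x ∷ k ∷ z ∷ a ∷ 0 ∷ [])) (inv (U 0)) ⟩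
      ∏[1‥ a ] h ℚ.* (first ℚ.* (eval uM (x ∷ k ∷ z ∷ a ∷ 0 ∷ []) ℚ.* inv (U 0))) ∎
      where
      U : ℕ → ℚ
      U j = eval uM (x ∷ k ∷ z ∷ j ∷ a ∸ j ∷ [])
      move : ∀ i → i < a → g (2 + i) ℚ.* U i ≡ h (suc i) ℚ.* U (suc i)
      move i lt = trans (cong (λ e → g (2 + i) ℚ.* eval uM (x ∷ k ∷ z ∷ i ∷ e ∷ [])) (trans (cong (_∸ i) (split-< lt)) (ℕ.m+n∸n≡m (suc (a ∸ suc i)) i)))
                        (step i (a ∸ suc i) (split-< lt))

  σᵢ σᵢ₊₁ : List Form
  σᵢ   = (1 ∷ [] , 0) ∷ (0 ∷ 1 ∷ [] , 0) ∷ (0 ∷ 0 ∷ 1 ∷ [] , 0) ∷ (0 ∷ 0 ∷ 0 ∷ 0 ∷ 0 ∷ 1 ∷ [] , 0) ∷ (0 ∷ 0 ∷ 0 ∷ 0 ∷ 0 ∷ 0 ∷ 1 ∷ [] , 1) ∷ []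
  σᵢ₊₁ = (1 ∷ [] , 0) ∷ (0 ∷ 1 ∷ [] , 0) ∷ (0 ∷ 0 ∷ 1 ∷ [] , 0) ∷ (0 ∷ 0 ∷ 0 ∷ 0 ∷ 0 ∷ 1 ∷ [] , 1) ∷ (0 ∷ 0 ∷ 0 ∷ 0 ∷ 0 ∷ 0 ∷ 1 ∷ [] , 0) ∷ []

  firstAE firstAO : ℕ → ℕ → ℕ → ℕ → ℚ
  firstAE x k z a = eval aE-firstM (x ∷ k ∷ z ∷ z / 2 ∷ (z + 1) / 2 ∷ 0 ∷ a ∷ [])
  firstAO x k z a = eval aO-firstM (x ∷ k ∷ z ∷ z / 2 ∷ (z + 1) / 2 ∷ 0 ∷ a ∷ [])

  A-even : ∀ x k z a → ∏[1‥ suc a ] (aE x (suc k) z (suc a)) ≡ ∏[1‥ a ] (aO x (suc k) z a)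
           ℚ.* (firstAE x k z a ℚ.* (eval auE (x ∷ k ∷ z ∷ a ∷ 0 ∷ []) ℚ.* inv (eval auE (x ∷ k ∷ z ∷ 0 ∷ a ∷ []))))
  A-even x k z a = AProduct.total x k z a _ (aO x (suc k) z a) auE (firstAE x k z a) (aE-eval K₁ (n# 1 ∔ D) (n# 1) x k z 0 a refl refl refl refl refl)
    (λ { i d refl → by-cross (aE-M K₁ A₂ J₂) (sub σᵢ auE) (aO-M K₁ A₁ J₁) (sub σᵢ₊₁ auE) (ρ i d) refl (aE-eval K₁ A₂ J₂ x k z i d refl refl refl refl refl) (eval-sub auE σᵢ (ρ i d)) (aO-eval K₁ A₁ J₁ x k z i d refl refl refl refl refl) (eval-sub auE σᵢ₊₁ (ρ i d)) })
    where
    ρ : ℕ → ℕ → List ℕ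
    ρ i d = x ∷ k ∷ z ∷ z / 2 ∷ (z + 1) / 2 ∷ i ∷ d ∷ []

  A-odd : ∀ x k z a → ∏[1‥ suc a ] (aO x k z (suc a)) ≡ ∏[1‥ a ] (aE x (suc k) z a)
          ℚ.* (firstAO x k z a ℚ.* (eval auO (x ∷ k ∷ z ∷ a ∷ 0 ∷ []) ℚ.* inv (eval auO (x ∷ k ∷ z ∷ 0 ∷ a ∷ []))))
  A-odd x k z a = AProduct.total x k z a _ (aE x (suc k) z a) auO (firstAO x k z a) (aO-eval K₀ (n# 1 ∔ D) (n# 1) x k z 0 a refl refl refl refl refl)
    (λ { i d refl → by-cross (aO-M K₀ A₂ J₂) (sub σᵢ auO) (aE-M K₁ A₁ J₁) (sub σᵢ₊₁ auO) (ρ i d) refl (aO-eval K₀ A₂ J₂ x k z i d refl refl refl refl refl) (eval-sub auO σᵢ (ρ i d)) (aE-eval K₁ A₁ J₁ x k z i d refl refl refl refl refl) (eval-sub auO σᵢ₊₁ (ρ i d)) })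
    where
    ρ : ℕ → ℕ → List ℕ
    ρ i d = x ∷ k ∷ z ∷ z / 2 ∷ (z + 1) / 2 ∷ i ∷ d ∷ []

-- The ratio of E₃ between (y,a+1) and (y+1,a).

module E3Step where

  open Monomial
  open Pochhammer
  open Factors using (f1E; f2E; f1O; f2O; h1E; h2E; h1O; h2O; aE; aO)
  open ThirdProduct
  open Telescoping
  open import Data.Integer.Base using (+_; -[1+_])

  module E3StepArith where
    open ℕSolver

    baseF1 : ∀ x k g → 2 * x + 6 * suc k + 2 * g ≡ suc (2 * (x + 3 * k + 2 + g)) + 1
    baseF1 = solve 3 (λ x k g → con 2 :* x :+ con 6 :* (con 1 :+ k) :+ con 2 :* g := con 1 :+ con 2 :* (x :+ con 3 :* k :+ con 2 :+ g) :+ con 1) refl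

    baseF1′ : ∀ x k g → 2 * x + 6 * suc k + 2 * g ≡ 2 * x + 6 * k + 2 * (3 + g)
    baseF1′ = solve 3 (λ x k g → con 2 :* x :+ con 6 :* (con 1 :+ k) :+ con 2 :* g := con 2 :* x :+ con 6 :* k :+ con 2 :* (con 3 :+ g)) refl

    baseF2 : ∀ x k g → x + 3 * suc k + g + 1 ≡ suc (x + 3 * k + (3 + g))
    baseF2 = solve 3 (λ x k g → x :+ con 3 :* (con 1 :+ k) :+ g :+ con 1 := con 1 :+ (x :+ con 3 :* k :+ (con 3 :+ g))) refl

    powE : ∀ al ah zl zh a z k → (suc al * zh + ah * zl + 1) + (a + z + 2 * suc k) ≡ (al * zh + ah * zl + zh) + (suc a + z + 2 * suc k)
    powE = solve 7 (λ al ah zl zh a z k → ((con 1 :+ al) :* zh :+ ah :* zl :+ con 1) :+ (a :+ z :+ con 2 :* (con 1 :+ k))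
       := (al :* zh :+ ah :* zl :+ zh) :+ (con 1 :+ a :+ z :+ con 2 :* (con 1 :+ k))) refl

    powO : ∀ al ah zl zh a z k → (ah * zh + suc al * zl) + (a + z + 2 * suc k) ≡ (ah * zh + al * zl + 1 + zl) + (suc a + z + 2 * k)
    powO = solve 7 (λ al ah zl zh a z k → (ah :* zh :+ (con 1 :+ al) :* zl) :+ (a :+ z :+ con 2 :* (con 1 :+ k))
       := (ah :* zh :+ al :* zl :+ con 1 :+ zl) :+ (con 1 :+ a :+ z :+ con 2 :* k)) refl

    countE : ∀ a z k → k + suc (k + 0) + suc a + z ≡ 2 * suc k + a + z
    countE = solve 3 (λ a z k → k :+ (con 1 :+ (k :+ con 0)) :+ (con 1 :+ a) :+ z := con 2 :* (con 1 :+ k) :+ a :+ z) refl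

    countO : ∀ a z k → 2 * k + suc a + z ≡ k + suc (k + 0) + a + z
    countO = solve 3 (λ a z k → con 2 :* k :+ (con 1 :+ a) :+ z := k :+ (con 1 :+ (k :+ con 0)) :+ a :+ z) refl

  open E3StepArith
  open ℚSolver using (solve; _:+_; _:*_; _:-_; :-_; _:=_; con)
  open ≡-Reasoning

  suc+2 : ∀ a → suc a + 1 ≡ a + 2
  suc+2 a = sym (ℕ.+-suc a 1)

  quotient : ∀ p q r s → s ≢ 0ℚ → p ℚ.* s ≡ q ℚ.* r → p ≡ q ℚ.* (r ℚ.* inv s)
  quotient p q r s s≢0 e = *-cancelˡ s p (q ℚ.* (r ℚ.* inv s)) s≢0 (begin
    s ℚ.* p                     ≡⟨ ℚ.*-comm s p ⟩
    p ℚ.* s                     ≡⟨ e ⟩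
    q ℚ.* r                     ≡⟨ ℚ.*-identityˡ (q ℚ.* r) ⟨
    1ℚ ℚ.* (q ℚ.* r)            ≡⟨ cong (ℚ._* (q ℚ.* r)) (inv-inverse s s≢0) ⟨
    s ℚ.* inv s ℚ.* (q ℚ.* r)   ≡⟨ solve 4 (λ s i q r → s :* i :* (q :* r) := s :* (q :* (r :* i))) refl s (inv s) q r ⟩
    s ℚ.* (q ℚ.* (r ℚ.* inv s)) ∎)

  f1-ratio : ℕ → ℕ → ℕ → ℚ
  f1-ratio x k a = ι (oddf (suc (x + 3 * k + 2 + 3 * a))) ℚ.* inv (ι (oddf (suc (x + 3 * k + 2 + 2 * a))))

  f2-ratio : ℕ → ℕ → ℕ → ℚ
  f2-ratio x k a = ι (suc (x + 3 * k + 3 * a) !) ℚ.* inv (ι (suc (x + 3 * k + 2 * a) !))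

  F1-even : ∀ x k a → ∏[1‥ (suc a + 1) / 3 ] (f1E x (suc k) (suc a)) ≡ ∏[1‥ a / 3 ] (f1O x (suc k) a) ℚ.* f1-ratio x k a
  F1-even x k a = trans (cong (λ n → ∏[1‥ n / 3 ] (f1E x (suc k) (suc a))) (suc+2 a)) (quotient (∏[1‥ (a + 2) / 3 ] (f1E x (suc k) (suc a))) (∏[1‥ a / 3 ] (f1O x (suc k) a))
    (ι (oddf (suc (x + 3 * k + 2 + 3 * a)))) (ι (oddf (suc (x + 3 * k + 2 + 2 * a)))) (oddf≢0 (suc (x + 3 * k + 2 + 2 * a)))
    (FProduct.total (λ n → ι (oddf n)) oddf≢0 (x + 3 * k + 2) a (f1E x (suc k) (suc a)) (f1O x (suc k) a)
      (λ i n e → poch2-quotient (x + 3 * k + 2 + f (a + i)) n (⊖-+ (suc (2 * (x + 3 * k + 2 + f (a + i)))) (baseF1 x k (f (a + i)))) (⊖-eq {f (suc a + 2 ∸ 3 * i)} {1} {n} e))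
      (λ i n _ e → poch2-quotient (x + 3 * k + 2 + f (a + suc i)) n (⊖-+ (suc (2 * (x + 3 * k + 2 + f (a + suc i)))) (baseF1 x k (f (a + suc i)))) (⊖-eq {f (a + 1 ∸ 3 * suc i)} {1} {n} e))))

  F2-even : ∀ x k a → ∏[1‥ suc a / 3 ] (f2E x k (suc a)) ≡ ∏[1‥ (a + 1) / 3 ] (f2O x k a)
  F2-even x k a = trans (cong (λ n → ∏[1‥ n / 3 ] (f2E x k (suc a))) (ℕ.+-comm 1 a)) (∏-cong ((a + 1) / 3) same)
    where
    same : ∀ i → i < (a + 1) / 3 → f2E x k (suc a) (suc i) ≡ f2O x k a (suc i)
    same i _ = cong₂ (λ m n → poch (+ (x + 3 * k + f m + 1)) (f (n ∸ 3 * suc i) ⊖ 1)) (trans (cong (_∸ 1) (ℕ.+-suc a i)) (sym (cong (_∸ 1) (ℕ.+-suc a i)))) (suc+2 a)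

  F1-odd : ∀ x k a → ∏[1‥ suc a / 3 ] (f1O x k (suc a)) ≡ ∏[1‥ (a + 1) / 3 ] (f1E x (suc k) a)
  F1-odd x k a = trans (cong (λ n → ∏[1‥ n / 3 ] (f1O x k (suc a))) (ℕ.+-comm 1 a)) (∏-cong ((a + 1) / 3) same)
    where
    same : ∀ i → i < (a + 1) / 3 → f1O x k (suc a) (suc i) ≡ f1E x (suc k) a (suc i)
    same i _ = cong₂ (λ m n → poch2 (m ⊖ 1) (f (n ∸ 3 * suc i) ⊖ 1))
      (trans (cong (λ t → 2 * x + 6 * k + 2 * f t) (cong suc (ℕ.+-suc a i))) (trans (cong (λ t → 2 * x + 6 * k + 2 * t) (f-2+ (a + i)))
        (trans (sym (baseF1′ x k (f (a + i)))) (cong (λ t → 2 * x + 6 * suc k + 2 * f t) (sym (cong (_∸ 1) (ℕ.+-suc a i)))))))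
      (suc+2 a)

  F2-odd : ∀ x k a → ∏[1‥ (suc a + 1) / 3 ] (f2O x k (suc a)) ≡ ∏[1‥ a / 3 ] (f2E x (suc k) a) ℚ.* f2-ratio x k a
  F2-odd x k a = trans (cong (λ n → ∏[1‥ n / 3 ] (f2O x k (suc a))) (suc+2 a)) (quotient (∏[1‥ (a + 2) / 3 ] (f2O x k (suc a))) (∏[1‥ a / 3 ] (f2E x (suc k) a))
    (ι (suc (x + 3 * k + 3 * a) !)) (ι (suc (x + 3 * k + 2 * a) !)) (fact≢0 (suc (x + 3 * k + 2 * a)))
    (FProduct.total (λ n → ι (n !)) fact≢0 (x + 3 * k) a (f2O x k (suc a)) (f2E x (suc k) a)
      (λ i n e → poch-quotient (x + 3 * k + f (a + i)) n (cong (+_) (ℕ.+-comm (x + 3 * k + f (a + i)) 1)) (⊖-eq {f (suc a + 2 ∸ 3 * i)} {1} {n} e))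
      (λ i n le e → poch-quotient (x + 3 * k + f (a + suc i)) n (cong (+_) (base i le)) (⊖-eq {f (a + 1 ∸ 3 * suc i)} {1} {n} e))))
    where
    base : ∀ i → 3 * suc i ≤ a → x + 3 * suc k + f (a + suc i ∸ 2) + 1 ≡ suc (x + 3 * k + f (a + suc i))
    -- 3(i+1) ≤ a ensures that the index is at least 2, so the subtraction of 2 is exact.
    base i le = trans (baseF2 x k (f (a + suc i ∸ 2))) (cong (λ t → suc (x + 3 * k + t)) (trans (sym (f-2+ (a + suc i ∸ 2)))
      (cong f (ℕ.m+[n∸m]≡n {2} (≤-trans (s≤s (s≤s z≤n)) (≤-trans (ℕ.*-monoʳ-≤ 3 (s≤s (z≤n {i}))) (≤-trans le (ℕ.m≤m+n a (suc i)))))))))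

  pow-ratio : ∀ p q p′ q′ t → p + q′ ≡ (p′ + t) + q → pow2 (p ⊖ q) ≡ pow2 (p′ ⊖ q′) ℚ.* ι (2 ^ t)
  pow-ratio p q p′ q′ t e = trans (cong pow2 (⊖-eq {p} {q} {p′ + t} {q′} e)) (trans (pow2-quotient (p′ + t) q′)
    (trans (cong (λ u → u ℚ.* inv (ι (2 ^ q′))) (trans (cong ι (ℕ.^-distribˡ-+-* 2 p′ t)) (ι-* (2 ^ p′) (2 ^ t))))
    (trans (solve 3 (λ a b i → a :* b :* i := a :* i :* b) refl (ι (2 ^ p′)) (ι (2 ^ t)) (inv (ι (2 ^ q′))))
      (cong (ℚ._* ι (2 ^ t)) (sym (pow2-quotient p′ q′))))))

  stepE-ratio stepO-ratio : ℕ → ℕ → ℕ → ℕ → ℚ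
  stepE-ratio x k z a = ι (2 ^ ((z + 1) / 2)) ℚ.* f1-ratio x k a
    ℚ.* (firstE x k z a ℚ.* (eval hvE (x ∷ k ∷ z ∷ a ∷ a ∷ []) ℚ.* inv (eval hvE (x ∷ k ∷ z ∷ a ∷ 0 ∷ []))))
    ℚ.* (firstAE x k z a ℚ.* (eval auE (x ∷ k ∷ z ∷ a ∷ 0 ∷ []) ℚ.* inv (eval auE (x ∷ k ∷ z ∷ 0 ∷ a ∷ []))))
  stepO-ratio x k z a = ι (2 ^ (z / 2)) ℚ.* f2-ratio x k a
    ℚ.* (firstO x k z a ℚ.* (eval hvO (x ∷ k ∷ z ∷ a ∷ a ∷ []) ℚ.* inv (eval hvO (x ∷ k ∷ z ∷ a ∷ 0 ∷ []))))
    ℚ.* (firstAO x k z a ℚ.* (eval auO (x ∷ k ∷ z ∷ a ∷ 0 ∷ []) ℚ.* inv (eval auO (x ∷ k ∷ z ∷ 0 ∷ a ∷ []))))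

  seven : ∀ p p′ P F F′ K H₁ H₂ H₁′ H₂′ A A′ t u v w → p ≡ p′ ℚ.* t → F ≡ F′ ℚ.* u → H₁ ℚ.* H₂ ≡ H₁′ ℚ.* H₂′ ℚ.* v → A ≡ A′ ℚ.* w →
          p ℚ.* P ℚ.* (F ℚ.* K) ℚ.* (H₁ ℚ.* H₂) ℚ.* A ≡ (p′ ℚ.* P ℚ.* (F′ ℚ.* K) ℚ.* (H₁′ ℚ.* H₂′) ℚ.* A′) ℚ.* (t ℚ.* u ℚ.* v ℚ.* w)
  seven p p′ P F F′ K H₁ H₂ H₁′ H₂′ A A′ t u v w e₁ e₂ e₃ e₄ = begin
    p ℚ.* P ℚ.* (F ℚ.* K) ℚ.* (H₁ ℚ.* H₂) ℚ.* A
      ≡⟨ cong₂ ℚ._*_ (cong₂ ℚ._*_ (cong₂ (λ a b → a ℚ.* P ℚ.* (b ℚ.* K)) e₁ e₂) e₃) e₄ ⟩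
    (p′ ℚ.* t) ℚ.* P ℚ.* ((F′ ℚ.* u) ℚ.* K) ℚ.* (H′ ℚ.* v) ℚ.* (A′ ℚ.* w)
      ≡⟨ cong (λ z → z ℚ.* (H′ ℚ.* v) ℚ.* (A′ ℚ.* w)) (solve 6 (λ p t P F u K → (p :* t) :* P :* ((F :* u) :* K) := (p :* P :* (F :* K)) :* (t :* u)) refl p′ t P F′ u K) ⟩
    ((p′ ℚ.* P ℚ.* (F′ ℚ.* K)) ℚ.* (t ℚ.* u)) ℚ.* (H′ ℚ.* v) ℚ.* (A′ ℚ.* w)
      ≡⟨ solve 6 (λ q s h v a w → (q :* s) :* (h :* v) :* (a :* w) := (q :* h :* a) :* (s :* v :* w)) refl (p′ ℚ.* P ℚ.* (F′ ℚ.* K)) (t ℚ.* u) H′ v A′ w ⟩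
    ((p′ ℚ.* P ℚ.* (F′ ℚ.* K)) ℚ.* H′ ℚ.* A′) ℚ.* ((t ℚ.* u) ℚ.* v ℚ.* w) ∎
    where H′ = H₁′ ℚ.* H₂′

  regroup : ∀ p P F K H₁ H₂ A → p ℚ.* P ℚ.* F ℚ.* K ℚ.* H₁ ℚ.* H₂ ℚ.* A ≡ p ℚ.* P ℚ.* (F ℚ.* K) ℚ.* (H₁ ℚ.* H₂) ℚ.* A
  regroup = solve 7 (λ p P F K H₁ H₂ A → p :* P :* F :* K :* H₁ :* H₂ :* A := p :* P :* (F :* K) :* (H₁ :* H₂) :* A) refl

  regroup′ : ∀ p P F K H₁ H₂ A → p ℚ.* P ℚ.* F ℚ.* K ℚ.* H₁ ℚ.* H₂ ℚ.* A ≡ p ℚ.* P ℚ.* (K ℚ.* F) ℚ.* (H₁ ℚ.* H₂) ℚ.* A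
  regroup′ = solve 7 (λ p P F K H₁ H₂ A → p :* P :* F :* K :* H₁ :* H₂ :* A := p :* P :* (K :* F) :* (H₁ :* H₂) :* A) refl

  -- From y = 2k+2 with gap a+1 to y = 2k+3 with gap a. Since y+a is kept, the product of the `P₃`
  -- is common to both sides, and only a power of two and telescoped remainders are left.
  E3-even-step : ∀ x k z a → E3even x (suc k) z (suc a) ≡ E3odd x (suc k) z a ℚ.* stepE-ratio x k z a
  E3-even-step x k z a = begin
    E3even x (suc k) z (suc a)
      ≡⟨ regroup pow₁ (∏[1‥ 2 * suc k ∸ 1 + suc a + z ] (P₃ x)) (∏[1‥ (suc a + 1) / 3 ] (f1E x (suc k) (suc a))) (∏[1‥ suc a / 3 ] (f2E x (suc k) (suc a)))
           (∏[1‥ (suc a + 1) / 2 ] (h1E x (suc k) z (suc a))) (∏[1‥ suc a / 2 ] (h2E x (suc k) z (suc a))) (∏[1‥ suc a ] (aE x (suc k) z (suc a))) ⟩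
    pow₁ ℚ.* ∏[1‥ 2 * suc k ∸ 1 + suc a + z ] (P₃ x) ℚ.* (∏[1‥ (suc a + 1) / 3 ] (f1E x (suc k) (suc a)) ℚ.* ∏[1‥ suc a / 3 ] (f2E x (suc k) (suc a)))
      ℚ.* (∏[1‥ (suc a + 1) / 2 ] (h1E x (suc k) z (suc a)) ℚ.* ∏[1‥ suc a / 2 ] (h2E x (suc k) z (suc a))) ℚ.* ∏[1‥ suc a ] (aE x (suc k) z (suc a))
      ≡⟨ cong₂ (λ n K → pow₁ ℚ.* ∏[1‥ n ] (P₃ x) ℚ.* (∏[1‥ (suc a + 1) / 3 ] (f1E x (suc k) (suc a)) ℚ.* K)
           ℚ.* (∏[1‥ (suc a + 1) / 2 ] (h1E x (suc k) z (suc a)) ℚ.* ∏[1‥ suc a / 2 ] (h2E x (suc k) z (suc a))) ℚ.* ∏[1‥ suc a ] (aE x (suc k) z (suc a)))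
           (countE a z k) (F2-even x (suc k) a) ⟩
    pow₁ ℚ.* P ℚ.* (∏[1‥ (suc a + 1) / 3 ] (f1E x (suc k) (suc a)) ℚ.* K)
      ℚ.* (∏[1‥ (suc a + 1) / 2 ] (h1E x (suc k) z (suc a)) ℚ.* ∏[1‥ suc a / 2 ] (h2E x (suc k) z (suc a))) ℚ.* ∏[1‥ suc a ] (aE x (suc k) z (suc a))
      ≡⟨ seven pow₁ pow₀ P (∏[1‥ (suc a + 1) / 3 ] (f1E x (suc k) (suc a))) F′ K
           (∏[1‥ (suc a + 1) / 2 ] (h1E x (suc k) z (suc a))) (∏[1‥ suc a / 2 ] (h2E x (suc k) z (suc a))) H₁′ H₂′ (∏[1‥ suc a ] (aE x (suc k) z (suc a))) A′
           (ι (2 ^ ((z + 1) / 2))) (f1-ratio x k a) h₊ a₊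
           (trans (cong₂ (λ m n → pow2 ((m * ((z + 1) / 2) + n * (z / 2) + 1) ⊖ (suc a + z + 2 * suc k))) (half₂ a) (half₁ a))
             (pow-ratio (suc (a / 2) * ((z + 1) / 2) + (a + 1) / 2 * (z / 2) + 1) (suc a + z + 2 * suc k)
                (a / 2 * ((z + 1) / 2) + (a + 1) / 2 * (z / 2)) (a + z + 2 * suc k) ((z + 1) / 2)
                (powE (a / 2) ((a + 1) / 2) (z / 2) ((z + 1) / 2) a z k)))
           (F1-even x k a) (H-even x k z a) (A-even x k z a) ⟩
    (pow₀ ℚ.* P ℚ.* (F′ ℚ.* K) ℚ.* (H₁′ ℚ.* H₂′) ℚ.* A′) ℚ.* stepE-ratio x k z a
      ≡⟨ cong (ℚ._* stepE-ratio x k z a) (regroup pow₀ P F′ K H₁′ H₂′ A′) ⟨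
    E3odd x (suc k) z a ℚ.* stepE-ratio x k z a ∎
    where
    pow₁ = pow2 ((((suc a + 1) / 2) * ((z + 1) / 2) + (suc a / 2) * (z / 2) + 1) ⊖ (suc a + z + 2 * suc k))
    pow₀ = pow2 (((a / 2) * ((z + 1) / 2) + ((a + 1) / 2) * (z / 2)) ⊖ (a + z + 2 * suc k))
    P   = ∏[1‥ 2 * suc k + a + z ] (P₃ x)
    F′  = ∏[1‥ a / 3 ] (f1O x (suc k) a)
    K   = ∏[1‥ (a + 1) / 3 ] (f2O x (suc k) a)
    H₁′ = ∏[1‥ (a + 1) / 2 ] (h1O x (suc k) z a)
    H₂′ = ∏[1‥ a / 2 ] (h2O x (suc k) z a)
    A′  = ∏[1‥ a ] (aO x (suc k) z a)
    h₊ = firstE x k z a ℚ.* (eval hvE (x ∷ k ∷ z ∷ a ∷ a ∷ []) ℚ.* inv (eval hvE (x ∷ k ∷ z ∷ a ∷ 0 ∷ [])))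
    a₊ = firstAE x k z a ℚ.* (eval auE (x ∷ k ∷ z ∷ a ∷ 0 ∷ []) ℚ.* inv (eval auE (x ∷ k ∷ z ∷ 0 ∷ a ∷ [])))

  E3-odd-step : ∀ x k z a → E3odd x k z (suc a) ≡ E3even x (suc k) z a ℚ.* stepO-ratio x k z a
  E3-odd-step x k z a = begin
    E3odd x k z (suc a)
      ≡⟨ regroup′ pow₁ (∏[1‥ 2 * k + suc a + z ] (P₃ x)) (∏[1‥ suc a / 3 ] (f1O x k (suc a))) (∏[1‥ (suc a + 1) / 3 ] (f2O x k (suc a)))
           (∏[1‥ (suc a + 1) / 2 ] (h1O x k z (suc a))) (∏[1‥ suc a / 2 ] (h2O x k z (suc a))) (∏[1‥ suc a ] (aO x k z (suc a))) ⟩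
    pow₁ ℚ.* ∏[1‥ 2 * k + suc a + z ] (P₃ x) ℚ.* (∏[1‥ (suc a + 1) / 3 ] (f2O x k (suc a)) ℚ.* ∏[1‥ suc a / 3 ] (f1O x k (suc a)))
      ℚ.* (∏[1‥ (suc a + 1) / 2 ] (h1O x k z (suc a)) ℚ.* ∏[1‥ suc a / 2 ] (h2O x k z (suc a))) ℚ.* ∏[1‥ suc a ] (aO x k z (suc a))
      ≡⟨ cong₂ (λ n K → pow₁ ℚ.* ∏[1‥ n ] (P₃ x) ℚ.* (∏[1‥ (suc a + 1) / 3 ] (f2O x k (suc a)) ℚ.* K)
           ℚ.* (∏[1‥ (suc a + 1) / 2 ] (h1O x k z (suc a)) ℚ.* ∏[1‥ suc a / 2 ] (h2O x k z (suc a))) ℚ.* ∏[1‥ suc a ] (aO x k z (suc a)))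
           (countO a z k) (F1-odd x k a) ⟩
    pow₁ ℚ.* P ℚ.* (∏[1‥ (suc a + 1) / 3 ] (f2O x k (suc a)) ℚ.* K)
      ℚ.* (∏[1‥ (suc a + 1) / 2 ] (h1O x k z (suc a)) ℚ.* ∏[1‥ suc a / 2 ] (h2O x k z (suc a))) ℚ.* ∏[1‥ suc a ] (aO x k z (suc a))
      ≡⟨ seven pow₁ pow₀ P (∏[1‥ (suc a + 1) / 3 ] (f2O x k (suc a))) F′ K
           (∏[1‥ (suc a + 1) / 2 ] (h1O x k z (suc a))) (∏[1‥ suc a / 2 ] (h2O x k z (suc a))) H₁′ H₂′ (∏[1‥ suc a ] (aO x k z (suc a))) A′
           (ι (2 ^ (z / 2))) (f2-ratio x k a) h₊ a₊
           (trans (cong₂ (λ m n → pow2 ((n * ((z + 1) / 2) + m * (z / 2)) ⊖ (suc a + z + 2 * k))) (half₂ a) (half₁ a))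
             (pow-ratio ((a + 1) / 2 * ((z + 1) / 2) + suc (a / 2) * (z / 2)) (suc a + z + 2 * k)
                ((a + 1) / 2 * ((z + 1) / 2) + a / 2 * (z / 2) + 1) (a + z + 2 * suc k) (z / 2)
                (powO (a / 2) ((a + 1) / 2) (z / 2) ((z + 1) / 2) a z k)))
           (F2-odd x k a) (H-odd x k z a) (A-odd x k z a) ⟩
    (pow₀ ℚ.* P ℚ.* (F′ ℚ.* K) ℚ.* (H₁′ ℚ.* H₂′) ℚ.* A′) ℚ.* stepO-ratio x k z a
      ≡⟨ cong (ℚ._* stepO-ratio x k z a) (regroup′ pow₀ P K F′ H₁′ H₂′ A′) ⟨
    E3even x (suc k) z a ℚ.* stepO-ratio x k z a ∎
    where
    pow₁ = pow2 (((suc a / 2) * ((z + 1) / 2) + ((suc a + 1) / 2) * (z / 2)) ⊖ (suc a + z + 2 * k))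
    pow₀ = pow2 ((((a + 1) / 2) * ((z + 1) / 2) + (a / 2) * (z / 2) + 1) ⊖ (a + z + 2 * suc k))
    P   = ∏[1‥ 2 * suc k ∸ 1 + a + z ] (P₃ x)
    F′  = ∏[1‥ a / 3 ] (f2E x (suc k) a)
    K   = ∏[1‥ (a + 1) / 3 ] (f1E x (suc k) a)
    H₁′ = ∏[1‥ (a + 1) / 2 ] (h1E x (suc k) z a)
    H₂′ = ∏[1‥ a / 2 ] (h2E x (suc k) z a)
    A′  = ∏[1‥ a ] (aE x (suc k) z a)
    h₊ = firstO x k z a ℚ.* (eval hvO (x ∷ k ∷ z ∷ a ∷ a ∷ []) ℚ.* inv (eval hvO (x ∷ k ∷ z ∷ a ∷ 0 ∷ [])))
    a₊ = firstAO x k z a ℚ.* (eval auO (x ∷ k ∷ z ∷ a ∷ 0 ∷ []) ℚ.* inv (eval auO (x ∷ k ∷ z ∷ 0 ∷ a ∷ [])))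

-- The ratio of K between (y,a+1) and (y+1,a).

module KStep where

  open Monomial
  open Pochhammer
  open Telescoping
  open import Data.Integer.Base using (+_; -[1+_])

  module KStepArith where
    open ℕSolver

    five-val : ∀ m i → m + 6 * suc i ≡ suc (m + 6 * i) + 5
    five-val = solve 2 (λ m i → m :+ con 6 :* (con 1 :+ i) := con 1 :+ (m :+ con 6 :* i) :+ con 5) refl

    one-val : ∀ m i → m + 3 * suc i ≡ suc (suc (m + 3 * i)) + 1
    one-val = solve 2 (λ m i → m :+ con 3 :* (con 1 :+ i) := con 2 :+ (m :+ con 3 :* i) :+ con 1) refl

    shift-k : ∀ x k m i → (x + 3 * suc k + m + 3 * i) + 1 ≡ (x + 3 * k + m + 3 * i) + 4
    shift-k = solve 4 (λ x k m i → (x :+ con 3 :* (con 1 :+ k) :+ m :+ con 3 :* i) :+ con 1 := (x :+ con 3 :* k :+ m :+ con 3 :* i) :+ con 4) refl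

    shift-a : ∀ m a i → (m + 3 * suc a + 3 * i) + 1 ≡ (m + 3 * a + 3 * i) + 4
    shift-a = solve 3 (λ m a i → (m :+ con 3 :* (con 1 :+ a) :+ con 3 :* i) :+ con 1 := (m :+ con 3 :* a :+ con 3 :* i) :+ con 4) refl

    shift-i : ∀ m a i → m + 3 * suc a + 3 * i ≡ m + 3 * a + 3 * suc i
    shift-i = solve 3 (λ m a i → m :+ con 3 :* (con 1 :+ a) :+ con 3 :* i := m :+ con 3 :* a :+ con 3 :* (con 1 :+ i)) refl

    swap-six : ∀ x k al i → 2 * x + 6 * suc k + 6 * al + 6 * i ≡ 2 * x + 6 * k + 6 * suc al + 6 * i
    swap-six = solve 4 (λ x k al i → con 2 :* x :+ con 6 :* (con 1 :+ k) :+ con 6 :* al :+ con 6 :* i := con 2 :* x :+ con 6 :* k :+ con 6 :* (con 1 :+ al) :+ con 6 :* i) refl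

    lastC : ∀ x k a al ah → al + ah ≡ a → suc (2 * x + 6 * suc k + 6 * ah + 6 * al) ≡ suc (2 * x + 6 * k + 6 * a + 6)
    lastC x k a al ah refl = solve 4 (λ x k al ah → con 1 :+ (con 2 :* x :+ con 6 :* (con 1 :+ k) :+ con 6 :* ah :+ con 6 :* al) := con 1 :+ (con 2 :* x :+ con 6 :* k :+ con 6 :* (al :+ ah) :+ con 6)) refl x k al ah

    countK : ∀ k z a → k + suc z + suc a ≡ suc (k + z + a + 1)
    countK = solve 3 (λ k z a → k :+ (con 1 :+ z) :+ (con 1 :+ a) := con 1 :+ (k :+ z :+ a :+ con 1)) refl

  open KStepArith
  open ℚSolver using (solve; _:+_; _:*_; _:-_; :-_; _:=_; con)
  open ≡-Reasoning

  five one four : ℕ → ℕ → ℚ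
  five m i = ⟦ (m + 6 * i) ⊖ 5 ⟧
  one  m i = ⟦ (m + 3 * i) ⊖ 1 ⟧
  four m i = ⟦ (m + 3 * i) ⊖ 4 ⟧

  five-suc : ∀ m i → five m (suc i) ≡ ι (suc (m + 6 * i))
  five-suc m i = trans (cong ⟦_⟧ (⊖-+ (suc (m + 6 * i)) (five-val m i))) (⟦⟧≡ι (suc (m + 6 * i)))

  one-suc : ∀ m i → one m (suc i) ≡ ι (suc (suc (m + 3 * i)))
  one-suc m i = trans (cong ⟦_⟧ (⊖-+ (suc (suc (m + 3 * i))) (one-val m i))) (⟦⟧≡ι (suc (suc (m + 3 * i))))

  ∏five≢0 : ∀ n m → ∏[1‥ n ] (five m) ≢ 0ℚ
  ∏five≢0 n m = ∏≢0 n (five m) (λ i _ → subst (_≢ 0ℚ) (sym (five-suc m i)) (ι-suc≢0 (m + 6 * i)))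

  ∏one≢0 : ∀ n m → ∏[1‥ n ] (one m) ≢ 0ℚ
  ∏one≢0 n m = ∏≢0 n (one m) (λ i _ → subst (_≢ 0ℚ) (sym (one-suc m i)) (ι-suc≢0 (suc (m + 3 * i))))

  four-k : ∀ x k m n → ∏[1‥ n ] (four (x + 3 * suc k + m)) ≡ ∏[1‥ n ] (one (x + 3 * k + m))
  four-k x k m n = ∏-cong n (λ i _ → cong ⟦_⟧ (⊖-eq {x + 3 * suc k + m + 3 * suc i} {4} {x + 3 * k + m + 3 * suc i} {1} (shift-k x k m (suc i))))

  four-a : ∀ m a n → ∏[1‥ n ] (four (m + 3 * suc a)) ≡ ∏[1‥ n ] (one (m + 3 * a))
  four-a m a n = ∏-cong n (λ i _ → cong ⟦_⟧ (⊖-eq {m + 3 * suc a + 3 * suc i} {4} {m + 3 * a + 3 * suc i} {1} (shift-a m a (suc i))))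

  pow2⁺≢0 : ∀ n → pow2 (+ n) ≢ 0ℚ
  pow2⁺≢0 n = ∏≢0 n (λ _ → ⟦ + 2 ⟧) (λ _ _ → subst (_≢ 0ℚ) (sym (⟦⟧≡ι 2)) (ι-suc≢0 1))

  pow2-suc : ∀ n → pow2 (+ suc n) ≡ pow2 (+ n) ℚ.* ι 2
  pow2-suc n = cong (pow2 (+ n) ℚ.*_) (⟦⟧≡ι 2)

  -- The form of `Keven` and of `Kodd`: a power of two, two products above and two below.
  shape : ℚ → ℚ → ℚ → ℚ → ℚ → ℚ
  shape p A B C D = p ℚ.* A ℚ.* B ℚ.* inv (C ℚ.* D)

  shape≢0 : ∀ p A B C D → p ≢ 0ℚ → A ≢ 0ℚ → B ≢ 0ℚ → C ≢ 0ℚ → D ≢ 0ℚ → shape p A B C D ≢ 0ℚ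
  shape≢0 p A B C D p≢0 A≢0 B≢0 C≢0 D≢0 = *≢0 (p ℚ.* A ℚ.* B) (inv (C ℚ.* D)) (*≢0 (p ℚ.* A) B (*≢0 p A p≢0 A≢0) B≢0) (inv≢0 (C ℚ.* D) (*≢0 C D C≢0 D≢0))

  shape-extend : ∀ p r A s B t C c D → C ≢ 0ℚ → c ≢ 0ℚ → D ≢ 0ℚ →
                 shape (p ℚ.* r) (A ℚ.* s) (B ℚ.* t) (C ℚ.* c) D ℚ.* c ≡ shape p A B C D ℚ.* (r ℚ.* s ℚ.* t)
  shape-extend p r A s B t C c D C≢0 c≢0 D≢0 = begin
    (p ℚ.* r) ℚ.* (A ℚ.* s) ℚ.* (B ℚ.* t) ℚ.* inv (C ℚ.* c ℚ.* D) ℚ.* c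
      ≡⟨ cong (λ i → (p ℚ.* r) ℚ.* (A ℚ.* s) ℚ.* (B ℚ.* t) ℚ.* i ℚ.* c) (trans (cong inv (solve 3 (λ C c D → C :* c :* D := C :* D :* c) refl C c D)) (inv-* (C ℚ.* D) c (*≢0 C D C≢0 D≢0) c≢0)) ⟩
    (p ℚ.* r) ℚ.* (A ℚ.* s) ℚ.* (B ℚ.* t) ℚ.* (inv (C ℚ.* D) ℚ.* inv c) ℚ.* c
      ≡⟨ cong (λ q → q ℚ.* (inv (C ℚ.* D) ℚ.* inv c) ℚ.* c) (solve 6 (λ p r A s B t → (p :* r) :* (A :* s) :* (B :* t) := (p :* A :* B) :* (r :* s :* t)) refl p r A s B t) ⟩
    (p ℚ.* A ℚ.* B) ℚ.* (r ℚ.* s ℚ.* t) ℚ.* (inv (C ℚ.* D) ℚ.* inv c) ℚ.* c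
      ≡⟨ solve 5 (λ q w i j c → q :* w :* (i :* j) :* c := q :* i :* w :* (c :* j)) refl (p ℚ.* A ℚ.* B) (r ℚ.* s ℚ.* t) (inv (C ℚ.* D)) (inv c) c ⟩
    shape p A B C D ℚ.* (r ℚ.* s ℚ.* t) ℚ.* (c ℚ.* inv c)
      ≡⟨ trans (cong (shape p A B C D ℚ.* (r ℚ.* s ℚ.* t) ℚ.*_) (inv-inverse c c≢0)) (ℚ.*-identityʳ (shape p A B C D ℚ.* (r ℚ.* s ℚ.* t))) ⟩
    shape p A B C D ℚ.* (r ℚ.* s ℚ.* t) ∎

  inv-swap : ∀ e o s t → o ≢ 0ℚ → s ≢ 0ℚ → t ≢ 0ℚ → e ℚ.* s ≡ o ℚ.* t → inv e ≡ inv o ℚ.* (s ℚ.* inv t)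
  inv-swap e o s t o≢0 s≢0 t≢0 q = inv-unique e (inv o ℚ.* (s ℚ.* inv t)) (begin
    e ℚ.* (inv o ℚ.* (s ℚ.* inv t))    ≡⟨ solve 4 (λ e i s j → e :* (i :* (s :* j)) := (e :* s) :* (i :* j)) refl e (inv o) s (inv t) ⟩
    e ℚ.* s ℚ.* (inv o ℚ.* inv t)      ≡⟨ cong (ℚ._* (inv o ℚ.* inv t)) q ⟩
    o ℚ.* t ℚ.* (inv o ℚ.* inv t)      ≡⟨ solve 4 (λ o t i j → o :* t :* (i :* j) := (o :* i) :* (t :* j)) refl o t (inv o) (inv t) ⟩
    (o ℚ.* inv o) ℚ.* (t ℚ.* inv t)    ≡⟨ cong₂ ℚ._*_ (inv-inverse o o≢0) (inv-inverse t t≢0) ⟩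
    1ℚ                                 ∎)

  half-sucʳ : ∀ ζ → (suc (ζ + ζ) + 1) / 2 ≡ suc ζ
  half-sucʳ ζ = trans (cong (_/ 2) (ℕ.+-comm (suc (ζ + ζ)) 1)) (trans (half-suc (ζ + ζ)) (cong suc (half-even ζ)))

  half-evenʳ : ∀ ζ → (ζ + ζ + 1) / 2 ≡ ζ
  half-evenʳ ζ = trans (cong (_/ 2) (ℕ.+-comm (ζ + ζ) 1)) (half-odd ζ)

  shape-cong : ∀ {p p′ A A′ B B′ C C′ D D′} → p ≡ p′ → A ≡ A′ → B ≡ B′ → C ≡ C′ → D ≡ D′ → shape p A B C D ≡ shape p′ A′ B′ C′ D′
  shape-cong refl refl refl refl refl = refl

  module KSteps (x k a : ℕ) where

    al ah : ℕ
    al = a / 2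
    ah = (a + 1) / 2

    C′ D′ : ℕ → ℚ
    C′ z = ∏[1‥ al ] (five (2 * x + 6 * suc k + 6 * ah))
    D′ z = ∏[1‥ suc k + z + ah ] (one (x + 3 * suc k + 3 * al))

    C′≢0 : ∀ z → C′ z ≢ 0ℚ
    C′≢0 z = ∏five≢0 al (2 * x + 6 * suc k + 6 * ah)

    D′≢0 : ∀ z → D′ z ≢ 0ℚ
    D′≢0 z = ∏one≢0 (suc k + z + ah) (x + 3 * suc k + 3 * al)

    c-last : ℚ
    c-last = ι (suc (2 * x + 6 * k + 6 * a + 6))

    Ceven : ∏[1‥ (suc a + 1) / 2 ] (five (2 * x + 6 * suc k + 6 * (suc a / 2))) ≡ ∏[1‥ al ] (five (2 * x + 6 * suc k + 6 * ah)) ℚ.* c-last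
    Ceven = trans (cong₂ (λ n h → ∏[1‥ n ] (five (2 * x + 6 * suc k + 6 * h))) (half₂ a) (half₁ a))
      (cong (∏[1‥ al ] (five (2 * x + 6 * suc k + 6 * ah)) ℚ.*_) (trans (five-suc (2 * x + 6 * suc k + 6 * ah) al) (cong ι (lastC x k a al ah (half-sum a)))))

    Deven : ∀ z → ∏[1‥ suc k + z + suc a / 2 ] (four (x + 3 * suc k + 3 * ((suc a + 1) / 2))) ≡ D′ z
    Deven z = trans (cong₂ (λ n h → ∏[1‥ suc k + z + n ] (four (x + 3 * suc k + 3 * h))) (half₁ a) (half₂ a)) (four-a (x + 3 * suc k) al (suc k + z + ah))

    Kodd≢0 : ∀ z → Kodd x (suc k) z a ≢ 0ℚ
    Kodd≢0 z = shape≢0 (pow2 (+ (suc k + z / 2 + al))) (∏[1‥ suc k + (z + 1) / 2 + a ] (five (2 * x))) (∏[1‥ z / 2 ] (one (x + 3 * suc k + 3 * a))) (C′ z) (D′ z)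
      (pow2⁺≢0 (suc k + z / 2 + al)) (∏five≢0 (suc k + (z + 1) / 2 + a) (2 * x)) (∏one≢0 (z / 2) (x + 3 * suc k + 3 * a)) (C′≢0 z) (D′≢0 z)

    -- The subscript is the parity of z. For even z the first product above gains a factor; for odd
    -- z the second one and the power of two do. The denominator gains `c-last` in both cases.
    Keven-ratio₀ : ∀ ζ → inv (Keven x (suc k) (ζ + ζ) (suc a)) ≡ inv (Kodd x (suc k) (ζ + ζ) a) ℚ.* (c-last ℚ.* inv (ι (suc (2 * x + 6 * (suc k + ζ + a)))))
    Keven-ratio₀ ζ = trans (inv-swap (Keven x (suc k) (ζ + ζ) (suc a)) (Kodd x (suc k) (ζ + ζ) a) c-last (1ℚ ℚ.* l ℚ.* 1ℚ) (Kodd≢0 (ζ + ζ)) (ι-suc≢0 (2 * x + 6 * k + 6 * a + 6))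
        (subst (_≢ 0ℚ) (solve 1 (λ l → l := con 1ℚ :* l :* con 1ℚ) refl l) (ι-suc≢0 (2 * x + 6 * (suc k + ζ + a))))
        (trans (cong (ℚ._* c-last) lhs) (trans (shape-extend p 1ℚ A l B 1ℚ (C′ (ζ + ζ)) c-last (D′ (ζ + ζ)) (C′≢0 (ζ + ζ)) (ι-suc≢0 (2 * x + 6 * k + 6 * a + 6)) (D′≢0 (ζ + ζ))) (cong (ℚ._* (1ℚ ℚ.* l ℚ.* 1ℚ)) (sym rhs)))))
      (cong (λ t → inv (Kodd x (suc k) (ζ + ζ) a) ℚ.* (c-last ℚ.* inv t)) (solve 1 (λ l → con 1ℚ :* l :* con 1ℚ := l) refl l))
      where
      p = pow2 (+ (suc k + ζ + al))
      A = ∏[1‥ suc k + ζ + a ] (five (2 * x))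
      B = ∏[1‥ ζ ] (one (x + 3 * suc k + 3 * a))
      l = ι (suc (2 * x + 6 * (suc k + ζ + a)))
      lhs : Keven x (suc k) (ζ + ζ) (suc a) ≡ shape (p ℚ.* 1ℚ) (A ℚ.* l) (B ℚ.* 1ℚ) (C′ (ζ + ζ) ℚ.* c-last) (D′ (ζ + ζ))
      lhs = shape-cong
        (trans (trans (cong₂ (λ u v → pow2 ((suc k + u + v) ⊖ 1)) (half-evenʳ ζ) (half₂ a)) (cong pow2 (⊖-+ (suc k + ζ + al) (trans (ℕ.+-suc (suc k + ζ) al) (ℕ.+-comm 1 (suc k + ζ + al)))))) (sym (ℚ.*-identityʳ p)))
        (trans (cong (λ n → ∏[1‥ n ] (five (2 * x))) (trans (cong (λ u → suc k + u + suc a) (half-even ζ)) (ℕ.+-suc (suc k + ζ) a))) (cong (A ℚ.*_) (five-suc (2 * x) (suc k + ζ + a))))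
        (trans (trans (cong (λ n → ∏[1‥ n ] (four (x + 3 * suc k + 3 * suc a))) (half-evenʳ ζ)) (four-a (x + 3 * suc k) a ζ)) (sym (ℚ.*-identityʳ B)))
        Ceven (Deven (ζ + ζ))
      rhs : Kodd x (suc k) (ζ + ζ) a ≡ shape p A B (C′ (ζ + ζ)) (D′ (ζ + ζ))
      rhs = shape-cong {C = C′ (ζ + ζ)} {D = D′ (ζ + ζ)} (cong (λ u → pow2 (+ (suc k + u + al))) (half-even ζ)) (cong (λ u → ∏[1‥ suc k + u + a ] (five (2 * x))) (half-evenʳ ζ))
        (cong (λ u → ∏[1‥ u ] (one (x + 3 * suc k + 3 * a))) (half-even ζ)) refl refl

    Keven-ratio₁ : ∀ ζ → inv (Keven x (suc k) (suc (ζ + ζ)) (suc a))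
                   ≡ inv (Kodd x (suc k) (suc (ζ + ζ)) a) ℚ.* (c-last ℚ.* inv (ι 2 ℚ.* ι (suc (suc (x + 3 * suc k + 3 * a + 3 * ζ)))))
    Keven-ratio₁ ζ = trans (inv-swap (Keven x (suc k) z (suc a)) (Kodd x (suc k) z a) c-last (ι 2 ℚ.* 1ℚ ℚ.* t) (Kodd≢0 z) (ι-suc≢0 (2 * x + 6 * k + 6 * a + 6))
        (*≢0 (ι 2 ℚ.* 1ℚ) t (*≢0 (ι 2) 1ℚ (ι-suc≢0 1) 1≢0) (ι-suc≢0 (suc (x + 3 * suc k + 3 * a + 3 * ζ))))
        (trans (cong (ℚ._* c-last) lhs) (trans (shape-extend p (ι 2) A 1ℚ B t (C′ z) c-last (D′ z) (C′≢0 z) (ι-suc≢0 (2 * x + 6 * k + 6 * a + 6)) (D′≢0 z)) (cong (ℚ._* (ι 2 ℚ.* 1ℚ ℚ.* t)) (sym rhs)))))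
      (cong (λ u → inv (Kodd x (suc k) z a) ℚ.* (c-last ℚ.* inv u)) (solve 2 (λ s t → s :* con 1ℚ :* t := s :* t) refl (ι 2) t))
      where
      z = suc (ζ + ζ)
      p = pow2 (+ (suc k + ζ + al))
      A = ∏[1‥ suc k + suc ζ + a ] (five (2 * x))
      B = ∏[1‥ ζ ] (one (x + 3 * suc k + 3 * a))
      t = ι (suc (suc (x + 3 * suc k + 3 * a + 3 * ζ)))
      lhs : Keven x (suc k) z (suc a) ≡ shape (p ℚ.* ι 2) (A ℚ.* 1ℚ) (B ℚ.* t) (C′ z ℚ.* c-last) (D′ z)
      lhs = shape-cong
        (trans (trans (cong₂ (λ u v → pow2 ((suc k + u + v) ⊖ 1)) (half-sucʳ ζ) (half₂ a)) (cong pow2 (⊖-+ (suc (suc k + ζ + al)) (trans (ℕ.+-suc (suc k + suc ζ) al)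
            (trans (cong (λ u → suc (suc u + al)) (ℕ.+-suc k ζ)) (ℕ.+-comm 1 (suc (suc k + ζ + al)))))))) (pow2-suc (suc k + ζ + al)))
        (trans (cong (λ n → ∏[1‥ n ] (five (2 * x))) (trans (cong (λ u → suc k + u + suc a) (half-odd ζ)) (trans (ℕ.+-suc (suc k + ζ) a) (cong (λ u → suc u + a) (sym (ℕ.+-suc k ζ)))))) (sym (ℚ.*-identityʳ A)))
        (trans (trans (cong (λ n → ∏[1‥ n ] (four (x + 3 * suc k + 3 * suc a))) (half-sucʳ ζ)) (four-a (x + 3 * suc k) a (suc ζ))) (cong (B ℚ.*_) (one-suc (x + 3 * suc k + 3 * a) ζ)))
        Ceven (Deven z)
      rhs : Kodd x (suc k) z a ≡ shape p A B (C′ z) (D′ z)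
      rhs = shape-cong {C = C′ z} {D = D′ z} (cong (λ u → pow2 (+ (suc k + u + al))) (half-odd ζ)) (cong (λ u → ∏[1‥ suc k + u + a ] (five (2 * x))) (half-sucʳ ζ))
        (cong (λ u → ∏[1‥ u ] (one (x + 3 * suc k + 3 * a))) (half-odd ζ)) refl refl

    C″ D″ : ℕ → ℚ
    C″ z = ∏[1‥ ah ] (five (2 * x + 6 * suc k + 6 * al))
    D″ z = ∏[1‥ suc k + z + al ] (four (x + 3 * suc k + 3 * ah))

    Codd : ∏[1‥ suc a / 2 ] (five (2 * x + 6 * k + 6 * ((suc a + 1) / 2))) ≡ ∏[1‥ ah ] (five (2 * x + 6 * suc k + 6 * al))
    Codd = trans (cong₂ (λ n h → ∏[1‥ n ] (five (2 * x + 6 * k + 6 * h))) (half₁ a) (half₂ a)) (∏-cong ah (λ i _ → cong (λ m → ⟦ m ⊖ 5 ⟧) (sym (swap-six x k al (suc i)))))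

    Dodd : ∀ z → ∏[1‥ k + z + (suc a + 1) / 2 ] (one (x + 3 * k + 3 * (suc a / 2))) ≡ D″ z
    Dodd z = trans (cong₂ (λ n h → ∏[1‥ n ] (one (x + 3 * k + 3 * h))) (trans (cong (λ u → k + z + u) (half₂ a)) (ℕ.+-suc (k + z) al)) (half₁ a)) (sym (four-k x k (3 * ah) (suc k + z + al)))

    D″≢0 : ∀ z → D″ z ≢ 0ℚ
    D″≢0 z = subst (_≢ 0ℚ) (sym (four-k x k (3 * ah) (suc k + z + al))) (∏one≢0 (suc k + z + al) (x + 3 * k + 3 * ah))

    pow-pred : ∀ u → pow2 ((suc k + u + ah) ⊖ 1) ≡ pow2 (+ (k + u + ah))
    pow-pred u = cong pow2 (⊖-+ (k + u + ah) (ℕ.+-comm 1 (k + u + ah)))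

    Keven≢0 : ∀ z → Keven x (suc k) z a ≢ 0ℚ
    Keven≢0 z = shape≢0 (pow2 ((suc k + (z + 1) / 2 + ah) ⊖ 1)) (∏[1‥ suc k + z / 2 + a ] (five (2 * x))) (∏[1‥ (z + 1) / 2 ] (four (x + 3 * suc k + 3 * a))) (C″ z) (D″ z)
      (subst (_≢ 0ℚ) (sym (pow-pred ((z + 1) / 2))) (pow2⁺≢0 (k + (z + 1) / 2 + ah))) (∏five≢0 (suc k + z / 2 + a) (2 * x)) (subst (_≢ 0ℚ) (sym (four-k x k (3 * a) ((z + 1) / 2))) (∏one≢0 ((z + 1) / 2) (x + 3 * k + 3 * a))) (∏five≢0 ah (2 * x + 6 * suc k + 6 * al)) (D″≢0 z)

    w : ℕ → ℚ
    w = one (x + 3 * k + 3 * a)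

    ∏w-shift : ∀ n → ∏[1‥ n ] (one (x + 3 * k + 3 * suc a)) ≡ ∏[1‥ n ] (λ i → w (suc i))
    ∏w-shift n = ∏-cong n (λ i _ → cong (λ m → ⟦ m ⊖ 1 ⟧) (shift-i (x + 3 * k) a (suc i)))

    w₁ : w 1 ≡ ι (suc (suc (x + 3 * k + 3 * a + 0)))
    w₁ = one-suc (x + 3 * k + 3 * a) 0

    w₁≢0 : w 1 ≢ 0ℚ
    w₁≢0 = subst (_≢ 0ℚ) (sym w₁) (ι-suc≢0 (suc (x + 3 * k + 3 * a + 0)))

    -- The second product above has the same length on both sides but is shifted by one index, so
    -- only its end factors survive.
    Kodd-ratio₀ : ∀ ζ → inv (Kodd x k (ζ + ζ) (suc a)) ≡ inv (Keven x (suc k) (ζ + ζ) a) ℚ.* (w 1 ℚ.* inv (w (suc ζ)))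
    Kodd-ratio₀ ζ = inv-swap (Kodd x k (ζ + ζ) (suc a)) (Keven x (suc k) (ζ + ζ) a) (w 1) (w (suc ζ)) (Keven≢0 (ζ + ζ)) w₁≢0
      (subst (_≢ 0ℚ) (sym (one-suc (x + 3 * k + 3 * a) ζ)) (ι-suc≢0 (suc (x + 3 * k + 3 * a + 3 * ζ)))) (begin
        Kodd x k (ζ + ζ) (suc a) ℚ.* w 1
          ≡⟨ cong (ℚ._* w 1) (shape-cong (cong₂ (λ u v → pow2 (+ (k + u + v))) (half-even ζ) (half₁ a))
               (trans (cong (λ u → ∏[1‥ k + u + suc a ] (five (2 * x))) (half-evenʳ ζ)) (cong (λ n → ∏[1‥ n ] (five (2 * x))) (ℕ.+-suc (k + ζ) a)))
               (trans (cong (λ u → ∏[1‥ u ] (one (x + 3 * k + 3 * suc a))) (half-even ζ)) (∏w-shift ζ)) Codd (Dodd (ζ + ζ))) ⟩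
        shape p A (∏[1‥ ζ ] (λ i → w (suc i))) (C″ (ζ + ζ)) (D″ (ζ + ζ)) ℚ.* w 1
          ≡⟨ solve 4 (λ q b i v → q :* b :* i :* v := q :* (v :* b) :* i) refl (p ℚ.* A) (∏[1‥ ζ ] (λ i → w (suc i))) (inv (C″ (ζ + ζ) ℚ.* D″ (ζ + ζ))) (w 1) ⟩
        shape p A (w 1 ℚ.* ∏[1‥ ζ ] (λ i → w (suc i))) (C″ (ζ + ζ)) (D″ (ζ + ζ))
          ≡⟨ cong (λ b → shape p A b (C″ (ζ + ζ)) (D″ (ζ + ζ))) (∏-head ζ w) ⟨
        shape p A (∏[1‥ ζ ] w ℚ.* w (suc ζ)) (C″ (ζ + ζ)) (D″ (ζ + ζ))
          ≡⟨ solve 4 (λ q b i v → q :* (b :* v) :* i := q :* b :* i :* v) refl (p ℚ.* A) (∏[1‥ ζ ] w) (inv (C″ (ζ + ζ) ℚ.* D″ (ζ + ζ))) (w (suc ζ)) ⟩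
        shape p A (∏[1‥ ζ ] w) (C″ (ζ + ζ)) (D″ (ζ + ζ)) ℚ.* w (suc ζ)
          ≡⟨ cong (ℚ._* w (suc ζ)) (shape-cong {C = C″ (ζ + ζ)} {D = D″ (ζ + ζ)} (trans (cong (λ u → pow2 ((suc k + u + ah) ⊖ 1)) (half-evenʳ ζ)) (pow-pred ζ))
               (cong (λ u → ∏[1‥ suc k + u + a ] (five (2 * x))) (half-even ζ))
               (trans (cong (λ u → ∏[1‥ u ] (four (x + 3 * suc k + 3 * a))) (half-evenʳ ζ)) (four-k x k (3 * a) ζ)) refl refl) ⟨
        Keven x (suc k) (ζ + ζ) a ℚ.* w (suc ζ) ∎)
      where
      p = pow2 (+ (k + ζ + ah))
      A = ∏[1‥ suc k + ζ + a ] (five (2 * x))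

    Kodd-ratio₁ : ∀ ζ → inv (Kodd x k (suc (ζ + ζ)) (suc a))
                  ≡ inv (Keven x (suc k) (suc (ζ + ζ)) a) ℚ.* ((ι 2 ℚ.* w 1) ℚ.* inv (ι (suc (2 * x + 6 * (k + ζ + a + 1)))))
    Kodd-ratio₁ ζ = inv-swap (Kodd x k z (suc a)) (Keven x (suc k) z a) (ι 2 ℚ.* w 1) l (Keven≢0 z) (*≢0 (ι 2) (w 1) (ι-suc≢0 1) w₁≢0) (ι-suc≢0 (2 * x + 6 * (k + ζ + a + 1))) (begin
        Kodd x k z (suc a) ℚ.* (ι 2 ℚ.* w 1)
          ≡⟨ cong (ℚ._* (ι 2 ℚ.* w 1)) (shape-cong (cong₂ (λ u v → pow2 (+ (k + u + v))) (half-odd ζ) (half₁ a))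
               (trans (cong (λ u → ∏[1‥ k + u + suc a ] (five (2 * x))) (half-sucʳ ζ)) (trans (cong (λ n → ∏[1‥ n ] (five (2 * x))) (countK k ζ a)) (cong (A ℚ.*_) (five-suc (2 * x) (k + ζ + a + 1)))))
               (trans (cong (λ u → ∏[1‥ u ] (one (x + 3 * k + 3 * suc a))) (half-odd ζ)) (∏w-shift ζ)) Codd (Dodd z)) ⟩
        shape p (A ℚ.* l) B (C″ z) (D″ z) ℚ.* (ι 2 ℚ.* w 1)
          ≡⟨ cong (λ i → p ℚ.* (A ℚ.* l) ℚ.* B ℚ.* i ℚ.* (ι 2 ℚ.* w 1)) refl ⟩
        p ℚ.* (A ℚ.* l) ℚ.* B ℚ.* inv (C″ z ℚ.* D″ z) ℚ.* (ι 2 ℚ.* w 1)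
          ≡⟨ solve 7 (λ p A l B i t v → p :* (A :* l) :* B :* i :* (t :* v) := (p :* t) :* A :* (v :* B) :* i :* l) refl p A l B (inv (C″ z ℚ.* D″ z)) (ι 2) (w 1) ⟩
        shape (p ℚ.* ι 2) A (w 1 ℚ.* B) (C″ z) (D″ z) ℚ.* l
          ≡⟨ cong (ℚ._* l) (shape-cong {C = C″ z} {D = D″ z} (trans (cong (λ u → pow2 ((suc k + u + ah) ⊖ 1)) (half-sucʳ ζ)) (trans (pow-pred (suc ζ)) (trans (cong (λ u → pow2 (+ (u + ah))) (ℕ.+-suc k ζ)) (pow2-suc (k + ζ + ah)))))
               (trans (cong (λ u → ∏[1‥ suc k + u + a ] (five (2 * x))) (half-odd ζ)) (cong (λ n → ∏[1‥ n ] (five (2 * x))) (ℕ.+-comm 1 (k + ζ + a))))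
               (trans (cong (λ u → ∏[1‥ u ] (four (x + 3 * suc k + 3 * a))) (half-sucʳ ζ)) (trans (four-k x k (3 * a) (suc ζ)) (∏-head ζ w))) refl refl) ⟨
        Keven x (suc k) z a ℚ.* l ∎)
      where
      z = suc (ζ + ζ)
      p = pow2 (+ (k + ζ + ah))
      A = ∏[1‥ k + ζ + a + 1 ] (five (2 * x))
      B = ∏[1‥ ζ ] (λ i → w (suc i))
      l = ι (suc (2 * x + 6 * (k + ζ + a + 1)))

-- Compatibility of the ratio of E₄ in (y,a) with the ratio of G in z.

module Raising where

  open Monomial
  open CornerMinor using (Q; qM)
  open GapFormula using (G; ρM; X₄; Y₄; A₄; Z₄; _+′_)
  open Pochhammer
  open Factors using (h1E-firstM; h1O-firstM; aE-firstM; aO-firstM)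
  open Telescoping
  open E3Step

  module RaisingArith where
    open ℕSolver

    q-index₀ : ∀ c k z → (z + z) + (c + (k + k)) ≡ c + ((z + z) + (k + k))
    q-index₀ = solve 3 (λ c k z → (z :+ z) :+ (c :+ (k :+ k)) := c :+ ((z :+ z) :+ (k :+ k))) refl

    q-index₁ : ∀ c k z → suc (z + z) + (c + (k + k)) ≡ suc c + ((z + z) + (k + k))
    q-index₁ = solve 3 (λ c k z → con 1 :+ (z :+ z) :+ (c :+ (k :+ k)) := con 1 :+ c :+ ((z :+ z) :+ (k :+ k))) refl

  open RaisingArith
  open ℚSolver using (solve; _:+_; _:*_; _:-_; :-_; _:=_; con)
  open ≡-Reasoning

  -- The variables are x, k, a, ζ; zf, lf and hf express z, ⌊z/2⌋ and ⌈z/2⌉ in them.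
  first-σ v-σ : Form → Form → Form → List Form
  first-σ zf lf hf = X₄ ∷ Y₄ ∷ zf ∷ lf ∷ hf ∷ ([] , 0) ∷ A₄ ∷ []
  v-σ zf f g = X₄ ∷ Y₄ ∷ zf ∷ f ∷ g ∷ []

  0₄ : Form
  0₄ = [] , 0

  collect : ∀ t u l m n o p q c d ρ →
    eval t ρ ℚ.* eval u ρ ℚ.* (eval l ρ ℚ.* (eval m ρ ℚ.* inv (eval n ρ))) ℚ.* (eval o ρ ℚ.* (eval p ρ ℚ.* inv (eval q ρ))) ℚ.* (eval c ρ ℚ.* inv (eval d ρ))
    ≡ eval ((((t ++ u) ++ (l ++ m ++ flip n)) ++ (o ++ p ++ flip q)) ++ (c ++ flip d)) ρ
  collect t u l m n o p q c d ρ = sym (trans (eval-++ (((t ++ u) ++ (l ++ m ++ flip n)) ++ (o ++ p ++ flip q)) (c ++ flip d) ρ)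
    (cong₂ ℚ._*_ (trans (eval-++ ((t ++ u) ++ (l ++ m ++ flip n)) (o ++ p ++ flip q) ρ)
        (cong₂ ℚ._*_ (trans (eval-++ (t ++ u) (l ++ m ++ flip n) ρ) (cong₂ ℚ._*_ (eval-++ t u ρ) (three l m n))) (three o p q)))
      (trans (eval-++ c (flip d) ρ) (cong (eval c ρ ℚ.*_) (sym (inv-eval d ρ))))))
    where
    three : ∀ l m n → eval (l ++ m ++ flip n) ρ ≡ eval l ρ ℚ.* (eval m ρ ℚ.* inv (eval n ρ))
    three l m n = trans (eval-++ l (m ++ flip n) ρ) (cong (eval l ρ ℚ.*_) (trans (eval-++ m (flip n) ρ) (cong (eval m ρ ℚ.*_) (sym (inv-eval n ρ)))))

  -- The ratio of E₃ times the ratio c/d of the reciprocals of K, as one formal product in which the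
  -- parity of z has been made explicit.
  seM soM : (zf lf hf : Form) → Mono → Mono → Mono
  seM zf lf hf c d = ((((↑ (p2 hf) ∷ []) ++ (↑ (odd (1 ∷ 3 ∷ 3 ∷ [] , 3)) ∷ ↓ (odd (1 ∷ 3 ∷ 2 ∷ [] , 3)) ∷ []))
    ++ (sub (first-σ zf lf hf) h1E-firstM ++ sub (v-σ zf A₄ A₄) hvE ++ flip (sub (v-σ zf A₄ 0₄) hvE)))
    ++ (sub (first-σ zf lf hf) aE-firstM ++ sub (v-σ zf A₄ 0₄) auE ++ flip (sub (v-σ zf 0₄ A₄) auE))) ++ (c ++ flip d)
  soM zf lf hf c d = ((((↑ (p2 lf) ∷ []) ++ (↑ (fac (1 ∷ 3 ∷ 3 ∷ [] , 1)) ∷ ↓ (fac (1 ∷ 3 ∷ 2 ∷ [] , 1)) ∷ []))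
    ++ (sub (first-σ zf lf hf) h1O-firstM ++ sub (v-σ zf A₄ A₄) hvO ++ flip (sub (v-σ zf A₄ 0₄) hvO)))
    ++ (sub (first-σ zf lf hf) aO-firstM ++ sub (v-σ zf A₄ 0₄) auO ++ flip (sub (v-σ zf 0₄ A₄) auO))) ++ (c ++ flip d)

  module _ (x k a ζ : ℕ) where

    private
      ρ : List ℕ
      ρ = x ∷ k ∷ a ∷ ζ ∷ []

      X K A : LExp
      X = var 0
      K = var 1
      A = var 2

    f1-eval : f1-ratio x k a ≡ eval (↑ (odd (1 ∷ 3 ∷ 3 ∷ [] , 3)) ∷ ↓ (odd (1 ∷ 3 ∷ 2 ∷ [] , 3)) ∷ []) ρ
    f1-eval = trans (cong₂ (λ m n → ι (oddf m) ℚ.* inv (ι (oddf n)))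
        (linear (n# 1 ∔ (X ∔ 3 · K ∔ n# 2 ∔ 3 · A)) (frm (1 ∷ 3 ∷ 3 ∷ [] , 3)) ρ refl) (linear (n# 1 ∔ (X ∔ 3 · K ∔ n# 2 ∔ 2 · A)) (frm (1 ∷ 3 ∷ 2 ∷ [] , 3)) ρ refl))
      (pair (odd (1 ∷ 3 ∷ 3 ∷ [] , 3)) (odd (1 ∷ 3 ∷ 2 ∷ [] , 3)) ρ)

    f2-eval : f2-ratio x k a ≡ eval (↑ (fac (1 ∷ 3 ∷ 3 ∷ [] , 1)) ∷ ↓ (fac (1 ∷ 3 ∷ 2 ∷ [] , 1)) ∷ []) ρ
    f2-eval = trans (cong₂ (λ m n → ι (m !) ℚ.* inv (ι (n !)))
        (linear (n# 1 ∔ (X ∔ 3 · K ∔ 3 · A)) (frm (1 ∷ 3 ∷ 3 ∷ [] , 1)) ρ refl) (linear (n# 1 ∔ (X ∔ 3 · K ∔ 2 · A)) (frm (1 ∷ 3 ∷ 2 ∷ [] , 1)) ρ refl))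
      (pair (fac (1 ∷ 3 ∷ 3 ∷ [] , 1)) (fac (1 ∷ 3 ∷ 2 ∷ [] , 1)) ρ)

    stepE-eval : ∀ zf lf hf c d z {C D} → z ≡ ⟪ zf ⟫ ρ → z / 2 ≡ ⟪ lf ⟫ ρ → (z + 1) / 2 ≡ ⟪ hf ⟫ ρ → C ≡ eval c ρ → D ≡ eval d ρ →
                 stepE-ratio x k z a ℚ.* (C ℚ.* inv D) ≡ eval (seM zf lf hf c d) ρ
    stepE-eval zf lf hf c d z refl el eh refl refl = trans (cong (ℚ._* (eval c ρ ℚ.* inv (eval d ρ)))
        (cong₂ ℚ._*_ (cong₂ ℚ._*_ (cong₂ ℚ._*_ (trans (cong (λ h → ι (2 ^ h)) eh) (sym (ℚ.*-identityʳ (ι (2 ^ ⟪ hf ⟫ ρ))))) f1-eval)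
            (cong₂ ℚ._*_ (trans (cong₂ (λ l h → eval h1E-firstM (x ∷ k ∷ z ∷ l ∷ h ∷ 0 ∷ a ∷ [])) el eh) (eval-sub h1E-firstM (first-σ zf lf hf) ρ))
              (cong₂ (λ u v → u ℚ.* inv v) (eval-sub hvE (v-σ zf A₄ A₄) ρ) (eval-sub hvE (v-σ zf A₄ 0₄) ρ))))
          (cong₂ ℚ._*_ (trans (cong₂ (λ l h → eval aE-firstM (x ∷ k ∷ z ∷ l ∷ h ∷ 0 ∷ a ∷ [])) el eh) (eval-sub aE-firstM (first-σ zf lf hf) ρ))
            (cong₂ (λ u v → u ℚ.* inv v) (eval-sub auE (v-σ zf A₄ 0₄) ρ) (eval-sub auE (v-σ zf 0₄ A₄) ρ)))))
      (collect (↑ (p2 hf) ∷ []) (↑ (odd (1 ∷ 3 ∷ 3 ∷ [] , 3)) ∷ ↓ (odd (1 ∷ 3 ∷ 2 ∷ [] , 3)) ∷ [])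
        (sub (first-σ zf lf hf) h1E-firstM) (sub (v-σ zf A₄ A₄) hvE) (sub (v-σ zf A₄ 0₄) hvE)
        (sub (first-σ zf lf hf) aE-firstM) (sub (v-σ zf A₄ 0₄) auE) (sub (v-σ zf 0₄ A₄) auE) c d ρ)

    stepO-eval : ∀ zf lf hf c d z {C D} → z ≡ ⟪ zf ⟫ ρ → z / 2 ≡ ⟪ lf ⟫ ρ → (z + 1) / 2 ≡ ⟪ hf ⟫ ρ → C ≡ eval c ρ → D ≡ eval d ρ →
                 stepO-ratio x k z a ℚ.* (C ℚ.* inv D) ≡ eval (soM zf lf hf c d) ρ
    stepO-eval zf lf hf c d z refl el eh refl refl = trans (cong (ℚ._* (eval c ρ ℚ.* inv (eval d ρ)))
        (cong₂ ℚ._*_ (cong₂ ℚ._*_ (cong₂ ℚ._*_ (trans (cong (λ h → ι (2 ^ h)) el) (sym (ℚ.*-identityʳ (ι (2 ^ ⟪ lf ⟫ ρ))))) f2-eval)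
            (cong₂ ℚ._*_ (trans (cong₂ (λ l h → eval h1O-firstM (x ∷ k ∷ z ∷ l ∷ h ∷ 0 ∷ a ∷ [])) el eh) (eval-sub h1O-firstM (first-σ zf lf hf) ρ))
              (cong₂ (λ u v → u ℚ.* inv v) (eval-sub hvO (v-σ zf A₄ A₄) ρ) (eval-sub hvO (v-σ zf A₄ 0₄) ρ))))
          (cong₂ ℚ._*_ (trans (cong₂ (λ l h → eval aO-firstM (x ∷ k ∷ z ∷ l ∷ h ∷ 0 ∷ a ∷ [])) el eh) (eval-sub aO-firstM (first-σ zf lf hf) ρ))
            (cong₂ (λ u v → u ℚ.* inv v) (eval-sub auO (v-σ zf A₄ 0₄) ρ) (eval-sub auO (v-σ zf 0₄ A₄) ρ)))))
      (collect (↑ (p2 lf) ∷ []) (↑ (fac (1 ∷ 3 ∷ 3 ∷ [] , 1)) ∷ ↓ (fac (1 ∷ 3 ∷ 2 ∷ [] , 1)) ∷ [])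
        (sub (first-σ zf lf hf) h1O-firstM) (sub (v-σ zf A₄ A₄) hvO) (sub (v-σ zf A₄ 0₄) hvO)
        (sub (first-σ zf lf hf) aO-firstM) (sub (v-σ zf A₄ 0₄) auO) (sub (v-σ zf 0₄ A₄) auO) c d ρ)

  two-ζ : ℕ → Form
  two-ζ n = 0 ∷ 0 ∷ 0 ∷ 2 ∷ [] , n

  seM₀ seM₁ soM₀ soM₁ : Mono
  seM₀ = seM (two-ζ 0) Z₄ Z₄ (↑ (lin (2 ∷ 6 ∷ 6 ∷ [] , 6)) ∷ []) (↑ (lin (2 ∷ 6 ∷ 6 ∷ 6 ∷ [] , 6)) ∷ [])
  seM₁ = seM (two-ζ 1) Z₄ (Z₄ +′ 1) (↑ (lin (2 ∷ 6 ∷ 6 ∷ [] , 6)) ∷ []) (↑ two ∷ ↑ (lin (1 ∷ 3 ∷ 3 ∷ 3 ∷ [] , 4)) ∷ [])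
  soM₀ = soM (two-ζ 0) Z₄ Z₄ (↑ (lin (1 ∷ 3 ∷ 3 ∷ [] , 1)) ∷ []) (↑ (lin (1 ∷ 3 ∷ 3 ∷ 3 ∷ [] , 1)) ∷ [])
  soM₁ = soM (two-ζ 1) Z₄ (Z₄ +′ 1) (↑ two ∷ ↑ (lin (1 ∷ 3 ∷ 3 ∷ [] , 1)) ∷ []) (↑ (lin (2 ∷ 6 ∷ 6 ∷ 6 ∷ [] , 6)) ∷ [])

  -- The generating function for (y+1, a-1), with a = 0 allowed.
  raise : ℕ → ℕ → ℕ → ℕ → ℚ
  raise x y zero    z = Q x (z + y)
  raise x y (suc a) z = G x (suc y) a z

  raise-step : ∀ u {p g r v} s t R V ρ → residue (s ++ R) (V ++ t) ≡ [] → g ≡ u ℚ.* p → p ≡ eval s ρ → r ≡ eval R ρ → v ≡ eval V ρ →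
               ∀ {q} → q ≡ eval t ρ → g ℚ.* r ≡ u ℚ.* v ℚ.* q
  raise-step u s t R V ρ e refl refl refl refl refl = trans (ℚ.*-assoc u (eval s ρ) (eval R ρ)) (trans
    (cong (u ℚ.*_) (trans (sym (eval-++ s R ρ)) (trans (mono (s ++ R) (V ++ t) ρ e) (eval-++ V t ρ)))) (sym (ℚ.*-assoc u (eval V ρ) (eval t ρ))))

  at-ζ : Form → ℕ → List Form
  at-ζ af n = X₄ ∷ Y₄ ∷ af ∷ Z₄ +′ n ∷ []

  ρσ : ℕ → Form → ℕ → List Form
  ρσ c af n = X₄ ∷ (0 ∷ 2 ∷ [] , c) ∷ af ∷ two-ζ n ∷ []

  qσ : ℕ → ℕ → List Form
  qσ c n = X₄ ∷ (0 ∷ 2 ∷ 0 ∷ 2 ∷ [] , n + c) ∷ []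

  -- The variable a of the substituted monomials stands for a or a - 1.
  module Raise (c : ℕ) (s₀ s₁ : Mono)
    (start : residue (sub (X₄ ∷ Y₄ ∷ A₄ ∷ 0₄ ∷ []) s₀) [] ≡ [])
    (base₀ : residue (sub (at-ζ 0₄ 0) s₀ ++ sub (ρσ c 0₄ 0) ρM) (sub (qσ c 0) qM ++ sub (at-ζ 0₄ 0) s₁) ≡ [])
    (base₁ : residue (sub (at-ζ 0₄ 0) s₁ ++ sub (ρσ c 0₄ 1) ρM) (sub (qσ c 1) qM ++ sub (at-ζ 0₄ 1) s₀) ≡ [])
    (next₀ : residue (sub (at-ζ (A₄ +′ 1) 0) s₀ ++ sub (ρσ c (A₄ +′ 1) 0) ρM) (sub (ρσ (suc c) A₄ 0) ρM ++ sub (at-ζ (A₄ +′ 1) 0) s₁) ≡ [])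
    (next₁ : residue (sub (at-ζ (A₄ +′ 1) 0) s₁ ++ sub (ρσ c (A₄ +′ 1) 1) ρM) (sub (ρσ (suc c) A₄ 1) ρM ++ sub (at-ζ (A₄ +′ 1) 1) s₀) ≡ [])
    where

    -- Induction on z, alternating between even and odd z. One step compares the factor of `G` at
    -- (y,a), the factor at (y+1,a-1) and the two values of the E₄ ratio; these are the
    -- cancellations taken as hypotheses, with a = 0 apart because there `qM` replaces `ρM`.
    raise₀ : ∀ x k a ζ → G x (c + (k + k)) a (ζ + ζ) ≡ raise x (c + (k + k)) a (ζ + ζ) ℚ.* eval s₀ (x ∷ k ∷ a ∷ ζ ∷ [])
    raise₁ : ∀ x k a ζ → G x (c + (k + k)) a (suc (ζ + ζ)) ≡ raise x (c + (k + k)) a (suc (ζ + ζ)) ℚ.* eval s₁ (x ∷ k ∷ a ∷ ζ ∷ [])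

    raise₀ x k a zero = trans (same a) (sym (trans (cong (raise x (c + (k + k)) a 0 ℚ.*_)
        (trans (eval-sub s₀ (X₄ ∷ Y₄ ∷ A₄ ∷ 0₄ ∷ []) (x ∷ k ∷ a ∷ [])) (mono (sub (X₄ ∷ Y₄ ∷ A₄ ∷ 0₄ ∷ []) s₀) [] (x ∷ k ∷ a ∷ []) start)))
      (ℚ.*-identityʳ (raise x (c + (k + k)) a 0))))
      where
      same : ∀ a → Q x (c + (k + k) + a) ≡ raise x (c + (k + k)) a 0
      same zero    = cong (Q x) (ℕ.+-identityʳ (c + (k + k)))
      same (suc a) = cong (Q x) (ℕ.+-suc (c + (k + k)) a)
    raise₀ x k a (suc ζ) = trans (cong (λ z → G x (c + (k + k)) a (suc z)) (ℕ.+-suc ζ ζ))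
      (trans (go a (raise₁ x k a ζ)) (cong (λ z → raise x (c + (k + k)) a (suc z) ℚ.* eval s₀ (x ∷ k ∷ a ∷ suc ζ ∷ [])) (sym (ℕ.+-suc ζ ζ))))
      where
      go : ∀ a → G x (c + (k + k)) a (suc (ζ + ζ)) ≡ raise x (c + (k + k)) a (suc (ζ + ζ)) ℚ.* eval s₁ (x ∷ k ∷ a ∷ ζ ∷ []) →
           G x (c + (k + k)) a (2 + (ζ + ζ)) ≡ raise x (c + (k + k)) a (2 + (ζ + ζ)) ℚ.* eval s₀ (x ∷ k ∷ a ∷ suc ζ ∷ [])
      go zero    ih = raise-step (raise x (c + (k + k)) 0 (suc (ζ + ζ))) (sub (at-ζ 0₄ 0) s₁) (sub (at-ζ 0₄ 1) s₀) (sub (ρσ c 0₄ 1) ρM) (sub (qσ c 1) qM) ρ base₁ ih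
        (eval-sub s₁ (at-ζ 0₄ 0) ρ) (eval-sub ρM (ρσ c 0₄ 1) ρ)
        (trans (cong (λ n → eval qM (x ∷ n ∷ [])) (q-index₁ c k ζ)) (eval-sub qM (qσ c 1) ρ)) (eval-sub s₀ (at-ζ 0₄ 1) ρ)
        where ρ = x ∷ k ∷ 0 ∷ ζ ∷ []
      go (suc a) ih = raise-step (raise x (c + (k + k)) (suc a) (suc (ζ + ζ))) (sub (at-ζ (A₄ +′ 1) 0) s₁) (sub (at-ζ (A₄ +′ 1) 1) s₀) (sub (ρσ c (A₄ +′ 1) 1) ρM) (sub (ρσ (suc c) A₄ 1) ρM) ρ next₁ ih
        (eval-sub s₁ (at-ζ (A₄ +′ 1) 0) ρ) (eval-sub ρM (ρσ c (A₄ +′ 1) 1) ρ) (eval-sub ρM (ρσ (suc c) A₄ 1) ρ) (eval-sub s₀ (at-ζ (A₄ +′ 1) 1) ρ)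
        where ρ = x ∷ k ∷ a ∷ ζ ∷ []

    raise₁ x k a ζ = go a (raise₀ x k a ζ)
      where
      go : ∀ a → G x (c + (k + k)) a (ζ + ζ) ≡ raise x (c + (k + k)) a (ζ + ζ) ℚ.* eval s₀ (x ∷ k ∷ a ∷ ζ ∷ []) →
           G x (c + (k + k)) a (suc (ζ + ζ)) ≡ raise x (c + (k + k)) a (suc (ζ + ζ)) ℚ.* eval s₁ (x ∷ k ∷ a ∷ ζ ∷ [])
      go zero    ih = raise-step (raise x (c + (k + k)) 0 (ζ + ζ)) (sub (at-ζ 0₄ 0) s₀) (sub (at-ζ 0₄ 0) s₁) (sub (ρσ c 0₄ 0) ρM) (sub (qσ c 0) qM) ρ base₀ ih
        (eval-sub s₀ (at-ζ 0₄ 0) ρ) (eval-sub ρM (ρσ c 0₄ 0) ρ)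
        (trans (cong (λ n → eval qM (x ∷ n ∷ [])) (q-index₀ c k ζ)) (eval-sub qM (qσ c 0) ρ)) (eval-sub s₁ (at-ζ 0₄ 0) ρ)
        where ρ = x ∷ k ∷ 0 ∷ ζ ∷ []
      go (suc a) ih = raise-step (raise x (c + (k + k)) (suc a) (ζ + ζ)) (sub (at-ζ (A₄ +′ 1) 0) s₀) (sub (at-ζ (A₄ +′ 1) 0) s₁) (sub (ρσ c (A₄ +′ 1) 0) ρM) (sub (ρσ (suc c) A₄ 0) ρM) ρ next₀ ih
        (eval-sub s₀ (at-ζ (A₄ +′ 1) 0) ρ) (eval-sub ρM (ρσ c (A₄ +′ 1) 0) ρ) (eval-sub ρM (ρσ (suc c) A₄ 0) ρ) (eval-sub s₁ (at-ζ (A₄ +′ 1) 0) ρ)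
        where ρ = x ∷ k ∷ a ∷ ζ ∷ []

  -- The constant is the least positive y of the parity in question, y = c+2k; each `refl` is a
  -- cancellation of factorials.
  module RaiseEven = Raise 2 seM₀ seM₁ refl refl refl refl refl
  module RaiseOdd  = Raise 1 soM₀ soM₁ refl refl refl refl refl

-- The case a = 0: E₃/K is a corner minor.

module Gapless where

  open Monomial
  open CornerMinor using (Q; qM)
  open Pochhammer
  open Telescoping using (interleave)
  open KStep
  open import Data.Integer.Base using (+_; -[1+_])

  module GaplessArith where
    open ℕSolver

    base₁ : ∀ x m → 2 * x + 2 * suc m ∸ 1 ≡ suc (2 * x + 2 * m)
    base₁ x m = cong (_∸ 1) (solve 2 (λ x m → con 2 :* x :+ con 2 :* (con 1 :+ m) := con 2 :+ (con 2 :* x :+ con 2 :* m)) refl x m)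

    base₂ : ∀ x m → x + 2 * suc m ∸ 1 ≡ suc (x + 2 * m)
    base₂ x m = cong (_∸ 1) (solve 2 (λ x m → x :+ con 2 :* (con 1 :+ m) := con 2 :+ (x :+ con 2 :* m)) refl x m)

    base₃ : ∀ x m → 2 * x + 3 * suc m ∸ 2 ≡ suc (2 * x + 3 * m)
    base₃ x m = cong (_∸ 2) (solve 2 (λ x m → con 2 :* x :+ con 3 :* (con 1 :+ m) := con 3 :+ (con 2 :* x :+ con 3 :* m)) refl x m)

    base₄ : ∀ x m → x + 3 * suc m ∸ 1 ≡ suc (suc (x + 3 * m))
    base₄ x m = cong (_∸ 1) (solve 2 (λ x m → x :+ con 3 :* (con 1 :+ m) := con 3 :+ (x :+ con 3 :* m)) refl x m)

    even-index : ∀ x i → 2 * x + 3 * (suc i + suc i) ≡ 2 + 2 * suc (suc (x + 3 * i))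
    even-index = solve 2 (λ x i → con 2 :* x :+ con 3 :* (con 1 :+ i :+ (con 1 :+ i)) := con 2 :+ con 2 :* (con 2 :+ (x :+ con 3 :* i))) refl

    odd-index : ∀ x i → 2 * x + 3 * suc (i + i) ≡ 2 + suc (2 * x + 6 * i)
    odd-index = solve 2 (λ x i → con 2 :* x :+ con 3 :* (con 1 :+ (i :+ i)) := con 2 :+ (con 1 :+ (con 2 :* x :+ con 6 :* i))) refl

    shift-index : ∀ x k i → x + 3 * k + 0 + 3 * i ≡ x + 3 * (k + i)
    shift-index = solve 3 (λ x k i → x :+ con 3 :* k :+ con 0 :+ con 3 :* i := x :+ con 3 :* (k :+ i)) refl

  open GaplessArith
  open ℚSolver using (solve; _:+_; _:*_; _:-_; :-_; _:=_; con)
  open ≡-Reasoning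

  -- the first three factors of P₃ x (m+1) and P₄ x (m+1)
  headM : Mono
  headM = ↑ (fac (0 ∷ 1 ∷ [] , 1)) ∷ ↑ two ∷ ↑ (fac (2 ∷ 3 ∷ [] , 0)) ∷ ↓ (fac (2 ∷ 2 ∷ [] , 0)) ∷ ↓ (fac (1 ∷ 2 ∷ [] , 1)) ∷ ↑ (fac (1 ∷ 1 ∷ [] , 0))
        ∷ ↑ (fac (1 ∷ 3 ∷ [] , 1)) ∷ ↓ (fac (1 ∷ 2 ∷ [] , 0)) ∷ []

  head : ℕ → ℕ → ℚ
  head x m = ⟦ suc m ! ⟧ℕ ℚ.* FR x (suc m) ℚ.* poch (+ (x + 2 * suc m ∸ 1)) (+ suc m)

  head-eval : ∀ x m → head x m ≡ eval headM (x ∷ m ∷ [])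
  head-eval x m = begin
    ⟦ suc m ! ⟧ℕ ℚ.* (⟦ + 2 ⟧ ℚ.* poch (+ (2 * x + 2 * suc m ∸ 1)) (suc m ⊖ 1) ℚ.* inv (poch (+ (x + suc m)) (+ suc m))) ℚ.* poch (+ (x + 2 * suc m ∸ 1)) (+ suc m)
      ≡⟨ cong₂ ℚ._*_ (cong₂ ℚ._*_ (⟦⟧≡ι (suc m !)) (cong₂ ℚ._*_ (cong₂ ℚ._*_ (⟦⟧≡ι 2) p₁) (trans (cong inv p₂) (inv-eval m₂ ρ)))) p₃ ⟩
    ι (suc m !) ℚ.* (ι 2 ℚ.* eval m₁ ρ ℚ.* eval (flip m₂) ρ) ℚ.* eval m₃ ρ
      ≡⟨ solve 8 (λ f t a b c d g h → f :* (t :* (a :* (b :* con 1ℚ)) :* (c :* (d :* con 1ℚ))) :* (g :* (h :* con 1ℚ)) := f :* (t :* (a :* (b :* (c :* (d :* (g :* (h :* con 1ℚ)))))))) refl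
           (ι (suc m !)) (ι 2) (evalS (↑ (fac (2 ∷ 3 ∷ [] , 0))) ρ) (evalS (↓ (fac (2 ∷ 2 ∷ [] , 0))) ρ) (evalS (↓ (fac (1 ∷ 2 ∷ [] , 1))) ρ) (evalS (↑ (fac (1 ∷ 1 ∷ [] , 0))) ρ)
           (evalS (↑ (fac (1 ∷ 3 ∷ [] , 1))) ρ) (evalS (↓ (fac (1 ∷ 2 ∷ [] , 0))) ρ) ⟩
    eval headM ρ ∎
    where
    ρ : List ℕ
    ρ = x ∷ m ∷ []
    m₁ m₂ m₃ : Mono
    m₁ = ↑ (fac (2 ∷ 3 ∷ [] , 0)) ∷ ↓ (fac (2 ∷ 2 ∷ [] , 0)) ∷ []
    m₂ = ↑ (fac (1 ∷ 2 ∷ [] , 1)) ∷ ↓ (fac (1 ∷ 1 ∷ [] , 0)) ∷ []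
    m₃ = ↑ (fac (1 ∷ 3 ∷ [] , 1)) ∷ ↓ (fac (1 ∷ 2 ∷ [] , 0)) ∷ []
    X N : LExp
    X = var 0
    N = var 1
    whole : + suc m ≡ suc m ⊖ 0
    whole = sym (⊖-+ {suc m} {0} (suc m) (sym (ℕ.+-identityʳ (suc m))))
    p₁ : poch (+ (2 * x + 2 * suc m ∸ 1)) (suc m ⊖ 1) ≡ eval m₁ ρ
    p₁ = trans (cong (λ t → poch (+ t) (suc m ⊖ 1)) (base₁ x m)) (poch⁺ (2 ∷ 2 ∷ [] , 0) (2 ∷ 3 ∷ [] , 0) (n# 1 ∔ (2 · X ∔ 2 · N)) (n# 1 ∔ N) (n# 1) ρ refl refl)
    p₂ : poch (+ (x + suc m)) (+ suc m) ≡ eval m₂ ρ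
    p₂ = trans (cong (poch (+ (x + suc m))) whole) (poch⁺ (1 ∷ 1 ∷ [] , 0) (1 ∷ 2 ∷ [] , 1) (X ∔ (n# 1 ∔ N)) (n# 1 ∔ N) (n# 0) ρ refl refl)
    p₃ : poch (+ (x + 2 * suc m ∸ 1)) (+ suc m) ≡ eval m₃ ρ
    p₃ = trans (cong₂ (λ t L → poch (+ t) L) (base₂ x m) whole) (poch⁺ (1 ∷ 2 ∷ [] , 0) (1 ∷ 3 ∷ [] , 1) (n# 1 ∔ (X ∔ 2 · N)) (n# 1 ∔ N) (n# 0) ρ refl refl)

  lastM : Form → Mono
  lastM f = ↑ (lin f) ∷ ↓ (fac (0 ∷ 2 ∷ [] , 2)) ∷ []

  last-eval : ∀ f x m n → n ≡ suc (⟪ f ⟫ (x ∷ m ∷ [])) → ∀ h → h ℚ.* ⟦ + n ⟧ ℚ.* inv ⟦ (2 * suc m) ! ⟧ℕ ≡ h ℚ.* eval (lastM f) (x ∷ m ∷ [])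
  last-eval f x m n refl h = trans (cong₂ (λ u v → h ℚ.* u ℚ.* v) (⟦⟧≡ι n) (cong inv (trans (⟦⟧≡ι ((2 * suc m) !)) (cong (λ t → ι (t !)) (linear (2 · (n# 1 ∔ var 1)) (frm (0 ∷ 2 ∷ [] , 2)) (x ∷ m ∷ []) refl)))))
    (solve 3 (λ h u v → h :* u :* v := h :* (u :* (v :* con 1ℚ))) refl h (ι n) (inv (ι (⟪ 0 ∷ 2 ∷ [] , 2 ⟫ (x ∷ m ∷ []) !))))

  P₄-eval : ∀ x m → P₄ x (suc m) ≡ ι 2 ℚ.* eval qM (x ∷ m ∷ [])
  P₄-eval x m = trans (last-eval (1 ∷ 3 ∷ [] , 1) x m (x + 3 * suc m ∸ 1) (trans (base₄ x m) (linear (n# 2 ∔ (var 0 ∔ 3 · var 1)) (n# 1 ∔ frm (1 ∷ 3 ∷ [] , 1)) ρ refl)) (head x m))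
    (trans (cong (ℚ._* eval (lastM (1 ∷ 3 ∷ [] , 1)) ρ) (head-eval x m)) (trans (sym (eval-++ headM (lastM (1 ∷ 3 ∷ [] , 1)) ρ))
      (mono (headM ++ lastM (1 ∷ 3 ∷ [] , 1)) (↑ two ∷ qM) ρ refl)))
    where
    ρ : List ℕ
    ρ = x ∷ m ∷ []

  -- With i = m+1, `P₃` and `P₄` differ only in the linear factor, 2x+3i-2 against x+3i-1; the
  -- latter is multiplied across to avoid a division.
  P₃-eval : ∀ x m → P₃ x (suc m) ℚ.* one x (suc m) ≡ ι 2 ℚ.* eval qM (x ∷ m ∷ []) ℚ.* ι (suc (2 * x + 3 * m))
  P₃-eval x m = begin
    P₃ x (suc m) ℚ.* one x (suc m)
      ≡⟨ cong₂ ℚ._*_ (trans (last-eval φ x m (2 * x + 3 * suc m ∸ 2) (trans (base₃ x m) lin-φ) (head x m)) (cong (ℚ._* eval (lastM φ) ρ) (head-eval x m)))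
           (trans (one-suc x m) (trans (cong ι (linear (n# 2 ∔ (var 0 ∔ 3 · var 1)) (n# 1 ∔ frm (1 ∷ 3 ∷ [] , 1)) ρ refl)) (sym (ℚ.*-identityʳ (ι (suc (⟪ 1 ∷ 3 ∷ [] , 1 ⟫ ρ))))))) ⟩
    eval headM ρ ℚ.* eval (lastM φ) ρ ℚ.* eval (↑ (lin (1 ∷ 3 ∷ [] , 1)) ∷ []) ρ
      ≡⟨ cong (ℚ._* eval (↑ (lin (1 ∷ 3 ∷ [] , 1)) ∷ []) ρ) (sym (eval-++ headM (lastM φ) ρ)) ⟩
    eval (headM ++ lastM φ) ρ ℚ.* eval (↑ (lin (1 ∷ 3 ∷ [] , 1)) ∷ []) ρ
      ≡⟨ sym (eval-++ (headM ++ lastM φ) (↑ (lin (1 ∷ 3 ∷ [] , 1)) ∷ []) ρ) ⟩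
    eval ((headM ++ lastM φ) ++ ↑ (lin (1 ∷ 3 ∷ [] , 1)) ∷ []) ρ
      ≡⟨ mono ((headM ++ lastM φ) ++ ↑ (lin (1 ∷ 3 ∷ [] , 1)) ∷ []) ((↑ two ∷ qM) ++ ↑ (lin φ) ∷ []) ρ refl ⟩
    eval ((↑ two ∷ qM) ++ ↑ (lin φ) ∷ []) ρ
      ≡⟨ eval-++ (↑ two ∷ qM) (↑ (lin φ) ∷ []) ρ ⟩
    ι 2 ℚ.* eval qM ρ ℚ.* (ι (suc (⟪ φ ⟫ ρ)) ℚ.* 1ℚ)
      ≡⟨ cong (ι 2 ℚ.* eval qM ρ ℚ.*_) (trans (ℚ.*-identityʳ (ι (suc (⟪ φ ⟫ ρ)))) (cong ι (sym lin-φ))) ⟩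
    ι 2 ℚ.* eval qM ρ ℚ.* ι (suc (2 * x + 3 * m)) ∎
    where
    φ : Form
    φ = 2 ∷ 3 ∷ [] , 0
    ρ : List ℕ
    ρ = x ∷ m ∷ []
    lin-φ : suc (2 * x + 3 * m) ≡ suc (⟪ φ ⟫ ρ)
    lin-φ = linear (n# 1 ∔ (2 · var 0 ∔ 3 · var 1)) (n# 1 ∔ frm φ) ρ refl

  2^-suc : ∀ n → ι (2 ^ suc n) ≡ ι (2 ^ n) ℚ.* ι 2
  2^-suc n = trans (ι-* 2 (2 ^ n)) (ℚ.*-comm (ι 2) (ι (2 ^ n)))

  2^≢0 : ∀ n → ι (2 ^ n) ≢ 0ℚ
  2^≢0 n = ι≢0 (2 ^ n) {{ℕ.m^n≢0 2 n}}

  pow2⁺ : ∀ n → pow2 (+ n) ≡ ι (2 ^ n)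
  pow2⁺ zero    = sym ι-1
  pow2⁺ (suc n) = trans (pow2-suc n) (trans (cong (ℚ._* ι 2) (pow2⁺ n)) (sym (2^-suc n)))

  ∏P₄ : ∀ x n → ∏[1‥ n ] (P₄ x) ≡ ι (2 ^ n) ℚ.* Q x n
  ∏P₄ x zero    = sym (trans (ℚ.*-identityʳ (ι 1)) ι-1)
  ∏P₄ x (suc n) = trans (cong₂ ℚ._*_ (∏P₄ x n) (P₄-eval x n)) (trans (solve 4 (λ p q t e → p :* q :* (t :* e) := p :* t :* (q :* e)) refl (ι (2 ^ n)) (Q x n) (ι 2) (eval qM (x ∷ n ∷ [])))
    (cong (ℚ._* Q x (suc n)) (sym (2^-suc n))))

  numer : ℕ → ℕ → ℚ
  numer x i = ⟦ (2 * x + 3 * i) ⊖ 2 ⟧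

  numer-suc : ∀ x m → numer x (suc m) ≡ ι (suc (2 * x + 3 * m))
  numer-suc x m = trans (cong ⟦_⟧ (⊖-+ (suc (2 * x + 3 * m)) (index x m))) (⟦⟧≡ι (suc (2 * x + 3 * m)))
    where
    index : ∀ x m → 2 * x + 3 * suc m ≡ suc (2 * x + 3 * m) + 2
    index x m = linear (2 · var 0 ∔ 3 · (n# 1 ∔ var 1)) (n# 1 ∔ (2 · var 0 ∔ 3 · var 1) ∔ n# 2) (x ∷ m ∷ []) refl

  ∏P₃ : ∀ x n → ∏[1‥ n ] (P₃ x) ℚ.* ∏[1‥ n ] (one x) ≡ ι (2 ^ n) ℚ.* Q x n ℚ.* ∏[1‥ n ] (numer x)
  ∏P₃ x zero    = sym (cong (λ i → i ℚ.* 1ℚ ℚ.* 1ℚ) ι-1)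
  ∏P₃ x (suc n) = begin
    ∏[1‥ n ] (P₃ x) ℚ.* P₃ x (suc n) ℚ.* (∏[1‥ n ] (one x) ℚ.* one x (suc n))
      ≡⟨ solve 4 (λ a b c d → a :* b :* (c :* d) := (a :* c) :* (b :* d)) refl (∏[1‥ n ] (P₃ x)) (P₃ x (suc n)) (∏[1‥ n ] (one x)) (one x (suc n)) ⟩
    (∏[1‥ n ] (P₃ x) ℚ.* ∏[1‥ n ] (one x)) ℚ.* (P₃ x (suc n) ℚ.* one x (suc n))
      ≡⟨ cong₂ ℚ._*_ (∏P₃ x n) (trans (P₃-eval x n) (cong (ι 2 ℚ.* eval qM (x ∷ n ∷ []) ℚ.*_) (sym (numer-suc x n)))) ⟩
    (ι (2 ^ n) ℚ.* Q x n ℚ.* ∏[1‥ n ] (numer x)) ℚ.* (ι 2 ℚ.* eval qM (x ∷ n ∷ []) ℚ.* numer x (suc n))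
      ≡⟨ solve 6 (λ p q u t e v → (p :* q :* u) :* (t :* e :* v) := p :* t :* (q :* e) :* (u :* v)) refl (ι (2 ^ n)) (Q x n) (∏[1‥ n ] (numer x)) (ι 2) (eval qM (x ∷ n ∷ [])) (numer x (suc n)) ⟩
    ι (2 ^ n) ℚ.* ι 2 ℚ.* Q x (suc n) ℚ.* ∏[1‥ suc n ] (numer x)
      ≡⟨ cong (λ p → p ℚ.* Q x (suc n) ℚ.* ∏[1‥ suc n ] (numer x)) (sym (2^-suc n)) ⟩
    ι (2 ^ suc n) ℚ.* Q x (suc n) ℚ.* ∏[1‥ suc n ] (numer x) ∎

  -- 2x+3i-2 is 2(x+3j-1) for i = 2j and 2x+6j-5 for i = 2j-1: the power of two and the two families
  -- of linear factors of K.
  numer-split : ∀ x n → ∏[1‥ n ] (numer x) ≡ pow2 (+ (n / 2)) ℚ.* ∏[1‥ n / 2 ] (one x) ℚ.* ∏[1‥ (n + 1) / 2 ] (five (2 * x))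
  numer-split x n = trans (sym (interleave n (numer x))) (cong₂ ℚ._*_
    (trans (∏-cong (n / 2) (λ i _ → evens i)) (∏-* (n / 2) (λ _ → ⟦ + 2 ⟧) (one x)))
    (∏-cong ((n + 1) / 2) (λ i _ → odds i)))
    where
    evens : ∀ i → numer x (suc i + suc i) ≡ ⟦ + 2 ⟧ ℚ.* one x (suc i)
    evens i = trans (cong ⟦_⟧ (⊖-+ (2 * suc (suc (x + 3 * i))) (trans (even-index x i) (ℕ.+-comm 2 (2 * suc (suc (x + 3 * i)))))))
      (trans (⟦⟧≡ι (2 * suc (suc (x + 3 * i)))) (trans (ι-* 2 (suc (suc (x + 3 * i)))) (cong₂ ℚ._*_ (sym (⟦⟧≡ι 2)) (sym (one-suc x i)))))
    odds : ∀ i → numer x (suc i + suc i ∸ 1) ≡ five (2 * x) (suc i)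
    odds i = trans (cong (numer x) (ℕ.+-suc i i)) (trans (cong ⟦_⟧ (⊖-+ (suc (2 * x + 6 * i)) (trans (odd-index x i) (ℕ.+-comm 2 (suc (2 * x + 6 * i))))))
      (trans (⟦⟧≡ι (suc (2 * x + 6 * i))) (sym (five-suc (2 * x) i))))

  ∏-+ : ∀ k n (g : ℕ → ℚ) → ∏[1‥ k + n ] g ≡ ∏[1‥ k ] g ℚ.* ∏[1‥ n ] (λ i → g (k + i))
  ∏-+ k zero    g = trans (cong (λ m → ∏[1‥ m ] g) (ℕ.+-identityʳ k)) (sym (ℚ.*-identityʳ (∏[1‥ k ] g)))
  ∏-+ k (suc n) g = trans (cong (λ m → ∏[1‥ m ] g) (ℕ.+-suc k n)) (trans (cong₂ ℚ._*_ (∏-+ k n g) (cong g (sym (ℕ.+-suc k n))))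
    (ℚ.*-assoc (∏[1‥ k ] g) (∏[1‥ n ] (λ i → g (k + i))) (g (k + suc n))))

  ∏one-+ : ∀ x k n → ∏[1‥ k + n ] (one x) ≡ ∏[1‥ k ] (one x) ℚ.* ∏[1‥ n ] (one (x + 3 * k + 0))
  ∏one-+ x k n = trans (∏-+ k n (one x)) (cong (∏[1‥ k ] (one x) ℚ.*_) (∏-cong n (λ i _ → cong (λ m → ⟦ m ⊖ 1 ⟧) (sym (shift-index x k (suc i))))))

  -- E₃ / K at a = 0, where n is y + z - 1 and K has c and d factors of the form x + 3k + 3i - 1.
  gapless : ∀ x n k c d → n / 2 ≡ k + c → n ≡ k + d →
            pow2 (0 ⊖ n) ℚ.* ∏[1‥ n ] (P₃ x)
              ℚ.* inv (shape (pow2 (+ (k + c))) (∏[1‥ (n + 1) / 2 ] (five (2 * x))) (∏[1‥ c ] (one (x + 3 * k + 0))) 1ℚ (∏[1‥ d ] (one (x + 3 * k + 0))))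
            ≡ Q x n
  gapless x n k c d n/2 n≡ = trans (cong (ℚ._* inv κ) (*-cancelˡ (W ℚ.* D) e (Q x n ℚ.* κ) (*≢0 W D W≢0 D≢0) (begin
      W ℚ.* D ℚ.* (pow2 (0 ⊖ n) ℚ.* Π)
        ≡⟨ cong₂ (λ w t → w ℚ.* (t ℚ.* Π)) (trans (sym (∏one-+ x k d)) (cong (λ m → ∏[1‥ m ] (one x)) (sym n≡)))
             (trans (pow2-quotient 0 n) (trans (cong (ℚ._* inv (ι (2 ^ n))) ι-1) (ℚ.*-identityˡ (inv (ι (2 ^ n)))))) ⟩
      ∏[1‥ n ] (one x) ℚ.* (inv t ℚ.* Π)
        ≡⟨ solve 3 (λ w i p → w :* (i :* p) := i :* (p :* w)) refl (∏[1‥ n ] (one x)) (inv t) Π ⟩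
      inv t ℚ.* (Π ℚ.* ∏[1‥ n ] (one x))
        ≡⟨ cong (inv t ℚ.*_) (trans (∏P₃ x n) (cong (t ℚ.* Q x n ℚ.*_) (trans (numer-split x n)
             (trans (cong (λ m → pow2 (+ m) ℚ.* ∏[1‥ m ] (one x) ℚ.* F) n/2) (cong (λ w → p ℚ.* w ℚ.* F) (∏one-+ x k c)))))) ⟩
      inv t ℚ.* (t ℚ.* Q x n ℚ.* (p ℚ.* (W ℚ.* C) ℚ.* F))
        ≡⟨ solve 7 (λ i t q p w c f → i :* (t :* q :* (p :* (w :* c) :* f)) := (t :* i) :* (q :* (p :* (w :* c) :* f))) refl (inv t) t (Q x n) p W C F ⟩
      (t ℚ.* inv t) ℚ.* (Q x n ℚ.* (p ℚ.* (W ℚ.* C) ℚ.* F))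
        ≡⟨ cong (ℚ._* (Q x n ℚ.* (p ℚ.* (W ℚ.* C) ℚ.* F))) (trans (inv-inverse t (2^≢0 n)) (sym (inv-inverse (1ℚ ℚ.* D) D′≢0))) ⟩
      (1ℚ ℚ.* D ℚ.* inv (1ℚ ℚ.* D)) ℚ.* (Q x n ℚ.* (p ℚ.* (W ℚ.* C) ℚ.* F))
        ≡⟨ solve 7 (λ d i q p w c f → (con 1ℚ :* d :* i) :* (q :* (p :* (w :* c) :* f)) := w :* d :* (q :* (p :* f :* c :* i))) refl D (inv (1ℚ ℚ.* D)) (Q x n) p W C F ⟩
      W ℚ.* D ℚ.* (Q x n ℚ.* κ) ∎)))
    (trans (ℚ.*-assoc (Q x n) κ (inv κ)) (trans (cong (Q x n ℚ.*_) (inv-inverse κ κ≢0)) (ℚ.*-identityʳ (Q x n))))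
    where
    Π = ∏[1‥ n ] (P₃ x)
    W = ∏[1‥ k ] (one x)
    C = ∏[1‥ c ] (one (x + 3 * k + 0))
    D = ∏[1‥ d ] (one (x + 3 * k + 0))
    F = ∏[1‥ (n + 1) / 2 ] (five (2 * x))
    p = pow2 (+ (k + c))
    t = ι (2 ^ n)
    e = pow2 (0 ⊖ n) ℚ.* Π
    κ = shape p F C 1ℚ D
    W≢0 : W ≢ 0ℚ
    W≢0 = ∏one≢0 k x
    D≢0 : D ≢ 0ℚ
    D≢0 = ∏one≢0 d (x + 3 * k + 0)
    D′≢0 : 1ℚ ℚ.* D ≢ 0ℚ
    D′≢0 = *≢0 1ℚ D 1≢0 D≢0
    κ≢0 : κ ≢ 0ℚ
    κ≢0 = shape≢0 p F C 1ℚ D (pow2⁺≢0 (k + c)) (∏five≢0 ((n + 1) / 2) (2 * x)) (∏one≢0 c (x + 3 * k + 0)) 1≢0 D≢0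

-- E₄ equals the closed form of the minors.

module ClosedForm where

  open Monomial
  open CornerMinor using (Q)
  open GapFormula using (G; G-y0; ½≡; Z₄; _+′_)
  open Pochhammer
  open E3Step
  open KStep
  open Raising
  open Gapless
  open import Data.Nat.DivMod using ([m+kn]%n≡m%n)
  open import Data.Integer.Base using (+_; -[1+_])

  module ClosedFormArith where
    open ℕSolver

    powE : ∀ k z → 1 + (suc (k + k) + z) ≡ 0 + (0 + z + 2 * suc k)
    powE = solve 2 (λ k z → con 1 :+ (con 1 :+ (k :+ k) :+ z) := con 0 :+ z :+ con 2 :* (con 1 :+ k)) refl

    powO : ∀ k z → k + k + z ≡ 0 + z + 2 * k
    powO = solve 2 (λ k z → k :+ k :+ z := con 0 :+ z :+ con 2 :* k) refl

    countE : ∀ k z → 2 * suc k ∸ 1 + 0 + z ≡ suc (k + k) + z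
    countE k z = solve 2 (λ k z → k :+ (con 1 :+ (k :+ con 0)) :+ con 0 :+ z := con 1 :+ (k :+ k) :+ z) refl k z

    countO : ∀ k z → 2 * k + 0 + z ≡ k + k + z
    countO = solve 2 (λ k z → con 2 :* k :+ con 0 :+ z := k :+ k :+ z) refl

    splitE : ∀ k z → suc (k + k) + z ≡ k + (suc k + z)
    splitE = solve 2 (λ k z → con 1 :+ (k :+ k) :+ z := k :+ (con 1 :+ k :+ z)) refl

    twice : ∀ m → m + m ≡ 0 + m * 2
    twice = solve 1 (λ m → m :+ m := con 0 :+ m :* con 2) refl

    twice₁ : ∀ m → suc (m + m) ≡ 1 + m * 2
    twice₁ = solve 1 (λ m → con 1 :+ (m :+ m) := con 1 :+ m :* con 2) refl

  open ClosedFormArith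
  open ℚSolver using (solve; _:+_; _:*_; _:-_; :-_; _:=_; con)
  open ≡-Reasoning

  -- Here `evenE₄` belongs to y = 2k+2, since its formula starts at k = 1, and `oddE₄` to y = 2k+1.
  evenE₄ oddE₄ : ℕ → ℕ → ℕ → ℕ → ℚ
  evenE₄ x k z a = E3even x (suc k) z a ℚ.* inv (Keven x (suc k) z a)
  oddE₄  x k z a = E3odd x k z a ℚ.* inv (Kodd x k z a)

  ratio-step : ∀ {e e′ i i′} o s j r S → e ≡ o ℚ.* s → i ≡ j ℚ.* r → s ℚ.* r ≡ S → e′ ≡ o → i′ ≡ j → e ℚ.* i ≡ e′ ℚ.* i′ ℚ.* S
  ratio-step o s j r S refl refl refl refl refl = solve 4 (λ o s j r → (o :* s) :* (j :* r) := o :* j :* (s :* r)) refl o s j r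

  module _ (x k a ζ : ℕ) where

    private
      ρ : List ℕ
      ρ = x ∷ k ∷ a ∷ ζ ∷ []

      X K A Z : LExp
      X = var 0
      K = var 1
      A = var 2
      Z = var 3

    lin₁ : ∀ e g → eqL e (n# 1 ∔ frm g) ≡ true → ι (⟦ e ⟧L ρ) ≡ eval (↑ (lin g) ∷ []) ρ
    lin₁ e g q = trans (cong ι (linear e (n# 1 ∔ frm g) ρ q)) (sym (ℚ.*-identityʳ (ι (suc (⟪ g ⟫ ρ)))))

    open KSteps x k a using (c-last; w₁)

    num-even : c-last ≡ eval (↑ (lin (2 ∷ 6 ∷ 6 ∷ [] , 6)) ∷ []) ρ
    num-even = lin₁ (n# 1 ∔ (2 · X ∔ 6 · K ∔ 6 · A ∔ n# 6)) (2 ∷ 6 ∷ 6 ∷ [] , 6) refl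

    num-odd : KSteps.w x k a 1 ≡ eval (↑ (lin (1 ∷ 3 ∷ 3 ∷ [] , 1)) ∷ []) ρ
    num-odd = trans w₁ (lin₁ (n# 2 ∔ (X ∔ 3 · K ∔ 3 · A ∔ n# 0)) (1 ∷ 3 ∷ 3 ∷ [] , 1) refl)

    even-step₀ : evenE₄ x k (ζ + ζ) (suc a) ≡ oddE₄ x (suc k) (ζ + ζ) a ℚ.* eval seM₀ ρ
    even-step₀ = ratio-step (E3odd x (suc k) (ζ + ζ) a) (stepE-ratio x k (ζ + ζ) a) (inv (Kodd x (suc k) (ζ + ζ) a)) _ (eval seM₀ ρ)
      (E3-even-step x k (ζ + ζ) a) (KSteps.Keven-ratio₀ x k a ζ)
      (stepE-eval x k a ζ (two-ζ 0) Z₄ Z₄ (↑ (lin (2 ∷ 6 ∷ 6 ∷ [] , 6)) ∷ []) (↑ (lin (2 ∷ 6 ∷ 6 ∷ 6 ∷ [] , 6)) ∷ []) (ζ + ζ) refl (half-even ζ) (half-evenʳ ζ)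
        num-even (lin₁ (n# 1 ∔ (2 · X ∔ 6 · (n# 1 ∔ K ∔ Z ∔ A))) (2 ∷ 6 ∷ 6 ∷ 6 ∷ [] , 6) refl)) refl refl

    even-step₁ : evenE₄ x k (suc (ζ + ζ)) (suc a) ≡ oddE₄ x (suc k) (suc (ζ + ζ)) a ℚ.* eval seM₁ ρ
    even-step₁ = ratio-step (E3odd x (suc k) (suc (ζ + ζ)) a) (stepE-ratio x k (suc (ζ + ζ)) a) (inv (Kodd x (suc k) (suc (ζ + ζ)) a)) _ (eval seM₁ ρ)
      (E3-even-step x k (suc (ζ + ζ)) a) (KSteps.Keven-ratio₁ x k a ζ)
      (stepE-eval x k a ζ (two-ζ 1) Z₄ (Z₄ +′ 1) (↑ (lin (2 ∷ 6 ∷ 6 ∷ [] , 6)) ∷ []) (↑ two ∷ ↑ (lin (1 ∷ 3 ∷ 3 ∷ 3 ∷ [] , 4)) ∷ []) (suc (ζ + ζ)) refl (half-odd ζ) (half-sucʳ ζ)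
        num-even (cong (ι 2 ℚ.*_) (lin₁ (n# 2 ∔ (X ∔ 3 · (n# 1 ∔ K) ∔ 3 · A ∔ 3 · Z)) (1 ∷ 3 ∷ 3 ∷ 3 ∷ [] , 4) refl))) refl refl

    odd-step₀ : oddE₄ x k (ζ + ζ) (suc a) ≡ evenE₄ x k (ζ + ζ) a ℚ.* eval soM₀ ρ
    odd-step₀ = ratio-step (E3even x (suc k) (ζ + ζ) a) (stepO-ratio x k (ζ + ζ) a) (inv (Keven x (suc k) (ζ + ζ) a)) _ (eval soM₀ ρ)
      (E3-odd-step x k (ζ + ζ) a) (KSteps.Kodd-ratio₀ x k a ζ)
      (stepO-eval x k a ζ (two-ζ 0) Z₄ Z₄ (↑ (lin (1 ∷ 3 ∷ 3 ∷ [] , 1)) ∷ []) (↑ (lin (1 ∷ 3 ∷ 3 ∷ 3 ∷ [] , 1)) ∷ []) (ζ + ζ) refl (half-even ζ) (half-evenʳ ζ)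
        num-odd (trans (one-suc (x + 3 * k + 3 * a) ζ) (lin₁ (n# 2 ∔ (X ∔ 3 · K ∔ 3 · A ∔ 3 · Z)) (1 ∷ 3 ∷ 3 ∷ 3 ∷ [] , 1) refl))) refl refl

    odd-step₁ : oddE₄ x k (suc (ζ + ζ)) (suc a) ≡ evenE₄ x k (suc (ζ + ζ)) a ℚ.* eval soM₁ ρ
    odd-step₁ = ratio-step (E3even x (suc k) (suc (ζ + ζ)) a) (stepO-ratio x k (suc (ζ + ζ)) a) (inv (Keven x (suc k) (suc (ζ + ζ)) a)) _ (eval soM₁ ρ)
      (E3-odd-step x k (suc (ζ + ζ)) a) (KSteps.Kodd-ratio₁ x k a ζ)
      (stepO-eval x k a ζ (two-ζ 1) Z₄ (Z₄ +′ 1) (↑ two ∷ ↑ (lin (1 ∷ 3 ∷ 3 ∷ [] , 1)) ∷ []) (↑ (lin (2 ∷ 6 ∷ 6 ∷ 6 ∷ [] , 6)) ∷ []) (suc (ζ + ζ)) refl (half-odd ζ) (half-sucʳ ζ)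
        (cong (ι 2 ℚ.*_) num-odd) (lin₁ (n# 1 ∔ (2 · X ∔ 6 · (K ∔ Z ∔ A ∔ n# 1))) (2 ∷ 6 ∷ 6 ∷ 6 ∷ [] , 6) refl)) refl refl

  drop-ones : ∀ p P → p ℚ.* P ℚ.* 1ℚ ℚ.* 1ℚ ℚ.* 1ℚ ℚ.* 1ℚ ℚ.* 1ℚ ≡ p ℚ.* P
  drop-ones = solve 2 (λ p P → p :* P :* con 1ℚ :* con 1ℚ :* con 1ℚ :* con 1ℚ :* con 1ℚ := p :* P) refl

  half-twice : ∀ c k z → c / 2 ≡ 0 → (c + (k + k) + z) / 2 ≡ k + (c + z) / 2
  half-twice c zero    z _ = cong (λ m → (m + z) / 2) (ℕ.+-identityʳ c)
  half-twice c (suc k) z e = trans (cong (_/ 2) (shift c k z)) (trans (half-suc (c + (k + k) + z)) (cong suc (half-twice c k z e)))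
    where
    shift : ∀ c k z → c + (suc k + suc k) + z ≡ 2 + (c + (k + k) + z)
    shift c k z = linear (var 0 ∔ (n# 1 ∔ var 1 ∔ (n# 1 ∔ var 1)) ∔ var 2) (n# 2 ∔ (var 0 ∔ (var 1 ∔ var 1) ∔ var 2)) (c ∷ k ∷ z ∷ []) refl

  even-base : ∀ x k z → evenE₄ x k z 0 ≡ Q x (suc (k + k) + z)
  even-base x k z = trans (cong₂ (λ e κ → e ℚ.* inv κ)
      (trans (drop-ones (pow2 (1 ⊖ (0 + z + 2 * suc k))) (∏[1‥ 2 * suc k ∸ 1 + 0 + z ] (P₃ x)))
        (cong₂ (λ e n → pow2 e ℚ.* ∏[1‥ n ] (P₃ x)) (⊖-eq {1} {0 + z + 2 * suc k} {0} {suc (k + k) + z} (powE k z)) (countE k z)))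
      (shape-cong {C = 1ℚ} {1ℚ} (trans (cong (λ m → pow2 (m ⊖ 1)) (ℕ.+-identityʳ (suc k + (z + 1) / 2))) (cong pow2 (⊖-+ {suc k + (z + 1) / 2} (k + (z + 1) / 2) (ℕ.+-comm 1 (k + (z + 1) / 2)))))
        (cong (λ m → ∏[1‥ m ] (five (2 * x))) (trans (ℕ.+-identityʳ (suc k + z / 2)) (sym nh)))
        (four-k x k 0 ((z + 1) / 2)) refl
        (trans (cong (λ m → ∏[1‥ m ] (four (x + 3 * suc k + 0))) (ℕ.+-identityʳ (suc k + z))) (four-k x k 0 (suc k + z)))))
    (gapless x (suc (k + k) + z) k ((z + 1) / 2) (suc k + z) nl (splitE k z))
    where
    nl : (suc (k + k) + z) / 2 ≡ k + (z + 1) / 2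
    nl = trans (half-twice 1 k z refl) (cong (λ m → k + m / 2) (ℕ.+-comm 1 z))
    nh : (suc (k + k) + z + 1) / 2 ≡ suc k + z / 2
    nh = trans (cong (_/ 2) (ℕ.+-comm (suc (k + k) + z) 1)) (trans (half-suc (k + k + z)) (cong suc (half-twice 0 k z refl)))

  odd-base : ∀ x k z → oddE₄ x k z 0 ≡ Q x (k + k + z)
  odd-base x k z = trans (cong₂ (λ e κ → e ℚ.* inv κ)
      (trans (drop-ones (pow2 (0 ⊖ (0 + z + 2 * k))) (∏[1‥ 2 * k + 0 + z ] (P₃ x)))
        (cong₂ (λ e n → pow2 (0 ⊖ e) ℚ.* ∏[1‥ n ] (P₃ x)) (sym (powO k z)) (countO k z)))
      (shape-cong {C = 1ℚ} {1ℚ} (cong (λ m → pow2 (+ m)) (ℕ.+-identityʳ (k + z / 2)))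
        (cong (λ m → ∏[1‥ m ] (five (2 * x))) (trans (ℕ.+-identityʳ (k + (z + 1) / 2)) (sym nh)))
        refl refl
        (cong (λ m → ∏[1‥ m ] (one (x + 3 * k + 0))) (ℕ.+-identityʳ (k + z)))))
    (gapless x (k + k + z) k (z / 2) (k + z) (half-twice 0 k z refl) (ℕ.+-assoc k k z))
    where
    nh : (k + k + z + 1) / 2 ≡ k + (z + 1) / 2
    nh = trans (cong (_/ 2) (ℕ.+-assoc (k + k) z 1)) (half-twice 0 k (z + 1) refl)

  even-step : ∀ x k a {z} → Parity z → oddE₄ x (suc k) z a ≡ raise x (2 + (k + k)) a z → evenE₄ x k z (suc a) ≡ G x (2 + (k + k)) a z
  even-step x k a (even ζ) ih = trans (even-step₀ x k a ζ) (trans (cong (ℚ._* eval seM₀ (x ∷ k ∷ a ∷ ζ ∷ [])) ih) (sym (RaiseEven.raise₀ x k a ζ)))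
  even-step x k a (odd ζ)  ih = trans (even-step₁ x k a ζ) (trans (cong (ℚ._* eval seM₁ (x ∷ k ∷ a ∷ ζ ∷ [])) ih) (sym (RaiseEven.raise₁ x k a ζ)))

  odd-step : ∀ x k a {z} → Parity z → evenE₄ x k z a ≡ raise x (1 + (k + k)) a z → oddE₄ x k z (suc a) ≡ G x (1 + (k + k)) a z
  odd-step x k a (even ζ) ih = trans (odd-step₀ x k a ζ) (trans (cong (ℚ._* eval soM₀ (x ∷ k ∷ a ∷ ζ ∷ [])) ih) (sym (RaiseOdd.raise₀ x k a ζ)))
  odd-step x k a (odd ζ)  ih = trans (odd-step₁ x k a ζ) (trans (cong (ℚ._* eval soM₁ (x ∷ k ∷ a ∷ ζ ∷ [])) ih) (sym (RaiseOdd.raise₁ x k a ζ)))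

  -- Each step trades one unit of the gap for one unit of y and changes the parity of y, until the
  -- gap is closed and `even-base` or `odd-base` gives `Q`.
  even-closed : ∀ a x k z → evenE₄ x k z (suc a) ≡ G x (2 + (k + k)) a z
  odd-closed  : ∀ a x k z → oddE₄ x k z (suc a) ≡ G x (1 + (k + k)) a z
  even-closed zero    x k z = even-step x k 0 (parity z) (trans (odd-base x (suc k) z) (cong (Q x) (trans (cong (λ m → suc m + z) (ℕ.+-suc k k)) (ℕ.+-comm (2 + (k + k)) z))))
  even-closed (suc a) x k z = even-step x k (suc a) (parity z) (trans (odd-closed a x (suc k) z) (cong (λ m → G x (2 + m) a z) (ℕ.+-suc k k)))
  odd-closed  zero    x k z = odd-step x k 0 (parity z) (trans (even-base x k z) (cong (Q x) (ℕ.+-comm (suc (k + k)) z)))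
  odd-closed  (suc a) x k z = odd-step x k (suc a) (parity z) (even-closed a x k z)

  -- Turns the case distinction of `E4` into a function of the remainder, so that a computed
  -- remainder can be substituted.
  by-parity : ℕ → ℚ → ℚ → ℚ
  by-parity zero    p q = p
  by-parity (suc _) p q = q

  E4-suc : ∀ x y z a → E4 x (suc y) z a ≡ by-parity (suc y % 2) (E3even x (suc y / 2) z a ℚ.* inv (Keven x (suc y / 2) z a)) (E3odd x (suc y / 2) z a ℚ.* inv (Kodd x (suc y / 2) z a))
  E4-suc x y z a with suc y % 2
  ... | zero  = refl
  ... | suc _ = refl

  E4-even : ∀ x k z a → E4 x (suc k + suc k) z a ≡ evenE₄ x k z a
  E4-even x k z a = trans (E4-suc x (k + suc k) z a) (trans
    (cong (λ r → by-parity r (E3even x ((suc k + suc k) / 2) z a ℚ.* inv (Keven x ((suc k + suc k) / 2) z a)) (E3odd x ((suc k + suc k) / 2) z a ℚ.* inv (Kodd x ((suc k + suc k) / 2) z a)))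
      (trans (cong (_% 2) (twice (suc k))) ([m+kn]%n≡m%n 0 (suc k) 2)))
    (cong (λ h → E3even x h z a ℚ.* inv (Keven x h z a)) (half-even (suc k))))

  E4-odd : ∀ x k z a → E4 x (suc (k + k)) z a ≡ oddE₄ x k z a
  E4-odd x k z a = trans (E4-suc x (k + k) z a) (trans
    (cong (λ r → by-parity r (E3even x (suc (k + k) / 2) z a ℚ.* inv (Keven x (suc (k + k) / 2) z a)) (E3odd x (suc (k + k) / 2) z a ℚ.* inv (Kodd x (suc (k + k) / 2) z a)))
      (trans (cong (_% 2) (twice₁ k)) ([m+kn]%n≡m%n 1 k 2)))
    (cong (λ h → E3odd x h z a ℚ.* inv (Kodd x h z a)) (half-odd k)))

  -- For y = 0 the two products of E₄ are, up to powers of two, the two blocks of the minor; the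
  -- power of two in front cancels all but one 1/2, which is the entry between the blocks.
  E4-zero : ∀ x a z → E4 x 0 z (suc a) ≡ G x 0 a z
  E4-zero x a zero = trans (cong₂ (λ p q → inv p ℚ.* q ℚ.* 1ℚ) (trans (cong pow2 (⊖-+ {suc a + 0} a (trans (ℕ.+-identityʳ (suc a)) (ℕ.+-comm 1 a)))) (pow2⁺ a)) (∏P₄ x a))
    (trans (solve 3 (λ i t q → i :* (t :* q) :* con 1ℚ := (t :* i) :* q) refl (inv (ι (2 ^ a))) (ι (2 ^ a)) (Q x a))
      (trans (cong (ℚ._* Q x a) (inv-inverse (ι (2 ^ a)) (2^≢0 a))) (ℚ.*-identityˡ (Q x a))))
  E4-zero x a (suc z) = trans (cong₂ (λ p q → inv p ℚ.* ∏[1‥ a ] (P₄ x) ℚ.* q) power (∏P₄ (x + 3 * suc a) z))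
    (trans (cong (λ q → inv (s ℚ.* t ℚ.* ι 2) ℚ.* q ℚ.* (t ℚ.* R)) (∏P₄ x a))
    (trans (cong (λ i → i ℚ.* (s ℚ.* Q x a) ℚ.* (t ℚ.* R)) (trans (inv-* (s ℚ.* t) (ι 2) (*≢0 s t (2^≢0 a) (2^≢0 z)) (ι-suc≢0 1)) (cong₂ ℚ._*_ (inv-* s t (2^≢0 a) (2^≢0 z)) ½≡)))
    (trans (solve 7 (λ s t i j h q r → i :* j :* h :* (s :* q) :* (t :* r) := (s :* i) :* (t :* j) :* (h :* r :* q)) refl s t (inv s) (inv t) ½ (Q x a) R)
    (trans (cong₂ (λ u v → u ℚ.* v ℚ.* (½ ℚ.* R ℚ.* Q x a)) (inv-inverse s (2^≢0 a)) (inv-inverse t (2^≢0 z)))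
    (trans (ℚ.*-identityˡ (½ ℚ.* R ℚ.* Q x a)) (sym (G-y0 x a z)))))))
    where
    s = ι (2 ^ a)
    t = ι (2 ^ z)
    R = Q (x + 3 * suc a) z
    power : pow2 ((suc a + suc z) ⊖ 1) ≡ s ℚ.* t ℚ.* ι 2
    power = trans (cong pow2 (⊖-+ {suc a + suc z} (suc (a + z)) (trans (cong suc (ℕ.+-suc a z)) (ℕ.+-comm 1 (suc (a + z))))))
      (trans (pow2⁺ (suc (a + z))) (trans (2^-suc (a + z)) (cong (ℚ._* ι 2) (trans (cong ι (ℕ.^-distribˡ-+-* 2 a z)) (ι-* (2 ^ a) (2 ^ z))))))

  E4-gap : ∀ x y z a → E4 x y z (suc a) ≡ G x y a z
  E4-gap x y z a with parity y
  ... | even zero    = E4-zero x a z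
  ... | even (suc k) = trans (E4-even x k z (suc a)) (trans (even-closed a x k z) (cong (λ m → G x (suc m) a z) (sym (ℕ.+-suc k k))))
  ... | odd k        = trans (E4-odd x k z (suc a)) (odd-closed a x k z)

  E4-gapless : ∀ x y z s → y + z ≡ suc s → E4 x y z 0 ≡ Q x s
  E4-gapless x y z s e with parity y
  ... | odd k        = trans (E4-odd x k z 0) (trans (odd-base x k z) (cong (Q x) (ℕ.suc-injective e)))
  ... | even (suc k) = trans (E4-even x k z 0) (trans (even-base x k z) (cong (Q x) (ℕ.suc-injective (trans (cong (λ m → suc m + z) (sym (ℕ.+-suc k k))) e))))
  E4-gapless x .0 .(suc s) s refl | even zero = trans (cong₂ (λ p q → inv p ℚ.* 1ℚ ℚ.* q) (trans (cong pow2 (⊖-+ {suc s} s (ℕ.+-comm 1 s))) (pow2⁺ s)) (∏P₄ (x + 0) s))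
    (trans (solve 3 (λ i t q → i :* con 1ℚ :* (t :* q) := (t :* i) :* q) refl (inv (ι (2 ^ s))) (ι (2 ^ s)) (Q (x + 0) s))
      (trans (cong (ℚ._* Q (x + 0) s) (inv-inverse (ι (2 ^ s)) (2^≢0 s))) (trans (ℚ.*-identityˡ (Q (x + 0) s)) (cong (λ m → Q m s) (ℕ.+-identityʳ x)))))

-- From the determinant of the tilings to the minors and the theorem.

module Assembly where

  open Determinant
  open Region
  open CornerMinor using (Q; det-Q)
  open GapMinor using (gap)
  open GapFormula using (gap≡G)
  open ClosedForm

  module AssemblyArith where
    open ℕSolver

    rows : ∀ y z a s → y + z ≡ suc s → s + 2 * suc a ≡ (y + a + suc a) + z
    rows y z a s e = trans (solve 2 (λ s a → s :+ con 2 :* (con 1 :+ a) := (con 1 :+ s) :+ (a :+ (con 1 :+ a))) refl s a)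
      (trans (cong (_+ (a + suc a)) (sym e)) (solve 3 (λ y z a → (y :+ z) :+ (a :+ (con 1 :+ a)) := (y :+ a :+ (con 1 :+ a)) :+ z) refl y z a))

    columns : ∀ y z a s → y + z ≡ suc s → s + suc a ≡ (y + a) + z
    columns y z a s e = trans (ℕ.+-suc s a) (trans (cong (_+ a) (sym e)) (solve 3 (λ y z a → y :+ z :+ a := y :+ a :+ z) refl y z a))

    gap-end : ∀ y a → (y + a) + suc a + 1 ≡ y + 2 * suc a
    gap-end = solve 2 (λ y a → (y :+ a) :+ (con 1 :+ a) :+ con 1 := y :+ con 2 :* (con 1 :+ a)) refl

  open AssemblyArith

  module _ (x y z s : ℕ) (yz : y + z ≡ suc s) where

    open ≡-Reasoning

    gapless-det : M*E x y z 0 ≡ Q x s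
    gapless-det = begin
      M*E x y z 0                                      ≡⟨ M≡det ⟩
      det A[ x ] (desc 0 (s + 0)) (exitRows (s + 0))   ≡⟨ cong (λ n → det A[ x ] (desc 0 n) (exitRows n)) (ℕ.+-identityʳ s) ⟩
      det A[ x ] (desc 0 s) (exitRows s)               ≡⟨ cong (det A[ x ] (desc 0 s)) (trans (exitRows-keep 0 s (λ i _ → kept (suc i) (ℕ.<-≤-connex (suc i) y))) (++-identityʳ (desc 0 s))) ⟩
      det A[ x ] (desc 0 s) (desc 0 s)                 ≡⟨ det-Q x s ⟩
      Q x s                                            ∎
      where
      open Tilings x y z 0 s yz
      -- For a = 0 the conditions y ≤ t and t+1 ≤ y exclude each other, so no row is removed.
      kept : ∀ t → t < y ⊎ y ≤ t → keep t ≡ true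
      kept t (inj₁ t<y) = cong (λ b → not (b ∧ (t + 1 ≤ᵇ y + 0))) (≤ᵇ-false (≤-trans t<y (ℕ.m≤m+n y 0)))
      kept t (inj₂ y≤t) = trans (cong (λ b → not ((y + 0 ≤ᵇ t) ∧ b)) (≤ᵇ-false (subst (y + 0 <_) (ℕ.+-comm 1 t) (s≤s (subst (_≤ t) (sym (ℕ.+-identityʳ y)) y≤t)))))
        (cong not (∧-zeroʳ (y + 0 ≤ᵇ t)))

    -- For a gap of length a+1 the removed triangles are those from y+a+1 to y+2a+1, so the gap
    -- begins after p = y+a rows.
    gap-det : ∀ a → M*E x y z (suc a) ≡ gap x (y + a) (suc a) z
    gap-det a = begin
      M*E x y z (suc a)                                                      ≡⟨ M≡det ⟩
      det A[ x ] (desc 0 (s + suc a)) (exitRows (s + 2 * suc a))             ≡⟨ cong₂ (λ m n → det A[ x ] (desc 0 m) (exitRows n)) (columns y z a s yz) (rows y z a s yz) ⟩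
      det A[ x ] (desc 0 (q + z)) (exitRows (q + suc a + z))                 ≡⟨ cong (det A[ x ] (desc 0 (q + z))) exits ⟩
      det A[ x ] (desc 0 (q + z)) (desc (q + suc a) z ++ desc 0 q)           ∎
      where
      open Tilings x y z (suc a) s yz
      q = y + a
      below : ∀ t → t ≤ q → keep t ≡ true
      below t le = cong (λ b → not (b ∧ (t + 1 ≤ᵇ y + 2 * suc a))) (≤ᵇ-false (subst (t <_) (sym (ℕ.+-suc y a)) (s≤s le)))
      within : ∀ i → i < suc a → keep (q + suc i) ≡ false
      within i lt = cong₂ (λ b c → not (b ∧ c))
        (≤ᵇ-true (subst (_≤ q + suc i) (sym (ℕ.+-suc y a)) (subst (suc q ≤_) (sym (ℕ.+-suc q i)) (s≤s (ℕ.m≤m+n q i)))))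
        (≤ᵇ-true (subst (q + suc i + 1 ≤_) (gap-end y a) (ℕ.+-monoˡ-≤ 1 (ℕ.+-monoʳ-≤ q lt))))
      above : ∀ i → keep (q + suc a + suc i) ≡ true
      above i = trans (cong (λ b → not ((y + suc a ≤ᵇ q + suc a + suc i) ∧ b)) (≤ᵇ-false (subst (_< q + suc a + suc i + 1) (gap-end y a)
          (ℕ.+-monoˡ-< 1 (ℕ.m<m+n (q + suc a) (s≤s z≤n))))))
        (cong not (∧-zeroʳ (y + suc a ≤ᵇ q + suc a + suc i)))
      exits : exitRows (q + suc a + z) ≡ desc (q + suc a) z ++ desc 0 q
      exits = trans (exitRows-keep (q + suc a) z (λ i _ → above i)) (cong (desc (q + suc a) z ++_)
        (trans (exitRows-drop q (suc a) within) (trans (exitRows-keep 0 q (λ i lt → below (suc i) lt)) (++-identityʳ (desc 0 q)))))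

open GapFormula using (gap≡G)
open ClosedForm using (E4-gapless; E4-gap)
open Assembly

theorem4p9 : (x y z a : ℕ) → 1 ≤ y + z → M*E x y z a ≡ E4 x y z a
theorem4p9 x y z a 1≤y+z = closed (y + z) refl 1≤y+z a
  where
  closed : ∀ n → y + z ≡ n → 1 ≤ n → ∀ a → M*E x y z a ≡ E4 x y z a
  closed (suc s) yz _ zero    = trans (gapless-det x y z s yz) (sym (E4-gapless x y z s yz))
  closed (suc s) yz _ (suc a) = trans (gap-det x y z s yz a) (trans (gap≡G x (y + a) a y z refl) (sym (E4-gap x y z a)))
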